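{- For every $\epsilon>0$ there is a set $A\subset\mathbb{P}$ whose relative density $d_{\mathbb{P}}(A)$ (exists and) is at least $1-\epsilon$ such that $\mathbb{P}-A$ is not piecewise syndetic. In particular, $R:=\mathbb{N}\setminus(\mathbb{P}-A)$ is thickly syndetic, but not prime intersective.
   Context: $\mathbb{N}=\{1,2,3,\dots\}$, $[N]=\{1,\dots,N\}$, $\mathbb{P}$ is the set of primes. For $A,E\subset\mathbb{N}$, $E$ infinite, $\overline{d}_E(A)=\limsup_{N}\frac{|A\cap E\cap[N]|}{|E\cap[N]|}$, $\underline{d}_E(A)=\liminf_{N}\frac{|A\cap E\cap[N]|}{|E\cap[N]|}$, and $d_E(A)$ is their common value when equal. $A-B=\{a-b:a\in A,b\in B\}$. $S\subset\mathbb{N}$ is thick if it contains arbitrarily long intervals of consecutive integers; syndetic if $S-F\supset\mathbb{N}$ for some finite $F$; piecewise syndetic if $S=T\cap R$ with $T$ thick and $R$ syndetic; thickly syndetic if it intersects every piecewise syndetic set (equivalently, for every $N$ there is a syndetic $J$ with $[N]+J\subset S$). A set $S\subset\mathbb{Z}$ has one of these properties if $S\cap\mathbb{N}$ does. $R\subset\mathbb{N}$ is prime intersective if for every $A\subset\mathbb{P}$ with $\overline{d}_{\mathbb{P}}(A)>0$ we have $R\cap(A-A)\neq\varnothing$. -}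

module Defs where

open import Level using (0ℓ)
open import Data.Bool using (Bool; true; false; if_then_else_; _∧_; T)
open import Data.Nat using (ℕ; zero; suc; _+_; _≤_; _<_)
open import Data.Nat.Primality using (prime?)
open import Data.Integer as ℤ using (ℤ; +_)
open import Data.Rational using (ℚ; 0ℚ; 1ℚ; _/_; _-_; ∣_∣) renaming (_<_ to _<ℚ_; _≤_ to _≤ℚ_)
open import Data.List using (List)
open import Data.List.Membership.Propositional using (_∈_)
open import Data.Product using (Σ; ∃; ∃-syntax; _×_)
open import Relation.Nullary using (¬_; isYes)
open import Relation.Unary using (Pred)
open import Relation.Binary.PropositionalEquality using (_≡_)

-- Subsets of ℕ are predicates; only positive members matter (ℕ = {1,2,...} in the paper).
Set⊆ℕ : Set₁
Set⊆ℕ = Pred ℕ 0ℓ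

-- Decidable subsets (needed to count elements of [N]).
DSet : Set
DSet = ℕ → Bool

isPrime : DSet
isPrime n = isYes (prime? n)

count : DSet → ℕ → ℕ
count p zero = 0
count p (suc N) = count p N + (if p (suc N) then 1 else 0)

_∩ℙ : DSet → DSet
(A ∩ℙ) n = A n ∧ isPrime n

-- |A ∩ ℙ ∩ [N]| / |ℙ ∩ [N]|  (set to 0 when the denominator vanishes, i.e. N < 2)
ratioℙ : DSet → ℕ → ℚ
ratioℙ A N with count isPrime N
... | zero  = 0ℚ
... | suc k = (+ count (A ∩ℙ) N) / suc k

densityExistsAtLeast : DSet → ℚ → Set
densityExistsAtLeast A c =
  (∀ δ → 0ℚ <ℚ δ → ∃[ M ] ∀ N N′ → M ≤ N → M ≤ N′ → ∣ ratioℙ A N - ratioℙ A N′ ∣ <ℚ δ)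
  × (∀ δ → 0ℚ <ℚ δ → ∃[ M ] ∀ N → M ≤ N → c - δ ≤ℚ ratioℙ A N)

upperDensityPos : DSet → Set
upperDensityPos A = ∃[ δ ] (0ℚ <ℚ δ × (∀ M → ∃[ N ] (M ≤ N × δ ≤ℚ ratioℙ A N)))

Thick : Set⊆ℕ → Set
Thick S = ∀ L → ∃[ m ] (1 ≤ m × (∀ i → i < L → S (m + i)))

Syndetic : Set⊆ℕ → Set
Syndetic S = Σ (List ℤ) λ F → ∀ n → 1 ≤ n →
  ∃[ f ] (f ∈ F × ∃[ s ] (1 ≤ s × S s × (+ n) ≡ (+ s) ℤ.- f))

PiecewiseSyndetic : Set⊆ℕ → Set₁
PiecewiseSyndetic S = Σ Set⊆ℕ λ Tk → Σ Set⊆ℕ λ R → Thick Tk × Syndetic R ×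
  (∀ n → 1 ≤ n → (S n → Tk n × R n) × (Tk n × R n → S n))

ThicklySyndetic : Set⊆ℕ → Set₁
ThicklySyndetic S = ∀ P → PiecewiseSyndetic P → ∃[ n ] (1 ≤ n × S n × P n)

ℙminus : DSet → Set⊆ℕ
ℙminus A n = 1 ≤ n × ∃[ a ] (T (A a) × T (isPrime (n + a)))

AminusA : DSet → Set⊆ℕ
AminusA A n = 1 ≤ n × ∃[ a ] ∃[ b ] (T (A a) × T (A b) × n + b ≡ a)

⊆ℙ : DSet → Set
⊆ℙ A = ∀ n → T (A n) → T (isPrime n)

-- prime intersective (quantifying over decidable A ⊆ ℙ)
PrimeIntersective : Set⊆ℕ → Set
PrimeIntersective R = ∀ A → ⊆ℙ A → upperDensityPos A →
  ∃[ n ] (1 ≤ n × R n × AminusA A n)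

{-# OPTIONS --safe #-}
module Submission where

-- An interval c + 1, …, c + L contains no difference p − a of a prime p and an element a of A if every a + c + i has a common factor
-- with M, and then neither does its translate by a suitable multiple of M. For M = D! the units modulo M have density at most
-- 1/(1 + 1/2 + … + 1/D), so some shift c makes the proportion of units a for which some a + c + i is again a unit arbitrarily small.
-- Primes in these few residue classes are removed, beyond a threshold depending on L, for all L at once; further primes are removed
-- greedily so that the removed set has density exactly 1/n₀. The finitely many a below the threshold for L are handled by making the
-- period divisible by all c + i + a. The translates form a syndetic family of intervals of length L free of ℙ − A.
--
-- That primes in the bad classes are few needs an upper bound of the right order, in intervals [z, y] as well: Λ₂ = μ ⋆ log² dominates
-- Λ log and, by Möbius inversion, is equidistributed over the weights of period M up to O(x); this bounds bad primes by a small multiple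
-- of π(y) − π(z), once the prime number theorem is available to compare Λ₂ with π on [z, y]. The theorem is proved by Selberg's method:
-- Selberg's formula, the iterated bound for |R| log², R(x) = ψ(x) − x, and the sign changes of R, which produce intervals where |R| is
-- small and so improve any bound |R(x)| ≤ αx by a fixed amount. Real logarithms are replaced by rational functions, exactly additive
-- and close to log up to X, one for each X; all error terms are uniform in X.

open import Level using (0ℓ)
open import Data.Nat as ℕ using (ℕ; zero; suc; z≤n; s≤s)
import Data.Nat.Properties as ℕₚ
import Data.Nat.DivMod as ℕ
open import Data.Integer as ℤ using (+_)
import Data.Integer.Properties as ℤₚ
open import Data.Rational hiding (truncate; floor; ceiling; round; fracPart)
open import Data.Rational.Properties
import Data.Rational.Unnormalised as ℚᵘ
import Data.Rational.Unnormalised.Properties as ℚᵘₚ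
open import Data.Maybe using (Maybe; just; nothing)
open import Data.List using (List; _∷_; []; _++_)
open import Data.List.Properties using (≡-dec)
open import Data.Product using (Σ; ∃-syntax; _×_; _,_; proj₁; proj₂)
open import Data.Sum using (_⊎_; inj₁; inj₂)
open import Data.Empty using (⊥; ⊥-elim)
open import Function using (_∘_)
open import Relation.Nullary using (Dec; yes; no; ¬_; isYes)
open import Relation.Nullary.Decidable using (from-yes; from-no; _×-dec_; _⊎-dec_)
open import Relation.Binary.PropositionalEquality using (_≡_; _≢_; refl; sym; trans; cong; cong₂; subst; subst₂; module ≡-Reasoning)
open import Tactic.RingSolver.Core.AlmostCommutativeRing using (AlmostCommutativeRing; fromCommutativeRing)
open import Tactic.RingSolver using (solve)
open import Data.Nat.Divisibility as ∣ using (_∣_; _∣?_; divides)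
open import Data.Nat.Primality using (Prime; prime?; euclidsLemma; prime⇒nonZero; prime⇒nonTrivial; prime⇒irreducible; ¬prime[1])
open import Data.Nat.Primality.Factorisation using (PrimeFactorisation; factors; factorise; factorisationUnique; factorisationHasAllPrimeFactors)
open import Data.Nat.ListAction using (product)
open import Data.Nat.ListAction.Properties using (product-++; ∈⇒∣product)
open import Data.Nat.Induction using (<-rec)
open import Data.List.Membership.Propositional using (_∈_)
open import Data.List.Membership.DecPropositional ℕ._≟_ using (_∈?_)
open import Data.List.Relation.Unary.All as All using (All)
open import Data.List.Relation.Unary.All.Properties using (++⁺)
open import Data.List.Relation.Unary.Any using (here; there)
open import Data.List.Relation.Binary.Permutation.Propositional as ↭ using (_↭_)
open import Data.List.Relation.Binary.Permutation.Propositional.Properties using (∈-resp-↭)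
open import Data.Nat.Coprimality as Coprimality using (Coprime; coprime?; coprime-Bézout; coprime-divisor; prime⇒coprime)
open import Data.Nat.GCD using (module Bézout; gcd; gcd[m,n]∣m; gcd[m,n]∣n)
import Data.Nat.Tactic.RingSolver as ℕ-Ring
open import Data.Bool as 𝔹 using (Bool; true; false; if_then_else_; _∧_; _∨_; not)
open import Defs

-- The density has to exist, and this dictates what must be known about bad primes. They are removed
-- unconditionally, so the removed proportion may overshoot 1/n₀. The overshoot at N depends on what
-- has been removed since the last moment z at which the proportion was at most 1/n₀, and z can be
-- anywhere below N. So the bad primes in (z, N] must be compared with all primes in (z, N], up to a
-- small multiple of π(N). A sieve bounds them by a small multiple of (N - z)/log N; converting N -
-- z into primes of (z, N] takes a lower bound in intervals, which Chebyshev's inequality does not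
-- give. On the sieve side, in contrast, a loss of any constant factor is harmless, since the gain K
-- is arbitrary; hence Λ₂ can stand in for the prime number theorem in progressions. The logarithm
-- in such a comparison depends on the end point, so the threshold of the prime number theorem must
-- be chosen before the logarithm.

0≟ : ∀ x → Maybe (0ℚ ≡ x)
0≟ x with 0ℚ ≟ x
... | yes p = just p
... | no _  = nothing

ℚ-ring : AlmostCommutativeRing 0ℓ 0ℓ
ℚ-ring = fromCommutativeRing +-*-commutativeRing 0≟

infixl 6 _⊕_
infixl 7 _⊗_

by : ∀ {a b e} → 0ℚ ≤ e → b ≡ a + e → a ≤ b
by {a} {b} {e} p refl = subst (_≤ a + e) (+-identityʳ a) (+-monoʳ-≤ a p)

↑ : ∀ {a b} → a ≤ b → 0ℚ ≤ b - a
↑ {a} {b} p = subst (_≤ b - a) (+-inverseʳ a) (+-monoˡ-≤ (- a) p)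

_⊕_ : ∀ {a b} → 0ℚ ≤ a → 0ℚ ≤ b → 0ℚ ≤ a + b
p ⊕ q = +-mono-≤ p q

_⊗_ : ∀ {a b} → 0ℚ ≤ a → 0ℚ ≤ b → 0ℚ ≤ a * b
_⊗_ {a} {b} p q = subst (_≤ a * b) (*-zeroʳ a) (*-monoˡ-≤-nonNeg a {{nonNegative p}} q)

0≤1 : 0ℚ ≤ 1ℚ
0≤1 = from-yes (0ℚ ≤? 1ℚ)

1≰0 : ¬ (1ℚ ≤ 0ℚ)
1≰0 = from-no (1ℚ ≤? 0ℚ)

♯_ : ℕ → ℚ
♯ n = + n / 1

infix 9 ♯_

T-isYes : ∀ {P : Set} (d : Dec P) → 𝔹.T (isYes d) → P
T-isYes (yes p) _ = p

T-∧ˡ : ∀ {a b} → 𝔹.T (a ∧ b) → 𝔹.T a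
T-∧ˡ {true} _ = _

T-∧ʳ : ∀ {a b} → 𝔹.T (a ∧ b) → 𝔹.T b
T-∧ʳ {true} t = t

T-∨ : ∀ a {b} → 𝔹.T (a ∨ b) → 𝔹.T a ⊎ 𝔹.T b
T-∨ true  t = inj₁ t
T-∨ false t = inj₂ t

♯≥0 : ∀ n → 0ℚ ≤ ♯ n
♯≥0 n = nonNegative⁻¹ (♯ n) {{normalize-nonNeg n 1}}

½≥0 : 0ℚ ≤ ½
½≥0 = from-yes (0ℚ ≤? ½)

-- Polynomial identities, and inequalities that follow from nonnegative combinations of products of hypotheses, by reflection.
-- Variables are indices into a list of values (out of range: 0).

infixl 6 _:+_ _:-_
infixl 7 _:*_
infix 8 :-_
infix 9 #_

data Expr : Set where
  var : ℕ → Expr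
  con : ℚ → Expr
  _:+_ _:*_ _:-_ : Expr → Expr → Expr
  :-_ : Expr → Expr

#_ : ℕ → Expr
# n = con (♯ n)

get : List ℚ → ℕ → ℚ
get []       _       = 0ℚ
get (x ∷ ρ)  zero    = x
get (x ∷ ρ)  (suc i) = get ρ i

⟦_⟧ : Expr → List ℚ → ℚ
⟦ var i ⟧  ρ = get ρ i
⟦ con q ⟧  ρ = q
⟦ a :+ b ⟧ ρ = ⟦ a ⟧ ρ + ⟦ b ⟧ ρ
⟦ a :* b ⟧ ρ = ⟦ a ⟧ ρ * ⟦ b ⟧ ρ
⟦ a :- b ⟧ ρ = ⟦ a ⟧ ρ - ⟦ b ⟧ ρ
⟦ :- a ⟧   ρ = - ⟦ a ⟧ ρ

Poly : Set
Poly = List (List ℕ × ℚ)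

insert : ℕ → List ℕ → List ℕ
insert i []       = i ∷ []
insert i (j ∷ js) = if i ℕ.≤ᵇ j then i ∷ j ∷ js else j ∷ insert i js

mulMono : List ℕ → List ℕ → List ℕ
mulMono []       m = m
mulMono (i ∷ is) m = insert i (mulMono is m)

addTerm : List ℕ → ℚ → Poly → Poly
addTerm m q []             = (m , q) ∷ []
addTerm m q ((m′ , q′) ∷ p) with ≡-dec ℕ._≟_ m m′
... | yes _ = (m , q + q′) ∷ p
... | no _  = (m′ , q′) ∷ addTerm m q p

add : Poly → Poly → Poly
add []            r = r
add ((m , q) ∷ p) r = addTerm m q (add p r)

mulTerm : List ℕ → ℚ → Poly → Poly
mulTerm m q []              = []
mulTerm m q ((m′ , q′) ∷ p) = addTerm (mulMono m m′) (q * q′) (mulTerm m q p)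

mul : Poly → Poly → Poly
mul []            r = []
mul ((m , q) ∷ p) r = add (mulTerm m q r) (mul p r)

norm : Expr → Poly
norm (var i)  = (i ∷ [] , 1ℚ) ∷ []
norm (con q)  = ([] , q) ∷ []
norm (a :+ b) = add (norm a) (norm b)
norm (a :* b) = mul (norm a) (norm b)
norm (a :- b) = add (norm a) (mulTerm [] (- 1ℚ) (norm b))
norm (:- a)   = mulTerm [] (- 1ℚ) (norm a)

isZero : Poly → Bool
isZero []            = true
isZero ((_ , q) ∷ p) = isYes (q ≟ 0ℚ) ∧ isZero p

module _ (ρ : List ℚ) where
  mono : List ℕ → ℚ
  mono []       = 1ℚ
  mono (i ∷ is) = get ρ i * mono is

  poly : Poly → ℚ
  poly []            = 0ℚ
  poly ((m , q) ∷ p) = q * mono m + poly p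

  insert-sound : ∀ i m → mono (insert i m) ≡ get ρ i * mono m
  insert-sound i []       = refl
  insert-sound i (j ∷ js) with i ℕ.≤ᵇ j
  ... | true  = refl
  ... | false = trans (cong (get ρ j *_) (insert-sound i js)) (lem (get ρ i) (get ρ j) (mono js))
    where
    lem : ∀ a b c → b * (a * c) ≡ a * (b * c)
    lem a b c = solve (a ∷ b ∷ c ∷ []) ℚ-ring

  mulMono-sound : ∀ m m′ → mono (mulMono m m′) ≡ mono m * mono m′
  mulMono-sound []       m′ = sym (*-identityˡ (mono m′))
  mulMono-sound (i ∷ is) m′ = trans (insert-sound i (mulMono is m′)) (trans (cong (get ρ i *_) (mulMono-sound is m′)) (sym (*-assoc (get ρ i) (mono is) (mono m′))))

  addTerm-sound : ∀ m q p → poly (addTerm m q p) ≡ q * mono m + poly p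
  addTerm-sound m q []              = refl
  addTerm-sound m q ((m′ , q′) ∷ p) with ≡-dec ℕ._≟_ m m′
  ... | yes refl = lem q q′ (mono m) (poly p)
    where
    lem : ∀ a b m p → (a + b) * m + p ≡ a * m + (b * m + p)
    lem a b m p = solve (a ∷ b ∷ m ∷ p ∷ []) ℚ-ring
  ... | no _ = trans (cong (λ z → q′ * mono m′ + z) (addTerm-sound m q p)) (lem (q * mono m) (q′ * mono m′) (poly p))
    where
    lem : ∀ a b c → b + (a + c) ≡ a + (b + c)
    lem a b c = solve (a ∷ b ∷ c ∷ []) ℚ-ring

  add-sound : ∀ p r → poly (add p r) ≡ poly p + poly r
  add-sound []            r = sym (+-identityˡ (poly r))
  add-sound ((m , q) ∷ p) r = trans (addTerm-sound m q (add p r)) (trans (cong (λ z → q * mono m + z) (add-sound p r)) (sym (+-assoc (q * mono m) (poly p) (poly r))))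

  mulTerm-sound : ∀ m q p → poly (mulTerm m q p) ≡ q * mono m * poly p
  mulTerm-sound m q []              = sym (*-zeroʳ (q * mono m))
  mulTerm-sound m q ((m′ , q′) ∷ p) = trans (addTerm-sound (mulMono m m′) (q * q′) (mulTerm m q p)) (trans (cong₂ (λ x y → q * q′ * x + y) (mulMono-sound m m′) (mulTerm-sound m q p)) (lem q q′ (mono m) (mono m′) (poly p)))
    where
    lem : ∀ a b m n p → a * b * (m * n) + a * m * p ≡ a * m * (b * n + p)
    lem a b m n p = solve (a ∷ b ∷ m ∷ n ∷ p ∷ []) ℚ-ring

  mul-sound : ∀ p r → poly (mul p r) ≡ poly p * poly r
  mul-sound []            r = sym (*-zeroˡ (poly r))
  mul-sound ((m , q) ∷ p) r = trans (add-sound (mulTerm m q r) (mul p r)) (trans (cong₂ _+_ (mulTerm-sound m q r) (mul-sound p r)) (sym (*-distribʳ-+ (poly r) (q * mono m) (poly p))))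

  neg-sound : ∀ p → poly (mulTerm [] (- 1ℚ) p) ≡ - poly p
  neg-sound p = trans (mulTerm-sound [] (- 1ℚ) p) (lem (poly p))
    where
    lem : ∀ a → - 1ℚ * 1ℚ * a ≡ - a
    lem a = solve (a ∷ []) ℚ-ring

  norm-sound : ∀ e → poly (norm e) ≡ ⟦ e ⟧ ρ
  norm-sound (var i)  = lem (get ρ i)
    where
    lem : ∀ a → 1ℚ * (a * 1ℚ) + 0ℚ ≡ a
    lem a = solve (a ∷ []) ℚ-ring
  norm-sound (con q)  = trans (+-identityʳ (q * 1ℚ)) (*-identityʳ q)
  norm-sound (a :+ b) = trans (add-sound (norm a) (norm b)) (cong₂ _+_ (norm-sound a) (norm-sound b))
  norm-sound (a :* b) = trans (mul-sound (norm a) (norm b)) (cong₂ _*_ (norm-sound a) (norm-sound b))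
  norm-sound (a :- b) = trans (add-sound (norm a) (mulTerm [] (- 1ℚ) (norm b))) (cong₂ _+_ (norm-sound a) (trans (neg-sound (norm b)) (cong -_ (norm-sound b))))
  norm-sound (:- a)   = trans (neg-sound (norm a)) (cong -_ (norm-sound a))

  isZero-sound : ∀ p → 𝔹.T (isZero p) → poly p ≡ 0ℚ
  isZero-sound []            _ = refl
  isZero-sound ((m , q) ∷ p) t with q ≟ 0ℚ
  ... | yes refl = trans (cong₂ _+_ (*-zeroˡ (mono m)) (isZero-sound p t)) refl

  zero-sound : ∀ e → 𝔹.T (isZero (norm e)) → ⟦ e ⟧ ρ ≡ 0ℚ
  zero-sound e t = trans (sym (norm-sound e)) (isZero-sound (norm e) t)

  diff-sound : ∀ a b → 𝔹.T (isZero (norm (a :- b))) → ⟦ a ⟧ ρ ≡ ⟦ b ⟧ ρ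
  diff-sound a b t = lem (⟦ a ⟧ ρ) (⟦ b ⟧ ρ) (zero-sound (a :- b) t)
    where
    lem₀ : ∀ a b → a ≡ a - b + b
    lem₀ a b = solve (a ∷ b ∷ []) ℚ-ring
    lem : ∀ a b → a - b ≡ 0ℚ → a ≡ b
    lem a b h = trans (lem₀ a b) (trans (cong (_+ b) h) (+-identityˡ b))

-- Expressions are entered as functions of their variables; `close` feeds them the variables 0, 1,
-- 2, ..., and `Curried` binds the values in the same order.
Nary : ℕ → Set → Set
Nary zero    B = B
Nary (suc n) B = Expr → Nary n B

close : ∀ n {B} → ℕ → Nary n B → B
close zero    k b = b
close (suc n) k f = close n (suc k) (f (var k))

Curried : ℕ → (List ℚ → Set) → Set
Curried zero    P = P []
Curried (suc n) P = ∀ x → Curried n (λ ρ → P (x ∷ ρ))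

curried : ∀ n {P : List ℚ → Set} → (∀ ρ → P ρ) → Curried n P
curried zero    h = h []
curried (suc n) h = λ x → curried n (λ ρ → h (x ∷ ρ))

infix 5.5 _≼_ _≗_

data Relation : Set where
  _≼_ _≗_ : Expr → Expr → Relation

Holds : Relation → List ℚ → Set
Holds (a ≼ b) ρ = ⟦ a ⟧ ρ ≤ ⟦ b ⟧ ρ
Holds (a ≗ b) ρ = ⟦ a ⟧ ρ ≡ ⟦ b ⟧ ρ

ring : ∀ n (f : Nary n (Expr × Expr)) → let (a , b) = close n 0 f in {_ : 𝔹.T (isZero (norm (a :- b)))} → Curried n (λ ρ → ⟦ a ⟧ ρ ≡ ⟦ b ⟧ ρ)
ring n f {t} = curried n (λ ρ → diff-sound ρ (proj₁ (close n 0 f)) (proj₂ (close n 0 f)) t)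

gap : Relation → Expr
gap (a ≼ b) = b :- a
gap (a ≗ b) = b :- a

isEquation : Relation → Bool
isEquation (_ ≼ _) = false
isEquation (_ ≗ _) = true

hypothesis : List Relation → ℕ → Relation
-- Out of range a true equation is returned, so that `AllHold` stays provable and a wrong index
-- contributes 0.
hypothesis []       _       = con 0ℚ ≗ con 0ℚ
hypothesis (r ∷ rs) zero    = r
hypothesis (r ∷ rs) (suc i) = hypothesis rs i

-- A certificate term (q , is) stands for q times the product of the gaps of the hypotheses is; q may be negative if one of them is an equation.
Certificate : Set
Certificate = List (ℚ × List ℕ)

module _ (hs : List Relation) where
  gaps : List ℕ → Expr
  gaps []       = con 1ℚ
  gaps (i ∷ is) = gap (hypothesis hs i) :* gaps is

  combination : Certificate → Expr
  combination []             = con 0ℚ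
  combination ((q , is) ∷ c) = con q :* gaps is :+ combination c

  hasEquation : List ℕ → Bool
  hasEquation []       = false
  hasEquation (i ∷ is) = isEquation (hypothesis hs i) ∨ hasEquation is

  valid : Certificate → Bool
  valid []             = true
  valid ((q , is) ∷ c) = (isYes (0ℚ ≤? q) ∨ hasEquation is) ∧ valid c

Implies : List Relation → Relation → List ℚ → Set
Implies []       g ρ = Holds g ρ
Implies (h ∷ hs) g ρ = Holds h ρ → Implies hs g ρ

module _ (ρ : List ℚ) where
  AllHold : List Relation → Set
  AllHold hs = ∀ i → Holds (hypothesis hs i) ρ

  implies : ∀ hs g → (AllHold hs → Holds g ρ) → Implies hs g ρ
  implies []       g k = k (λ _ → refl)
  implies (h ∷ hs) g k = λ p → implies hs g (λ ps → k (λ { zero → p ; (suc i) → ps i }))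

  gap≥0 : ∀ r → Holds r ρ → 0ℚ ≤ ⟦ gap r ⟧ ρ
  gap≥0 (a ≼ b) p = ↑ p
  gap≥0 (a ≗ b) p = ↑ (≤-reflexive p)

  gap≡0 : ∀ r → 𝔹.T (isEquation r) → Holds r ρ → ⟦ gap r ⟧ ρ ≡ 0ℚ
  gap≡0 (a ≗ b) _ p = trans (cong (λ z → z - ⟦ a ⟧ ρ) (sym p)) (+-inverseʳ (⟦ a ⟧ ρ))

  module _ (hs : List Relation) (ps : AllHold hs) where
    gaps≥0 : ∀ is → 0ℚ ≤ ⟦ gaps hs is ⟧ ρ
    gaps≥0 []       = 0≤1
    gaps≥0 (i ∷ is) = gap≥0 (hypothesis hs i) (ps i) ⊗ gaps≥0 is

    gaps≡0 : ∀ is → 𝔹.T (hasEquation hs is) → ⟦ gaps hs is ⟧ ρ ≡ 0ℚ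
    gaps≡0 (i ∷ is) t with T-∨ (isEquation (hypothesis hs i)) t
    ... | inj₁ u = trans (cong (_* ⟦ gaps hs is ⟧ ρ) (gap≡0 (hypothesis hs i) u (ps i))) (*-zeroˡ (⟦ gaps hs is ⟧ ρ))
    ... | inj₂ u = trans (cong (⟦ gap (hypothesis hs i) ⟧ ρ *_) (gaps≡0 is u)) (*-zeroʳ (⟦ gap (hypothesis hs i) ⟧ ρ))

    combination≥0 : ∀ c → 𝔹.T (valid hs c) → 0ℚ ≤ ⟦ combination hs c ⟧ ρ
    combination≥0 []             _ = ≤-refl
    combination≥0 ((q , is) ∷ c) t = term (T-∨ (isYes (0ℚ ≤? q)) (T-∧ˡ t)) ⊕ combination≥0 c (T-∧ʳ {isYes (0ℚ ≤? q) ∨ hasEquation hs is} t)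
      where
      term : 𝔹.T (isYes (0ℚ ≤? q)) ⊎ 𝔹.T (hasEquation hs is) → 0ℚ ≤ q * ⟦ gaps hs is ⟧ ρ
      term (inj₁ u) = T-isYes (0ℚ ≤? q) u ⊗ gaps≥0 is
      term (inj₂ u) = ≤-reflexive (sym (trans (cong (q *_) (gaps≡0 is u)) (*-zeroʳ q)))

-- A certificate exhibits `b - a` as a sum of terms that are nonnegative under the hypotheses. Its
-- validity and the polynomial identity are decided by evaluation, which fills the implicit
-- argument. With the conclusion 1 ≤ 0 it refutes the hypotheses.
lin : ∀ n (f : Nary n (List Relation × Expr × Expr)) (c : Certificate) → let (hs , a , b) = close n 0 f in
  {_ : 𝔹.T (valid hs c ∧ isZero (norm (b :- (a :+ combination hs c))))} → Curried n (Implies hs (a ≼ b))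
lin n f c {t} = curried n (λ ρ → implies ρ hs (a ≼ b) (λ ps → by (combination≥0 ρ hs ps c (T-∧ˡ t)) (diff-sound ρ b (a :+ combination hs c) (T-∧ʳ {valid hs c} t))))
  where
  hs = proj₁ (close n 0 f)
  a = proj₁ (proj₂ (close n 0 f))
  b = proj₂ (proj₂ (close n 0 f))

sq : ∀ a → 0ℚ ≤ a * a
sq a with ≤-total 0ℚ a
... | inj₁ p = p ⊗ p
... | inj₂ p = subst (0ℚ ≤_) (lem a) (↑ p ⊗ ↑ p)
  where
  lem = ring 1 (λ a → (con 0ℚ :- a) :* (con 0ℚ :- a) , a :* a)

-- Naturals inside ℚ

abstract
  -- Opaque, in contrast to `♯`: the coefficients in `lin` and `ring` have to compute, whereas
  -- embedded factorials, powers and thresholds must never be unfolded.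
  ι : ℕ → ℚ
  ι n = ♯ n

  ι≡♯ : ∀ n → ι n ≡ ♯ n
  ι≡♯ n = refl

  inv : ℕ → ℚ
  inv zero    = 0ℚ
  inv (suc n) = + 1 / suc n

abstract
  /1-toℚᵘ : ∀ n → toℚᵘ (ι n) ℚᵘ.≃ ℚᵘ.mkℚᵘ (+ n) 0
  /1-toℚᵘ n = toℚᵘ-fromℚᵘ (ℚᵘ.mkℚᵘ (+ n) 0)

  ι-+ : ∀ m n → ι (m ℕ.+ n) ≡ ι m + ι n
  ι-+ m n = toℚᵘ-injective (begin
    toℚᵘ (ι (m ℕ.+ n))                          ≈⟨ /1-toℚᵘ (m ℕ.+ n) ⟩
    ℚᵘ.mkℚᵘ (+ (m ℕ.+ n)) 0                      ≈⟨ ℚᵘ.*≡* (cong₂ ℤ._*_ (cong₂ ℤ._+_ (sym (ℤₚ.*-identityʳ (+ m))) (sym (ℤₚ.*-identityʳ (+ n)))) refl) ⟩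
    ℚᵘ.mkℚᵘ (+ m) 0 ℚᵘ.+ ℚᵘ.mkℚᵘ (+ n) 0          ≈⟨ ℚᵘₚ.+-cong (/1-toℚᵘ m) (/1-toℚᵘ n) ⟨
    toℚᵘ (ι m) ℚᵘ.+ toℚᵘ (ι n)                   ≈⟨ toℚᵘ-homo-+ (ι m) (ι n) ⟨
    toℚᵘ (ι m + ι n)                            ∎)
    where open ℚᵘₚ.≃-Reasoning

  ι-* : ∀ m n → ι (m ℕ.* n) ≡ ι m * ι n
  ι-* m n = toℚᵘ-injective (begin
    toℚᵘ (ι (m ℕ.* n))                          ≈⟨ /1-toℚᵘ (m ℕ.* n) ⟩
    ℚᵘ.mkℚᵘ (+ (m ℕ.* n)) 0                      ≈⟨ ℚᵘ.*≡* (cong (ℤ._* + 1) (ℤₚ.pos-* m n)) ⟩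
    ℚᵘ.mkℚᵘ (+ m) 0 ℚᵘ.* ℚᵘ.mkℚᵘ (+ n) 0          ≈⟨ ℚᵘₚ.*-cong (/1-toℚᵘ m) (/1-toℚᵘ n) ⟨
    toℚᵘ (ι m) ℚᵘ.* toℚᵘ (ι n)                   ≈⟨ toℚᵘ-homo-* (ι m) (ι n) ⟨
    toℚᵘ (ι m * ι n)                            ∎)
    where open ℚᵘₚ.≃-Reasoning

ι-suc : ∀ n → ι (suc n) ≡ ι n + 1ℚ
ι-suc n = trans (cong ι (ℕₚ.+-comm 1 n)) (trans (ι-+ n 1) (cong (λ x → ι n + x) (ι≡♯ 1)))

abstract
  ι≥0 : ∀ n → 0ℚ ≤ ι n
  ι≥0 n = nonNegative⁻¹ (ι n) {{normalize-nonNeg n 1}}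

ι-mono : ∀ {m n} → m ℕ.≤ n → ι m ≤ ι n
ι-mono {m} {n} m≤n = by (ι≥0 (n ℕ.∸ m)) (trans (cong ι (sym (ℕₚ.m+[n∸m]≡n m≤n))) (ι-+ m (n ℕ.∸ m)))

ι≥1 : ∀ {n} → 1 ℕ.≤ n → 1ℚ ≤ ι n
ι≥1 {n} p = subst (_≤ ι n) (ι≡♯ 1) (ι-mono p)

ι-cancel-≤ : ∀ {m n} → ι m ≤ ι n → m ℕ.≤ n
ι-cancel-≤ {m} {n} p with m ℕ.≤? n
... | yes q = q
... | no ¬q = ⊥-elim (1≰0 (lem (ι m) (ι n) (ι (suc n)) (ι-suc n) p (ι-mono (ℕₚ.≰⇒> ¬q))))
  where
  lem = lin 3 (λ a b c → c ≗ b :+ con 1ℚ ∷ a ≼ b ∷ c ≼ a ∷ [] , con 1ℚ , con 0ℚ) ((- 1ℚ , 0 ∷ []) ∷ (1ℚ , 1 ∷ []) ∷ (1ℚ , 2 ∷ []) ∷ [])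

abstract
  inv≥0 : ∀ n → 0ℚ ≤ inv n
  inv≥0 zero    = ≤-refl
  inv≥0 (suc n) = nonNegative⁻¹ (inv (suc n)) {{normalize-nonNeg 1 (suc n)}}

  /-ι-inv : ∀ m n → + m / suc n ≡ ι m * inv (suc n)
  /-ι-inv m n = toℚᵘ-injective (begin
    toℚᵘ (+ m / suc n)                          ≈⟨ toℚᵘ-fromℚᵘ (ℚᵘ.mkℚᵘ (+ m) n) ⟩
    ℚᵘ.mkℚᵘ (+ m) n                              ≈⟨ ℚᵘ.*≡* (cong₂ ℤ._*_ (sym (ℤₚ.*-identityʳ (+ m))) (cong (λ k → + suc k) (ℕₚ.+-identityʳ n))) ⟩
    ℚᵘ.mkℚᵘ (+ m) 0 ℚᵘ.* ℚᵘ.mkℚᵘ (+ 1) n          ≈⟨ ℚᵘₚ.*-cong (/1-toℚᵘ m) (toℚᵘ-fromℚᵘ (ℚᵘ.mkℚᵘ (+ 1) n)) ⟨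
    toℚᵘ (ι m) ℚᵘ.* toℚᵘ (inv (suc n))           ≈⟨ toℚᵘ-homo-* (ι m) (inv (suc n)) ⟨
    toℚᵘ (ι m * inv (suc n))                    ∎)
    where open ℚᵘₚ.≃-Reasoning

  ι*inv : ∀ {n} → 1 ℕ.≤ n → ι n * inv n ≡ 1ℚ
  ι*inv {suc n} _ = trans (sym (/-ι-inv (suc n) n)) (fromℚᵘ-cong {ℚᵘ.mkℚᵘ (+ suc n) n} {ℚᵘ.1ℚᵘ} (ℚᵘ.*≡* (ℤₚ.*-comm (+ suc n) (+ 1))))

*-inverse-unique : ∀ y a b → y * a ≡ 1ℚ → y * b ≡ 1ℚ → a ≡ b
*-inverse-unique y a b p q = begin
  a              ≡⟨ *-identityʳ a ⟨
  a * 1ℚ         ≡⟨ cong (a *_) q ⟨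
  a * (y * b)    ≡⟨ ring 3 (λ a y b → a :* (y :* b) , y :* a :* b) a y b ⟩
  (y * a) * b    ≡⟨ cong (_* b) p ⟩
  1ℚ * b         ≡⟨ *-identityˡ b ⟩
  b              ∎
  where open ≡-Reasoning

inv-* : ∀ {m n} → 1 ℕ.≤ m → 1 ℕ.≤ n → inv (m ℕ.* n) ≡ inv m * inv n
inv-* {m} {n} p q = *-inverse-unique (ι (m ℕ.* n)) _ _ (ι*inv (ℕₚ.*-mono-≤ p q)) (begin
  ι (m ℕ.* n) * (inv m * inv n)       ≡⟨ cong (_* (inv m * inv n)) (ι-* m n) ⟩
  ι m * ι n * (inv m * inv n)         ≡⟨ lem (ι m) (ι n) (inv m) (inv n) ⟩
  (ι m * inv m) * (ι n * inv n)       ≡⟨ cong₂ _*_ (ι*inv p) (ι*inv q) ⟩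
  1ℚ * 1ℚ                             ≡⟨⟩
  1ℚ                                  ∎)
  where
  open ≡-Reasoning
  lem = ring 4 (λ a b c d → a :* b :* (c :* d) , (a :* c) :* (b :* d))

inv-diff : ∀ {m n} → 1 ℕ.≤ m → 1 ℕ.≤ n → inv m - inv n ≡ (ι n - ι m) * (inv m * inv n)
inv-diff {m} {n} p q = trans (lem (inv m) (inv n) (ι m) (ι n))
    (cong₂ (λ u v → (ι n - ι m) * (inv m * inv n) + ((1ℚ - u) * inv m - (1ℚ - v) * inv n)) (ι*inv q) (ι*inv p))
   ▸ lem₂ (inv m) (inv n) ((ι n - ι m) * (inv m * inv n))
  where
  infixl 4 _▸_
  _▸_ : ∀ {a b c : ℚ} → a ≡ b → b ≡ c → a ≡ c
  _▸_ = trans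
  lem = ring 4 (λ i j a b → i :- j , (b :- a) :* (i :* j) :+ ((con 1ℚ :- b :* j) :* i :- (con 1ℚ :- a :* i) :* j))
  lem₂ = ring 3 (λ i j e → e :+ ((con 1ℚ :- con 1ℚ) :* i :- (con 1ℚ :- con 1ℚ) :* j) , e)

inv-mono : ∀ {m n} → 1 ℕ.≤ m → m ℕ.≤ n → inv n ≤ inv m
inv-mono {m} {n} p q = lem (inv m) (inv n) (ι m) (ι n) (ι-mono q) (inv≥0 m) (inv≥0 n) (inv-diff p (ℕₚ.≤-trans p q))
  where
  lem = lin 4 (λ a b x y → x ≼ y ∷ con 0ℚ ≼ a ∷ con 0ℚ ≼ b ∷ a :- b ≗ (y :- x) :* (a :* b) ∷ [] , b , a) ((- 1ℚ , 3 ∷ []) ∷ (1ℚ , 0 ∷ 1 ∷ 2 ∷ []) ∷ [])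

inv1 : inv 1 ≡ 1ℚ
inv1 = trans (sym (*-identityˡ (inv 1))) (trans (cong (_* inv 1) (sym (ι≡♯ 1))) (ι*inv (s≤s z≤n)))

inv≤1 : ∀ {n} → 1 ℕ.≤ n → inv n ≤ 1ℚ
inv≤1 {n} p = subst (inv n ≤_) inv1 (inv-mono ℕₚ.≤-refl p)

inv-suc : ∀ {n} → 1 ℕ.≤ n → inv n - inv (suc n) ≡ inv n * inv (suc n)
inv-suc {n} p = trans (inv-diff p (s≤s z≤n)) (trans (cong (λ u → (u - ι n) * (inv n * inv (suc n))) (ι-suc n)) (lem (ι n) (inv n * inv (suc n))))
  where
  lem = ring 2 (λ a b → (a :+ con 1ℚ :- a) :* b , b)

inv-half-lem = lin 2 (λ i j → con 0ℚ ≼ j ∷ i ≼ con 1ℚ ∷ i :- j ≗ i :* j ∷ [] , con ½ :* i , j) ((½ , 2 ∷ []) ∷ (½ , 0 ∷ 1 ∷ []) ∷ [])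

inv-half : ∀ {n} → 1 ℕ.≤ n → ½ * inv n ≤ inv (suc n)
inv-half {n} p = inv-half-lem (inv n) (inv (suc n)) (inv≥0 (suc n)) (inv≤1 p) (inv-suc p)

-- Absolute values

abs≤ : ∀ {a b} → a ≤ b → - a ≤ b → ∣ a ∣ ≤ b
abs≤ {a} p q with ∣p∣≡p∨∣p∣≡-p a
... | inj₁ e = subst (_≤ _) (sym e) p
... | inj₂ e = subst (_≤ _) (sym e) q

≤abs : ∀ a → a ≤ ∣ a ∣
≤abs a with ≤-total 0ℚ a
... | inj₁ p = ≤-reflexive (sym (0≤p⇒∣p∣≡p p))
... | inj₂ p = ≤-trans p (0≤∣p∣ a)

-≤abs : ∀ a → - a ≤ ∣ a ∣
-≤abs a = subst (- a ≤_) (∣-p∣≡∣p∣ a) (≤abs (- a))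

abs-hi : ∀ {a b} → ∣ a ∣ ≤ b → a ≤ b
abs-hi {a} p = ≤-trans (≤abs a) p

abs-lo : ∀ {a b} → ∣ a ∣ ≤ b → - a ≤ b
abs-lo {a} p = ≤-trans (-≤abs a) p

-- Archimedean property

representation : ∀ q → (∃[ p ] ∃[ d ] q ≡ ι p * inv (suc d)) ⊎ q ≤ 0ℚ
representation q@(mkℚ (+ p) d _) = inj₁ (p , d , trans (sym (↥p/↧p≡p q)) (/-ι-inv p d))
representation q@(mkℚ ℤ.-[1+ p ] d _) = inj₂ (nonPositive⁻¹ q)

archimedean : ∀ q → ∃[ n ] q ≤ ι n
archimedean q with representation q
... | inj₂ q≤0 = 0 , ≤-trans q≤0 (ι≥0 0)
... | inj₁ (p , d , refl) = p , lem (ι p) (inv (suc d)) (ι≥0 p) (inv≤1 (s≤s z≤n))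
  where
  lem = lin 2 (λ a b → con 0ℚ ≼ a ∷ b ≼ con 1ℚ ∷ [] , a :* b , a) ((1ℚ , 0 ∷ 1 ∷ []) ∷ [])

archimedean-inv : ∀ {κ} → 0ℚ < κ → ∃[ n ] (1 ℕ.≤ n × 1ℚ ≤ ι n * κ)
archimedean-inv {κ} κ>0 with representation κ
... | inj₂ q≤0 = ⊥-elim (<-irrefl refl (<-≤-trans κ>0 q≤0))
... | inj₁ (zero , d , refl) = ⊥-elim (<-irrefl (sym (trans (cong (_* inv (suc d)) (ι≡♯ 0)) (*-zeroˡ (inv (suc d))))) κ>0)
... | inj₁ (suc p , d , refl) = suc d , s≤s z≤n , ≤-trans (ι≥1 (s≤s (z≤n {p}))) (≤-reflexive (begin
  ι (suc p)                              ≡⟨ *-identityʳ _ ⟨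
  ι (suc p) * 1ℚ                         ≡⟨ cong (ι (suc p) *_) (ι*inv (s≤s (z≤n {d}))) ⟨
  ι (suc p) * (ι (suc d) * inv (suc d))  ≡⟨ lem (ι (suc p)) (ι (suc d)) (inv (suc d)) ⟩
  ι (suc d) * (ι (suc p) * inv (suc d))  ∎))
  where
  open ≡-Reasoning
  lem = ring 3 (λ a b c → a :* (b :* c) , b :* (a :* c))

-- Finite sums

Sum : ℕ → (ℕ → ℚ) → ℚ
Sum zero    f = 0ℚ
Sum (suc N) f = Sum N f + f (suc N)

Sum-cong : ∀ N {f g} → (∀ n → 1 ℕ.≤ n → n ℕ.≤ N → f n ≡ g n) → Sum N f ≡ Sum N g
Sum-cong zero    h = refl
Sum-cong (suc N) h = cong₂ _+_ (Sum-cong N (λ n p q → h n p (ℕₚ.m≤n⇒m≤1+n q))) (h (suc N) (s≤s z≤n) ℕₚ.≤-refl)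

Sum-mono : ∀ N {f g} → (∀ n → 1 ℕ.≤ n → n ℕ.≤ N → f n ≤ g n) → Sum N f ≤ Sum N g
Sum-mono zero    h = ≤-refl
Sum-mono (suc N) h = +-mono-≤ (Sum-mono N (λ n p q → h n p (ℕₚ.m≤n⇒m≤1+n q))) (h (suc N) (s≤s z≤n) ℕₚ.≤-refl)

Sum-zero : ∀ N → Sum N (λ _ → 0ℚ) ≡ 0ℚ
Sum-zero zero    = refl
Sum-zero (suc N) = trans (+-identityʳ _) (Sum-zero N)

Sum-≥0 : ∀ N {f} → (∀ n → 1 ℕ.≤ n → n ℕ.≤ N → 0ℚ ≤ f n) → 0ℚ ≤ Sum N f
Sum-≥0 N h = subst (_≤ Sum N _) (Sum-zero N) (Sum-mono N h)

Sum-vanish : ∀ N {f} → (∀ n → 1 ℕ.≤ n → n ℕ.≤ N → f n ≡ 0ℚ) → Sum N f ≡ 0ℚ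
Sum-vanish N h = trans (Sum-cong N h) (Sum-zero N)

Sum-+ : ∀ N f g → Sum N (λ n → f n + g n) ≡ Sum N f + Sum N g
Sum-+ zero    f g = refl
Sum-+ (suc N) f g = trans (cong (_+ (f (suc N) + g (suc N))) (Sum-+ N f g)) (lem (Sum N f) (Sum N g) (f (suc N)) (g (suc N)))
  where
  lem = ring 4 (λ a b c d → (a :+ b) :+ (c :+ d) , (a :+ c) :+ (b :+ d))

Sum-- : ∀ N f g → Sum N (λ n → f n - g n) ≡ Sum N f - Sum N g
Sum-- zero    f g = refl
Sum-- (suc N) f g = trans (cong (_+ (f (suc N) - g (suc N))) (Sum-- N f g)) (lem (Sum N f) (Sum N g) (f (suc N)) (g (suc N)))
  where
  lem = ring 4 (λ a b c d → (a :- b) :+ (c :- d) , (a :+ c) :- (b :+ d))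

Sum-*ˡ : ∀ N c f → Sum N (λ n → c * f n) ≡ c * Sum N f
Sum-*ˡ zero    c f = sym (*-zeroʳ c)
Sum-*ˡ (suc N) c f = trans (cong (_+ c * f (suc N)) (Sum-*ˡ N c f)) (sym (*-distribˡ-+ c (Sum N f) (f (suc N))))

Sum-*ʳ : ∀ N c f → Sum N (λ n → f n * c) ≡ Sum N f * c
Sum-*ʳ N c f = trans (Sum-cong N (λ n _ _ → *-comm (f n) c)) (trans (Sum-*ˡ N c f) (*-comm c (Sum N f)))

Sum-const : ∀ N c → Sum N (λ _ → c) ≡ ι N * c
Sum-const zero    c = sym (trans (cong (_* c) (ι≡♯ 0)) (*-zeroˡ c))
Sum-const (suc N) c = trans (cong (_+ c) (Sum-const N c)) (trans (lem (ι N) c) (cong (_* c) (sym (ι-suc N))))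
  where
  lem = ring 2 (λ a c → a :* c :+ c , (a :+ con 1ℚ) :* c)

Sum-swap : ∀ M N (f : ℕ → ℕ → ℚ) → Sum M (λ m → Sum N (f m)) ≡ Sum N (λ n → Sum M (λ m → f m n))
Sum-swap zero    N f = sym (Sum-zero N)
Sum-swap (suc M) N f = trans (cong (_+ Sum N (f (suc M))) (Sum-swap M N f)) (sym (Sum-+ N (λ n → Sum M (λ m → f m n)) (f (suc M))))

Sum-abs : ∀ N {f g} → (∀ n → 1 ℕ.≤ n → n ℕ.≤ N → ∣ f n ∣ ≤ g n) → ∣ Sum N f ∣ ≤ Sum N g
Sum-abs zero    h = ≤-refl
Sum-abs (suc N) {f} h = ≤-trans (∣p+q∣≤∣p∣+∣q∣ (Sum N f) (f (suc N)))
  (+-mono-≤ (Sum-abs N (λ n p q → h n p (ℕₚ.m≤n⇒m≤1+n q))) (h (suc N) (s≤s z≤n) ℕₚ.≤-refl))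

Sum-trunc : ∀ {M N} f → M ℕ.≤ N → (∀ n → M ℕ.< n → n ℕ.≤ N → f n ≡ 0ℚ) → Sum N f ≡ Sum M f
Sum-trunc {M} {N} f M≤N h with ℕₚ.m≤n⇒m<n∨m≡n M≤N
... | inj₂ refl = refl
Sum-trunc {M} {suc N} f M≤N h | inj₁ (s≤s M≤N′) =
  trans (cong₂ _+_ (Sum-trunc f M≤N′ (λ n p q → h n p (ℕₚ.m≤n⇒m≤1+n q))) (h (suc N) (s≤s M≤N′) ℕₚ.≤-refl)) (+-identityʳ _)

Sum-extend : ∀ {M N} f → M ℕ.≤ N → (∀ n → 1 ℕ.≤ n → n ℕ.≤ N → 0ℚ ≤ f n) → Sum M f ≤ Sum N f
Sum-extend {M} {N} f M≤N h with ℕₚ.m≤n⇒m<n∨m≡n M≤N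
... | inj₂ refl = ≤-refl
Sum-extend {M} {suc N} f M≤N h | inj₁ (s≤s M≤N′) =
  subst (_≤ Sum N f + f (suc N)) (+-identityʳ (Sum M f))
    (+-mono-≤ (Sum-extend f M≤N′ (λ n p q → h n p (ℕₚ.m≤n⇒m≤1+n q))) (h (suc N) (s≤s z≤n) ℕₚ.≤-refl))

-- Indicators

[_] : ∀ {p} {P : Set p} → Dec P → ℚ
[ yes _ ] = 1ℚ
[ no _ ]  = 0ℚ

[]-yes : ∀ {p} {P : Set p} (d : Dec P) → P → [ d ] ≡ 1ℚ
[]-yes (yes _) _ = refl
[]-yes (no ¬p) p = ⊥-elim (¬p p)

[]-no : ∀ {p} {P : Set p} (d : Dec P) → ¬ P → [ d ] ≡ 0ℚ
[]-no (yes p) ¬p = ⊥-elim (¬p p)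
[]-no (no _)  _  = refl

[]-≥0 : ∀ {p} {P : Set p} (d : Dec P) → 0ℚ ≤ [ d ]
[]-≥0 (yes _) = 0≤1
[]-≥0 (no _)  = ≤-refl

[]-≤1 : ∀ {p} {P : Set p} (d : Dec P) → [ d ] ≤ 1ℚ
[]-≤1 (yes _) = ≤-refl
[]-≤1 (no _)  = 0≤1

[]-cong : ∀ {p q} {P : Set p} {Q : Set q} (d : Dec P) (e : Dec Q) → (P → Q) → (Q → P) → [ d ] ≡ [ e ]
[]-cong (yes p) e f g = sym ([]-yes e (f p))
[]-cong (no ¬p) e f g = sym ([]-no e (¬p ∘ g))

[]*-cong : ∀ {p} {P : Set p} (d : Dec P) {a b} → (P → a ≡ b) → [ d ] * a ≡ [ d ] * b
[]*-cong (yes p) h = cong (1ℚ *_) (h p)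
[]*-cong (no _) {a} {b} h = trans (*-zeroˡ a) (sym (*-zeroˡ b))

[]*-no : ∀ {p} {P : Set p} (d : Dec P) {a} → ¬ P → [ d ] * a ≡ 0ℚ
[]*-no d {a} ¬p = trans (cong (_* a) ([]-no d ¬p)) (*-zeroˡ a)

[]*-yes : ∀ {p} {P : Set p} (d : Dec P) {a} → P → [ d ] * a ≡ a
[]*-yes d {a} p = trans (cong (_* a) ([]-yes d p)) (*-identityˡ a)

Sum-pick : ∀ N k (f : ℕ → ℚ) → 1 ℕ.≤ k → k ℕ.≤ N → Sum N (λ n → [ k ℕ.≟ n ] * f n) ≡ f k
Sum-pick zero (suc k) f _ ()
Sum-pick (suc N) k f 1≤k k≤N with ℕₚ.m≤n⇒m<n∨m≡n k≤N
... | inj₁ (s≤s k≤N′) = trans (cong₂ _+_ (Sum-pick N k f 1≤k k≤N′) ([]*-no (k ℕ.≟ suc N) (ℕₚ.<⇒≢ (s≤s k≤N′)))) (+-identityʳ _)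
... | inj₂ refl = trans (cong₂ _+_ (Sum-vanish N (λ n _ n≤N → []*-no (k ℕ.≟ n) (ℕₚ.>⇒≢ (s≤s n≤N)))) ([]*-yes (k ℕ.≟ k) refl)) (+-identityˡ _)

Sum-pick-out : ∀ N k (f : ℕ → ℚ) → N ℕ.< k → Sum N (λ n → [ k ℕ.≟ n ] * f n) ≡ 0ℚ
Sum-pick-out N k f N<k = Sum-vanish N (λ n _ n≤N → []*-no (k ℕ.≟ n) (ℕₚ.>⇒≢ (ℕₚ.≤-<-trans n≤N N<k)))

Sum-pick-≤ : ∀ N k (f : ℕ → ℚ) → 1 ℕ.≤ k → Sum N (λ n → [ k ℕ.≟ n ] * f n) ≡ [ k ℕ.≤? N ] * f k
Sum-pick-≤ N k f 1≤k with k ℕ.≤? N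
... | yes k≤N = trans (Sum-pick N k f 1≤k k≤N) (sym (*-identityˡ (f k)))
... | no k≰N  = trans (Sum-pick-out N k f (ℕₚ.≰⇒> k≰N)) (sym (*-zeroˡ (f k)))

-- Insert the indicators of `φ m ≡ n` and exchange the sums: every `n` in the support of `g` is then
-- counted at least once, and every `m` at most once.
Sum-cover : ∀ N M (φ : ℕ → ℕ) (g : ℕ → ℚ) → (∀ n → 0ℚ ≤ g n) →
  (∀ n → 1 ℕ.≤ n → n ℕ.≤ N → g n ≡ 0ℚ ⊎ (∃[ m ] (1 ℕ.≤ m × m ℕ.≤ M × φ m ≡ n))) →
  Sum N g ≤ Sum M (g ∘ φ)
Sum-cover N M φ g g≥0 h = ≤-trans (Sum-mono N step₁) (≤-trans (≤-reflexive (Sum-swap N M (λ n m → [ φ m ℕ.≟ n ] * g n))) (Sum-mono M step₂))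
  where
  step₁ : ∀ n → 1 ℕ.≤ n → n ℕ.≤ N → g n ≤ Sum M (λ m → [ φ m ℕ.≟ n ] * g n)
  step₁ n p q with h n p q
  ... | inj₁ g≡0 = subst (_≤ Sum M (λ m → [ φ m ℕ.≟ n ] * g n)) (sym g≡0) (Sum-≥0 M (λ m _ _ → []-≥0 (φ m ℕ.≟ n) ⊗ g≥0 n))
  ... | inj₂ (m , 1≤m , m≤M , φm≡n) = subst (_≤ Sum M (λ m → [ φ m ℕ.≟ n ] * g n)) (trans (Sum-pick M m (λ k → [ φ k ℕ.≟ n ] * g n) 1≤m m≤M) ([]*-yes (φ m ℕ.≟ n) φm≡n))
        (Sum-mono M (λ k _ _ → lem [ m ℕ.≟ k ] ([ φ k ℕ.≟ n ] * g n) ([]-≤1 (m ℕ.≟ k)) ([]-≥0 (φ k ℕ.≟ n) ⊗ g≥0 n)))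
    where
    lem = lin 2 (λ a b → a ≼ con 1ℚ ∷ con 0ℚ ≼ b ∷ [] , a :* b , b) ((1ℚ , 0 ∷ 1 ∷ []) ∷ [])
  step₂ : ∀ m → 1 ℕ.≤ m → m ℕ.≤ M → Sum N (λ n → [ φ m ℕ.≟ n ] * g n) ≤ g (φ m)
  step₂ m _ _ with φ m in eq
  ... | zero = subst (_≤ g 0) (sym (Sum-vanish N (λ n 1≤n _ → []*-no (zero ℕ.≟ n) (ℕₚ.<⇒≢ 1≤n)))) (g≥0 0)
  ... | suc k = ≤-trans (≤-reflexive (Sum-pick-≤ N (suc k) g (s≤s z≤n))) (lem [ suc k ℕ.≤? N ] (g (suc k)) ([]-≤1 (suc k ℕ.≤? N)) (g≥0 (suc k)))
    where
    lem = lin 2 (λ a b → a ≼ con 1ℚ ∷ con 0ℚ ≼ b ∷ [] , a :* b , b) ((1ℚ , 0 ∷ 1 ∷ []) ∷ [])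

-- Floor division with x // 0 = 0

_//_ : ℕ → ℕ → ℕ
x // zero  = 0
x // suc d = x ℕ./ suc d

infixl 7 _//_

//-*≤ : ∀ x d → x // d ℕ.* d ℕ.≤ x
//-*≤ x zero    = z≤n
//-*≤ x (suc d) = ℕ.m/n*n≤m x (suc d)

*≤⇒≤// : ∀ {x d m} → 1 ℕ.≤ d → d ℕ.* m ℕ.≤ x → m ℕ.≤ x // d
*≤⇒≤// {x} {suc d} {m} _ p = subst (ℕ._≤ x ℕ./ suc d) (trans (cong (ℕ._/ suc d) (ℕₚ.*-comm (suc d) m)) (ℕ.m*n/n≡m m (suc d))) (ℕ./-monoˡ-≤ (suc d) p)

≤//⇒*≤ : ∀ {x d m} → m ℕ.≤ x // d → d ℕ.* m ℕ.≤ x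
≤//⇒*≤ {x} {d} {m} p = ℕₚ.≤-trans (ℕₚ.≤-trans (ℕₚ.*-monoʳ-≤ d p) (ℕₚ.≤-reflexive (ℕₚ.*-comm d (x // d)))) (//-*≤ x d)

//-≤ : ∀ x d → x // d ℕ.≤ x
//-≤ x zero    = z≤n
//-≤ x (suc d) = ℕ.m/n≤m x (suc d)

<*suc// : ∀ x {d} → 1 ℕ.≤ d → x ℕ.< d ℕ.* suc (x // d)
<*suc// x {d} 1≤d with d ℕ.* suc (x // d) ℕ.≤? x
... | no p  = ℕₚ.≰⇒> p
... | yes p = ⊥-elim (ℕₚ.<-irrefl refl (*≤⇒≤// 1≤d p))

1≤// : ∀ {x d} → 1 ℕ.≤ d → d ℕ.≤ x → 1 ℕ.≤ x // d
1≤// {x} {d} p q = *≤⇒≤// p (subst (ℕ._≤ x) (sym (ℕₚ.*-identityʳ d)) q)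

//-anti : ∀ x {d e} → 1 ℕ.≤ d → d ℕ.≤ e → x // e ℕ.≤ x // d
//-anti x {d} {e} 1≤d d≤e = *≤⇒≤// 1≤d (ℕₚ.≤-trans (ℕₚ.*-monoˡ-≤ (x // e) d≤e) (≤//⇒*≤ {x} {e} ℕₚ.≤-refl))

//-assoc : ∀ x {d e} → 1 ℕ.≤ d → 1 ℕ.≤ e → (x // d) // e ≡ x // (d ℕ.* e)
//-assoc x {d} {e} 1≤d 1≤e = ℕₚ.≤-antisym
  (*≤⇒≤// (ℕₚ.*-mono-≤ 1≤d 1≤e) (subst (ℕ._≤ x) (sym (ℕₚ.*-assoc d e _)) (≤//⇒*≤ {x} {d} (≤//⇒*≤ {x // d} {e} ℕₚ.≤-refl))))
  (*≤⇒≤// 1≤e (*≤⇒≤// 1≤d (subst (ℕ._≤ x) (ℕₚ.*-assoc d e _) (≤//⇒*≤ {x} {d ℕ.* e} ℕₚ.≤-refl))))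

-- Sums over lattice points d * m ≤ x

Hyp : ℕ → (ℕ → ℕ → ℚ) → ℚ
Hyp x F = Sum x (λ d → Sum (x // d) (F d))

Sum-// : ∀ x {d} f → 1 ℕ.≤ d → Sum (x // d) f ≡ Sum x (λ m → [ d ℕ.* m ℕ.≤? x ] * f m)
Sum-// x {d} f 1≤d = trans
  (Sum-cong (x // d) (λ m _ q → sym ([]*-yes (d ℕ.* m ℕ.≤? x) (≤//⇒*≤ {x} {d} q))))
  (sym (Sum-trunc _ (//-≤ x d) (λ m p _ → []*-no (d ℕ.* m ℕ.≤? x) (λ q → ℕₚ.<⇒≱ p (*≤⇒≤// 1≤d q)))))

Hyp-rect : ∀ x F → Hyp x F ≡ Sum x (λ d → Sum x (λ m → [ d ℕ.* m ℕ.≤? x ] * F d m))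
Hyp-rect x F = Sum-cong x (λ d p _ → Sum-// x (F d) p)

Hyp-cong : ∀ x {F G} → (∀ d m → 1 ℕ.≤ d → 1 ℕ.≤ m → d ℕ.* m ℕ.≤ x → F d m ≡ G d m) → Hyp x F ≡ Hyp x G
Hyp-cong x h = Sum-cong x (λ d p _ → Sum-cong (x // d) (λ m q r → h d m p q (≤//⇒*≤ {x} {d} r)))

-- Dirichlet convolution

Arith : Set
Arith = ℕ → ℚ

infixl 7 _⋆_

-- Dirichlet convolution, written over the square [1, n]² with the indicator of `d * m ≡ n`.
-- Enlarging the square changes nothing (`rect-extend`), so sums can be exchanged without
-- enumerating divisors.
_⋆_ : Arith → Arith → Arith
(f ⋆ g) n = Sum n (λ d → Sum n (λ m → [ d ℕ.* m ℕ.≟ n ] * (f d * g m)))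

m≤d*m : ∀ {d} m → 1 ℕ.≤ d → m ℕ.≤ d ℕ.* m
m≤d*m {d} m p = subst (ℕ._≤ d ℕ.* m) (ℕₚ.*-identityˡ m) (ℕₚ.*-monoˡ-≤ m p)

d≤d*m : ∀ d {m} → 1 ℕ.≤ m → d ℕ.≤ d ℕ.* m
d≤d*m d {m} p = subst (d ℕ.≤_) (ℕₚ.*-comm m d) (m≤d*m d p)

rect-extend : ∀ {a b a′ b′ n} (F : ℕ → ℕ → ℚ) → n ℕ.≤ a → n ℕ.≤ b → a ℕ.≤ a′ → b ℕ.≤ b′ →
  Sum a (λ d → Sum b (λ m → [ d ℕ.* m ℕ.≟ n ] * F d m)) ≡ Sum a′ (λ d → Sum b′ (λ m → [ d ℕ.* m ℕ.≟ n ] * F d m))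
rect-extend {a} {b} {a′} {b′} {n} F n≤a n≤b a≤a′ b≤b′ = sym (trans
  (Sum-trunc {a} {a′} _ a≤a′ (λ d p _ → Sum-vanish b′ (λ m q _ → []*-no (d ℕ.* m ℕ.≟ n) (λ e →
     ℕₚ.<⇒≱ p (ℕₚ.≤-trans (d≤d*m d q) (ℕₚ.≤-trans (ℕₚ.≤-reflexive e) n≤a))))))
  (Sum-cong a (λ d q _ → Sum-trunc {b} {b′} _ b≤b′ (λ m p _ → []*-no (d ℕ.* m ℕ.≟ n) (λ e →
     ℕₚ.<⇒≱ p (ℕₚ.≤-trans (m≤d*m m q) (ℕₚ.≤-trans (ℕₚ.≤-reflexive e) n≤b)))))))

⋆-extend : ∀ f g {n x} → n ℕ.≤ x → (f ⋆ g) n ≡ Sum x (λ d → Sum x (λ m → [ d ℕ.* m ℕ.≟ n ] * (f d * g m)))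
⋆-extend f g n≤x = rect-extend (λ d m → f d * g m) ℕₚ.≤-refl ℕₚ.≤-refl n≤x n≤x

*-left-comm = ring 3 (λ a b c → a :* (b :* c) , b :* (a :* c))

Sum-⋆ : ∀ x (w f g : Arith) → Sum x (λ n → w n * (f ⋆ g) n) ≡ Hyp x (λ d m → w (d ℕ.* m) * (f d * g m))
Sum-⋆ x w f g = begin
  Sum x (λ n → w n * (f ⋆ g) n)
    ≡⟨ Sum-cong x (λ n _ n≤x → trans (cong (w n *_) (⋆-extend f g n≤x)) (trans (sym (Sum-*ˡ x (w n) _))
         (Sum-cong x (λ d _ _ → trans (sym (Sum-*ˡ x (w n) _)) (Sum-cong x (λ m _ _ → *-left-comm (w n) [ d ℕ.* m ℕ.≟ n ] (f d * g m))))))) ⟩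
  Sum x (λ n → Sum x (λ d → Sum x (λ m → [ d ℕ.* m ℕ.≟ n ] * (w n * (f d * g m)))))
    ≡⟨ Sum-swap x x _ ⟩
  Sum x (λ d → Sum x (λ n → Sum x (λ m → [ d ℕ.* m ℕ.≟ n ] * (w n * (f d * g m)))))
    ≡⟨ Sum-cong x (λ d _ _ → Sum-swap x x _) ⟩
  Sum x (λ d → Sum x (λ m → Sum x (λ n → [ d ℕ.* m ℕ.≟ n ] * (w n * (f d * g m)))))
    ≡⟨ Sum-cong x (λ d p _ → Sum-cong x (λ m q _ → Sum-pick-≤ x (d ℕ.* m) (λ n → w n * (f d * g m)) (ℕₚ.*-mono-≤ p q))) ⟩
  Sum x (λ d → Sum x (λ m → [ d ℕ.* m ℕ.≤? x ] * (w (d ℕ.* m) * (f d * g m))))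
    ≡⟨ Hyp-rect x _ ⟨
  Hyp x (λ d m → w (d ℕ.* m) * (f d * g m)) ∎
  where open ≡-Reasoning

⋆-cong : ∀ {f f′ g g′} n → (∀ k → 1 ℕ.≤ k → k ℕ.≤ n → f k ≡ f′ k) → (∀ k → 1 ℕ.≤ k → k ℕ.≤ n → g k ≡ g′ k) → (f ⋆ g) n ≡ (f′ ⋆ g′) n
⋆-cong n p q = Sum-cong n (λ d r s → Sum-cong n (λ m t u → cong ([ d ℕ.* m ℕ.≟ n ] *_) (cong₂ _*_ (p d r s) (q m t u))))

⋆-comm : ∀ f g n → (f ⋆ g) n ≡ (g ⋆ f) n
⋆-comm f g n = trans (Sum-swap n n _) (Sum-cong n (λ d _ _ → Sum-cong n (λ m _ _ →
  cong₂ (λ k l → [ k ℕ.≟ n ] * l) (ℕₚ.*-comm m d) (*-comm (f m) (g d)))))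

⋆-distribʳ : ∀ f g h n → ((λ k → f k + g k) ⋆ h) n ≡ (f ⋆ h) n + (g ⋆ h) n
⋆-distribʳ f g h n = trans (Sum-cong n (λ d _ _ → trans (Sum-cong n (λ m _ _ → lem [ d ℕ.* m ℕ.≟ n ] (f d) (g d) (h m))) (Sum-+ n _ _))) (Sum-+ n _ _)
  where
  lem = ring 4 (λ i a b c → i :* ((a :+ b) :* c) , i :* (a :* c) :+ i :* (b :* c))

⋆-distribˡ : ∀ f g h n → (f ⋆ (λ k → g k + h k)) n ≡ (f ⋆ g) n + (f ⋆ h) n
⋆-distribˡ f g h n = trans (⋆-comm f _ n) (trans (⋆-distribʳ g h f n) (cong₂ _+_ (⋆-comm g f n) (⋆-comm h f n)))

⋆-scaleʳ : ∀ c f g n → (f ⋆ (λ k → c * g k)) n ≡ c * (f ⋆ g) n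
⋆-scaleʳ c f g n = trans (Sum-cong n (λ d _ _ → trans (Sum-cong n (λ m _ _ → lem [ d ℕ.* m ℕ.≟ n ] c (f d) (g m))) (Sum-*ˡ n c _))) (Sum-*ˡ n c _)
  where
  lem = ring 4 (λ i c a b → i :* (a :* (c :* b)) , c :* (i :* (a :* b)))

-- A weight that vanishes beyond x enforces `d * m ≤ x` by itself, so the region under the hyperbola
-- may be replaced by a square. This brings both bracketings in `⋆-assoc` to the same triple sum.
Sum-⋆-rect : ∀ x (w f g : Arith) → (∀ n → x ℕ.< n → w n ≡ 0ℚ) →
  Sum x (λ n → w n * (f ⋆ g) n) ≡ Sum x (λ d → Sum x (λ m → w (d ℕ.* m) * (f d * g m)))
Sum-⋆-rect x w f g w0 = trans (Sum-⋆ x w f g) (trans (Hyp-rect x _) (Sum-cong x (λ d _ _ → Sum-cong x (λ m _ _ → lem d m))))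
  where
  lem : ∀ d m → [ d ℕ.* m ℕ.≤? x ] * (w (d ℕ.* m) * (f d * g m)) ≡ w (d ℕ.* m) * (f d * g m)
  lem d m with d ℕ.* m ℕ.≤? x
  ... | yes _ = *-identityˡ _
  ... | no p  = trans (*-zeroˡ (w (d ℕ.* m) * (f d * g m))) (sym (trans (cong (_* (f d * g m)) (w0 _ (ℕₚ.≰⇒> p))) (*-zeroˡ (f d * g m))))

⋆-assoc : ∀ f g h n → ((f ⋆ g) ⋆ h) n ≡ (f ⋆ (g ⋆ h)) n
⋆-assoc f g h n = begin
  ((f ⋆ g) ⋆ h) n
    ≡⟨ Sum-swap n n _ ⟩
  Sum n (λ k → Sum n (λ e → [ e ℕ.* k ℕ.≟ n ] * ((f ⋆ g) e * h k)))
    ≡⟨ Sum-cong n (λ k 1≤k _ → trans (Sum-cong n (λ e _ _ → lem₁ [ e ℕ.* k ℕ.≟ n ] ((f ⋆ g) e) (h k)))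
         (Sum-⋆-rect n (λ e → [ e ℕ.* k ℕ.≟ n ] * h k) f g (λ e n<e → []*-no (e ℕ.* k ℕ.≟ n) (λ eq → ℕₚ.<⇒≱ n<e (ℕₚ.≤-trans (d≤d*m e 1≤k) (ℕₚ.≤-reflexive eq)))))) ⟩
  Sum n (λ k → Sum n (λ d → Sum n (λ m → [ d ℕ.* m ℕ.* k ℕ.≟ n ] * h k * (f d * g m))))
    ≡⟨ Sum-swap n n _ ⟩
  Sum n (λ d → Sum n (λ k → Sum n (λ m → [ d ℕ.* m ℕ.* k ℕ.≟ n ] * h k * (f d * g m))))
    ≡⟨ Sum-cong n (λ d _ _ → Sum-swap n n _) ⟩
  Sum n (λ d → Sum n (λ m → Sum n (λ k → [ d ℕ.* m ℕ.* k ℕ.≟ n ] * h k * (f d * g m))))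
    ≡⟨ Sum-cong n (λ d _ _ → Sum-cong n (λ m _ _ → Sum-cong n (λ k _ _ →
         trans (cong (λ z → [ z ℕ.≟ n ] * h k * (f d * g m)) (ℕₚ.*-assoc d m k)) (lem₂ [ d ℕ.* (m ℕ.* k) ℕ.≟ n ] (f d) (g m) (h k))))) ⟩
  Sum n (λ d → Sum n (λ m → Sum n (λ k → [ d ℕ.* (m ℕ.* k) ℕ.≟ n ] * f d * (g m * h k))))
    ≡⟨ Sum-cong n (λ d 1≤d _ → trans (sym (Sum-⋆-rect n (λ e → [ d ℕ.* e ℕ.≟ n ] * f d) g h (λ e n<e → []*-no (d ℕ.* e ℕ.≟ n) (λ eq → ℕₚ.<⇒≱ n<e (ℕₚ.≤-trans (m≤d*m e 1≤d) (ℕₚ.≤-reflexive eq))))))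
         (Sum-cong n (λ e _ _ → *-assoc [ d ℕ.* e ℕ.≟ n ] (f d) ((g ⋆ h) e)))) ⟩
  (f ⋆ (g ⋆ h)) n ∎
  where
  open ≡-Reasoning
  lem₁ = ring 3 (λ i a b → i :* (a :* b) , i :* b :* a)
  lem₂ = ring 4 (λ i a b c → i :* c :* (a :* b) , i :* a :* (b :* c))

δ : Arith
δ n = [ 1 ℕ.≟ n ]

one : Arith
one _ = 1ℚ

⋆-identityˡ : ∀ f n → 1 ℕ.≤ n → (δ ⋆ f) n ≡ f n
⋆-identityˡ f n 1≤n = begin
  (δ ⋆ f) n
    ≡⟨ Sum-cong n (λ d _ _ → trans (Sum-cong n (λ m _ _ → *-left-comm [ d ℕ.* m ℕ.≟ n ] [ 1 ℕ.≟ d ] (f m))) (Sum-*ˡ n [ 1 ℕ.≟ d ] _)) ⟩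
  Sum n (λ d → [ 1 ℕ.≟ d ] * Sum n (λ m → [ d ℕ.* m ℕ.≟ n ] * f m))
    ≡⟨ Sum-pick n 1 _ ℕₚ.≤-refl 1≤n ⟩
  Sum n (λ m → [ 1 ℕ.* m ℕ.≟ n ] * f m)
    ≡⟨ Sum-cong n (λ m _ _ → cong (_* f m) ([]-cong (1 ℕ.* m ℕ.≟ n) (n ℕ.≟ m) (λ e → trans (sym e) (ℕₚ.*-identityˡ m)) (λ e → trans (ℕₚ.*-identityˡ m) (sym e)))) ⟩
  Sum n (λ m → [ n ℕ.≟ m ] * f m)
    ≡⟨ Sum-pick n n f 1≤n ℕₚ.≤-refl ⟩
  f n ∎
  where open ≡-Reasoning

-- On the terms with `d * m ≡ n` the factor `ℓ n` splits as `ℓ d + ℓ m`: multiplication by a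
-- logarithm is a derivation of the convolution ring.
⋆-derivation : ∀ (ℓ : Arith) → (∀ m n → 1 ℕ.≤ m → 1 ℕ.≤ n → ℓ (m ℕ.* n) ≡ ℓ m + ℓ n) → ∀ f g n →
  ℓ n * (f ⋆ g) n ≡ ((λ k → ℓ k * f k) ⋆ g) n + (f ⋆ (λ k → ℓ k * g k)) n
⋆-derivation ℓ ℓ-* f g n = trans (sym (Sum-*ˡ n (ℓ n) _)) (trans (Sum-cong n (λ d p _ → trans (sym (Sum-*ˡ n (ℓ n) _)) (trans (Sum-cong n (λ m q _ → step d m p q)) (Sum-+ n _ _)))) (Sum-+ n _ _))
  where
  lem = ring 5 (λ i a b u v → (u :+ v) :* (i :* (a :* b)) , i :* (u :* a :* b) :+ i :* (a :* (v :* b)))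
  lem₀ = ring 3 (λ i l c → l :* (i :* c) , i :* (l :* c))
  step : ∀ d m → 1 ℕ.≤ d → 1 ℕ.≤ m → ℓ n * ([ d ℕ.* m ℕ.≟ n ] * (f d * g m)) ≡ [ d ℕ.* m ℕ.≟ n ] * (ℓ d * f d * g m) + [ d ℕ.* m ℕ.≟ n ] * (f d * (ℓ m * g m))
  step d m p q = trans (lem₀ [ d ℕ.* m ℕ.≟ n ] (ℓ n) (f d * g m)) (trans ([]*-cong (d ℕ.* m ℕ.≟ n) (λ e → cong (λ z → z * (f d * g m)) (trans (cong ℓ (sym e)) (ℓ-* d m p q))))
    (trans (sym (lem₀ [ d ℕ.* m ℕ.≟ n ] (ℓ d + ℓ m) (f d * g m))) (lem [ d ℕ.* m ℕ.≟ n ] (f d) (g m) (ℓ d) (ℓ m))))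

-- Splitting the divisors of q * m, q prime

Sum-multiples : ∀ q m (G : Arith) → 1 ℕ.≤ q → Sum (q ℕ.* m) (λ E → [ q ∣? E ] * G E) ≡ Sum m (λ e → G (q ℕ.* e))
Sum-multiples q m G 1≤q = sym (begin
  Sum m (λ e → G (q ℕ.* e))
    ≡⟨ Sum-cong m (λ e p r → sym (Sum-pick (q ℕ.* m) (q ℕ.* e) G (ℕₚ.*-mono-≤ 1≤q p) (ℕₚ.*-monoʳ-≤ q r))) ⟩
  Sum m (λ e → Sum (q ℕ.* m) (λ E → [ q ℕ.* e ℕ.≟ E ] * G E))
    ≡⟨ Sum-swap m (q ℕ.* m) _ ⟩
  Sum (q ℕ.* m) (λ E → Sum m (λ e → [ q ℕ.* e ℕ.≟ E ] * G E))
    ≡⟨ Sum-cong (q ℕ.* m) (λ E p r → lem E p r) ⟩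
  Sum (q ℕ.* m) (λ E → [ q ∣? E ] * G E) ∎)
  where
  open ≡-Reasoning
  lem : ∀ E → 1 ℕ.≤ E → E ℕ.≤ q ℕ.* m → Sum m (λ e → [ q ℕ.* e ℕ.≟ E ] * G E) ≡ [ q ∣? E ] * G E
  lem E 1≤E E≤ with q ∣? E
  ... | no ¬d = trans (Sum-vanish m (λ e _ _ → []*-no (q ℕ.* e ℕ.≟ E) (λ eq → ¬d (divides e (trans (sym eq) (ℕₚ.*-comm q e)))))) (sym (*-zeroˡ (G E)))
  ... | yes (divides k E≡) = trans (Sum-cong m (λ e _ _ → cong (_* G E) ([]-cong (q ℕ.* e ℕ.≟ E) (k ℕ.≟ e)
            (λ eq → ℕₚ.*-cancelʳ-≡ k e q {{ℕ.>-nonZero 1≤q}} (trans (sym E≡) (trans (sym eq) (ℕₚ.*-comm q e))))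
            (λ eq → trans (cong (q ℕ.*_) (sym eq)) (trans (ℕₚ.*-comm q k) (sym E≡))))))
        (trans (Sum-pick m k (λ _ → G E) (k≥1 k E≡) (ℕₚ.*-cancelˡ-≤ q {{ℕ.>-nonZero 1≤q}} (subst (ℕ._≤ q ℕ.* m) (trans E≡ (ℕₚ.*-comm k q)) E≤))) (sym (*-identityˡ (G E))))
    where
    k≥1 : ∀ k → E ≡ k ℕ.* q → 1 ℕ.≤ k
    k≥1 zero    eq = ⊥-elim (ℕₚ.<⇒≢ 1≤E (sym eq))
    k≥1 (suc k) eq = s≤s z≤n

notDiv : ℕ → Arith
notDiv q e = 1ℚ - [ q ∣? e ]

notDiv-yes : ∀ {q e} → q ∣ e → notDiv q e ≡ 0ℚ
notDiv-yes {q} {e} p = cong (λ z → 1ℚ - z) ([]-yes (q ∣? e) p)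

notDiv-no : ∀ {q e} → ¬ (q ∣ e) → notDiv q e ≡ 1ℚ
notDiv-no {q} {e} p = cong (λ z → 1ℚ - z) ([]-no (q ∣? e) p)

prime≥1 : ∀ {q} → Prime q → 1 ℕ.≤ q
prime≥1 p = ℕ.>-nonZero⁻¹ _ {{prime⇒nonZero p}}

-- In a factorisation D E = q m either q divides E, and E = q e leaves D e = m, or it does not, and
-- Euclid's lemma puts q into D. Together with `prime-rec` this replaces computations with prime
-- powers.
⋆-prime : ∀ {q} → Prime q → ∀ f g m → (f ⋆ g) (q ℕ.* m) ≡ (f ⋆ (λ e → g (q ℕ.* e))) m + ((λ d → f (q ℕ.* d)) ⋆ (λ e → notDiv q e * g e)) m
⋆-prime {q} pq f g m = begin
  (f ⋆ g) (q ℕ.* m)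
    ≡⟨ Sum-cong N (λ D _ _ → trans (Sum-cong N (λ E _ _ → lem [ q ∣? E ] (t D E))) (Sum-+ N _ _)) ⟩
  Sum N (λ D → Sum N (λ E → [ q ∣? E ] * t D E) + Sum N (λ E → notDiv q E * t D E))
    ≡⟨ Sum-+ N _ _ ⟩
  Sum N (λ D → Sum N (λ E → [ q ∣? E ] * t D E)) + Sum N (λ D → Sum N (λ E → notDiv q E * t D E))
    ≡⟨ cong₂ _+_ first second ⟩
  (f ⋆ (λ e → g (q ℕ.* e))) m + ((λ d → f (q ℕ.* d)) ⋆ (λ e → notDiv q e * g e)) m ∎
  where
  open ≡-Reasoning
  N = q ℕ.* m
  1≤q = prime≥1 pq
  t : ℕ → ℕ → ℚ
  t D E = [ D ℕ.* E ℕ.≟ N ] * (f D * g E)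
  lem = ring 2 (λ i a → a , i :* a :+ (con 1ℚ :- i) :* a)
  cancel : ∀ {a b} → q ℕ.* a ≡ q ℕ.* b → a ≡ b
  cancel {a} {b} = ℕₚ.*-cancelˡ-≡ a b q {{ℕ.>-nonZero 1≤q}}
  swap : ∀ D e → D ℕ.* (q ℕ.* e) ≡ q ℕ.* (D ℕ.* e)
  swap D e = trans (sym (ℕₚ.*-assoc D q e)) (trans (cong (ℕ._* e) (ℕₚ.*-comm D q)) (ℕₚ.*-assoc q D e))
  first : Sum N (λ D → Sum N (λ E → [ q ∣? E ] * t D E)) ≡ (f ⋆ (λ e → g (q ℕ.* e))) m
  first = begin
    Sum N (λ D → Sum N (λ E → [ q ∣? E ] * t D E))
      ≡⟨ Sum-cong N (λ D _ _ → Sum-multiples q m (t D) 1≤q) ⟩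
    Sum N (λ D → Sum m (λ e → [ D ℕ.* (q ℕ.* e) ℕ.≟ N ] * (f D * g (q ℕ.* e))))
      ≡⟨ Sum-cong N (λ D _ _ → Sum-cong m (λ e _ _ → cong (_* (f D * g (q ℕ.* e))) ([]-cong (D ℕ.* (q ℕ.* e) ℕ.≟ N) (D ℕ.* e ℕ.≟ m)
           (λ eq → cancel (trans (sym (swap D e)) eq)) (λ eq → trans (swap D e) (cong (q ℕ.*_) eq))))) ⟩
    Sum N (λ D → Sum m (λ e → [ D ℕ.* e ℕ.≟ m ] * (f D * g (q ℕ.* e))))
      ≡⟨ rect-extend (λ D e → f D * g (q ℕ.* e)) ℕₚ.≤-refl ℕₚ.≤-refl (m≤d*m m 1≤q) ℕₚ.≤-refl ⟨
    (f ⋆ (λ e → g (q ℕ.* e))) m ∎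
  ins : ∀ D E → notDiv q E * t D E ≡ [ q ∣? D ] * (notDiv q E * t D E)
  ins D E with q ∣? E
  ... | yes _ = trans (*-zeroˡ (t D E)) (sym (trans (cong ([ q ∣? D ] *_) (*-zeroˡ (t D E))) (*-zeroʳ [ q ∣? D ])))
  ... | no ¬d with D ℕ.* E ℕ.≟ N
  ...   | no _ = trans (z (f D * g E)) (sym (trans (cong ([ q ∣? D ] *_) (z (f D * g E))) (*-zeroʳ [ q ∣? D ])))
    where
    z = ring 1 (λ a → (con 1ℚ :- con 0ℚ) :* (con 0ℚ :* a) , con 0ℚ)
  ...   | yes eq with euclidsLemma D E pq (subst (q ∣_) (sym eq) (divides m (ℕₚ.*-comm q m)))
  ...     | inj₁ q∣D = sym ([]*-yes (q ∣? D) q∣D)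
  ...     | inj₂ q∣E = ⊥-elim (¬d q∣E)
  second : Sum N (λ D → Sum N (λ E → notDiv q E * t D E)) ≡ ((λ d → f (q ℕ.* d)) ⋆ (λ e → notDiv q e * g e)) m
  second = begin
    Sum N (λ D → Sum N (λ E → notDiv q E * t D E))
      ≡⟨ Sum-swap N N _ ⟩
    Sum N (λ E → Sum N (λ D → notDiv q E * t D E))
      ≡⟨ Sum-cong N (λ E _ _ → trans (Sum-cong N (λ D _ _ → ins D E)) (Sum-multiples q m (λ D → notDiv q E * t D E) 1≤q)) ⟩
    Sum N (λ E → Sum m (λ d → notDiv q E * t (q ℕ.* d) E))
      ≡⟨ Sum-swap N m _ ⟩
    Sum m (λ d → Sum N (λ E → notDiv q E * t (q ℕ.* d) E))
      ≡⟨ Sum-cong m (λ d _ _ → Sum-cong N (λ E _ _ → trans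
           (cong (λ z → notDiv q E * (z * (f (q ℕ.* d) * g E))) ([]-cong (q ℕ.* d ℕ.* E ℕ.≟ N) (d ℕ.* E ℕ.≟ m)
             (λ eq → cancel (trans (sym (ℕₚ.*-assoc q d E)) eq)) (λ eq → trans (ℕₚ.*-assoc q d E) (cong (q ℕ.*_) eq))))
           (lem₂ (notDiv q E) [ d ℕ.* E ℕ.≟ m ] (f (q ℕ.* d)) (g E)))) ⟩
    Sum m (λ d → Sum N (λ E → [ d ℕ.* E ℕ.≟ m ] * (f (q ℕ.* d) * (notDiv q E * g E))))
      ≡⟨ rect-extend (λ d E → f (q ℕ.* d) * (notDiv q E * g E)) ℕₚ.≤-refl ℕₚ.≤-refl ℕₚ.≤-refl (m≤d*m m 1≤q) ⟨
    ((λ d → f (q ℕ.* d)) ⋆ (λ e → notDiv q e * g e)) m ∎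
    where
    lem₂ = ring 4 (λ n i a b → n :* (i :* (a :* b)) , i :* (a :* (n :* b)))

-- Prime factorisations and the Möbius function

fac : ℕ → List ℕ
fac zero    = []
fac (suc n) = factors (factorise (suc n))

open PrimeFactorisation using (isFactorisation; factorsPrime)

fac-product : ∀ {n} → 1 ℕ.≤ n → n ≡ product (fac n)
fac-product {suc n} _ = isFactorisation (factorise (suc n))

fac-prime : ∀ n → All Prime (fac n)
fac-prime zero    = All.[]
fac-prime (suc n) = factorsPrime (factorise (suc n))

fac-unique : ∀ {n} ps → 1 ℕ.≤ n → n ≡ product ps → All Prime ps → fac n ↭ ps
fac-unique {suc n} ps _ eq pr = factorisationUnique (factorise (suc n)) (record { factors = ps ; isFactorisation = eq ; factorsPrime = pr })

fac-* : ∀ {m n} → 1 ℕ.≤ m → 1 ℕ.≤ n → fac (m ℕ.* n) ↭ fac m ++ fac n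
fac-* {m} {n} p q = fac-unique (fac m ++ fac n) (ℕₚ.*-mono-≤ p q)
  (trans (cong₂ ℕ._*_ (fac-product p) (fac-product q)) (sym (product-++ (fac m) (fac n)))) (++⁺ (fac-prime m) (fac-prime n))

fac-prime-* : ∀ {q m} → Prime q → 1 ℕ.≤ m → fac (q ℕ.* m) ↭ q ∷ fac m
fac-prime-* {q} {m} pq p = fac-unique (q ∷ fac m) (ℕₚ.*-mono-≤ (prime≥1 pq) p) (cong (q ℕ.*_) (fac-product p)) (pq All.∷ fac-prime m)

prime-factor : ∀ n → 2 ℕ.≤ n → ∃[ q ] ∃[ m ] (Prime q × 1 ℕ.≤ m × m ℕ.< n × n ≡ q ℕ.* m)
prime-factor n 2≤n with fac n | fac-product {n} (ℕₚ.≤-trans (s≤s z≤n) 2≤n) | fac-prime n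
... | [] | refl | _ = ⊥-elim (ℕₚ.<-irrefl refl 2≤n)
... | q ∷ ps | eq | pq All.∷ _ = q , product ps , pq , m≥1 , m<n , eq
  where
  m≥1 : 1 ℕ.≤ product ps
  m≥1 with product ps
  ... | zero  = ⊥-elim (ℕₚ.<⇒≱ 2≤n (ℕₚ.≤-trans (ℕₚ.≤-reflexive (trans eq (ℕₚ.*-zeroʳ q))) z≤n))
  ... | suc _ = s≤s z≤n
  m<n : product ps ℕ.< n
  m<n = subst (product ps ℕ.<_) (sym eq) (subst (ℕ._< q ℕ.* product ps) (ℕₚ.*-identityˡ (product ps))
    (ℕₚ.*-monoˡ-< (product ps) {{ℕ.>-nonZero m≥1}} (ℕ.nonTrivial⇒n>1 q {{prime⇒nonTrivial pq}})))

∈fac⇒∣ : ∀ {q n} → 1 ℕ.≤ n → q ∈ fac n → q ∣ n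
∈fac⇒∣ {q} {n} p h = subst (q ∣_) (sym (fac-product p)) (∈⇒∣product h)

∣⇒∈fac : ∀ {q n} → Prime q → 1 ℕ.≤ n → q ∣ n → q ∈ fac n
∣⇒∈fac {q} {n} pq p h = factorisationHasAllPrimeFactors pq (subst (q ∣_) (fac-product p) h) (fac-prime n)

prime-rec : ∀ {a} (P : ℕ → Set a) → P 1 → (∀ q m → Prime q → 1 ℕ.≤ m → P m → P (q ℕ.* m)) → ∀ n → 1 ℕ.≤ n → P n
prime-rec P p1 step = <-rec (λ n → 1 ℕ.≤ n → P n) go
  where
  go : ∀ n → (∀ {m} → m ℕ.< n → 1 ℕ.≤ m → P m) → 1 ℕ.≤ n → P n
  go 1 rec _ = p1
  go n@(suc (suc _)) rec _ with prime-factor n (s≤s (s≤s z≤n))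
  ... | q , m , pq , m≥1 , m<n , eq = subst P (sym eq) (step q m pq m≥1 (rec m<n m≥1))

-- The Möbius function read off a list of prime factors: every prime changes the sign, and one that
-- recurs further down gives 0.
sign : List ℕ → ℚ
sign []       = 1ℚ
sign (p ∷ ps) = (1ℚ - [ p ∈? ps ]) * - sign ps

sign-yes : ∀ {p ps} → p ∈ ps → sign (p ∷ ps) ≡ 0ℚ
sign-yes {p} {ps} h = trans (cong (λ z → (1ℚ - z) * - sign ps) ([]-yes (p ∈? ps) h)) (*-zeroˡ (- sign ps))

sign-no : ∀ {p ps} → ¬ (p ∈ ps) → sign (p ∷ ps) ≡ - sign ps
sign-no {p} {ps} h = trans (cong (λ z → (1ℚ - z) * - sign ps) ([]-no (p ∈? ps) h)) (*-identityˡ (- sign ps))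

sign-prep : ∀ p {ps qs} → ps ↭ qs → sign ps ≡ sign qs → sign (p ∷ ps) ≡ sign (p ∷ qs)
sign-prep p {ps} {qs} ps↭qs eq = cong₂ (λ z s → (1ℚ - z) * - s)
  ([]-cong (p ∈? ps) (p ∈? qs) (∈-resp-↭ ps↭qs) (∈-resp-↭ (↭.↭-sym ps↭qs))) eq

sign-swap : ∀ p q ps → sign (p ∷ q ∷ ps) ≡ sign (q ∷ p ∷ ps)
sign-swap p q ps = go (p ℕ.≟ q) (p ∈? ps) (q ∈? ps)
  where
  new : ∀ {p q ps} → p ≢ q → ¬ (p ∈ ps) → ¬ (p ∈ q ∷ ps)
  new p≢q ¬h (here e)  = p≢q e
  new p≢q ¬h (there z) = ¬h z
  go : Dec (p ≡ q) → Dec (p ∈ ps) → Dec (q ∈ ps) → sign (p ∷ q ∷ ps) ≡ sign (q ∷ p ∷ ps)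
  go (yes refl) _ _ = refl
  go (no p≢q) (yes h) (yes k) = trans (sign-yes (there h)) (sym (sign-yes (there k)))
  go (no p≢q) (yes h) (no ¬k) = trans (sign-yes (there h)) (sym (trans (sign-no (new (p≢q ∘ sym) ¬k)) (cong -_ (sign-yes h))))
  go (no p≢q) (no ¬h) (yes k) = trans (sign-no (new p≢q ¬h)) (trans (cong -_ (sign-yes k)) (sym (sign-yes (there k))))
  go (no p≢q) (no ¬h) (no ¬k) = trans (sign-no (new p≢q ¬h)) (trans (cong -_ (trans (sign-no ¬k) (sym (sign-no ¬h))))
    (sym (sign-no (new (p≢q ∘ sym) ¬k))))

sign-↭ : ∀ {ps qs} → ps ↭ qs → sign ps ≡ sign qs
sign-↭ ↭.refl = refl
sign-↭ (↭.prep p h) = sign-prep p h (sign-↭ h)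
sign-↭ (↭.swap p q h) = trans (sign-prep p (↭.prep q h) (sign-prep q h (sign-↭ h))) (sign-swap p q _)
sign-↭ (↭.trans h k) = trans (sign-↭ h) (sign-↭ k)

sign-bound : ∀ ps → ∣ sign ps ∣ ≤ 1ℚ
sign-bound [] = ≤-refl
sign-bound (p ∷ ps) with p ∈? ps
... | yes _ = subst (λ z → ∣ z ∣ ≤ 1ℚ) (sym (*-zeroˡ (- sign ps))) 0≤1
... | no _  = subst (λ z → ∣ z ∣ ≤ 1ℚ) (sym (*-identityˡ (- sign ps))) (subst (_≤ 1ℚ) (sym (∣-p∣≡∣p∣ (sign ps))) (sign-bound ps))

abstract
  μ : Arith
  μ n = sign (fac n)

  μ-bound : ∀ n → ∣ μ n ∣ ≤ 1ℚ
  μ-bound n = sign-bound (fac n)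

  μ-1 : μ 1 ≡ 1ℚ
  μ-1 = refl

  μ-prime-* : ∀ {q m} → Prime q → 1 ℕ.≤ m → μ (q ℕ.* m) ≡ - (notDiv q m * μ m)
  μ-prime-* {q} {m} pq p = trans (sign-↭ (fac-prime-* pq p)) lem
    where
    lem : sign (q ∷ fac m) ≡ - (notDiv q m * μ m)
    lem with q ∣? m
    ... | yes h = trans (sign-yes (∣⇒∈fac pq p h)) (sym (cong -_ (*-zeroˡ (sign (fac m)))))
    ... | no ¬h = trans (sign-no (λ z → ¬h (∈fac⇒∣ p z))) (sym (cong -_ (*-identityˡ (sign (fac m)))))

⋆-neg : ∀ f g n → ((λ k → - f k) ⋆ g) n ≡ - (f ⋆ g) n
⋆-neg f g n = trans (⋆-comm _ g n) (trans (⋆-cong {g} {g} n (λ _ _ _ → refl) (λ k _ _ → lem (f k))) (trans (⋆-scaleʳ (- 1ℚ) g f n) (trans (sym (lem ((g ⋆ f) n))) (cong -_ (⋆-comm g f n)))))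
  where
  lem = ring 1 (λ a → :- a , :- con 1ℚ :* a)

-- The second summand of ⋆-prime when the left factor is μ.
μ-shift-⋆ : ∀ {q} → Prime q → ∀ g m → 1 ℕ.≤ m → ((λ d → μ (q ℕ.* d)) ⋆ (λ e → notDiv q e * g e)) m ≡ - (notDiv q m * (μ ⋆ g) m)
μ-shift-⋆ {q} pq g m 1≤m = trans (⋆-cong {g = λ e → notDiv q e * g e} m (λ k p _ → μ-prime-* pq p) (λ _ _ _ → refl)) (trans (⋆-neg (λ d → notDiv q d * μ d) (λ e → notDiv q e * g e) m) (cong -_ (trans
    (Sum-cong m (λ d _ _ → trans (Sum-cong m (λ e _ _ → step d e)) (Sum-*ˡ m (notDiv q m) _))) (Sum-*ˡ m (notDiv q m) _))))
  where
  lem₁ = ring 4 (λ a b x y → x :* a :* (y :* b) , (x :* y) :* (a :* b))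
  nd : ∀ d e → notDiv q d * notDiv q e ≡ notDiv q (d ℕ.* e)
  nd d e with q ∣? d | q ∣? e
  ... | yes h | k = trans (*-zeroˡ (1ℚ - [ k ])) (sym (notDiv-yes (∣.∣m⇒∣m*n e h)))
  ... | no _ | yes k = sym (notDiv-yes (∣.∣n⇒∣m*n d k))
  ... | no ¬h | no ¬k = sym (notDiv-no {q} {d ℕ.* e} (λ z → case (euclidsLemma d e pq z)))
    where
    case : (q ∣ d) ⊎ (q ∣ e) → ⊥
    case (inj₁ h) = ¬h h
    case (inj₂ k) = ¬k k
  step : ∀ d e → [ d ℕ.* e ℕ.≟ m ] * (notDiv q d * μ d * (notDiv q e * g e)) ≡ notDiv q m * ([ d ℕ.* e ℕ.≟ m ] * (μ d * g e))
  step d e = trans ([]*-cong (d ℕ.* e ℕ.≟ m) (λ eq → trans (lem₁ (μ d) (g e) (notDiv q d) (notDiv q e)) (cong (_* (μ d * g e)) (trans (nd d e) (cong (notDiv q) eq)))))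
    (*-left-comm [ d ℕ.* e ℕ.≟ m ] (notDiv q m) (μ d * g e))

-- By `⋆-prime` and `μ-shift-⋆` the value at q m is the value at m times the indicator of q ∣ m. If
-- q ∣ m, then m > 1 and the value at m is already 0.
μ⋆one : ∀ n → 1 ℕ.≤ n → (μ ⋆ one) n ≡ δ n
μ⋆one = prime-rec _ base step
  where
  base : (μ ⋆ one) 1 ≡ δ 1
  base = trans (lem (μ 1)) μ-1
    where
    lem = ring 1 (λ a → con 0ℚ :+ (con 0ℚ :+ con 1ℚ :* (a :* con 1ℚ)) , a)
  step : ∀ q m → Prime q → 1 ℕ.≤ m → (μ ⋆ one) m ≡ δ m → (μ ⋆ one) (q ℕ.* m) ≡ δ (q ℕ.* m)
  step q m pq 1≤m ih = trans (⋆-prime pq μ one m) (trans (cong (λ z → (μ ⋆ one) m + z) (μ-shift-⋆ pq one m 1≤m)) (trans (lem ((μ ⋆ one) m) [ q ∣? m ]) (trans fin (sym δ0))))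
    where
    lem = ring 2 (λ a b → a :+ :- ((con 1ℚ :- b) :* a) , b :* a)
    2≤q = ℕ.nonTrivial⇒n>1 q {{prime⇒nonTrivial pq}}
    δ0 : δ (q ℕ.* m) ≡ 0ℚ
    δ0 = []-no (1 ℕ.≟ q ℕ.* m) (ℕₚ.<⇒≢ (ℕₚ.*-mono-≤ 2≤q 1≤m))
    fin : [ q ∣? m ] * (μ ⋆ one) m ≡ 0ℚ
    fin with q ∣? m
    ... | no _ = *-zeroˡ ((μ ⋆ one) m)
    ... | yes h = trans (*-identityˡ ((μ ⋆ one) m)) (trans ih ([]-no (1 ℕ.≟ m) (ℕₚ.<⇒≢ (ℕₚ.≤-trans 2≤q (∣.∣⇒≤ {{ℕ.>-nonZero 1≤m}} h)))))

-- A rational stand-in for log, exactly additive, whose increments are controlled only up to X.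
record LogTo (X : ℕ) : Set where
  field
    ℓ       : Arith
    ℓ-*     : ∀ m n → 1 ℕ.≤ m → 1 ℕ.≤ n → ℓ (m ℕ.* n) ≡ ℓ m + ℓ n
    ℓ≥0     : ∀ n → 0ℚ ≤ ℓ n
    step≥0  : ∀ n → 1 ℕ.≤ n → n ℕ.≤ X → ℓ n ≤ ℓ (suc n)
    step-hi : ∀ n → 1 ℕ.≤ n → n ℕ.≤ X → ℓ (suc n) - ℓ n ≤ inv n + inv n * inv n
    step-lo : ∀ n → 1 ℕ.≤ n → n ℕ.≤ X → inv n - ♯ 2 * (inv n * inv n) ≤ ℓ (suc n) - ℓ n
    ℓ2≥½    : ½ ≤ ℓ 2

-- Möbius inversion in summed form: collecting the terms with `d * m ≡ n` leaves `w n * δ n`. Such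
-- sums are evaluated exactly, although nothing is known about partial sums of `μ`.
Hyp-μ : ∀ x (w : Arith) → 1 ℕ.≤ x → Hyp x (λ d m → μ d * w (d ℕ.* m)) ≡ w 1
Hyp-μ x w 1≤x = trans (Hyp-cong x (λ d m _ _ _ → lem (μ d) (w (d ℕ.* m)))) (trans (sym (Sum-⋆ x w μ one))
  (trans (Sum-cong x (λ n p _ → trans (cong (w n *_) (μ⋆one n p)) (*-comm (w n) (δ n)))) (Sum-pick x 1 w ℕₚ.≤-refl 1≤x)))
  where
  lem = ring 2 (λ a b → a :* b , b :* (a :* con 1ℚ))

Hyp-*ˡ : ∀ x (f : Arith) (F : ℕ → ℕ → ℚ) → Hyp x (λ d m → f d * F d m) ≡ Sum x (λ d → f d * Sum (x // d) (F d))
Hyp-*ˡ x f F = Sum-cong x (λ d _ _ → Sum-*ˡ (x // d) (f d) (F d))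

-- Telescoping, partial summation and bounded search

abs-* : ∀ {a b A B} → ∣ a ∣ ≤ A → ∣ b ∣ ≤ B → ∣ a * b ∣ ≤ A * B
abs-* {a} {b} {A} {B} p q = subst (_≤ A * B) (sym (∣p*q∣≡∣p∣*∣q∣ a b)) (lem ∣ a ∣ ∣ b ∣ A B (0≤∣p∣ a) (0≤∣p∣ b) p q)
  where
  lem = lin 4 (λ a b A B → con 0ℚ ≼ a ∷ con 0ℚ ≼ b ∷ a ≼ A ∷ b ≼ B ∷ [] , a :* b , A :* B) ((1ℚ , 0 ∷ 3 ∷ []) ∷ (1ℚ , 1 ∷ 2 ∷ []) ∷ (1ℚ , 2 ∷ 3 ∷ []) ∷ [])

H : Arith
H n = Sum n inv

H≥0 : ∀ n → 0ℚ ≤ H n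
H≥0 n = Sum-≥0 n (λ m _ _ → inv≥0 m)

-- Telescoping with a majorant `e`. It does the work of convergence: `g n` is within `e n` of the
-- value at a far end point, and no limit is formed.
dominated : ∀ X (g e : Arith) → (∀ n → 1 ℕ.≤ n → n ℕ.≤ X → ∣ g (suc n) - g n ∣ ≤ e n - e (suc n)) →
  ∀ {n m} → 1 ℕ.≤ n → n ℕ.≤ m → m ℕ.≤ suc X → ∣ g m - g n ∣ ≤ e n - e m
dominated X g e h {n} {m} 1≤n n≤m m≤X with ℕₚ.m≤n⇒m<n∨m≡n n≤m
... | inj₂ refl = subst₂ _≤_ (cong ∣_∣ (sym (+-inverseʳ (g n)))) (sym (+-inverseʳ (e n))) ≤-refl
dominated X g e h {n} {suc m} 1≤n n≤m (s≤s m≤X) | inj₁ (s≤s n≤m′) =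
  abs≤ (lem₁ (g (suc m)) (g m) (g n) (e n) (e m) (e (suc m)) (abs-hi ih) (abs-hi st))
       (lem₂ (g (suc m)) (g m) (g n) (e n) (e m) (e (suc m)) (abs-lo ih) (abs-lo st))
  where
  ih = dominated X g e h 1≤n n≤m′ (ℕₚ.m≤n⇒m≤1+n m≤X)
  st = h m (ℕₚ.≤-trans 1≤n n≤m′) m≤X
  lem₁ = lin 6 (λ a b c x y z → b :- c ≼ x :- y ∷ a :- b ≼ y :- z ∷ [] , a :- c , x :- z) ((1ℚ , 0 ∷ []) ∷ (1ℚ , 1 ∷ []) ∷ [])
  lem₂ = lin 6 (λ a b c x y z → :- (b :- c) ≼ x :- y ∷ :- (a :- b) ≼ y :- z ∷ [] , :- (a :- c) , x :- z) ((1ℚ , 0 ∷ []) ∷ (1ℚ , 1 ∷ []) ∷ [])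

abs-+ : ∀ {a b A B} → ∣ a ∣ ≤ A → ∣ b ∣ ≤ B → ∣ a + b ∣ ≤ A + B
abs-+ {a} {b} p q = ≤-trans (∣p+q∣≤∣p∣+∣q∣ a b) (+-mono-≤ p q)

abs-- : ∀ {a b A B} → ∣ a ∣ ≤ A → ∣ b ∣ ≤ B → ∣ a - b ∣ ≤ A + B
abs-- {a} {b} p q = ≤-trans (∣p-q∣≤∣p∣+∣q∣ a b) (+-mono-≤ p q)

ι-- : ∀ {m n} → m ℕ.≤ n → ι (n ℕ.∸ m) ≡ ι n - ι m
ι-- {m} {n} p = lem (ι n) (ι m) (ι (n ℕ.∸ m)) (trans (cong ι (sym (ℕₚ.m+[n∸m]≡n p))) (ι-+ m (n ℕ.∸ m)))
  where
  lem₀ = ring 2 (λ b c → c , b :+ c :- b)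
  lem : ∀ a b c → a ≡ b + c → c ≡ a - b
  lem a b c e = trans (lem₀ b c) (cong (_- b) (sym e))

module _ {x d : ℕ} (1≤d : 1 ℕ.≤ d) where
  ι//≤ : ι (x // d) ≤ ι x * inv d
  ι//≤ = lem (ι d) (ι (x // d)) (ι x) (inv d) (subst (_≤ ι x) (ι-* d (x // d)) (ι-mono (≤//⇒*≤ {x} {d} ℕₚ.≤-refl))) (ι*inv 1≤d) (inv≥0 d)
    where
    lem₀ = ring 3 (λ d n i → n :* (d :* i) , (d :* n) :* i)
    lem : ∀ d n x i → d * n ≤ x → d * i ≡ 1ℚ → 0ℚ ≤ i → n ≤ x * i
    lem d n x i p e i0 = subst (_≤ x * i) (trans (sym (lem₀ d n i)) (trans (cong (n *_) e) (*-identityʳ n))) (*-monoʳ-≤-nonNeg i {{nonNegative i0}} p)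

  ≤ι//+1 : ι x * inv d ≤ ι (x // d) + 1ℚ
  ≤ι//+1 = lem (ι d) (ι (x // d) + 1ℚ) (ι x) (inv d) (subst (ι x ≤_) (trans (ι-* d (suc (x // d))) (cong (ι d *_) (ι-suc (x // d)))) (ι-mono (ℕₚ.<⇒≤ (<*suc// x 1≤d)))) (ι*inv 1≤d) (inv≥0 d)
    where
    lem₀ = ring 3 (λ d n i → n :* (d :* i) , (d :* n) :* i)
    lem : ∀ d n x i → x ≤ d * n → d * i ≡ 1ℚ → 0ℚ ≤ i → x * i ≤ n
    lem d n x i p e i0 = subst (x * i ≤_) (trans (sym (lem₀ d n i)) (trans (cong (n *_) e) (*-identityʳ n))) (*-monoʳ-≤-nonNeg i {{nonNegative i0}} p)

-- Partial summation. The variation of `g` is paid for by the decrease of `k`, and Σ n (k n - k (n +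
-- 1)) + x k x collapses to Σ k.
abel : ∀ C (e g k : Arith) x → 1 ℕ.≤ x → 0ℚ ≤ C →
  (∀ n → 1 ℕ.≤ n → n ℕ.≤ x → ∣ Sum n e ∣ ≤ C * ι n) →
  (∀ n → 1 ℕ.≤ n → n ℕ.< x → ∣ g n - g (suc n) ∣ ≤ k n - k (suc n)) →
  ∣ g x ∣ ≤ k x →
  ∣ Sum x (λ n → e n * g n) ∣ ≤ C * Sum x k
abel C e g k x 1≤x C≥0 hE hg hx = subst₂ _≤_ (cong ∣_∣ (lem₁ (Sum x (λ n → e n * g n)) (Sum x e * g x))) (lem₂ C (Sum x k) (ι x) (k x))
    (abs-+ (partial x 1≤x ℕₚ.≤-refl) (abs-* (hE x 1≤x ℕₚ.≤-refl) hx))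
  where
  lem₁ = ring 2 (λ a b → (a :- b) :+ b , a)
  lem₂ = ring 4 (λ c a x k → c :* (a :- x :* k) :+ c :* x :* k , c :* a)
  lem₃ = ring 2 (λ e g → (con 0ℚ :+ e :* g) :- (con 0ℚ :+ e) :* g , con 0ℚ)
  lem₄ = ring 2 (λ c k → c :* ((con 0ℚ :+ k) :- con 1ℚ :* k) , con 0ℚ)
  lem₅ = ring 5 (λ a b c g g′ → (a :- b :* g) :+ b :* (g :- g′) , (a :+ c :* g′) :- (b :+ c) :* g′)
  lem₆ = ring 5 (λ c s n k k′ → c :* (s :- n :* k) :+ c :* n :* (k :- k′) , c :* ((s :+ k′) :- (n :+ con 1ℚ) :* k′))
  partial : ∀ m → 1 ℕ.≤ m → m ℕ.≤ x → ∣ Sum m (λ n → e n * g n) - Sum m e * g m ∣ ≤ C * (Sum m k - ι m * k m)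
  partial (suc zero) _ _ = subst₂ _≤_ (cong ∣_∣ (sym (lem₃ (e 1) (g 1)))) (sym (trans (cong (λ z → C * ((0ℚ + k 1) - z * k 1)) (ι≡♯ 1)) (lem₄ C (k 1)))) ≤-refl
  partial (suc (suc m)) _ m<x = subst₂ _≤_
    (cong ∣_∣ (lem₅ (Sum (suc m) (λ n → e n * g n)) (Sum (suc m) e) (e (suc (suc m))) (g (suc m)) (g (suc (suc m)))))
    (trans (lem₆ C (Sum (suc m) k) (ι (suc m)) (k (suc m)) (k (suc (suc m)))) (cong (λ z → C * (Sum (suc (suc m)) k - z * k (suc (suc m)))) (sym (ι-suc (suc m)))))
    (abs-+ (partial (suc m) (s≤s z≤n) (ℕₚ.<⇒≤ m<x)) (abs-* (hE (suc m) (s≤s z≤n) (ℕₚ.<⇒≤ m<x)) (hg (suc m) (s≤s z≤n) m<x)))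

search : ∀ {P : ℕ → Set} → (∀ n → Dec (P n)) → ∀ a b → (∃[ v ] (a ℕ.≤ v × v ℕ.≤ b × P v)) ⊎ (∀ v → a ℕ.≤ v → v ℕ.≤ b → ¬ P v)
search {P} P? a zero with P? zero
... | yes p with a ℕ.≤? zero
...   | yes q = inj₁ (zero , q , z≤n , p)
...   | no ¬q = inj₂ (λ v a≤v v≤0 _ → ¬q (ℕₚ.≤-trans a≤v v≤0))
search {P} P? a zero | no ¬p = inj₂ (λ { zero _ _ → ¬p })
search {P} P? a (suc b) with search P? a b
... | inj₁ (v , p , q , r) = inj₁ (v , p , ℕₚ.m≤n⇒m≤1+n q , r)
... | inj₂ none with P? (suc b) | a ℕ.≤? suc b
...   | yes p | yes q = inj₁ (suc b , q , ℕₚ.≤-refl , p)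
...   | yes _ | no ¬q = inj₂ (λ v a≤v v≤b _ → ¬q (ℕₚ.≤-trans a≤v v≤b))
...   | no ¬p | _ = inj₂ λ v a≤v v≤b → case v a≤v (ℕₚ.m≤n⇒m<n∨m≡n v≤b)
  where
  case : ∀ v → a ℕ.≤ v → (v ℕ.< suc b) ⊎ (v ≡ suc b) → ¬ P v
  case v a≤v (inj₁ (s≤s v≤b)) = none v a≤v v≤b
  case v a≤v (inj₂ refl) = ¬p

search? : ∀ {P : ℕ → Set} → (∀ n → Dec (P n)) → ∀ a b → Dec (∃[ v ] (a ℕ.≤ v × v ℕ.≤ b × P v))
search? P? a b with search P? a b
... | inj₁ p = yes p
... | inj₂ ¬p = no (λ (v , p , q , r) → ¬p v p q r)

-- The hypothesis puts `f (suc x)` beyond `x`, so the passage from `f i ≤ x` to `f (suc i) ≤ x` must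
-- fail for some i ≤ x.
bracket : ∀ (f : ℕ → ℕ) → (∀ i → i ℕ.< f (suc i)) → ∀ x → f 0 ℕ.≤ x → ∃[ i ] (f i ℕ.≤ x × x ℕ.< f (suc i))
bracket f grows x p with search (λ i → (f i ℕ.≤? x) ×-dec (x ℕ.<? f (suc i))) 0 x
... | inj₁ (i , _ , _ , h) = i , h
... | inj₂ none = ⊥-elim (ℕₚ.<⇒≱ (grows x) (all (suc x) ℕₚ.≤-refl))
  where
  all : ∀ i → i ℕ.≤ suc x → f i ℕ.≤ x
  all zero    _ = p
  all (suc i) (s≤s i≤x) with f (suc i) ℕ.≤? x
  ... | yes h = h
  ... | no ¬h = ⊥-elim (none i z≤n i≤x (all i (ℕₚ.m≤n⇒m≤1+n i≤x) , ℕₚ.≰⇒> ¬h))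

Sum-range-mono : ∀ {a b} {f g : Arith} → a ℕ.≤ b → (∀ n → a ℕ.< n → n ℕ.≤ b → f n ≤ g n) → Sum b f - Sum a f ≤ Sum b g - Sum a g
Sum-range-mono {a} {b} {f} {g} a≤b h with ℕₚ.m≤n⇒m<n∨m≡n a≤b
... | inj₂ refl = ≤-reflexive (trans (+-inverseʳ (Sum a f)) (sym (+-inverseʳ (Sum a g))))
Sum-range-mono {a} {suc b} {f} {g} a≤b h | inj₁ (s≤s a≤b′) =
  lem (Sum b f) (Sum a f) (f (suc b)) (Sum b g) (Sum a g) (g (suc b)) (Sum-range-mono {f = f} {g} a≤b′ (λ n p q → h n p (ℕₚ.m≤n⇒m≤1+n q))) (h (suc b) (s≤s a≤b′) ℕₚ.≤-refl)
  where
  lem = lin 6 (λ b a f b' a' g → b :- a ≼ b' :- a' ∷ f ≼ g ∷ [] , (b :+ f) :- a , (b' :+ g) :- a') ((1ℚ , 0 ∷ []) ∷ (1ℚ , 1 ∷ []) ∷ [])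

1≤2^ : ∀ e → 1 ℕ.≤ 2 ℕ.^ e
1≤2^ e = ℕₚ.m^n>0 2 e

-- Periodic functions and residues modulo M

Sum-split : ∀ a b f → Sum (a ℕ.+ b) f ≡ Sum a f + Sum b (λ i → f (a ℕ.+ i))
Sum-split a zero    f = trans (cong (λ z → Sum z f) (ℕₚ.+-identityʳ a)) (sym (+-identityʳ (Sum a f)))
Sum-split a (suc b) f = trans (cong (λ z → Sum z f) (ℕₚ.+-suc a b)) (trans (cong₂ _+_ (Sum-split a b f) (cong f (sym (ℕₚ.+-suc a b)))) (+-assoc (Sum a f) (Sum b (λ i → f (a ℕ.+ i))) (f (a ℕ.+ suc b))))

Periodic : ℕ → Arith → Set
Periodic M f = ∀ n → f (M ℕ.+ n) ≡ f n

Sum-shift : ∀ M f → Periodic M f → ∀ k → Sum M (λ c → f (k ℕ.+ c)) ≡ Sum M f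
Sum-shift M f per zero    = refl
Sum-shift M f per (suc k) = trans (lem (Sum M (λ c → f (suc k ℕ.+ c))) (f (k ℕ.+ 1)) (Sum M (λ c → f (k ℕ.+ c))) eq) (Sum-shift M f per k)
  where
  lem₀ = ring 2 (λ b c → (c :+ b) :- b , c)
  lem : ∀ a b c → b + a ≡ c + b → a ≡ c
  lem a b c e = trans (sym (lem₀ b a)) (trans (cong (_- b) (trans (+-comm a b) e)) (lem₀ b c))
  eq : f (k ℕ.+ 1) + Sum M (λ c → f (suc k ℕ.+ c)) ≡ Sum M (λ c → f (k ℕ.+ c)) + f (k ℕ.+ 1)
  eq = begin
    f (k ℕ.+ 1) + Sum M (λ c → f (suc k ℕ.+ c))
      ≡⟨ cong₂ _+_ (sym (+-identityˡ (f (k ℕ.+ 1)))) (Sum-cong M (λ c _ _ → cong f (sym (ℕₚ.+-suc k c)))) ⟩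
    Sum 1 (λ c → f (k ℕ.+ c)) + Sum M (λ c → f (k ℕ.+ (1 ℕ.+ c)))
      ≡⟨ Sum-split 1 M (λ c → f (k ℕ.+ c)) ⟨
    Sum M (λ c → f (k ℕ.+ c)) + f (k ℕ.+ suc M)
      ≡⟨ cong (λ z → Sum M (λ c → f (k ℕ.+ c)) + z) (trans (cong f (trans (ℕₚ.+-comm k (suc M)) (trans (sym (ℕₚ.+-suc M k)) (cong (M ℕ.+_) (ℕₚ.+-comm 1 k))))) (per (k ℕ.+ 1))) ⟩
    Sum M (λ c → f (k ℕ.+ c)) + f (k ℕ.+ 1) ∎
    where open ≡-Reasoning

periodic-bound : ∀ M f c → 1 ℕ.≤ M → Periodic M f → Sum M f ≡ 0ℚ → (∀ n → ∣ f n ∣ ≤ c) → ∀ v → ∣ Sum v f ∣ ≤ ι M * c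
periodic-bound M f c 1≤M per mean bd = <-rec _ go
  where
  c≥0 : 0ℚ ≤ c
  c≥0 = ≤-trans (0≤∣p∣ (f 0)) (bd 0)
  go : ∀ v → (∀ {u} → u ℕ.< v → ∣ Sum u f ∣ ≤ ι M * c) → ∣ Sum v f ∣ ≤ ι M * c
  go v rec with v ℕ.≤? M
  ... | yes v≤M = ≤-trans (Sum-abs v (λ n _ _ → bd n)) (≤-trans (≤-reflexive (Sum-const v c)) (*-monoʳ-≤-nonNeg c {{nonNegative c≥0}} (ι-mono v≤M)))
  ... | no v≰M = subst (λ z → ∣ z ∣ ≤ ι M * c) (sym eq) (rec (ℕₚ.∸-monoʳ-< {v} {M} {0} 1≤M M≤v))
    where
    u = v ℕ.∸ M
    M≤v = ℕₚ.<⇒≤ (ℕₚ.≰⇒> v≰M)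
    eq : Sum v f ≡ Sum u f
    eq = trans (cong (λ z → Sum z f) (sym (ℕₚ.m+[n∸m]≡n M≤v))) (trans (Sum-split M u f) (trans (cong₂ _+_ mean (Sum-cong u (λ n _ _ → per n))) (+-identityˡ (Sum u f))))

-- Partial summation: the increments of `g` are nonnegative and telescope to at most `g v`, and the
-- boundary term contributes `b * g v` once more.
monotone-weight : ∀ v (f g : Arith) b → 1 ℕ.≤ v → (∀ n → ∣ Sum n f ∣ ≤ b) → (∀ n → 0ℚ ≤ g n) →
  (∀ n → 1 ℕ.≤ n → n ℕ.< v → g n ≤ g (suc n)) → ∣ Sum v (λ n → f n * g n) ∣ ≤ ♯ 2 * b * g v
monotone-weight v f g b 1≤v hf g≥0 mono = ≤-trans (subst (λ z → ∣ z ∣ ≤ b * (g v - g 1) + b * g v) (lem₀ (Sum v (λ n → f n * g n)) (Sum v f * g v))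
    (abs-+ (partial v 1≤v ℕₚ.≤-refl) (abs-* (hf v) (≤-reflexive (0≤p⇒∣p∣≡p (g≥0 v)))))) (lem₁ b (g v) (g 1) (≤-trans (0≤∣p∣ (Sum 0 f)) (hf 0)) (g≥0 1))
  where
  lem₀ = ring 2 (λ a b → (a :- b) :+ b , a)
  lem₁ = lin 3 (λ b g h → con 0ℚ ≼ b ∷ con 0ℚ ≼ h ∷ [] , b :* (g :- h) :+ b :* g , # 2 :* b :* g) ((1ℚ , 0 ∷ 1 ∷ []) ∷ [])
  lem₂ = ring 3 (λ f g b → (con 0ℚ :+ f :* g) :- (con 0ℚ :+ f) :* g , b :* (g :- g))
  lem₃ = ring 2 (λ g b → con 0ℚ , b :* (g :- g))
  lem₄ = ring 5 (λ a s f g h → (a :- s :* g) :- s :* (h :- g) , (a :+ f :* h) :- (s :+ f) :* h)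
  lem₅ = ring 4 (λ b g h k → b :* (g :- k) :+ b :* (h :- g) , b :* (h :- k))
  partial : ∀ m → 1 ℕ.≤ m → m ℕ.≤ v → ∣ Sum m (λ n → f n * g n) - Sum m f * g m ∣ ≤ b * (g m - g 1)
  partial (suc zero) _ _ = subst (λ z → ∣ z ∣ ≤ b * (g 1 - g 1)) (sym (trans (lem₂ (f 1) (g 1) b) (sym (lem₃ (g 1) b)))) (≤-reflexive (lem₃ (g 1) b))
  partial (suc (suc m)) _ m<v = subst₂ _≤_ (cong ∣_∣ (lem₄ (Sum (suc m) (λ n → f n * g n)) (Sum (suc m) f) (f (suc (suc m))) (g (suc m)) (g (suc (suc m))))) (lem₅ b (g (suc m)) (g (suc (suc m))) (g 1))
    (abs-- (partial (suc m) (s≤s z≤n) (ℕₚ.<⇒≤ m<v)) (abs-* (hf (suc m)) (≤-reflexive (0≤p⇒∣p∣≡p (↑ (mono (suc m) (s≤s z≤n) m<v))))))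

periodic-multiple : ∀ M f → Periodic M f → ∀ k n → f (M ℕ.* k ℕ.+ n) ≡ f n
periodic-multiple M f per zero    n = cong (λ z → f (z ℕ.+ n)) (ℕₚ.*-zeroʳ M)
periodic-multiple M f per (suc k) n = trans (cong f (trans (cong (ℕ._+ n) (ℕₚ.*-suc M k)) (ℕₚ.+-assoc M (M ℕ.* k) n))) (trans (per (M ℕ.* k ℕ.+ n)) (periodic-multiple M f per k n))

periodic-cong : ∀ M f → Periodic M f → ∀ {a b} s t → a ℕ.+ M ℕ.* s ≡ b ℕ.+ M ℕ.* t → f a ≡ f b
periodic-cong M f per {a} {b} s t eq = trans (sym (periodic-multiple M f per s a)) (trans (cong f (trans (ℕₚ.+-comm (M ℕ.* s) a) (trans eq (ℕₚ.+-comm b (M ℕ.* t))))) (periodic-multiple M f per t b))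

-- The congruence d d′ ≡ 1 modulo M, with multiples of M on both sides in place of a subtraction.
Inverse : ℕ → ℕ → ℕ → Set
Inverse M d d′ = ∃[ s ] ∃[ t ] d ℕ.* d′ ℕ.+ M ℕ.* s ≡ 1 ℕ.+ M ℕ.* t

module Residues (M : ℕ) (1≤M : 1 ℕ.≤ M) where
  instance
    M≢0 : ℕ.NonZero M
    M≢0 = ℕ.>-nonZero 1≤M

  -- The representative in 1, ..., M rather than 0, ..., M - 1, because `Sum` starts at 1.
  res : ℕ → ℕ
  res k = suc (ℕ.pred k ℕ.% M)

  1≤res : ∀ k → 1 ℕ.≤ res k
  1≤res k = s≤s z≤n

  res≤M : ∀ k → res k ℕ.≤ M
  res≤M k = ℕ.m%n<n (ℕ.pred k) M

  res-spec : ∀ k → 1 ℕ.≤ k → k ≡ res k ℕ.+ M ℕ.* (ℕ.pred k ℕ./ M)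
  res-spec (suc k) _ = cong suc (trans (ℕ.m≡m%n+[m/n]*n k M) (cong (k ℕ.% M ℕ.+_) (ℕₚ.*-comm (k ℕ./ M) M)))

  unique : ∀ {a b} s t → 1 ℕ.≤ a → a ℕ.≤ M → 1 ℕ.≤ b → b ℕ.≤ M → a ℕ.+ M ℕ.* s ≡ b ℕ.+ M ℕ.* t → a ≡ b
  unique {suc a} {suc b} s t _ a<M _ b<M eq = cong suc (begin
    a                      ≡⟨ ℕ.m<n⇒m%n≡m a<M ⟨
    a ℕ.% M                ≡⟨ ℕ.[m+kn]%n≡m%n a s M ⟨
    (a ℕ.+ s ℕ.* M) ℕ.% M   ≡⟨ cong (ℕ._% M) (trans (cong (a ℕ.+_) (ℕₚ.*-comm s M)) (trans (ℕₚ.suc-injective eq) (cong (b ℕ.+_) (ℕₚ.*-comm M t)))) ⟩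
    (b ℕ.+ t ℕ.* M) ℕ.% M   ≡⟨ ℕ.[m+kn]%n≡m%n b t M ⟩
    b ℕ.% M                ≡⟨ ℕ.m<n⇒m%n≡m b<M ⟩
    b                      ∎)
    where open ≡-Reasoning

  f-res : ∀ f → Periodic M f → ∀ k → 1 ℕ.≤ k → f (res k) ≡ f k
  f-res f per k 1≤k = sym (periodic-cong M f per 0 (ℕ.pred k ℕ./ M) (trans (cong (k ℕ.+_) (ℕₚ.*-zeroʳ M)) (trans (ℕₚ.+-identityʳ k) (res-spec k 1≤k))))

  -- Every residue n is reached as d m with m = d′ n, so the dilated sum covers a whole period.
  permute-≤ : ∀ f → Periodic M f → (∀ n → 0ℚ ≤ f n) → ∀ {d d′} → 1 ℕ.≤ d → 1 ℕ.≤ d′ → Inverse M d d′ → Sum M f ≤ Sum M (λ m → f (d ℕ.* m))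
  permute-≤ f per f≥0 {d} {d′} 1≤d 1≤d′ (s , t , inverse) = subst (Sum M f ≤_) (Sum-cong M (λ m p _ → f-res f per (d ℕ.* m) (ℕₚ.*-mono-≤ 1≤d p)))
      (Sum-cover M M (λ m → res (d ℕ.* m)) f f≥0 (λ n p r → inj₂ (res (d′ ℕ.* n) , 1≤res (d′ ℕ.* n) , res≤M (d′ ℕ.* n) , hit n p r)))
    where
    hit : ∀ n → 1 ℕ.≤ n → n ℕ.≤ M → res (d ℕ.* res (d′ ℕ.* n)) ≡ n
    hit n p r = unique (p₂ ℕ.+ (d ℕ.* p₁ ℕ.+ s ℕ.* n)) (t ℕ.* n) (1≤res (d ℕ.* m₁)) (res≤M (d ℕ.* m₁)) p r (begin
        res (d ℕ.* m₁) ℕ.+ M ℕ.* (p₂ ℕ.+ (d ℕ.* p₁ ℕ.+ s ℕ.* n))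
          ≡⟨ lem₁ (res (d ℕ.* m₁)) M p₂ d p₁ s n ⟩
        (res (d ℕ.* m₁) ℕ.+ M ℕ.* p₂) ℕ.+ (d ℕ.* (M ℕ.* p₁) ℕ.+ M ℕ.* s ℕ.* n)
          ≡⟨ cong (ℕ._+ (d ℕ.* (M ℕ.* p₁) ℕ.+ M ℕ.* s ℕ.* n)) (res-spec (d ℕ.* m₁) (ℕₚ.*-mono-≤ 1≤d (1≤res (d′ ℕ.* n)))) ⟨
        d ℕ.* m₁ ℕ.+ (d ℕ.* (M ℕ.* p₁) ℕ.+ M ℕ.* s ℕ.* n)
          ≡⟨ lem₂ d m₁ (M ℕ.* p₁) (M ℕ.* s ℕ.* n) ⟩
        d ℕ.* (m₁ ℕ.+ M ℕ.* p₁) ℕ.+ M ℕ.* s ℕ.* n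
          ≡⟨ cong (λ z → d ℕ.* z ℕ.+ M ℕ.* s ℕ.* n) (res-spec (d′ ℕ.* n) (ℕₚ.*-mono-≤ 1≤d′ p)) ⟨
        d ℕ.* (d′ ℕ.* n) ℕ.+ M ℕ.* s ℕ.* n
          ≡⟨ lem₃ d d′ n (M ℕ.* s) ⟩
        (d ℕ.* d′ ℕ.+ M ℕ.* s) ℕ.* n
          ≡⟨ cong (ℕ._* n) inverse ⟩
        (1 ℕ.+ M ℕ.* t) ℕ.* n
          ≡⟨ lem₄ M t n ⟩
        n ℕ.+ M ℕ.* (t ℕ.* n) ∎)
      where
      open ≡-Reasoning
      m₁ p₁ p₂ : ℕ
      m₁ = res (d′ ℕ.* n)
      p₁ = ℕ.pred (d′ ℕ.* n) ℕ./ M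
      p₂ = ℕ.pred (d ℕ.* m₁) ℕ./ M
      lem₁ : ∀ r M p d q s n → r ℕ.+ M ℕ.* (p ℕ.+ (d ℕ.* q ℕ.+ s ℕ.* n)) ≡ (r ℕ.+ M ℕ.* p) ℕ.+ (d ℕ.* (M ℕ.* q) ℕ.+ M ℕ.* s ℕ.* n)
      lem₁ = ℕ-Ring.solve-∀
      lem₂ : ∀ d m p q → d ℕ.* m ℕ.+ (d ℕ.* p ℕ.+ q) ≡ d ℕ.* (m ℕ.+ p) ℕ.+ q
      lem₂ = ℕ-Ring.solve-∀
      lem₃ : ∀ d e n q → d ℕ.* (e ℕ.* n) ℕ.+ q ℕ.* n ≡ (d ℕ.* e ℕ.+ q) ℕ.* n
      lem₃ = ℕ-Ring.solve-∀
      lem₄ : ∀ M t n → (1 ℕ.+ M ℕ.* t) ℕ.* n ≡ n ℕ.+ M ℕ.* (t ℕ.* n)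
      lem₄ = ℕ-Ring.solve-∀

  Periodic-dilate : ∀ f → Periodic M f → ∀ d → Periodic M (λ m → f (d ℕ.* m))
  Periodic-dilate f per d n = trans (cong f (trans (ℕₚ.*-distribˡ-+ d M n) (cong (ℕ._+ d ℕ.* n) (ℕₚ.*-comm d M)))) (periodic-multiple M f per d (d ℕ.* n))

  -- `permute-≤` is used twice, for `d` and, on the dilated function, for `d′`; thus no bijection
  -- has to be constructed.
  permute : ∀ f → Periodic M f → (∀ n → 0ℚ ≤ f n) → ∀ {d d′} → 1 ℕ.≤ d → 1 ℕ.≤ d′ → Inverse M d d′ → Sum M (λ m → f (d ℕ.* m)) ≡ Sum M f
  permute f per f≥0 {d} {d′} 1≤d 1≤d′ iv@(s , t , inverse) = ≤-antisym
    (subst (Sum M (λ m → f (d ℕ.* m)) ≤_) (Sum-cong M (λ m _ _ → periodic-cong M f per (s ℕ.* m) (t ℕ.* m) (begin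
        d ℕ.* (d′ ℕ.* m) ℕ.+ M ℕ.* (s ℕ.* m)   ≡⟨ lem₃ d d′ m M s ⟩
        (d ℕ.* d′ ℕ.+ M ℕ.* s) ℕ.* m           ≡⟨ cong (ℕ._* m) inverse ⟩
        (1 ℕ.+ M ℕ.* t) ℕ.* m                  ≡⟨ lem₄ M t m ⟩
        m ℕ.+ M ℕ.* (t ℕ.* m)                  ∎)))
      (permute-≤ (λ m → f (d ℕ.* m)) (Periodic-dilate f per d) (λ n → f≥0 (d ℕ.* n)) 1≤d′ 1≤d (s , t , trans (cong (ℕ._+ M ℕ.* s) (ℕₚ.*-comm d′ d)) inverse)))
    (permute-≤ f per f≥0 1≤d 1≤d′ iv)
    where
    open ≡-Reasoning
    lem₃ : ∀ d e n M s → d ℕ.* (e ℕ.* n) ℕ.+ M ℕ.* (s ℕ.* n) ≡ (d ℕ.* e ℕ.+ M ℕ.* s) ℕ.* n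
    lem₃ = ℕ-Ring.solve-∀
    lem₄ : ∀ M t n → (1 ℕ.+ M ℕ.* t) ℕ.* n ≡ n ℕ.+ M ℕ.* (t ℕ.* n)
    lem₄ = ℕ-Ring.solve-∀

  coprime-inverse : ∀ {d} → Coprime d M → ∃[ d′ ] (1 ℕ.≤ d′ × Inverse M d d′)
  coprime-inverse {d} cop with coprime-Bézout cop
  ... | Bézout.+- x y eq = x ℕ.+ M , ℕₚ.≤-trans 1≤M (ℕₚ.m≤n+m M x) , 0 , y ℕ.+ d , trans (lem d x M) (trans (cong (ℕ._+ M ℕ.* d) (sym eq)) (lem′ y M d))
    where
    lem : ∀ d x M → d ℕ.* (x ℕ.+ M) ℕ.+ M ℕ.* 0 ≡ x ℕ.* d ℕ.+ M ℕ.* d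
    lem = ℕ-Ring.solve-∀
    lem′ : ∀ y M d → 1 ℕ.+ y ℕ.* M ℕ.+ M ℕ.* d ≡ 1 ℕ.+ M ℕ.* (y ℕ.+ d)
    lem′ = ℕ-Ring.solve-∀
  -- Here x d ≡ -1, so x (x d) is an inverse of d because (x d)² ≡ 1. Adding M makes the witness
  -- positive.
  ... | Bézout.-+ x y eq = x ℕ.* (x ℕ.* d) ℕ.+ M , ℕₚ.≤-trans 1≤M (ℕₚ.m≤n+m M _) , y , x ℕ.* d ℕ.* y ℕ.+ d , trans (lem d x M y) (trans (cong (λ z → x ℕ.* d ℕ.* (x ℕ.* d) ℕ.+ z ℕ.+ M ℕ.* d) (sym eq)) (trans (lem₂ x d M) (trans (cong (λ z → 1 ℕ.+ x ℕ.* d ℕ.* z ℕ.+ M ℕ.* d) eq) (lem₃ x d y M))))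
    where
    lem : ∀ d x M y → d ℕ.* (x ℕ.* (x ℕ.* d) ℕ.+ M) ℕ.+ M ℕ.* y ≡ x ℕ.* d ℕ.* (x ℕ.* d) ℕ.+ y ℕ.* M ℕ.+ M ℕ.* d
    lem = ℕ-Ring.solve-∀
    lem₂ : ∀ x d M → x ℕ.* d ℕ.* (x ℕ.* d) ℕ.+ (1 ℕ.+ x ℕ.* d) ℕ.+ M ℕ.* d ≡ 1 ℕ.+ x ℕ.* d ℕ.* (1 ℕ.+ x ℕ.* d) ℕ.+ M ℕ.* d
    lem₂ = ℕ-Ring.solve-∀
    lem₃ : ∀ x d y M → 1 ℕ.+ x ℕ.* d ℕ.* (y ℕ.* M) ℕ.+ M ℕ.* d ≡ 1 ℕ.+ M ℕ.* (x ℕ.* d ℕ.* y ℕ.+ d)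
    lem₃ = ℕ-Ring.solve-∀

-- Powers of 2, square roots and binary logarithms

n<2^n : ∀ n → n ℕ.< 2 ℕ.^ n
n<2^n zero    = ℕₚ.≤-refl
n<2^n (suc n) = ℕₚ.≤-trans (s≤s (n<2^n n)) (subst (suc (2 ℕ.^ n) ℕ.≤_) (cong (2 ℕ.^ n ℕ.+_) (sym (ℕₚ.+-identityʳ (2 ℕ.^ n)))) (ℕₚ.+-monoˡ-≤ (2 ℕ.^ n) (1≤2^ n)))

-- With h = 3g + r the bound reads 9C (g+1)² ≤ (g+1)³ ≤ 2^(3g).
quadratic≤2^ : ∀ C h → 27 ℕ.* C ℕ.≤ h → C ℕ.* (suc h ℕ.* suc h) ℕ.≤ 2 ℕ.^ h
quadratic≤2^ C h big = begin
  C ℕ.* (suc h ℕ.* suc h)              ≤⟨ ℕₚ.*-monoʳ-≤ C (ℕₚ.*-mono-≤ h<3g h<3g) ⟩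
  C ℕ.* (3 ℕ.* G ℕ.* (3 ℕ.* G))        ≡⟨ lem C G ⟩
  9 ℕ.* C ℕ.* (G ℕ.* G)                ≤⟨ ℕₚ.*-monoˡ-≤ (G ℕ.* G) 9C≤G ⟩
  G ℕ.* (G ℕ.* G)                      ≤⟨ ℕₚ.*-mono-≤ (n<2^n g) (ℕₚ.*-mono-≤ (n<2^n g) (n<2^n g)) ⟩
  2 ℕ.^ g ℕ.* (2 ℕ.^ g ℕ.* 2 ℕ.^ g)     ≡⟨ trans (cong (2 ℕ.^ g ℕ.*_) (sym (ℕₚ.^-distribˡ-+-* 2 g g))) (sym (ℕₚ.^-distribˡ-+-* 2 g (g ℕ.+ g))) ⟩
  2 ℕ.^ (g ℕ.+ (g ℕ.+ g))              ≤⟨ ℕₚ.^-monoʳ-≤ 2 (ℕₚ.≤-trans (ℕₚ.≤-reflexive (lem₂ g)) (≤//⇒*≤ {h} {3} ℕₚ.≤-refl)) ⟩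
  2 ℕ.^ h                              ∎
  where
  open ℕₚ.≤-Reasoning
  g G : ℕ
  g = h // 3
  G = suc g
  h<3g : suc h ℕ.≤ 3 ℕ.* G
  h<3g = <*suc// h (s≤s z≤n)
  lem₃ : ∀ C → 3 ℕ.* (9 ℕ.* C) ≡ 27 ℕ.* C
  lem₃ = ℕ-Ring.solve-∀
  9C≤G : 9 ℕ.* C ℕ.≤ G
  9C≤G = ℕₚ.*-cancelˡ-≤ 3 (ℕₚ.≤-trans (ℕₚ.≤-reflexive (lem₃ C)) (ℕₚ.≤-trans big (ℕₚ.<⇒≤ h<3g)))
  lem : ∀ C G → C ℕ.* (3 ℕ.* G ℕ.* (3 ℕ.* G)) ≡ 9 ℕ.* C ℕ.* (G ℕ.* G)
  lem = ℕ-Ring.solve-∀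
  lem₂ : ∀ g → g ℕ.+ (g ℕ.+ g) ≡ 3 ℕ.* g
  lem₂ = ℕ-Ring.solve-∀

-- s = ⌊√x⌋ and t = ⌊log₂ x⌋
abstract
  sqrt : ∀ x → ∃[ s ] (s ℕ.* s ℕ.≤ x × x ℕ.< suc s ℕ.* suc s)
  sqrt x = bracket (λ i → i ℕ.* i) (λ i → d≤d*m (suc i) (s≤s z≤n)) x z≤n

  log₂ : ∀ x → 1 ℕ.≤ x → ∃[ t ] (2 ℕ.^ t ℕ.≤ x × x ℕ.< 2 ℕ.^ suc t)
  log₂ x 1≤x = bracket (2 ℕ.^_) (λ i → ℕₚ.<-trans (n<2^n i) (ℕₚ.^-monoʳ-< 2 (s≤s (s≤s z≤n)) (ℕₚ.n<1+n i))) x 1≤x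

-- Proper prime powers contribute an error of the shape √x log² x. Since 2^⌊t/2⌋ ≤ s, it suffices to
-- keep the quadratic in t below 2^⌊t/2⌋.
sqrt*log²-small : ∀ e {x s t} → 2 ℕ.^ (e ℕ.* 432) ℕ.≤ x → s ℕ.* s ℕ.≤ x → x ℕ.< suc s ℕ.* suc s → 2 ℕ.^ t ℕ.≤ x → x ℕ.< 2 ℕ.^ suc t →
  e ℕ.* (s ℕ.* (t ℕ.* (2 ℕ.* t ℕ.+ 2))) ℕ.≤ x
sqrt*log²-small e {x} {s} {t} big s²≤x x<s² 2^t≤x x<2^t = begin
  e ℕ.* (s ℕ.* (t ℕ.* (2 ℕ.* t ℕ.+ 2)))             ≡⟨ lem e s (t ℕ.* (2 ℕ.* t ℕ.+ 2)) ⟩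
  s ℕ.* (e ℕ.* (t ℕ.* (2 ℕ.* t ℕ.+ 2)))             ≤⟨ ℕₚ.*-monoʳ-≤ s (ℕₚ.≤-trans small 2^h≤s) ⟩
  s ℕ.* s                                           ≤⟨ s²≤x ⟩
  x                                                 ∎
  where
  open ℕₚ.≤-Reasoning
  lem : ∀ e s t → e ℕ.* (s ℕ.* t) ≡ s ℕ.* (e ℕ.* t)
  lem = ℕ-Ring.solve-∀
  h : ℕ
  h = t // 2
  t≤ : t ℕ.≤ 2 ℕ.* suc h
  t≤ = ℕₚ.<⇒≤ (<*suc// t (s≤s z≤n))
  2^h≤s : 2 ℕ.^ h ℕ.≤ s
  2^h≤s with 2 ℕ.^ h ℕ.≤? s
  ... | yes p = p
  ... | no ¬p = ⊥-elim (ℕₚ.<⇒≱ x<s² (ℕₚ.≤-trans (ℕₚ.*-mono-≤ (ℕₚ.≰⇒> ¬p) (ℕₚ.≰⇒> ¬p)) (ℕₚ.≤-trans (ℕₚ.≤-reflexive (sym (ℕₚ.^-distribˡ-+-* 2 h h)))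
      (ℕₚ.≤-trans (ℕₚ.^-monoʳ-≤ 2 (ℕₚ.≤-trans (ℕₚ.≤-reflexive (cong (h ℕ.+_) (sym (ℕₚ.+-identityʳ h)))) (≤//⇒*≤ {t} {2} ℕₚ.≤-refl))) 2^t≤x))))
  e432≤t : e ℕ.* 432 ℕ.≤ t
  e432≤t with e ℕ.* 432 ℕ.≤? t
  ... | yes p = p
  ... | no ¬p = ⊥-elim (ℕₚ.<⇒≱ x<2^t (ℕₚ.≤-trans (ℕₚ.^-monoʳ-≤ 2 (ℕₚ.≰⇒> ¬p)) big))
  -- 432 = 2 · 27 · 8: the 2 comes from h = ⌊t/2⌋, the 27 from `quadratic≤2^`, and the 8 from t (2t
  -- + 2) ≤ 8 (h + 1)².
  h-big : 27 ℕ.* (e ℕ.* 8) ℕ.≤ h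
  h-big = *≤⇒≤// (s≤s z≤n) (ℕₚ.≤-trans (ℕₚ.≤-reflexive (lem₂ e)) e432≤t)
    where
    lem₂ : ∀ e → 2 ℕ.* (27 ℕ.* (e ℕ.* 8)) ≡ e ℕ.* 432
    lem₂ = ℕ-Ring.solve-∀
  t+1≤ : t ℕ.+ 1 ℕ.≤ 2 ℕ.* suc h
  t+1≤ = subst (ℕ._≤ 2 ℕ.* suc h) (ℕₚ.+-comm 1 t) (<*suc// t (s≤s z≤n))
  small : e ℕ.* (t ℕ.* (2 ℕ.* t ℕ.+ 2)) ℕ.≤ 2 ℕ.^ h
  small = ℕₚ.≤-trans (ℕₚ.≤-trans (ℕₚ.≤-reflexive (lem₃ e t)) (ℕₚ.≤-trans (ℕₚ.*-monoʳ-≤ (e ℕ.* 2) (ℕₚ.*-mono-≤ t≤ t+1≤)) (ℕₚ.≤-reflexive (lem₄ e (suc h))))) (quadratic≤2^ (e ℕ.* 8) h h-big)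
    where
    lem₃ : ∀ e t → e ℕ.* (t ℕ.* (2 ℕ.* t ℕ.+ 2)) ≡ e ℕ.* 2 ℕ.* (t ℕ.* (t ℕ.+ 1))
    lem₃ = ℕ-Ring.solve-∀
    lem₄ : ∀ e h → e ℕ.* 2 ℕ.* (2 ℕ.* h ℕ.* (2 ℕ.* h)) ≡ e ℕ.* 8 ℕ.* (h ℕ.* h)
    lem₄ = ℕ-Ring.solve-∀

Sum-cover₂ : ∀ N s t (φ : ℕ → ℕ → ℕ) (g : Arith) → (∀ n → 0ℚ ≤ g n) →
  (∀ n → 1 ℕ.≤ n → n ℕ.≤ N → g n ≡ 0ℚ ⊎ (∃[ a ] ∃[ b ] (1 ℕ.≤ a × a ℕ.≤ s × 1 ℕ.≤ b × b ℕ.≤ t × φ a b ≡ n))) →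
  Sum N g ≤ Sum s (λ a → Sum t (λ b → g (φ a b)))
Sum-cover₂ N s t φ g g≥0 h = ≤-trans (Sum-mono N step) (≤-trans (≤-reflexive (Sum-swap N s _)) (Sum-mono s (λ a _ _ → Sum-cover N t (φ a) (ga a) (ga≥0 a) (hit a))  ▹′ Sum-mono s (λ a _ _ → Sum-mono t (λ b _ _ → []*≤ (any a (φ a b)) (g≥0 (φ a b))))))
  where
  _▹′_ : ∀ {a b c} → a ≤ b → b ≤ c → a ≤ c
  _▹′_ = ≤-trans
  any : ∀ a n → Dec (∃[ b ] (1 ℕ.≤ b × b ℕ.≤ t × φ a b ≡ n))
  any a n with search (λ b → φ a b ℕ.≟ n) 1 t
  ... | inj₁ p = yes p
  ... | inj₂ ¬p = no (λ (b , p , q , r) → ¬p b p q r)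
  ga : ℕ → Arith
  ga a n = [ any a n ] * g n
  ga≥0 : ∀ a n → 0ℚ ≤ ga a n
  ga≥0 a n = []-≥0 (any a n) ⊗ g≥0 n
  []*≤ : ∀ {P : Set} (d : Dec P) {c} → 0ℚ ≤ c → [ d ] * c ≤ c
  []*≤ d {c} c≥0 = lem [ d ] c ([]-≤1 d) c≥0
    where
    lem = lin 2 (λ a b → a ≼ con 1ℚ ∷ con 0ℚ ≼ b ∷ [] , a :* b , b) ((1ℚ , 0 ∷ 1 ∷ []) ∷ [])
  hit : ∀ a n → 1 ℕ.≤ n → n ℕ.≤ N → ga a n ≡ 0ℚ ⊎ (∃[ b ] (1 ℕ.≤ b × b ℕ.≤ t × φ a b ≡ n))
  hit a n _ _ with any a n
  ... | yes p = inj₂ p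
  ... | no _  = inj₁ (*-zeroˡ (g n))
  step : ∀ n → 1 ℕ.≤ n → n ℕ.≤ N → g n ≤ Sum s (λ a → ga a n)
  step n p q with h n p q
  ... | inj₁ z = subst (_≤ Sum s (λ a → ga a n)) (sym z) (Sum-≥0 s (λ a _ _ → ga≥0 a n))
  ... | inj₂ (a , b , 1≤a , a≤s , 1≤b , b≤t , eq) = ≤-trans (≤-reflexive (sym (trans (Sum-pick s a (λ k → ga k n) 1≤a a≤s) ([]*-yes (any a n) (b , 1≤b , b≤t , eq)))))
      (Sum-mono s (λ k _ _ → []*≤ (a ℕ.≟ k) (ga≥0 k n)))

prime∣prime : ∀ {p r} → Prime p → Prime r → p ∣ r → p ≡ r
prime∣prime pp pr p∣r with prime⇒irreducible pr p∣r
... | inj₁ refl = ⊥-elim (¬prime[1] pp)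
... | inj₂ e = e

prime∣power : ∀ {p r} k → Prime p → Prime r → p ∣ r ℕ.^ k → p ≡ r
prime∣power zero pp pr h = ⊥-elim (¬prime[1] (subst Prime (∣.∣1⇒≡1 h) pp))
prime∣power {p} {r} (suc k) pp pr h with euclidsLemma r (r ℕ.^ k) pp h
... | inj₁ p∣r = prime∣prime pp pr p∣r
... | inj₂ p∣ = prime∣power k pp pr p∣

*-cancelˡ-≤ : ∀ {c a b} → 1ℚ ≤ c → c * a ≤ c * b → a ≤ b
*-cancelˡ-≤ {c} {a} {b} c≥1 h = *-cancelˡ-≤-pos c {{positive (<-≤-trans (*<* (ℤ.+<+ (s≤s z≤n))) c≥1)}} h

-- Gathered outside `Analysis`, so that they are manifestly the same for all X and all logarithms.
-- 1/m is the relative length of a window on which |R| stays small; log σ ≥ c forces a sign change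
-- of R; y₀ is where the local estimates begin; E bounds log (2σ); 1/B is the rate of the total
-- saving; C₁, C₂ and C₄ are error constants; x₁ is the threshold after one improvement by `gain`.
module Constants (q : ℕ) where
  m c σ y₀ : ℕ
  m = 24 ℕ.* q
  c = q ℕ.* 352 ℕ.+ 12
  σ = 2 ℕ.^ (2 ℕ.* c)
  y₀ = 2 ℕ.^ (2 ℕ.* (q ℕ.* 2240064)) ℕ.+ (256 ℕ.* (q ℕ.* q) ℕ.+ 1)

  E B C₁ C₂ : ℕ
  E = 2 ℕ.* suc (2 ℕ.* c)
  B = 8 ℕ.* m ℕ.* E
  C₁ = 2 ℕ.* (2 ℕ.* σ) ℕ.+ 2 ℕ.+ 2 ℕ.* (2 ℕ.* m) ℕ.+ 2 ℕ.* y₀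
  C₂ = 2 ℕ.* C₁ ℕ.+ E

  C₄ L₀ x₁ : ℕ → ℕ
  C₄ x₀ = x₀ ℕ.* 64 ℕ.+ 11002400
  L₀ x₀ = 2 ℕ.* (C₂ ℕ.+ 2 ℕ.* (q ℕ.* B ℕ.* C₄ x₀)) ℕ.+ (C₁ ℕ.+ E) ℕ.+ 1
  x₁ x₀ = 2 ℕ.^ (2 ℕ.* L₀ x₀) ℕ.+ x₀ ℕ.+ 2 ℕ.* m ℕ.* y₀

  gain : ℚ
  gain = ½ * inv (q ℕ.* B)

-- The functions Λ and Λ₂

module Analysis (X : ℕ) (1≤X : 1 ℕ.≤ X) (logarithm : LogTo X) where
  open LogTo logarithm public

  ℓ1≡0 : ℓ 1 ≡ 0ℚ
  ℓ1≡0 = lem (ℓ 1) (ℓ-* 1 1 ℕₚ.≤-refl ℕₚ.≤-refl)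
    where
    lem₀ = ring 1 (λ a → (a :+ a) :- a , a)
    lem : ∀ a → a ≡ a + a → a ≡ 0ℚ
    lem a p = trans (sym (lem₀ a)) (trans (cong (_- a) (sym p)) (+-inverseʳ a))

  ℓ-mono : ∀ {m n} → 1 ℕ.≤ m → m ℕ.≤ n → n ℕ.≤ suc X → ℓ m ≤ ℓ n
  ℓ-mono {m} {n} 1≤m m≤n n≤X with ℕₚ.m≤n⇒m<n∨m≡n m≤n
  ... | inj₂ refl = ≤-refl
  ℓ-mono {m} {suc n} 1≤m m≤n (s≤s n≤X) | inj₁ (s≤s m≤n′) =
    ≤-trans (ℓ-mono 1≤m m≤n′ (ℕₚ.m≤n⇒m≤1+n n≤X)) (step≥0 n (ℕₚ.≤-trans 1≤m m≤n′) n≤X)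

  abstract
    Λ : Arith
    Λ = μ ⋆ ℓ

    Λ⋆one : ∀ n → 1 ℕ.≤ n → (Λ ⋆ one) n ≡ ℓ n
    Λ⋆one n 1≤n = begin
      ((μ ⋆ ℓ) ⋆ one) n   ≡⟨ ⋆-cong {g = one} n (λ k _ _ → ⋆-comm μ ℓ k) (λ _ _ _ → refl) ⟩
      ((ℓ ⋆ μ) ⋆ one) n   ≡⟨ ⋆-assoc ℓ μ one n ⟩
      (ℓ ⋆ (μ ⋆ one)) n   ≡⟨ ⋆-cong {ℓ} n (λ _ _ _ → refl) (λ k p _ → μ⋆one k p) ⟩
      (ℓ ⋆ δ) n           ≡⟨ ⋆-comm ℓ δ n ⟩
      (δ ⋆ ℓ) n           ≡⟨ ⋆-identityˡ ℓ n 1≤n ⟩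
      ℓ n                 ∎
      where open ≡-Reasoning

    Λ-0 : Λ 0 ≡ 0ℚ
    Λ-0 = refl

    Λ-1 : Λ 1 ≡ 0ℚ
    Λ-1 = trans (lem (μ 1) (ℓ 1)) (trans (cong (μ 1 *_) ℓ1≡0) (*-zeroʳ (μ 1)))
      where
      lem : ∀ a b → 0ℚ + (0ℚ + 1ℚ * (a * b)) ≡ a * b
      lem = ring 2 (λ a b → con 0ℚ :+ (con 0ℚ :+ con 1ℚ :* (a :* b)) , a :* b)

    -- In `⋆-prime` the two occurrences of (μ ⋆ ℓ) m cancel unless q ∣ m. This recursion shows that
    -- Λ is nonnegative, at most ℓ and supported on prime powers, without defining it by cases.
    Λ-prime-* : ∀ {q m} → Prime q → 1 ℕ.≤ m → Λ (q ℕ.* m) ≡ ℓ q * δ m + [ q ∣? m ] * Λ m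
    Λ-prime-* {q} {m} pq 1≤m = begin
      (μ ⋆ ℓ) (q ℕ.* m)
        ≡⟨ ⋆-prime pq μ ℓ m ⟩
      (μ ⋆ (λ e → ℓ (q ℕ.* e))) m + ((λ d → μ (q ℕ.* d)) ⋆ (λ e → notDiv q e * ℓ e)) m
        ≡⟨ cong₂ _+_ (trans (⋆-cong {μ} {μ} {g′ = λ e → ℓ q * one e + ℓ e} m (λ _ _ _ → refl) (λ k p _ → trans (ℓ-* q k (prime≥1 pq) p) (cong (_+ ℓ k) (sym (*-identityʳ (ℓ q))))))
             (trans (⋆-distribˡ μ (λ e → ℓ q * one e) ℓ m) (cong (_+ (μ ⋆ ℓ) m) (trans (⋆-scaleʳ (ℓ q) μ one m) (cong (ℓ q *_) (μ⋆one m 1≤m))))))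
             (μ-shift-⋆ pq ℓ m 1≤m) ⟩
      (ℓ q * δ m + Λ m) + - (notDiv q m * Λ m)
        ≡⟨ lem (ℓ q * δ m) (Λ m) [ q ∣? m ] ⟩
      ℓ q * δ m + [ q ∣? m ] * Λ m ∎
      where
      open ≡-Reasoning
      lem : ∀ a b i → (a + b) + - ((1ℚ - i) * b) ≡ a + i * b
      lem = ring 3 (λ a b i → (a :+ b) :+ :- ((con 1ℚ :- i) :* b) , a :+ i :* b)

  Λ≥0 : ∀ n → 1 ℕ.≤ n → 0ℚ ≤ Λ n
  Λ≥0 = prime-rec _ (≤-reflexive (sym Λ-1)) (λ q m pq 1≤m ih →
    subst (0ℚ ≤_) (sym (Λ-prime-* pq 1≤m)) ((ℓ≥0 q ⊗ []-≥0 (1 ℕ.≟ m)) ⊕ ([]-≥0 (q ∣? m) ⊗ ih)))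

  Λ≤ℓ : ∀ n → 1 ℕ.≤ n → Λ n ≤ ℓ n
  Λ≤ℓ = prime-rec _ (≤-trans (≤-reflexive Λ-1) (ℓ≥0 1)) (λ q m pq 1≤m ih →
    subst₂ _≤_ (sym (Λ-prime-* pq 1≤m)) (sym (ℓ-* q m (prime≥1 pq) 1≤m))
      (lem (ℓ q) (δ m) [ q ∣? m ] (Λ m) (ℓ m) (ℓ≥0 q) ([]-≤1 (1 ℕ.≟ m)) ([]-≤1 (q ∣? m)) (Λ≥0 m 1≤m) ih))
    where
    lem = lin 5 (λ a d i l m → con 0ℚ ≼ a ∷ d ≼ con 1ℚ ∷ i ≼ con 1ℚ ∷ con 0ℚ ≼ l ∷ l ≼ m ∷ [] , a :* d :+ i :* l , a :+ m) ((1ℚ , 4 ∷ []) ∷ (1ℚ , 0 ∷ 1 ∷ []) ∷ (1ℚ , 2 ∷ 3 ∷ []) ∷ [])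

  Λ-prime : ∀ {q} → Prime q → Λ q ≡ ℓ q
  Λ-prime {q} pq = begin
    Λ q                            ≡⟨ cong Λ (ℕₚ.*-identityʳ q) ⟨
    Λ (q ℕ.* 1)                    ≡⟨ Λ-prime-* pq ℕₚ.≤-refl ⟩
    ℓ q * 1ℚ + [ q ∣? 1 ] * Λ 1    ≡⟨ cong (λ z → ℓ q * 1ℚ + [ q ∣? 1 ] * z) Λ-1 ⟩
    ℓ q * 1ℚ + [ q ∣? 1 ] * 0ℚ     ≡⟨ lem (ℓ q) [ q ∣? 1 ] ⟩
    ℓ q                            ∎
    where
    open ≡-Reasoning
    lem = ring 2 (λ a b → a :* con 1ℚ :+ b :* con 0ℚ , a)

  abstract
    -- In this form nonnegativity and the domination of Λ log are visible; `μ⋆ℓ²` supplies the form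
    -- that can be summed.
    Λ₂ : Arith
    Λ₂ n = ℓ n * Λ n + (Λ ⋆ Λ) n

    Λ₂-def : ∀ n → Λ₂ n ≡ ℓ n * Λ n + (Λ ⋆ Λ) n
    Λ₂-def n = refl

  ℓ² : Arith
  ℓ² n = ℓ n * ℓ n

  -- Apply the derivation `ℓ` to the identity Λ ⋆ one = ℓ.
  Λ₂⋆one : ∀ n → 1 ℕ.≤ n → (Λ₂ ⋆ one) n ≡ ℓ² n
  Λ₂⋆one n 1≤n = sym (begin
    ℓ n * ℓ n
      ≡⟨ cong (ℓ n *_) (Λ⋆one n 1≤n) ⟨
    ℓ n * (Λ ⋆ one) n
      ≡⟨ ⋆-derivation ℓ ℓ-* Λ one n ⟩
    ((λ k → ℓ k * Λ k) ⋆ one) n + (Λ ⋆ (λ k → ℓ k * one k)) n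
      ≡⟨ cong (λ z → ((λ k → ℓ k * Λ k) ⋆ one) n + z) (trans (⋆-cong {Λ} {Λ} n (λ _ _ _ → refl) (λ k p _ → trans (*-identityʳ (ℓ k)) (sym (Λ⋆one k p)))) (sym (⋆-assoc Λ Λ one n))) ⟩
    ((λ k → ℓ k * Λ k) ⋆ one) n + ((Λ ⋆ Λ) ⋆ one) n
      ≡⟨ ⋆-distribʳ (λ k → ℓ k * Λ k) (Λ ⋆ Λ) one n ⟨
    ((λ k → ℓ k * Λ k + (Λ ⋆ Λ) k) ⋆ one) n
      ≡⟨ ⋆-cong {f′ = Λ₂} {one} n (λ k _ _ → sym (Λ₂-def k)) (λ _ _ _ → refl) ⟩
    (Λ₂ ⋆ one) n ∎)
    where open ≡-Reasoning

  μ⋆ℓ² : ∀ n → 1 ℕ.≤ n → (μ ⋆ ℓ²) n ≡ Λ₂ n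
  μ⋆ℓ² n 1≤n = begin
    (μ ⋆ ℓ²) n            ≡⟨ ⋆-cong {μ} {μ} n (λ _ _ _ → refl) (λ k p _ → trans (sym (Λ₂⋆one k p)) (⋆-comm Λ₂ one k)) ⟩
    (μ ⋆ (one ⋆ Λ₂)) n    ≡⟨ ⋆-assoc μ one Λ₂ n ⟨
    ((μ ⋆ one) ⋆ Λ₂) n    ≡⟨ ⋆-cong {g = Λ₂} n (λ k p _ → μ⋆one k p) (λ _ _ _ → refl) ⟩
    (δ ⋆ Λ₂) n            ≡⟨ ⋆-identityˡ Λ₂ n 1≤n ⟩
    Λ₂ n                  ∎
    where open ≡-Reasoning

  Λ⋆Λ≥0 : ∀ n → 0ℚ ≤ (Λ ⋆ Λ) n
  Λ⋆Λ≥0 n = Sum-≥0 n (λ d p _ → Sum-≥0 n (λ m q _ → []-≥0 (d ℕ.* m ℕ.≟ n) ⊗ (Λ≥0 d p ⊗ Λ≥0 m q)))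

  ℓΛ≤Λ₂ : ∀ n → ℓ n * Λ n ≤ Λ₂ n
  ℓΛ≤Λ₂ n = by (Λ⋆Λ≥0 n) (Λ₂-def n)

  Λ₂≥0 : ∀ n → 1 ℕ.≤ n → 0ℚ ≤ Λ₂ n
  Λ₂≥0 n 1≤n = ≤-trans (ℓ≥0 n ⊗ Λ≥0 n 1≤n) (ℓΛ≤Λ₂ n)

  -- Summed forms of Λ ⋆ one = ℓ, μ ⋆ one = δ and μ ⋆ ℓ² = Λ₂

  Hyp-Λ : ∀ x (w : Arith) → Hyp x (λ d m → Λ d * w (d ℕ.* m)) ≡ Sum x (λ n → w n * ℓ n)
  Hyp-Λ x w = trans (Hyp-cong x (λ d m _ _ _ → lem (Λ d) (w (d ℕ.* m)))) (trans (sym (Sum-⋆ x w Λ one)) (Sum-cong x (λ n p _ → cong (w n *_) (Λ⋆one n p))))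
    where
    lem = ring 2 (λ a b → a :* b , b :* (a :* con 1ℚ))

  Sum-Λ₂ : ∀ x (w : Arith) → Sum x (λ n → w n * Λ₂ n) ≡ Hyp x (λ d m → μ d * (w (d ℕ.* m) * ℓ² m))
  Sum-Λ₂ x w = trans (Sum-cong x (λ n p _ → cong (w n *_) (sym (μ⋆ℓ² n p)))) (trans (Sum-⋆ x w μ ℓ²) (Hyp-cong x (λ d m _ _ _ → *-left-comm (w (d ℕ.* m)) (μ d) (ℓ² m))))

  -- Increments of the logarithm and moments of log (x/d)

  s : Arith
  s n = ℓ (suc n) - ℓ n

  s≥0 : ∀ n → 1 ℕ.≤ n → n ℕ.≤ X → 0ℚ ≤ s n
  s≥0 n p q = ↑ (step≥0 n p q)

  s≤2inv : ∀ n → 1 ℕ.≤ n → n ℕ.≤ X → s n ≤ ♯ 2 * inv n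
  s≤2inv n p q = lem (inv n) (s n) (inv≥0 n) (inv≤1 p) (step-hi n p q)
    where
    lem = lin 2 (λ i s → con 0ℚ ≼ i ∷ i ≼ con 1ℚ ∷ s ≼ i :+ i :* i ∷ [] , s , # 2 :* i) ((1ℚ , 2 ∷ []) ∷ (1ℚ , 0 ∷ 1 ∷ []) ∷ [])

  ιs-hi : ∀ n → 1 ℕ.≤ n → n ℕ.≤ X → ι n * s n ≤ 1ℚ + inv n
  ιs-hi n p q = lem (ι n) (inv n) (s n) (ι≥0 n) (inv≥0 n) (ι*inv p) (step-hi n p q)
    where
    lem = lin 3 (λ n i s → con 0ℚ ≼ n ∷ con 0ℚ ≼ i ∷ n :* i ≗ con 1ℚ ∷ s ≼ i :+ i :* i ∷ [] , n :* s , con 1ℚ :+ i) ((1ℚ , 2 ∷ []) ∷ (1ℚ , 0 ∷ 3 ∷ []) ∷ (1ℚ , 1 ∷ 2 ∷ []) ∷ [])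

  ιs-lo : ∀ n → 1 ℕ.≤ n → n ℕ.≤ X → 1ℚ - ♯ 2 * inv n ≤ ι n * s n
  ιs-lo n p q = lem (ι n) (inv n) (s n) (ι≥0 n) (inv≥0 n) (ι*inv p) (step-lo n p q)
    where
    lem = lin 3 (λ n i s → con 0ℚ ≼ n ∷ con 0ℚ ≼ i ∷ n :* i ≗ con 1ℚ ∷ i :- # 2 :* (i :* i) ≼ s ∷ [] , con 1ℚ :- # 2 :* i , n :* s) ((- 1ℚ , 2 ∷ []) ∷ (1ℚ , 0 ∷ 3 ∷ []) ∷ (♯ 2 , 1 ∷ 2 ∷ []) ∷ [])

  -- The first two moments of log (x/d), close to x and 2x. They are estimated through their
  -- recurrences in x, where `s x` is about 1/x.
  S₁ S₂ : Arith
  S₁ x = Sum x (λ d → ℓ x - ℓ d)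
  S₂ x = Sum x (λ d → (ℓ x - ℓ d) * (ℓ x - ℓ d))

  S₁-suc : ∀ x → S₁ (suc x) ≡ S₁ x + ι x * s x
  S₁-suc x = begin
    Sum x (λ d → ℓ (suc x) - ℓ d) + (ℓ (suc x) - ℓ (suc x))
      ≡⟨ cong₂ _+_ (Sum-cong x (λ d _ _ → lem (ℓ (suc x)) (ℓ x) (ℓ d))) (+-inverseʳ (ℓ (suc x))) ⟩
    Sum x (λ d → (ℓ x - ℓ d) + s x) + 0ℚ
      ≡⟨ +-identityʳ (Sum x (λ d → (ℓ x - ℓ d) + s x)) ⟩
    Sum x (λ d → (ℓ x - ℓ d) + s x)
      ≡⟨ Sum-+ x _ _ ⟩
    S₁ x + Sum x (λ _ → s x)
      ≡⟨ cong (λ z → S₁ x + z) (Sum-const x (s x)) ⟩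
    S₁ x + ι x * s x ∎
    where
    open ≡-Reasoning
    lem = ring 3 (λ a b c → a :- c , (b :- c) :+ (a :- b))

  S₂-suc : ∀ x → S₂ (suc x) ≡ S₂ x + (♯ 2 * (s x * S₁ x) + s x * (ι x * s x))
  S₂-suc x = begin
    Sum x (λ d → (ℓ (suc x) - ℓ d) * (ℓ (suc x) - ℓ d)) + (ℓ (suc x) - ℓ (suc x)) * (ℓ (suc x) - ℓ (suc x))
      ≡⟨ cong₂ _+_ (Sum-cong x (λ d _ _ → lem (ℓ (suc x)) (ℓ x) (ℓ d))) (lem₂ (ℓ (suc x))) ⟩
    Sum x (λ d → (ℓ x - ℓ d) * (ℓ x - ℓ d) + (♯ 2 * s x * (ℓ x - ℓ d) + s x * s x)) + 0ℚ
      ≡⟨ +-identityʳ (Sum x (λ d → (ℓ x - ℓ d) * (ℓ x - ℓ d) + (♯ 2 * s x * (ℓ x - ℓ d) + s x * s x))) ⟩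
    Sum x (λ d → (ℓ x - ℓ d) * (ℓ x - ℓ d) + (♯ 2 * s x * (ℓ x - ℓ d) + s x * s x))
      ≡⟨ trans (Sum-+ x _ _) (cong (λ z → S₂ x + z) (Sum-+ x _ _)) ⟩
    S₂ x + (Sum x (λ d → ♯ 2 * s x * (ℓ x - ℓ d)) + Sum x (λ _ → s x * s x))
      ≡⟨ cong₂ (λ y z → S₂ x + (y + z)) (Sum-*ˡ x (♯ 2 * s x) _) (Sum-const x (s x * s x)) ⟩
    S₂ x + (♯ 2 * s x * S₁ x + ι x * (s x * s x))
      ≡⟨ cong (λ z → S₂ x + z) (lem₃ (s x) (S₁ x) (ι x)) ⟩
    S₂ x + (♯ 2 * (s x * S₁ x) + s x * (ι x * s x)) ∎
    where
    open ≡-Reasoning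
    lem = ring 3 (λ a b c → (a :- c) :* (a :- c) , (b :- c) :* (b :- c) :+ (# 2 :* (a :- b) :* (b :- c) :+ (a :- b) :* (a :- b)))
    lem₂ = ring 1 (λ a → (a :- a) :* (a :- a) , con 0ℚ)
    lem₃ = ring 3 (λ a b n → # 2 :* a :* b :+ n :* (a :* a) , # 2 :* (a :* b) :+ a :* (n :* a))

  S₁-one : S₁ 1 ≡ 0ℚ
  S₁-one = trans (+-identityˡ (ℓ 1 - ℓ 1)) (+-inverseʳ (ℓ 1))

  S₂-one : S₂ 1 ≡ 0ℚ
  S₂-one = lem (ℓ 1)
    where
    lem = ring 1 (λ a → con 0ℚ :+ (a :- a) :* (a :- a) , con 0ℚ)

  S₁≥0 : ∀ x → x ℕ.≤ suc X → 0ℚ ≤ S₁ x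
  S₁≥0 x x≤X = Sum-≥0 x (λ d p q → ↑ (ℓ-mono p q x≤X))

  S₁≤ : ∀ x → 1 ℕ.≤ x → x ℕ.≤ suc X → S₁ x ≤ ♯ 2 * ι x
  S₁≤ (suc zero) _ _ = ≤-trans (≤-reflexive S₁-one) (♯≥0 2 ⊗ ι≥0 1)
  S₁≤ (suc (suc y)) _ (s≤s x≤X) = lem (S₁ x) (S₁ (suc x)) (ι x) (ι (suc x)) (inv x) (s x)
      (S₁≤ (suc y) 1≤x (ℕₚ.m≤n⇒m≤1+n x≤X)) (S₁-suc x) (ι-suc x) (ιs-hi x 1≤x x≤X) (inv≤1 1≤x)
    where
    x = suc y
    1≤x = s≤s (z≤n {y})
    lem = lin 6 (λ a b n m i s → a ≼ # 2 :* n ∷ b ≗ a :+ n :* s ∷ m ≗ n :+ con 1ℚ ∷ n :* s ≼ con 1ℚ :+ i ∷ i ≼ con 1ℚ ∷ [] , b , # 2 :* m) ((1ℚ , 0 ∷ []) ∷ (1ℚ , 1 ∷ []) ∷ (- (♯ 2) , 2 ∷ []) ∷ (1ℚ , 3 ∷ []) ∷ (1ℚ , 4 ∷ []) ∷ [])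

  S₁-near : ∀ x → 1 ℕ.≤ x → x ℕ.≤ suc X → ∣ S₁ x - ι x ∣ ≤ 1ℚ + ♯ 4 * H x
  S₁-near (suc zero) _ _ = subst (λ z → ∣ z - ι 1 ∣ ≤ 1ℚ + ♯ 4 * H 1) (sym S₁-one)
      (subst (λ z → ∣ 0ℚ - z ∣ ≤ 1ℚ + ♯ 4 * H 1) (sym (ι≡♯ 1)) (lem (H 1) (H≥0 1)))
    where
    lem = lin 1 (λ h → con 0ℚ ≼ h ∷ [] , con 1ℚ , con 1ℚ :+ # 4 :* h) ((♯ 4 , 0 ∷ []) ∷ [])
  S₁-near (suc (suc y)) _ (s≤s x≤X) = let ih = S₁-near (suc y) 1≤x (ℕₚ.m≤n⇒m≤1+n x≤X) in abs≤
      (lem₁ (S₁ x) (S₁ (suc x)) (ι x) (ι (suc x)) (inv x) (inv (suc x)) (s x) (H x) (S₁-suc x) (ι-suc x) (ιs-hi x 1≤x x≤X) (inv-half 1≤x) (inv≥0 x) (abs-hi ih))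
      (lem₂ (S₁ x) (S₁ (suc x)) (ι x) (ι (suc x)) (inv x) (inv (suc x)) (s x) (H x) (S₁-suc x) (ι-suc x) (ιs-lo x 1≤x x≤X) (inv-half 1≤x) (inv≥0 x) (abs-lo ih))
    where
    x = suc y
    1≤x = s≤s (z≤n {y})
    lem₁ = lin 8 (λ a b n m i j s h → b ≗ a :+ n :* s ∷ m ≗ n :+ con 1ℚ ∷ n :* s ≼ con 1ℚ :+ i ∷ con ½ :* i ≼ j ∷ con 0ℚ ≼ i ∷ a :- n ≼ con 1ℚ :+ # 4 :* h ∷ [] , b :- m , con 1ℚ :+ # 4 :* (h :+ j)) ((1ℚ , 0 ∷ []) ∷ (- 1ℚ , 1 ∷ []) ∷ (1ℚ , 2 ∷ []) ∷ (♯ 4 , 3 ∷ []) ∷ (1ℚ , 4 ∷ []) ∷ (1ℚ , 5 ∷ []) ∷ [])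
    lem₂ = lin 8 (λ a b n m i j s h → b ≗ a :+ n :* s ∷ m ≗ n :+ con 1ℚ ∷ con 1ℚ :- # 2 :* i ≼ n :* s ∷ con ½ :* i ≼ j ∷ con 0ℚ ≼ i ∷ :- (a :- n) ≼ con 1ℚ :+ # 4 :* h ∷ [] , :- (b :- m) , con 1ℚ :+ # 4 :* (h :+ j)) ((1ℚ , 1 ∷ []) ∷ (- 1ℚ , 0 ∷ []) ∷ (1ℚ , 2 ∷ []) ∷ (♯ 4 , 3 ∷ []) ∷ (1ℚ , 5 ∷ []) ∷ [])

  sS₁-hi : ∀ x → 1 ℕ.≤ x → x ℕ.≤ X → s x * S₁ x ≤ 1ℚ + inv x * (♯ 3 + ♯ 4 * H x)
  sS₁-hi x p q = lem (s x) (S₁ x) (ι x) (inv x) (H x) (step-hi x p q) (S₁≥0 x q′) (S₁≤ x p q′) (abs-hi (S₁-near x p q′)) (ι*inv p) (inv≥0 x)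
    where
    q′ = ℕₚ.m≤n⇒m≤1+n q
    lem = lin 5 (λ s a n i h → s ≼ i :+ i :* i ∷ con 0ℚ ≼ a ∷ a ≼ # 2 :* n ∷ a :- n ≼ con 1ℚ :+ # 4 :* h ∷ n :* i ≗ con 1ℚ ∷ con 0ℚ ≼ i ∷ [] , s :* a , con 1ℚ :+ i :* (# 3 :+ # 4 :* h)) ((1ℚ , 0 ∷ 1 ∷ []) ∷ (1ℚ , 3 ∷ 5 ∷ []) ∷ (1ℚ , 2 ∷ 5 ∷ 5 ∷ []) ∷ (1ℚ , 4 ∷ []) ∷ (♯ 2 , 4 ∷ 5 ∷ []) ∷ [])

  sS₁-lo : ∀ x → 1 ℕ.≤ x → x ℕ.≤ X → 1ℚ - inv x * (♯ 5 + ♯ 4 * H x) ≤ s x * S₁ x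
  sS₁-lo x p q = lem (s x) (S₁ x) (ι x) (inv x) (H x) (step-lo x p q) (S₁≥0 x q′) (S₁≤ x p q′) (abs-lo (S₁-near x p q′)) (ι*inv p) (inv≥0 x)
    where
    q′ = ℕₚ.m≤n⇒m≤1+n q
    lem = lin 5 (λ s a n i h → i :- # 2 :* (i :* i) ≼ s ∷ con 0ℚ ≼ a ∷ a ≼ # 2 :* n ∷ :- (a :- n) ≼ con 1ℚ :+ # 4 :* h ∷ n :* i ≗ con 1ℚ ∷ con 0ℚ ≼ i ∷ [] , con 1ℚ :- i :* (# 5 :+ # 4 :* h) , s :* a) ((1ℚ , 0 ∷ 1 ∷ []) ∷ (1ℚ , 3 ∷ 5 ∷ []) ∷ (♯ 2 , 2 ∷ 5 ∷ 5 ∷ []) ∷ (- 1ℚ , 4 ∷ []) ∷ (♯ 4 , 4 ∷ 5 ∷ []) ∷ [])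

  s²-hi : ∀ x → 1 ℕ.≤ x → x ℕ.≤ X → s x * (ι x * s x) ≤ ♯ 4 * inv x
  s²-hi x p q = lem (s x) (ι x * s x) (inv x) (s≥0 x p q) (s≤2inv x p q) (ιs-hi x p q) (inv≤1 p)
    where
    lem = lin 3 (λ s m i → con 0ℚ ≼ s ∷ s ≼ # 2 :* i ∷ m ≼ con 1ℚ :+ i ∷ i ≼ con 1ℚ ∷ [] , s :* m , # 4 :* i) ((♯ 2 , 1 ∷ []) ∷ (1ℚ , 0 ∷ 2 ∷ []) ∷ (1ℚ , 0 ∷ 3 ∷ []) ∷ [])

  s²≥0 : ∀ x → 1 ℕ.≤ x → x ℕ.≤ X → 0ℚ ≤ s x * (ι x * s x)
  s²≥0 x p q = s≥0 x p q ⊗ (ι≥0 x ⊗ s≥0 x p q)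

  S₂≤ : ∀ x → 1 ℕ.≤ x → x ℕ.≤ suc X → S₂ x ≤ ♯ 12 * ι x
  S₂≤ (suc zero) _ _ = ≤-trans (≤-reflexive S₂-one) (♯≥0 12 ⊗ ι≥0 1)
  S₂≤ (suc (suc y)) _ (s≤s x≤X) = lem (S₂ x) (S₂ (suc x)) (S₁ x) (ι x) (ι (suc x)) (inv x) (s x) (s x * (ι x * s x))
      (S₂≤ (suc y) 1≤x x≤X′) (S₂-suc x) (ι-suc x) (s²-hi x 1≤x x≤X) (inv≤1 1≤x) (s≤2inv x 1≤x x≤X) (S₁≥0 x x≤X′) (S₁≤ x 1≤x x≤X′) (ι*inv 1≤x) (inv≥0 x)
    where
    x = suc y
    1≤x = s≤s (z≤n {y})
    x≤X′ = ℕₚ.m≤n⇒m≤1+n x≤X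
    lem = lin 8 (λ a b S n m i s q → a ≼ # 12 :* n ∷ b ≗ a :+ (# 2 :* (s :* S) :+ q) ∷ m ≗ n :+ con 1ℚ ∷ q ≼ # 4 :* i ∷ i ≼ con 1ℚ ∷ s ≼ # 2 :* i ∷ con 0ℚ ≼ S ∷ S ≼ # 2 :* n ∷ n :* i ≗ con 1ℚ ∷ con 0ℚ ≼ i ∷ [] , b , # 12 :* m) ((1ℚ , 0 ∷ []) ∷ (1ℚ , 1 ∷ []) ∷ (- (♯ 12) , 2 ∷ []) ∷ (1ℚ , 3 ∷ []) ∷ (♯ 4 , 4 ∷ []) ∷ (♯ 2 , 5 ∷ 6 ∷ []) ∷ (♯ 4 , 7 ∷ 9 ∷ []) ∷ (♯ 8 , 8 ∷ []) ∷ [])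

  S₂-near : ∀ x → 1 ℕ.≤ x → x ℕ.≤ suc X → ∣ S₂ x - ♯ 2 * ι x ∣ ≤ ♯ 20 * ((1ℚ + H x) * (1ℚ + H x))
  S₂-near (suc zero) _ _ = subst (λ z → ∣ z - ♯ 2 * ι 1 ∣ ≤ ♯ 20 * ((1ℚ + H 1) * (1ℚ + H 1))) (sym S₂-one)
      (subst (λ z → ∣ 0ℚ - ♯ 2 * z ∣ ≤ ♯ 20 * ((1ℚ + H 1) * (1ℚ + H 1))) (sym (ι≡♯ 1)) (lem (H 1) (H≥0 1)))
    where
    lem = lin 1 (λ h → con 0ℚ ≼ h ∷ [] , # 2 , # 20 :* ((con 1ℚ :+ h) :* (con 1ℚ :+ h))) ((♯ 18 , []) ∷ (♯ 40 , 0 ∷ []) ∷ (♯ 20 , 0 ∷ 0 ∷ []) ∷ [])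
  S₂-near (suc (suc y)) _ (s≤s x≤X) = let ih = S₂-near (suc y) 1≤x (ℕₚ.m≤n⇒m≤1+n x≤X) in abs≤
      (lem₁ (S₂ x) (S₂ (suc x)) (s x * S₁ x) (ι x) (ι (suc x)) (inv x) (inv (suc x)) (s x * (ι x * s x)) (H x) (S₂-suc x) (ι-suc x) (s²-hi x 1≤x x≤X) (sS₁-hi x 1≤x x≤X) (inv-half 1≤x) (inv≥0 x) (inv≥0 (suc x)) (H≥0 x) (abs-hi ih))
      (lem₂ (S₂ x) (S₂ (suc x)) (s x * S₁ x) (ι x) (ι (suc x)) (inv x) (inv (suc x)) (s x * (ι x * s x)) (H x) (S₂-suc x) (ι-suc x) (s²≥0 x 1≤x x≤X) (sS₁-lo x 1≤x x≤X) (inv-half 1≤x) (inv≥0 x) (inv≥0 (suc x)) (H≥0 x) (abs-lo ih))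
    where
    x = suc y
    1≤x = s≤s (z≤n {y})
    lem₁ = lin 9 (λ a b S n m i j q h → b ≗ a :+ (# 2 :* S :+ q) ∷ m ≗ n :+ con 1ℚ ∷ q ≼ # 4 :* i ∷ S ≼ con 1ℚ :+ i :* (# 3 :+ # 4 :* h) ∷ con ½ :* i ≼ j ∷ con 0ℚ ≼ i ∷ con 0ℚ ≼ j ∷ con 0ℚ ≼ h ∷ a :- # 2 :* n ≼ # 20 :* ((con 1ℚ :+ h) :* (con 1ℚ :+ h)) ∷ [] , b :- # 2 :* m , # 20 :* ((con 1ℚ :+ (h :+ j)) :* (con 1ℚ :+ (h :+ j)))) ((1ℚ , 0 ∷ []) ∷ (- (♯ 2) , 1 ∷ []) ∷ (1ℚ , 2 ∷ []) ∷ (♯ 2 , 3 ∷ []) ∷ (♯ 20 , 4 ∷ []) ∷ (♯ 16 , 4 ∷ 7 ∷ []) ∷ (♯ 20 , 6 ∷ []) ∷ (1ℚ , 8 ∷ []) ∷ (♯ 24 , 6 ∷ 7 ∷ []) ∷ (♯ 20 , 6 ∷ 6 ∷ []) ∷ [])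
    lem₂ = lin 9 (λ a b S n m i j q h → b ≗ a :+ (# 2 :* S :+ q) ∷ m ≗ n :+ con 1ℚ ∷ con 0ℚ ≼ q ∷ con 1ℚ :- i :* (# 5 :+ # 4 :* h) ≼ S ∷ con ½ :* i ≼ j ∷ con 0ℚ ≼ i ∷ con 0ℚ ≼ j ∷ con 0ℚ ≼ h ∷ :- (a :- # 2 :* n) ≼ # 20 :* ((con 1ℚ :+ h) :* (con 1ℚ :+ h)) ∷ [] , :- (b :- # 2 :* m) , # 20 :* ((con 1ℚ :+ (h :+ j)) :* (con 1ℚ :+ (h :+ j)))) ((♯ 2 , 1 ∷ []) ∷ (- 1ℚ , 0 ∷ []) ∷ (1ℚ , 2 ∷ []) ∷ (♯ 2 , 3 ∷ []) ∷ (♯ 20 , 4 ∷ []) ∷ (♯ 16 , 4 ∷ 7 ∷ []) ∷ (♯ 20 , 6 ∷ []) ∷ (1ℚ , 8 ∷ []) ∷ (♯ 24 , 6 ∷ 7 ∷ []) ∷ (♯ 20 , 6 ∷ 6 ∷ []) ∷ [])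

  -- Harmonic sums and their constants

  s-inv : ∀ n → 1 ℕ.≤ n → n ℕ.≤ X → ∣ s n - inv (suc n) ∣ ≤ ♯ 2 * (inv n * inv n)
  s-inv n p q = abs≤ (lem₁ (inv n) (inv (suc n)) (s n) (step-hi n p q) (inv-suc p) (inv≥0 n) (inv-mono p (ℕₚ.n≤1+n n)))
                     (lem₂ (inv n) (inv (suc n)) (s n) (step-lo n p q) (inv-mono p (ℕₚ.n≤1+n n)))
    where
    lem₁ = lin 3 (λ i j s → s ≼ i :+ i :* i ∷ i :- j ≗ i :* j ∷ con 0ℚ ≼ i ∷ j ≼ i ∷ [] , s :- j , # 2 :* (i :* i)) ((1ℚ , 0 ∷ []) ∷ (1ℚ , 1 ∷ []) ∷ (1ℚ , 2 ∷ 3 ∷ []) ∷ [])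
    lem₂ = lin 3 (λ i j s → i :- # 2 :* (i :* i) ≼ s ∷ j ≼ i ∷ [] , :- (s :- j) , # 2 :* (i :* i)) ((1ℚ , 0 ∷ []) ∷ (1ℚ , 1 ∷ []) ∷ [])

  -- Stands for Euler's constant, with the value at X in place of the limit. It depends on X and the
  -- logarithm; its bounds `γ-hi` and `γ-lo` do not.
  γ : ℚ
  γ = H X - ℓ X

  H-ℓ : ∀ n → 1 ℕ.≤ n → n ℕ.≤ X → ∣ γ - (H n - ℓ n) ∣ ≤ ♯ 4 * inv n
  H-ℓ n p q = ≤-trans (dominated X (λ n → H n - ℓ n) (λ n → ♯ 4 * inv n) step p q (ℕₚ.n≤1+n X)) (lem (inv n) (inv X) (inv≥0 X))
    where
    lem = lin 2 (λ a b → con 0ℚ ≼ b ∷ [] , # 4 :* a :- # 4 :* b , # 4 :* a) ((♯ 4 , 0 ∷ []) ∷ [])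
    step : ∀ n → 1 ℕ.≤ n → n ℕ.≤ X → ∣ (H (suc n) - ℓ (suc n)) - (H n - ℓ n) ∣ ≤ ♯ 4 * inv n - ♯ 4 * inv (suc n)
    step n p q = abs≤ (lem₁ (H n) (ℓ n) (ℓ (suc n)) (inv n) (inv (suc n)) (abs-lo (s-inv n p q)) (inv-suc p) (inv-half p) (inv≥0 n))
                      (lem₂ (H n) (ℓ n) (ℓ (suc n)) (inv n) (inv (suc n)) (abs-hi (s-inv n p q)) (inv-suc p) (inv-half p) (inv≥0 n))
      where
      lem₁ = lin 5 (λ h l m i j → :- ((m :- l) :- j) ≼ # 2 :* (i :* i) ∷ i :- j ≗ i :* j ∷ con ½ :* i ≼ j ∷ con 0ℚ ≼ i ∷ [] , ((h :+ j) :- m) :- (h :- l) , # 4 :* i :- # 4 :* j) ((1ℚ , 0 ∷ []) ∷ (- (♯ 4) , 1 ∷ []) ∷ (♯ 4 , 2 ∷ 3 ∷ []) ∷ [])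
      lem₂ = lin 5 (λ h l m i j → (m :- l) :- j ≼ # 2 :* (i :* i) ∷ i :- j ≗ i :* j ∷ con ½ :* i ≼ j ∷ con 0ℚ ≼ i ∷ [] , :- (((h :+ j) :- m) :- (h :- l)) , # 4 :* i :- # 4 :* j) ((1ℚ , 0 ∷ []) ∷ (- (♯ 4) , 1 ∷ []) ∷ (♯ 4 , 2 ∷ 3 ∷ []) ∷ [])

  H1 : H 1 ≡ 1ℚ
  H1 = trans (+-identityˡ (inv 1)) inv1

  γ-hi : γ ≤ ♯ 5
  γ-hi = lem γ (H 1) (ℓ 1) (inv 1) H1 ℓ1≡0 inv1 (abs-hi (H-ℓ 1 ℕₚ.≤-refl 1≤X))
    where
    lem = lin 4 (λ g h l i → h ≗ con 1ℚ ∷ l ≗ con 0ℚ ∷ i ≗ con 1ℚ ∷ g :- (h :- l) ≼ # 4 :* i ∷ [] , g , # 5) ((1ℚ , 0 ∷ []) ∷ (- 1ℚ , 1 ∷ []) ∷ (♯ 4 , 2 ∷ []) ∷ (1ℚ , 3 ∷ []) ∷ [])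

  γ-lo : - γ ≤ ♯ 3
  γ-lo = lem γ (H 1) (ℓ 1) (inv 1) H1 ℓ1≡0 inv1 (abs-lo (H-ℓ 1 ℕₚ.≤-refl 1≤X))
    where
    lem = lin 4 (λ g h l i → h ≗ con 1ℚ ∷ l ≗ con 0ℚ ∷ i ≗ con 1ℚ ∷ :- (g :- (h :- l)) ≼ # 4 :* i ∷ [] , :- g , # 3) ((- 1ℚ , 0 ∷ []) ∷ (1ℚ , 1 ∷ []) ∷ (♯ 4 , 2 ∷ []) ∷ (1ℚ , 3 ∷ []) ∷ [])

  -- Σ log (n/m)/m. It equals ½ H² plus the constant `c₁`, up to O((1 + log n)/n).
  K : Arith
  K n = Sum n (λ m → (ℓ n - ℓ m) * inv m)

  K-suc : ∀ n → K (suc n) ≡ K n + s n * H n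
  K-suc n = begin
    Sum n (λ m → (ℓ (suc n) - ℓ m) * inv m) + (ℓ (suc n) - ℓ (suc n)) * inv (suc n)
      ≡⟨ cong₂ _+_ (Sum-cong n (λ m _ _ → lem (ℓ (suc n)) (ℓ n) (ℓ m) (inv m))) (lem₂ (ℓ (suc n)) (inv (suc n))) ⟩
    Sum n (λ m → (ℓ n - ℓ m) * inv m + s n * inv m) + 0ℚ
      ≡⟨ +-identityʳ (Sum n (λ m → (ℓ n - ℓ m) * inv m + s n * inv m)) ⟩
    Sum n (λ m → (ℓ n - ℓ m) * inv m + s n * inv m)
      ≡⟨ trans (Sum-+ n _ _) (cong (λ z → K n + z) (Sum-*ˡ n (s n) inv)) ⟩
    K n + s n * H n ∎
    where
    open ≡-Reasoning
    lem = ring 4 (λ a b c i → (a :- c) :* i , (b :- c) :* i :+ (a :- b) :* i)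
    lem₂ = ring 2 (λ a i → (a :- a) :* i , con 0ℚ)

  c₁ : ℚ
  c₁ = K X - ½ * (H X * H X)

  K-near : ∀ n → 1 ℕ.≤ n → n ℕ.≤ X → ∣ c₁ - (K n - ½ * (H n * H n)) ∣ ≤ (♯ 12 + ♯ 4 * H n) * inv n
  K-near n p q = ≤-trans (dominated X (λ n → K n - ½ * (H n * H n)) (λ n → (♯ 12 + ♯ 4 * H n) * inv n) step p q (ℕₚ.n≤1+n X))
      (lem ((♯ 12 + ♯ 4 * H n) * inv n) (H X) (inv X) (H≥0 X) (inv≥0 X))
    where
    lem = lin 3 (λ a h i → con 0ℚ ≼ h ∷ con 0ℚ ≼ i ∷ [] , a :- (# 12 :+ # 4 :* h) :* i , a) ((♯ 12 , 1 ∷ []) ∷ (♯ 4 , 0 ∷ 1 ∷ []) ∷ [])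
    step : ∀ n → 1 ℕ.≤ n → n ℕ.≤ X → ∣ (K (suc n) - ½ * (H (suc n) * H (suc n))) - (K n - ½ * (H n * H n)) ∣ ≤ (♯ 12 + ♯ 4 * H n) * inv n - (♯ 12 + ♯ 4 * H (suc n)) * inv (suc n)
    step n p q = abs≤ (lem₁ (K n) (K (suc n)) (H n) (s n) (inv n) (inv (suc n)) (K-suc n) (abs-hi (s-inv n p q)) (inv-suc p) (inv-half p) (inv≥0 n) (inv≥0 (suc n)) (inv-mono p (ℕₚ.n≤1+n n)) (H≥0 n))
                      (lem₂ (K n) (K (suc n)) (H n) (s n) (inv n) (inv (suc n)) (K-suc n) (abs-lo (s-inv n p q)) (inv-suc p) (inv-half p) (inv≥0 n) (inv≥0 (suc n)) (inv-mono p (ℕₚ.n≤1+n n)) (H≥0 n))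
      where
      lem₁ = lin 6 (λ k k' h s i j → k' ≗ k :+ s :* h ∷ s :- j ≼ # 2 :* (i :* i) ∷ i :- j ≗ i :* j ∷ con ½ :* i ≼ j ∷ con 0ℚ ≼ i ∷ con 0ℚ ≼ j ∷ j ≼ i ∷ con 0ℚ ≼ h ∷ [] , (k' :- con ½ :* ((h :+ j) :* (h :+ j))) :- (k :- con ½ :* (h :* h)) , (# 12 :+ # 4 :* h) :* i :- (# 12 :+ # 4 :* (h :+ j)) :* j) ((1ℚ , 0 ∷ []) ∷ (1ℚ , 1 ∷ 7 ∷ []) ∷ (- (♯ 12) , 2 ∷ []) ∷ (- (♯ 4) , 2 ∷ 7 ∷ []) ∷ (♯ 4 , 3 ∷ 4 ∷ 7 ∷ []) ∷ (+ 17 / 2 , 4 ∷ 5 ∷ []) ∷ (+ 7 / 2 , 6 ∷ 5 ∷ []) ∷ [])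
      lem₂ = lin 6 (λ k k' h s i j → k' ≗ k :+ s :* h ∷ :- (s :- j) ≼ # 2 :* (i :* i) ∷ i :- j ≗ i :* j ∷ con ½ :* i ≼ j ∷ con 0ℚ ≼ i ∷ con 0ℚ ≼ j ∷ j ≼ i ∷ con 0ℚ ≼ h ∷ [] , :- ((k' :- con ½ :* ((h :+ j) :* (h :+ j))) :- (k :- con ½ :* (h :* h))) , (# 12 :+ # 4 :* h) :* i :- (# 12 :+ # 4 :* (h :+ j)) :* j) ((- 1ℚ , 0 ∷ []) ∷ (1ℚ , 1 ∷ 7 ∷ []) ∷ (- (♯ 12) , 2 ∷ []) ∷ (- (♯ 4) , 2 ∷ 7 ∷ []) ∷ (♯ 4 , 3 ∷ 4 ∷ 7 ∷ []) ∷ (+ 15 / 2 , 4 ∷ 5 ∷ []) ∷ (+ 9 / 2 , 6 ∷ 5 ∷ []) ∷ [])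

  K-one : K 1 ≡ 0ℚ
  K-one = lem (ℓ 1) (inv 1)
    where
    lem = ring 2 (λ a i → con 0ℚ :+ (a :- a) :* i , con 0ℚ)

  c₁-hi : c₁ ≤ ♯ 16
  c₁-hi = lem c₁ (abs-hi (subst₂ (λ k h → ∣ c₁ - (k - ½ * (h * h)) ∣ ≤ (♯ 12 + ♯ 4 * h) * 1ℚ) K-one H1 (subst (λ i → ∣ c₁ - (K 1 - ½ * (H 1 * H 1)) ∣ ≤ (♯ 12 + ♯ 4 * H 1) * i) inv1 (K-near 1 ℕₚ.≤-refl 1≤X))))
    where
    lem = lin 1 (λ c → c :- (con 0ℚ :- con ½ :* (con 1ℚ :* con 1ℚ)) ≼ (# 12 :+ # 4 :* con 1ℚ) :* con 1ℚ ∷ [] , c , # 16) ((½ , []) ∷ (1ℚ , 0 ∷ []) ∷ [])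

  c₁-lo : - c₁ ≤ ♯ 17
  c₁-lo = lem c₁ (abs-lo (subst₂ (λ k h → ∣ c₁ - (k - ½ * (h * h)) ∣ ≤ (♯ 12 + ♯ 4 * h) * 1ℚ) K-one H1 (subst (λ i → ∣ c₁ - (K 1 - ½ * (H 1 * H 1)) ∣ ≤ (♯ 12 + ♯ 4 * H 1) * i) inv1 (K-near 1 ℕₚ.≤-refl 1≤X))))
    where
    lem = lin 1 (λ c → :- (c :- (con 0ℚ :- con ½ :* (con 1ℚ :* con 1ℚ))) ≼ (# 12 :+ # 4 :* con 1ℚ) :* con 1ℚ ∷ [] , :- c , # 17) ((½ , []) ∷ (1ℚ , 0 ∷ []) ∷ [])

  ℓ≤H : ∀ n → 1 ℕ.≤ n → n ℕ.≤ X → ℓ n ≤ ♯ 7 * (1ℚ + H n)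
  ℓ≤H n p q = lem γ (H n) (ℓ n) (inv n) (abs-hi (H-ℓ n p q)) γ-lo (inv≤1 p) (H≥0 n)
    where
    lem = lin 4 (λ g h l i → g :- (h :- l) ≼ # 4 :* i ∷ :- g ≼ # 3 ∷ i ≼ con 1ℚ ∷ con 0ℚ ≼ h ∷ [] , l , # 7 :* (con 1ℚ :+ h)) ((1ℚ , 0 ∷ []) ∷ (1ℚ , 1 ∷ []) ∷ (♯ 4 , 2 ∷ []) ∷ (♯ 6 , 3 ∷ []) ∷ [])

  H≤ℓ : ∀ n → 1 ℕ.≤ n → n ℕ.≤ X → H n ≤ ℓ n + ♯ 9
  H≤ℓ n p q = lem γ (H n) (ℓ n) (inv n) (abs-lo (H-ℓ n p q)) γ-hi (inv≤1 p)
    where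
    lem = lin 4 (λ g h l i → :- (g :- (h :- l)) ≼ # 4 :* i ∷ g ≼ # 5 ∷ i ≼ con 1ℚ ∷ [] , h , l :+ # 9) ((1ℚ , 0 ∷ []) ∷ (1ℚ , 1 ∷ []) ∷ (♯ 4 , 2 ∷ []) ∷ [])

  -- Sums of log² and Selberg's formula

  U : Arith
  U n = Sum n ℓ²

  U-moments : ∀ n → U n ≡ ι n * (ℓ n * ℓ n) - ♯ 2 * ℓ n * S₁ n + S₂ n
  U-moments n = begin
    Sum n ℓ²
      ≡⟨ Sum-cong n (λ m _ _ → lem (ℓ n) (ℓ m)) ⟩
    Sum n (λ m → (ℓ n * ℓ n - ♯ 2 * ℓ n * (ℓ n - ℓ m)) + (ℓ n - ℓ m) * (ℓ n - ℓ m))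
      ≡⟨ trans (Sum-+ n _ _) (cong (_+ S₂ n) (trans (Sum-- n _ _) (cong₂ _-_ (Sum-const n (ℓ n * ℓ n)) (Sum-*ˡ n (♯ 2 * ℓ n) _)))) ⟩
    ι n * (ℓ n * ℓ n) - ♯ 2 * ℓ n * S₁ n + S₂ n ∎
    where
    open ≡-Reasoning
    lem = ring 2 (λ a b → b :* b , (a :* a :- # 2 :* a :* (a :- b)) :+ (a :- b) :* (a :- b))

  U-near : ∀ n → 1 ℕ.≤ n → n ℕ.≤ X → ∣ U n - ι n * (ℓ n * ℓ n - ♯ 2 * ℓ n + ♯ 2) ∣ ≤ ♯ 76 * ((1ℚ + H n) * (1ℚ + H n))
  U-near n p q = abs≤
      (lem₁ (U n) (ι n) (ℓ n) (S₁ n) (S₂ n) (H n) (U-moments n) (ℓ≥0 n) (ℓ≤H n p q) (H≥0 n) (abs-lo (S₁-near n p q′)) (abs-hi (S₂-near n p q′)))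
      (lem₂ (U n) (ι n) (ℓ n) (S₁ n) (S₂ n) (H n) (U-moments n) (ℓ≥0 n) (ℓ≤H n p q) (H≥0 n) (abs-hi (S₁-near n p q′)) (abs-lo (S₂-near n p q′)))
    where
    q′ = ℕₚ.m≤n⇒m≤1+n q
    lem₁ = lin 6 (λ u n l a b h → u ≗ n :* (l :* l) :- # 2 :* l :* a :+ b ∷ con 0ℚ ≼ l ∷ l ≼ # 7 :* (con 1ℚ :+ h) ∷ con 0ℚ ≼ h ∷ :- (a :- n) ≼ con 1ℚ :+ # 4 :* h ∷ b :- # 2 :* n ≼ # 20 :* ((con 1ℚ :+ h) :* (con 1ℚ :+ h)) ∷ [] , u :- n :* (l :* l :- # 2 :* l :+ # 2) , # 76 :* ((con 1ℚ :+ h) :* (con 1ℚ :+ h))) ((1ℚ , 0 ∷ []) ∷ (♯ 6 , 1 ∷ []) ∷ (1ℚ , 5 ∷ []) ∷ (+ 8 / 7 , 1 ∷ 2 ∷ []) ∷ (♯ 2 , 1 ∷ 4 ∷ []) ∷ (+ 8 / 7 , 2 ∷ 2 ∷ []) ∷ [])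
    lem₂ = lin 6 (λ u n l a b h → u ≗ n :* (l :* l) :- # 2 :* l :* a :+ b ∷ con 0ℚ ≼ l ∷ l ≼ # 7 :* (con 1ℚ :+ h) ∷ con 0ℚ ≼ h ∷ a :- n ≼ con 1ℚ :+ # 4 :* h ∷ :- (b :- # 2 :* n) ≼ # 20 :* ((con 1ℚ :+ h) :* (con 1ℚ :+ h)) ∷ [] , :- (u :- n :* (l :* l :- # 2 :* l :+ # 2)) , # 76 :* ((con 1ℚ :+ h) :* (con 1ℚ :+ h))) ((- 1ℚ , 0 ∷ []) ∷ (♯ 6 , 1 ∷ []) ∷ (1ℚ , 5 ∷ []) ∷ (+ 8 / 7 , 1 ∷ 2 ∷ []) ∷ (♯ 2 , 1 ∷ 4 ∷ []) ∷ (+ 8 / 7 , 2 ∷ 2 ∷ []) ∷ [])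

  -- Substituting log = H - γ and ½ H² = K - c₁ turns log² - 2 log + 2 into 2 K + α H + β. The gain
  -- is that the sums of K and H against μ(d)/d are evaluated exactly by `Hyp-μ`.
  α β : ℚ
  α = - (♯ 2 * (γ + 1ℚ))
  β = γ * γ + ♯ 2 * γ + ♯ 2 - ♯ 2 * c₁

  α-bound : ∣ α ∣ ≤ ♯ 12
  α-bound = abs≤ (lem₁ γ γ-lo) (lem₂ γ γ-hi)
    where
    lem₁ = lin 1 (λ g → :- g ≼ # 3 ∷ [] , :- (# 2 :* (g :+ con 1ℚ)) , # 12) ((♯ 8 , []) ∷ (♯ 2 , 0 ∷ []) ∷ [])
    lem₂ = lin 1 (λ g → g ≼ # 5 ∷ [] , :- (:- (# 2 :* (g :+ con 1ℚ))) , # 12) ((♯ 2 , 0 ∷ []) ∷ [])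

  β-bound : ∣ β ∣ ≤ ♯ 71
  β-bound = abs≤ (lem₁ γ c₁ γ-hi γ-lo c₁-lo) (lem₂ γ c₁ γ-lo c₁-hi (sq γ))
    where
    lem₁ = lin 2 (λ g c → g ≼ # 5 ∷ :- g ≼ # 3 ∷ :- c ≼ # 17 ∷ [] , g :* g :+ # 2 :* g :+ # 2 :- # 2 :* c , # 71) ((♯ 4 , 0 ∷ []) ∷ (♯ 2 , 2 ∷ []) ∷ (1ℚ , 0 ∷ 1 ∷ []) ∷ [])
    lem₂ = lin 2 (λ g c → :- g ≼ # 3 ∷ c ≼ # 16 ∷ con 0ℚ ≼ g :* g ∷ [] , :- (g :* g :+ # 2 :* g :+ # 2 :- # 2 :* c) , # 71) ((♯ 35 , []) ∷ (♯ 2 , 0 ∷ []) ∷ (♯ 2 , 1 ∷ []) ∷ (1ℚ , 2 ∷ []) ∷ [])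

  ℓ-Lipschitz : ∀ {m n} → 1 ℕ.≤ m → m ℕ.≤ n → n ℕ.≤ suc X → ℓ n - ℓ m ≤ ♯ 2 * ((ι n - ι m) * inv m)
  ℓ-Lipschitz {m} {n} 1≤m m≤n n≤X with ℕₚ.m≤n⇒m<n∨m≡n m≤n
  ... | inj₂ refl = ≤-reflexive (lem (ℓ m) (ι m) (inv m))
    where
    lem = ring 3 (λ a n i → a :- a , # 2 :* ((n :- n) :* i))
  ℓ-Lipschitz {m} {suc n} 1≤m m≤n (s≤s n≤X) | inj₁ (s≤s m≤n′) =
    lem (ℓ m) (ℓ n) (ℓ (suc n)) (ι m) (ι n) (ι (suc n)) (inv m) (inv n) (ℓ-Lipschitz 1≤m m≤n′ (ℕₚ.m≤n⇒m≤1+n n≤X))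
      (s≤2inv n (ℕₚ.≤-trans 1≤m m≤n′) n≤X) (inv-mono 1≤m m≤n′) (ι-suc n) (inv≥0 m)
    where
    lem = lin 8 (λ a b c m n k i j → b :- a ≼ # 2 :* ((n :- m) :* i) ∷ c :- b ≼ # 2 :* j ∷ j ≼ i ∷ k ≗ n :+ con 1ℚ ∷ con 0ℚ ≼ i ∷ [] , c :- a , # 2 :* ((k :- m) :* i)) ((1ℚ , 0 ∷ []) ∷ (1ℚ , 1 ∷ []) ∷ (♯ 2 , 2 ∷ []) ∷ (- (♯ 2) , 3 ∷ 4 ∷ []) ∷ [])

  -- The contribution of one d ≤ x, with N = ⌊x/d⌋ and t = log (x/d)

  module Term {x d : ℕ} (1≤d : 1 ℕ.≤ d) (d≤x : d ℕ.≤ x) (x≤X : x ℕ.≤ X) where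
    N = x // d
    1≤N : 1 ℕ.≤ N
    1≤N = 1≤// 1≤d d≤x
    N≤X : N ℕ.≤ X
    N≤X = ℕₚ.≤-trans (//-≤ x d) x≤X
    n i h l t v p K′ Q : ℚ
    n = ι N
    i = inv N
    h = H N
    l = ℓ N
    t = ℓ x - ℓ d
    v = ι x * inv d
    p = 1ℚ + h
    -- Not `K N`: with `t` in place of `ℓ N` the summand, divided by d, is a function of d m alone,
    -- as Möbius inversion requires.
    K′ = Sum N (λ m → (t - ℓ m) * inv m)
    Q = ♯ 2 * K′ + α * h + β

    dN≥1 : 1 ℕ.≤ d ℕ.* N
    dN≥1 = ℕₚ.*-mono-≤ 1≤d 1≤N
    dN≤x : d ℕ.* N ℕ.≤ x
    dN≤x = ≤//⇒*≤ {x} {d} ℕₚ.≤-refl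

    l≤t : l ≤ t
    l≤t = lem l (ℓ d) (ℓ x) (subst (_≤ ℓ x) (ℓ-* d N 1≤d 1≤N) (ℓ-mono dN≥1 dN≤x (ℕₚ.m≤n⇒m≤1+n x≤X)))
      where
      lem = lin 3 (λ l d x → d :+ l ≼ x ∷ [] , l , x :- d) ((1ℚ , 0 ∷ []) ∷ [])

    t≤l : t - l ≤ ♯ 2 * i
    t≤l = lem l (ℓ d) (ℓ x) (ℓ (d ℕ.* N)) (ι x) (ι (d ℕ.* N)) (ι d) n (inv (d ℕ.* N)) (inv d) i v
        (ℓ-Lipschitz dN≥1 dN≤x (ℕₚ.m≤n⇒m≤1+n x≤X)) (ℓ-* d N 1≤d 1≤N) (ι-* d N) (inv-* 1≤d 1≤N) (≤ι//+1 {x} 1≤d) refl (ι*inv 1≤d) (inv≥0 N)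
      where
      lem₀ = lin 3 (λ v n i → v ≼ n :+ con 1ℚ ∷ con 0ℚ ≼ i ∷ [] , # 2 :* ((v :- n :* con 1ℚ) :* i) , # 2 :* i) ((♯ 2 , 0 ∷ 1 ∷ []) ∷ [])
      lem₁ = ring 5 (λ x d n j i → # 2 :* ((x :- d :* n) :* (j :* i)) , # 2 :* ((x :* j :- n :* (d :* j)) :* i))
      lem₂ = ring 3 (λ a b c → c :- b :- a , c :- (b :+ a))
      lem : ∀ l ld lx ldn x dn d n idn j i v → lx - ldn ≤ ♯ 2 * ((x - dn) * idn) → ldn ≡ ld + l → dn ≡ d * n → idn ≡ j * i →
        v ≤ n + 1ℚ → v ≡ x * j → d * j ≡ 1ℚ → 0ℚ ≤ i → lx - ld - l ≤ ♯ 2 * i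
      lem l ld lx _ x _ d n _ j i v p refl refl refl q refl e i0 = subst (_≤ ♯ 2 * i) (sym (lem₂ l ld lx))
        (≤-trans p (≤-trans (≤-reflexive (trans (lem₁ x d n j i) (cong (λ z → ♯ 2 * ((x * j - n * z) * i)) e))) (lem₀ v n i q i0)))

    K′-eq : K′ ≡ K N + (t - l) * h
    K′-eq = trans (Sum-cong N (λ m _ _ → lem t l (ℓ m) (inv m))) (trans (Sum-+ N _ _) (cong (λ z → K N + z) (Sum-*ˡ N (t - l) inv)))
      where
      lem = ring 4 (λ t l a i → (t :- a) :* i , (l :- a) :* i :+ (t :- l) :* i)

    K′-near : ∣ K′ - (½ * (h * h) + c₁) ∣ ≤ ♯ 14 * (p * i)
    K′-near = abs≤ (lem₁ K′ (K N) t l h i c₁ K′-eq l≤t t≤l (H≥0 N) (inv≥0 N) (abs-lo (K-near N 1≤N N≤X)))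
                   (lem₂ K′ (K N) t l h i c₁ K′-eq l≤t t≤l (H≥0 N) (inv≥0 N) (abs-hi (K-near N 1≤N N≤X)))
      where
      lem₁ = lin 7 (λ k' k t l h i c → k' ≗ k :+ (t :- l) :* h ∷ l ≼ t ∷ t :- l ≼ # 2 :* i ∷ con 0ℚ ≼ h ∷ con 0ℚ ≼ i ∷ :- (c :- (k :- con ½ :* (h :* h))) ≼ (# 12 :+ # 4 :* h) :* i ∷ [] , k' :- (con ½ :* (h :* h) :+ c) , # 14 :* ((con 1ℚ :+ h) :* i)) ((1ℚ , 0 ∷ []) ∷ (1ℚ , 1 ∷ []) ∷ (1ℚ , 2 ∷ []) ∷ (1ℚ , 5 ∷ []) ∷ (♯ 4 , 1 ∷ 3 ∷ []) ∷ (♯ 5 , 2 ∷ 3 ∷ []) ∷ [])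
      lem₂ = lin 7 (λ k' k t l h i c → k' ≗ k :+ (t :- l) :* h ∷ l ≼ t ∷ t :- l ≼ # 2 :* i ∷ con 0ℚ ≼ h ∷ con 0ℚ ≼ i ∷ c :- (k :- con ½ :* (h :* h)) ≼ (# 12 :+ # 4 :* h) :* i ∷ [] , :- (k' :- (con ½ :* (h :* h) :+ c)) , # 14 :* ((con 1ℚ :+ h) :* i)) ((- 1ℚ , 0 ∷ []) ∷ (1ℚ , 1 ∷ []) ∷ (1ℚ , 2 ∷ []) ∷ (1ℚ , 5 ∷ []) ∷ (♯ 6 , 1 ∷ 3 ∷ []) ∷ (♯ 5 , 2 ∷ 3 ∷ []) ∷ [])

    h≥0 : 0ℚ ≤ h
    h≥0 = H≥0 N

    p≥1 : 1ℚ ≤ p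
    p≥1 = lem h h≥0
      where
      lem = lin 1 (λ h → con 0ℚ ≼ h ∷ [] , con 1ℚ , con 1ℚ :+ h) ((1ℚ , 0 ∷ []) ∷ [])

    Q-bound : ∣ Q ∣ ≤ ♯ 145 * (p * p)
    Q-bound = abs≤ (lem₁ K′ α β h i c₁ (abs-hi K′-near) (inv≤1 1≤N) (inv≥0 N) h≥0 c₁-hi (abs-hi α-bound) (abs-hi β-bound))
                   (lem₂ K′ α β h i c₁ (abs-lo K′-near) (inv≤1 1≤N) (inv≥0 N) h≥0 c₁-lo (abs-lo α-bound) (abs-lo β-bound))
      where
      lem₁ = lin 6 (λ k a b h i c → k :- (con ½ :* (h :* h) :+ c) ≼ # 14 :* ((con 1ℚ :+ h) :* i) ∷ i ≼ con 1ℚ ∷ con 0ℚ ≼ i ∷ con 0ℚ ≼ h ∷ c ≼ # 16 ∷ a ≼ # 12 ∷ b ≼ # 71 ∷ [] , # 2 :* k :+ a :* h :+ b , # 145 :* ((con 1ℚ :+ h) :* (con 1ℚ :+ h))) ((♯ 14 , []) ∷ (♯ 2 , 0 ∷ []) ∷ (♯ 28 , 1 ∷ []) ∷ (♯ 250 , 3 ∷ []) ∷ (♯ 2 , 4 ∷ []) ∷ (1ℚ , 6 ∷ []) ∷ (♯ 28 , 1 ∷ 3 ∷ []) ∷ (♯ 144 , 3 ∷ 3 ∷ []) ∷ (1ℚ , 3 ∷ 5 ∷ []) ∷ [])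
      lem₂ = lin 6 (λ k a b h i c → :- (k :- (con ½ :* (h :* h) :+ c)) ≼ # 14 :* ((con 1ℚ :+ h) :* i) ∷ i ≼ con 1ℚ ∷ con 0ℚ ≼ i ∷ con 0ℚ ≼ h ∷ :- c ≼ # 17 ∷ :- a ≼ # 12 ∷ :- b ≼ # 71 ∷ [] , :- (# 2 :* k :+ a :* h :+ b) , # 145 :* ((con 1ℚ :+ h) :* (con 1ℚ :+ h))) ((♯ 12 , []) ∷ (♯ 2 , 0 ∷ []) ∷ (♯ 28 , 1 ∷ []) ∷ (♯ 250 , 3 ∷ []) ∷ (♯ 2 , 4 ∷ []) ∷ (1ℚ , 6 ∷ []) ∷ (♯ 28 , 1 ∷ 3 ∷ []) ∷ (♯ 146 , 3 ∷ 3 ∷ []) ∷ (1ℚ , 3 ∷ 5 ∷ []) ∷ [])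

    scaled : ∀ {e b} → ∣ e ∣ ≤ b * i → ∣ n * e ∣ ≤ b
    scaled {e} {b} q = subst (∣ n * e ∣ ≤_) (trans (lem n b i) (trans (cong (b *_) (ι*inv 1≤N)) (*-identityʳ b)))
        (abs-* (≤-reflexive (0≤p⇒∣p∣≡p (ι≥0 N))) q)
      where
      lem = ring 3 (λ n b i → n :* (b :* i) , b :* (n :* i))

    part₂ : ∣ (n * (γ - (h - l))) * (l + (h - γ) - ♯ 2) ∣ ≤ ♯ 4 * (♯ 14 * p)
    part₂ = abs-* {A = ♯ 4} (scaled (H-ℓ N 1≤N N≤X)) (abs≤ (lem₁ l h γ (ℓ≤H N 1≤N N≤X) h≥0 γ-lo) (lem₂ l h γ (ℓ≥0 N) h≥0 γ-hi))
      where
      lem₁ = lin 3 (λ l h g → l ≼ # 7 :* (con 1ℚ :+ h) ∷ con 0ℚ ≼ h ∷ :- g ≼ # 3 ∷ [] , l :+ (h :- g) :- # 2 , # 14 :* (con 1ℚ :+ h)) ((♯ 6 , []) ∷ (1ℚ , 0 ∷ []) ∷ (♯ 6 , 1 ∷ []) ∷ (1ℚ , 2 ∷ []) ∷ [])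
      lem₂ = lin 3 (λ l h g → con 0ℚ ≼ l ∷ con 0ℚ ≼ h ∷ g ≼ # 5 ∷ [] , :- (l :+ (h :- g) :- # 2) , # 14 :* (con 1ℚ :+ h)) ((♯ 7 , []) ∷ (1ℚ , 0 ∷ []) ∷ (♯ 15 , 1 ∷ []) ∷ (1ℚ , 2 ∷ []) ∷ [])

    part₃ : ∣ n * (K′ - (½ * (h * h) + c₁)) ∣ ≤ ♯ 14 * p
    part₃ = scaled (subst (∣ K′ - (½ * (h * h) + c₁) ∣ ≤_) (sym (*-assoc (♯ 14) p i)) K′-near)

    part₄ : ∣ (v - n) * Q ∣ ≤ 1ℚ * (♯ 145 * (p * p))
    part₄ = abs-* (abs≤ (lem₁ v n (≤ι//+1 {x} 1≤d)) (lem₂ v n (ι//≤ {x} 1≤d))) Q-bound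
      where
      lem₁ = lin 2 (λ v n → v ≼ n :+ con 1ℚ ∷ [] , v :- n , con 1ℚ) ((1ℚ , 0 ∷ []) ∷ [])
      lem₂ = lin 2 (λ v n → n ≼ v ∷ [] , :- (v :- n) , con 1ℚ) ((1ℚ , []) ∷ (1ℚ , 0 ∷ []) ∷ [])

    -- Replacing log, log² and the floor N by their substitutes costs only O((1 + log (x/d))²),
    -- which `p²-bound` and `S₂≤` sum to O(x) over d.
    main : ∣ U N - v * Q ∣ ≤ ♯ 305 * (p * p)
    main = ≤-trans (subst (λ z → ∣ z ∣ ≤ ♯ 76 * (p * p) + ♯ 4 * (♯ 14 * p) + ♯ 2 * (♯ 14 * p) + 1ℚ * (♯ 145 * (p * p))) (sym (lem (U N) n l h γ c₁ K′ v))
        (abs-- (abs-- (abs-+ (U-near N 1≤N N≤X) part₂) (abs-* {♯ 2} ≤-refl part₃)) part₄)) (fin p p≥1)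
      where
      lem = ring 8 (λ u n l h g c k v → u :- v :* (# 2 :* k :+ (:- (# 2 :* (g :+ con 1ℚ))) :* h :+ (g :* g :+ # 2 :* g :+ # 2 :- # 2 :* c)) , ((u :- n :* (l :* l :- # 2 :* l :+ # 2)) :+ (n :* (g :- (h :- l))) :* (l :+ (h :- g) :- # 2) :- # 2 :* (n :* (k :- (con ½ :* (h :* h) :+ c)))) :- (v :- n) :* (# 2 :* k :+ (:- (# 2 :* (g :+ con 1ℚ))) :* h :+ (g :* g :+ # 2 :* g :+ # 2 :- # 2 :* c)))
      fin = lin 1 (λ p → con 1ℚ ≼ p ∷ [] , # 76 :* (p :* p) :+ # 4 :* (# 14 :* p) :+ # 2 :* (# 14 :* p) :+ con 1ℚ :* (# 145 :* (p :* p)) , # 305 :* (p :* p)) ((♯ 84 , 0 ∷ []) ∷ (♯ 84 , 0 ∷ 0 ∷ []) ∷ [])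

    p²-bound : p * p ≤ ♯ 2 * (t * t) + ♯ 200
    p²-bound = ≤-trans (lem₁ h t h≥0 (≤-trans (H≤ℓ N 1≤N N≤X) (+-monoˡ-≤ (♯ 9) l≤t))) (lem₂ t (sq (t - ♯ 10)))
      where
      lem₁ = lin 2 (λ h t → con 0ℚ ≼ h ∷ h ≼ t :+ # 9 ∷ [] , (con 1ℚ :+ h) :* (con 1ℚ :+ h) , (t :+ # 10) :* (t :+ # 10)) ((♯ 2 , 1 ∷ []) ∷ (♯ 2 , 0 ∷ 1 ∷ []) ∷ (1ℚ , 1 ∷ 1 ∷ []) ∷ [])
      lem₂ = lin 1 (λ t → con 0ℚ ≼ (t :- # 10) :* (t :- # 10) ∷ [] , (t :+ # 10) :* (t :+ # 10) , # 2 :* (t :* t) :+ # 200) ((1ℚ , 0 ∷ []) ∷ [])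

  μ-weighted : ∀ N {f g : Arith} → (∀ n → 1 ℕ.≤ n → n ℕ.≤ N → ∣ f n ∣ ≤ g n) → ∣ Sum N (λ n → μ n * f n) ∣ ≤ Sum N g
  μ-weighted N {f} {g} h = Sum-abs N (λ n p q → subst (∣ μ n * f n ∣ ≤_) (*-identityˡ (g n)) (abs-* (μ-bound n) (h n p q)))

  F : Arith
  F x = Sum x Λ₂

  cF : ℚ
  cF = ♯ 70000

  module _ {x : ℕ} (1≤x : 1 ℕ.≤ x) (x≤X : x ℕ.≤ X) where
    private
      t v K′ : Arith
      t d = ℓ x - ℓ d
      v d = ι x * inv d
      K′ d = Sum (x // d) (λ m → (t d - ℓ m) * inv m)

    F-U : F x ≡ Sum x (λ d → μ d * U (x // d))
    F-U = trans (Sum-cong x (λ n _ _ → sym (*-identityˡ (Λ₂ n)))) (trans (Sum-Λ₂ x one) (trans (Hyp-cong x (λ d m _ _ _ → cong (μ d *_) (*-identityˡ (ℓ² m)))) (Hyp-*ˡ x μ (λ _ → ℓ²))))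

    μ-K : Sum x (λ d → μ d * (inv d * K′ d)) ≡ ℓ x
    μ-K = begin
      Sum x (λ d → μ d * (inv d * K′ d))
        ≡⟨ Sum-cong x (λ d _ _ → cong (μ d *_) (sym (Sum-*ˡ (x // d) (inv d) _))) ⟩
      Sum x (λ d → μ d * Sum (x // d) (λ m → inv d * ((t d - ℓ m) * inv m)))
        ≡⟨ Hyp-*ˡ x μ (λ d m → inv d * ((t d - ℓ m) * inv m)) ⟨
      Hyp x (λ d m → μ d * (inv d * ((t d - ℓ m) * inv m)))
        ≡⟨ Hyp-cong x (λ d m p q _ → cong (μ d *_) (trans (lem (ℓ x) (ℓ d) (ℓ m) (inv d) (inv m)) (sym (cong₂ (λ a b → (ℓ x - a) * b) (ℓ-* d m p q) (inv-* p q))))) ⟩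
      Hyp x (λ d m → μ d * ((ℓ x - ℓ (d ℕ.* m)) * inv (d ℕ.* m)))
        ≡⟨ Hyp-μ x (λ n → (ℓ x - ℓ n) * inv n) 1≤x ⟩
      (ℓ x - ℓ 1) * inv 1
        ≡⟨ cong₂ (λ a b → (ℓ x - a) * b) ℓ1≡0 inv1 ⟩
      (ℓ x - 0ℚ) * 1ℚ
        ≡⟨ lem₂ (ℓ x) ⟩
      ℓ x ∎
      where
      open ≡-Reasoning
      lem = ring 5 (λ a b c i j → i :* ((a :- b :- c) :* j) , (a :- (b :+ c)) :* (i :* j))
      lem₂ = ring 1 (λ a → (a :- con 0ℚ) :* con 1ℚ , a)

    μ-H : Sum x (λ d → μ d * (inv d * H (x // d))) ≡ 1ℚ
    μ-H = begin
      Sum x (λ d → μ d * (inv d * H (x // d)))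
        ≡⟨ Sum-cong x (λ d _ _ → cong (μ d *_) (sym (Sum-*ˡ (x // d) (inv d) inv))) ⟩
      Sum x (λ d → μ d * Sum (x // d) (λ m → inv d * inv m))
        ≡⟨ Hyp-*ˡ x μ (λ d m → inv d * inv m) ⟨
      Hyp x (λ d m → μ d * (inv d * inv m))
        ≡⟨ Hyp-cong x (λ d m p q _ → cong (μ d *_) (sym (inv-* p q))) ⟩
      Hyp x (λ d m → μ d * inv (d ℕ.* m))
        ≡⟨ Hyp-μ x inv 1≤x ⟩
      inv 1
        ≡⟨ inv1 ⟩
      1ℚ ∎
      where open ≡-Reasoning

    μ-N : Sum x (λ d → μ d * ι (x // d)) ≡ 1ℚ
    μ-N = trans (Sum-cong x (λ d _ _ → cong (μ d *_) (sym (trans (Sum-const (x // d) 1ℚ) (*-identityʳ (ι (x // d)))))))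
      (trans (sym (Hyp-*ˡ x μ (λ _ _ → 1ℚ))) (Hyp-μ x one 1≤x))

    -- Σ μ(d) ⌊x/d⌋ = 1, and omitting the floors changes each of the x terms by at most 1.
    μ-v : ∣ Sum x (λ d → μ d * v d) ∣ ≤ ♯ 2 * ι x
    μ-v = ≤-trans (subst (λ z → ∣ z ∣ ≤ 1ℚ + ι x * 1ℚ) eq (abs-+ {1ℚ} {Sum x (λ d → μ d * (v d - ι (x // d)))} ≤-refl
        (≤-trans (μ-weighted x (λ d p _ → abs≤ (lem₁ (v d) (ι (x // d)) (≤ι//+1 {x} p)) (lem₂ (v d) (ι (x // d)) (ι//≤ {x} p)))) (≤-reflexive (Sum-const x 1ℚ)))))
        (lem₃ (ι x) (ι≥1 1≤x))
      where
      lem₁ = lin 2 (λ v n → v ≼ n :+ con 1ℚ ∷ [] , v :- n , con 1ℚ) ((1ℚ , 0 ∷ []) ∷ [])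
      lem₂ = lin 2 (λ v n → n ≼ v ∷ [] , :- (v :- n) , con 1ℚ) ((1ℚ , []) ∷ (1ℚ , 0 ∷ []) ∷ [])
      lem₃ = lin 1 (λ x → con 1ℚ ≼ x ∷ [] , con 1ℚ :+ x :* con 1ℚ , # 2 :* x) ((1ℚ , 0 ∷ []) ∷ [])
      lem₄ = ring 3 (λ a b c → a :* b :+ a :* (c :- b) , a :* c)
      eq : 1ℚ + Sum x (λ d → μ d * (v d - ι (x // d))) ≡ Sum x (λ d → μ d * v d)
      eq = trans (cong (_+ Sum x (λ d → μ d * (v d - ι (x // d)))) (sym μ-N)) (trans (sym (Sum-+ x _ _)) (Sum-cong x (λ d _ _ → lem₄ (μ d) (ι (x // d)) (v d))))

    -- Only the K term yields x log x; the other two are O(x) because Σ μ(d) H(x/d)/d = 1 and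
    -- because of `μ-v`.
    F-main : Sum x (λ d → μ d * (v d * (♯ 2 * K′ d + α * H (x // d) + β))) ≡ ♯ 2 * (ι x * ℓ x) + (α * ι x + β * Sum x (λ d → μ d * v d))
    F-main = begin
      Sum x (λ d → μ d * (v d * (♯ 2 * K′ d + α * H (x // d) + β)))
        ≡⟨ Sum-cong x (λ d _ _ → lem (μ d) (ι x) (inv d) (K′ d) (H (x // d)) α β) ⟩
      Sum x (λ d → ♯ 2 * ι x * (μ d * (inv d * K′ d)) + (α * ι x * (μ d * (inv d * H (x // d))) + β * (μ d * v d)))
        ≡⟨ trans (Sum-+ x _ _) (cong₂ _+_ (Sum-*ˡ x (♯ 2 * ι x) _) (trans (Sum-+ x _ _) (cong₂ _+_ (Sum-*ˡ x (α * ι x) _) (Sum-*ˡ x β _)))) ⟩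
      ♯ 2 * ι x * Sum x (λ d → μ d * (inv d * K′ d)) + (α * ι x * Sum x (λ d → μ d * (inv d * H (x // d))) + β * Sum x (λ d → μ d * v d))
        ≡⟨ cong₂ (λ a b → ♯ 2 * ι x * a + (α * ι x * b + β * Sum x (λ d → μ d * v d))) μ-K μ-H ⟩
      ♯ 2 * ι x * ℓ x + (α * ι x * 1ℚ + β * Sum x (λ d → μ d * v d))
        ≡⟨ lem₂ (ι x) (ℓ x) α (β * Sum x (λ d → μ d * v d)) ⟩
      ♯ 2 * (ι x * ℓ x) + (α * ι x + β * Sum x (λ d → μ d * v d)) ∎
      where
      open ≡-Reasoning
      lem = ring 7 (λ m x i k h a b → m :* ((x :* i) :* (# 2 :* k :+ a :* h :+ b)) , # 2 :* x :* (m :* (i :* k)) :+ (a :* x :* (m :* (i :* h)) :+ b :* (m :* (x :* i))))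
      lem₂ = ring 4 (λ x l a c → # 2 :* x :* l :+ (a :* x :* con 1ℚ :+ c) , # 2 :* (x :* l) :+ (a :* x :+ c))

    -- 224 = 2 · 12 + 200, from p² ≤ 2 t² + 200 and Σ t² ≤ 12 x.
    F-error : ∣ Sum x (λ d → μ d * (U (x // d) - v d * (♯ 2 * K′ d + α * H (x // d) + β))) ∣ ≤ ♯ 305 * (♯ 224 * ι x)
    F-error = ≤-trans (μ-weighted x (λ d p q → Term.main p q x≤X)) (≤-trans (≤-reflexive (Sum-*ˡ x (♯ 305) _)) (lem₁ (Sum x (λ d → (1ℚ + H (x // d)) * (1ℚ + H (x // d)))) (ι x)
        (≤-trans (Sum-mono x (λ d p q → Term.p²-bound p q x≤X)) (≤-trans (≤-reflexive (trans (Sum-+ x _ _) (cong₂ _+_ (Sum-*ˡ x (♯ 2) _) (Sum-const x (♯ 200)))))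
          (lem₂ (S₂ x) (ι x) (S₂≤ x 1≤x (ℕₚ.m≤n⇒m≤1+n x≤X)))))))
      where
      lem₁ = lin 2 (λ a x → a ≼ # 224 :* x ∷ [] , # 305 :* a , # 305 :* (# 224 :* x)) ((♯ 305 , 0 ∷ []) ∷ [])
      lem₂ = lin 2 (λ a x → a ≼ # 12 :* x ∷ [] , # 2 :* a :+ x :* # 200 , # 224 :* x) ((♯ 2 , 0 ∷ []) ∷ [])

    selberg : ∣ F x - ♯ 2 * (ι x * ℓ x) ∣ ≤ cF * ι x
    selberg = ≤-trans (subst (λ z → ∣ z ∣ ≤ ♯ 305 * (♯ 224 * ι x) + (♯ 12 * ι x + ♯ 71 * (♯ 2 * ι x))) (sym eq)
        (abs-+ F-error (abs-+ (abs-* α-bound (≤-reflexive (0≤p⇒∣p∣≡p (ι≥0 x)))) (abs-* β-bound μ-v)))) (fin (ι x) (ι≥0 x))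
      where
      fin = lin 1 (λ x → con 0ℚ ≼ x ∷ [] , # 305 :* (# 224 :* x) :+ (# 12 :* x :+ # 71 :* (# 2 :* x)) , # 70000 :* x) ((♯ 1526 , 0 ∷ []) ∷ [])
      lem : ∀ a b c d → a - (c + d) ≡ b → a - c ≡ b + d
      lem a _ c d refl = ring 3 (λ a c d → a :- c , a :- (c :+ d) :+ d) a c d
      lem₂ = ring 3 (λ m a b → m :* (a :- b) , m :* a :- m :* b)
      eq : F x - ♯ 2 * (ι x * ℓ x) ≡ Sum x (λ d → μ d * (U (x // d) - v d * (♯ 2 * K′ d + α * H (x // d) + β))) + (α * ι x + β * Sum x (λ d → μ d * v d))
      eq = lem (F x) _ (♯ 2 * (ι x * ℓ x)) (α * ι x + β * Sum x (λ d → μ d * v d))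
        (trans (cong₂ _-_ F-U (sym F-main)) (trans (sym (Sum-- x _ _)) (Sum-cong x (λ d _ _ → sym (lem₂ (μ d) (U (x // d)) (v d * (♯ 2 * K′ d + α * H (x // d) + β)))))))

  -- The bounds of Chebyshev and Mertens

  ψ T : Arith
  ψ x = Sum x Λ
  T x = Sum x ℓ

  ψ≥0 : ∀ x → 0ℚ ≤ ψ x
  ψ≥0 x = Sum-≥0 x (λ n p _ → Λ≥0 n p)

  ψ-mono : ∀ {m n} → m ℕ.≤ n → ψ m ≤ ψ n
  ψ-mono m≤n = Sum-extend Λ m≤n (λ n p _ → Λ≥0 n p)

  T-S₁ : ∀ x → T x ≡ ι x * ℓ x - S₁ x
  T-S₁ x = trans (lem (T x) (ι x * ℓ x)) (cong (λ z → ι x * ℓ x - z) (sym (trans (Sum-- x (λ _ → ℓ x) ℓ) (cong (_- T x) (Sum-const x (ℓ x))))))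
    where
    lem = ring 2 (λ a b → a , b :- (b :- a))

  T-Λ : ∀ x → Sum x (λ d → Λ d * ι (x // d)) ≡ T x
  T-Λ x = trans (Sum-cong x (λ d _ _ → cong (Λ d *_) (sym (trans (Sum-const (x // d) 1ℚ) (*-identityʳ (ι (x // d)))))))
    (trans (sym (Hyp-*ˡ x Λ (λ _ _ → 1ℚ))) (trans (Hyp-Λ x one) (Sum-cong x (λ n _ _ → *-identityˡ (ℓ n)))))

  ℓ≤2ι : ∀ x → 1 ℕ.≤ x → x ℕ.≤ suc X → ℓ x ≤ ♯ 2 * ι x
  ℓ≤2ι x 1≤x x≤X = lem (ℓ x) (ℓ 1) (ι x) (ι 1) (inv 1) (ℓ-Lipschitz ℕₚ.≤-refl 1≤x x≤X) ℓ1≡0 inv1 (ι≥0 1)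
    where
    lem : ∀ a b x o i → a - b ≤ ♯ 2 * ((x - o) * i) → b ≡ 0ℚ → i ≡ 1ℚ → 0ℚ ≤ o → a ≤ ♯ 2 * x
    lem a _ x o _ p refl refl o0 = lem′ a x o p o0
      where
      lem′ = lin 3 (λ a x o → a :- con 0ℚ ≼ # 2 :* ((x :- o) :* con 1ℚ) ∷ con 0ℚ ≼ o ∷ [] , a , # 2 :* x) ((1ℚ , 0 ∷ []) ∷ (♯ 2 , 1 ∷ []) ∷ [])

  -- Chebyshev's bound from T(x) - 2 T(x/2)

  ψ-halving : ∀ x → ψ x - ψ (x // 2) ≤ T x - ♯ 2 * T (x // 2)
  ψ-halving x = subst₂ _≤_ lhs rhs (Sum-mono x (λ d p q → term d p q))
    where
    h = x // 2
    h≤x = //-≤ x 2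
    two : 1 ℕ.≤ 2
    two = s≤s z≤n
    term : ∀ d → 1 ℕ.≤ d → d ℕ.≤ x → Λ d - [ d ℕ.≤? h ] * Λ d ≤ Λ d * ι (x // d) - ♯ 2 * (Λ d * ι (h // d))
    term d p q with d ℕ.≤? h
    ... | yes _ = lem (Λ d) (ι (x // d)) (ι (h // d)) (Λ≥0 d p) (subst (_≤ ι (x // d)) (trans (ι-* 2 (h // d)) (cong (_* ι (h // d)) (ι≡♯ 2))) (ι-mono two*))
      where
      two* : 2 ℕ.* (h // d) ℕ.≤ x // d
      two* = *≤⇒≤// p (ℕₚ.≤-trans (ℕₚ.≤-reflexive (trans (sym (ℕₚ.*-assoc d 2 (h // d))) (trans (cong (ℕ._* (h // d)) (ℕₚ.*-comm d 2)) (ℕₚ.*-assoc 2 d (h // d)))))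
        (≤//⇒*≤ {x} {2} (≤//⇒*≤ {h} {d} ℕₚ.≤-refl)))
      lem = lin 3 (λ l a b → con 0ℚ ≼ l ∷ # 2 :* b ≼ a ∷ [] , l :- con 1ℚ :* l , l :* a :- # 2 :* (l :* b)) ((1ℚ , 0 ∷ 1 ∷ []) ∷ [])
    ... | no d≰h = subst (λ z → Λ d - 0ℚ * Λ d ≤ Λ d * ι (x // d) - ♯ 2 * (Λ d * z)) (sym (trans (cong ι h//d≡0) (ι≡♯ 0))) (lem (Λ d) (ι (x // d)) (Λ≥0 d p) (ι≥1 (1≤// p q)))
      where
      h//d≡0 : h // d ≡ 0
      h//d≡0 with h // d in eq
      ... | zero  = refl
      ... | suc k = ⊥-elim (d≰h (ℕₚ.≤-trans (d≤d*m d (s≤s (z≤n {k}))) (≤//⇒*≤ {h} {d} (ℕₚ.≤-reflexive (sym eq)))))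
      lem = lin 2 (λ l a → con 0ℚ ≼ l ∷ con 1ℚ ≼ a ∷ [] , l :- con 0ℚ :* l , l :* a :- # 2 :* (l :* con 0ℚ)) ((1ℚ , 0 ∷ 1 ∷ []) ∷ [])
    lhs : Sum x (λ d → Λ d - [ d ℕ.≤? h ] * Λ d) ≡ ψ x - ψ h
    lhs = trans (Sum-- x _ _) (cong (λ z → ψ x - z) (trans (Sum-trunc _ h≤x (λ n p _ → []*-no (n ℕ.≤? h) (ℕₚ.<⇒≱ p))) (Sum-cong h (λ n _ q → []*-yes (n ℕ.≤? h) q))))
    zeros : ∀ n → h ℕ.< n → n ℕ.≤ x → Λ n * ι (h // n) ≡ 0ℚ
    zeros n p _ with h // n in eq
    ... | zero  = trans (cong (Λ n *_) (ι≡♯ 0)) (*-zeroʳ (Λ n))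
    ... | suc k = ⊥-elim (ℕₚ.<⇒≱ p (ℕₚ.≤-trans (d≤d*m n (s≤s (z≤n {k}))) (≤//⇒*≤ {h} {n} (ℕₚ.≤-reflexive (sym eq)))))
    rhs : Sum x (λ d → Λ d * ι (x // d) - ♯ 2 * (Λ d * ι (h // d))) ≡ T x - ♯ 2 * T h
    rhs = trans (Sum-- x _ _) (cong₂ _-_ (T-Λ x) (trans (Sum-*ˡ x (♯ 2) _) (cong (♯ 2 *_) (trans (Sum-trunc _ h≤x zeros) (T-Λ h)))))

  T-halving : ∀ x → 2 ℕ.≤ x → x ℕ.≤ X → T x - ♯ 2 * T (x // 2) ≤ ♯ 8 * ι x
  T-halving x 2≤x x≤X = subst₂ (λ a b → a - ♯ 2 * b ≤ ♯ 8 * ι x) (sym (T-S₁ x)) (sym (T-S₁ h))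
      (lem (ι x) (ι h) (ℓ x) (ℓ h) (S₁ x) (S₁ h) (inv h) (S₁≥0 x (ℕₚ.m≤n⇒m≤1+n x≤X)) (S₁≤ h 1≤h h≤X) xh hx (ι≥1 1≤h) (ℓ-Lipschitz 1≤h (//-≤ x 2) (ℕₚ.m≤n⇒m≤1+n x≤X)) (ι*inv 1≤h) (inv≥0 h)
        (ℓ≤2ι h 1≤h h≤X) (ℓ≥0 h))
    where
    h = x // 2
    1≤h : 1 ℕ.≤ h
    1≤h = 1≤// (s≤s z≤n) 2≤x
    h≤X = ℕₚ.m≤n⇒m≤1+n (ℕₚ.≤-trans (//-≤ x 2) x≤X)
    hx : ♯ 2 * ι h ≤ ι x
    hx = subst (_≤ ι x) (trans (ι-* 2 h) (cong (_* ι h) (ι≡♯ 2))) (ι-mono (≤//⇒*≤ {x} {2} ℕₚ.≤-refl))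
    xh : ι x ≤ ♯ 2 * ι h + 1ℚ
    xh = subst (ι x ≤_) (trans (ι-+ (2 ℕ.* h) 1) (cong₂ _+_ (trans (ι-* 2 h) (cong (_* ι h) (ι≡♯ 2))) (ι≡♯ 1)))
      (ι-mono (ℕₚ.≤-trans (ℕₚ.≤-pred (<*suc// x (s≤s z≤n))) (ℕₚ.≤-reflexive (trans (ℕₚ.+-suc h (h ℕ.+ 0)) (ℕₚ.+-comm 1 (2 ℕ.* h))))))
    lem = lin 7 (λ x h l m a b i → con 0ℚ ≼ a ∷ b ≼ # 2 :* h ∷ x ≼ # 2 :* h :+ con 1ℚ ∷ # 2 :* h ≼ x ∷ con 1ℚ ≼ h ∷ l :- m ≼ # 2 :* ((x :- h) :* i) ∷ h :* i ≗ con 1ℚ ∷ con 0ℚ ≼ i ∷ m ≼ # 2 :* h ∷ con 0ℚ ≼ m ∷ [] , (x :* l :- a) :- # 2 :* (h :* m :- b) , # 8 :* x) ((1ℚ , 0 ∷ []) ∷ (♯ 2 , 1 ∷ []) ∷ (1ℚ , 5 ∷ 3 ∷ []) ∷ (♯ 2 , 5 ∷ 4 ∷ []) ∷ (♯ 2 , 5 ∷ []) ∷ (♯ 4 , 8 ∷ []) ∷ (♯ 3 , 9 ∷ []) ∷ (1ℚ , 2 ∷ 9 ∷ []) ∷ (♯ 2 , 2 ∷ 7 ∷ 3 ∷ []) ∷ (♯ 2 , 4 ∷ 7 ∷ 3 ∷ []) ∷ (♯ 4 , 6 ∷ []) ∷ (♯ 4 , 6 ∷ 4 ∷ []) ∷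 (♯ 8 , 6 ∷ 3 ∷ []) ∷ [])

  ψ≤ : ∀ x → x ℕ.≤ X → ψ x ≤ ♯ 16 * ι x
  ψ≤ = <-rec _ go
    where
    lem = lin 6 (λ a b c d x h → a :- b ≼ c :- d ∷ c :- d ≼ # 8 :* x ∷ b ≼ # 16 :* h ∷ # 2 :* h ≼ x ∷ [] , a , # 16 :* x) ((1ℚ , 0 ∷ []) ∷ (1ℚ , 1 ∷ []) ∷ (1ℚ , 2 ∷ []) ∷ (♯ 8 , 3 ∷ []) ∷ [])
    go : ∀ x → (∀ {y} → y ℕ.< x → y ℕ.≤ X → ψ y ≤ ♯ 16 * ι y) → x ℕ.≤ X → ψ x ≤ ♯ 16 * ι x
    go zero rec _ = ♯≥0 16 ⊗ ι≥0 0
    go (suc zero) rec _ = ≤-trans (≤-reflexive (trans (+-identityˡ (Λ 1)) Λ-1)) (♯≥0 16 ⊗ ι≥0 1)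
    go x@(suc (suc y)) rec x≤X = lem (ψ x) (ψ h) (T x) (♯ 2 * T h) (ι x) (ι h) (ψ-halving x) (T-halving x (s≤s (s≤s z≤n)) x≤X)
        (rec h<x (ℕₚ.≤-trans (//-≤ x 2) x≤X)) hx
      where
      h = x // 2
      h<x : h ℕ.< x
      h<x = ℕ.m/n<m x 2 (s≤s (s≤s z≤n))
      hx : ♯ 2 * ι h ≤ ι x
      hx = subst (_≤ ι x) (trans (ι-* 2 h) (cong (_* ι h) (ι≡♯ 2))) (ι-mono (≤//⇒*≤ {x} {2} ℕₚ.≤-refl))

  M : Arith
  M x = Sum x (λ d → Λ d * inv d)

  -- Compare with T x = Σ Λ(d) ⌊x/d⌋: omitting the floors costs at most ψ x, which is O(x); then
  -- divide by x.
  mertens : ∀ x → 1 ℕ.≤ x → x ℕ.≤ X → ∣ M x - ℓ x ∣ ≤ ♯ 18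
  mertens x 1≤x x≤X = abs≤
      (lem₁ (M x) (ℓ x) (ι x) (inv x) (T x) (S₁ x) (ψ x) (T-S₁ x) (S₁≥0 x x≤X′) hi (ψ≤ x x≤X) (ι≥0 x) (ι*inv 1≤x) (inv≥0 x))
      (lem₂ (M x) (ℓ x) (ι x) (inv x) (T x) (S₁ x) (T-S₁ x) (S₁≤ x 1≤x x≤X′) lo (ι≥0 x) (ι*inv 1≤x) (inv≥0 x))
    where
    x≤X′ = ℕₚ.m≤n⇒m≤1+n x≤X
    eq : Sum x (λ d → Λ d * (ι x * inv d)) ≡ ι x * M x
    eq = trans (Sum-cong x (λ d _ _ → *-left-comm (Λ d) (ι x) (inv d))) (Sum-*ˡ x (ι x) _)
    l1 = lin 3 (λ l v n → con 0ℚ ≼ l ∷ v ≼ n :+ con 1ℚ ∷ [] , l :* v , l :* n :+ l) ((1ℚ , 0 ∷ 1 ∷ []) ∷ [])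
    l2 = lin 3 (λ l v n → con 0ℚ ≼ l ∷ n ≼ v ∷ [] , l :* n , l :* v) ((1ℚ , 0 ∷ 1 ∷ []) ∷ [])
    hi : ι x * M x ≤ T x + ψ x
    hi = subst₂ _≤_ eq (trans (Sum-+ x _ _) (cong (_+ ψ x) (T-Λ x))) (Sum-mono x (λ d p _ → l1 (Λ d) (ι x * inv d) (ι (x // d)) (Λ≥0 d p) (≤ι//+1 {x} p)))
    lo : T x ≤ ι x * M x
    lo = subst₂ _≤_ (T-Λ x) eq (Sum-mono x (λ d p _ → l2 (Λ d) (ι x * inv d) (ι (x // d)) (Λ≥0 d p) (ι//≤ {x} p)))
    cancel : ∀ x i a → x * i ≡ 1ℚ → x * a * i ≡ a
    cancel x i a e = trans (lem₀ x i a) (trans (cong (_* a) e) (*-identityˡ a))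
      where
      lem₀ = ring 3 (λ x i a → x :* a :* i , (x :* i) :* a)
    lem₁′ = lin 6 (λ m l x t a f → t ≗ x :* l :- a ∷ con 0ℚ ≼ a ∷ x :* m ≼ t :+ f ∷ f ≼ # 16 :* x ∷ con 0ℚ ≼ x ∷ [] , x :* (m :- l) , x :* # 18) ((1ℚ , 0 ∷ []) ∷ (1ℚ , 1 ∷ []) ∷ (1ℚ , 2 ∷ []) ∷ (1ℚ , 3 ∷ []) ∷ (♯ 2 , 4 ∷ []) ∷ [])
    lem₂′ = lin 5 (λ m l x t a → t ≗ x :* l :- a ∷ a ≼ # 2 :* x ∷ t ≼ x :* m ∷ con 0ℚ ≼ x ∷ [] , x :* :- (m :- l) , x :* # 18) ((- 1ℚ , 0 ∷ []) ∷ (1ℚ , 1 ∷ []) ∷ (1ℚ , 2 ∷ []) ∷ (♯ 16 , 3 ∷ []) ∷ [])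
    lem₁ : ∀ m l x i t a f → t ≡ x * l - a → 0ℚ ≤ a → x * m ≤ t + f → f ≤ ♯ 16 * x → 0ℚ ≤ x → x * i ≡ 1ℚ → 0ℚ ≤ i → m - l ≤ ♯ 18
    lem₁ m l x i t a f et a0 p q x0 e i0 = subst₂ _≤_ (cancel x i (m - l) e) (cancel x i (♯ 18) e) (*-monoʳ-≤-nonNeg i {{nonNegative i0}} (lem₁′ m l x t a f et a0 p q x0))
    lem₂ : ∀ m l x i t a → t ≡ x * l - a → a ≤ ♯ 2 * x → t ≤ x * m → 0ℚ ≤ x → x * i ≡ 1ℚ → 0ℚ ≤ i → - (m - l) ≤ ♯ 18
    lem₂ m l x i t a et a0 p x0 e i0 = subst₂ _≤_ (cancel x i (- (m - l)) e) (cancel x i (♯ 18) e) (*-monoʳ-≤-nonNeg i {{nonNegative i0}} (lem₂′ m l x t a et a0 p x0))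

  -- Σ Λ(n) log (x/n), the difference between ψ(x) log x and Σ Λ(n) log n. It is only O(x).
  A : Arith
  A x = Sum x (λ n → Λ n * (ℓ x - ℓ n))

  A-suc : ∀ x → A (suc x) ≡ A x + s x * ψ x
  A-suc x = begin
    Sum x (λ n → Λ n * (ℓ (suc x) - ℓ n)) + Λ (suc x) * (ℓ (suc x) - ℓ (suc x))
      ≡⟨ cong₂ _+_ (Sum-cong x (λ n _ _ → lem (Λ n) (ℓ (suc x)) (ℓ x) (ℓ n))) (lem₂ (Λ (suc x)) (ℓ (suc x))) ⟩
    Sum x (λ n → Λ n * (ℓ x - ℓ n) + s x * Λ n) + 0ℚ
      ≡⟨ +-identityʳ (Sum x (λ n → Λ n * (ℓ x - ℓ n) + s x * Λ n)) ⟩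
    Sum x (λ n → Λ n * (ℓ x - ℓ n) + s x * Λ n)
      ≡⟨ trans (Sum-+ x _ _) (cong (λ z → A x + z) (Sum-*ˡ x (s x) Λ)) ⟩
    A x + s x * ψ x ∎
    where
    open ≡-Reasoning
    lem = ring 4 (λ m a b c → m :* (a :- c) , m :* (b :- c) :+ (a :- b) :* m)
    lem₂ = ring 2 (λ m a → m :* (a :- a) , con 0ℚ)

  A≥0 : ∀ x → x ℕ.≤ X → 0ℚ ≤ A x
  A≥0 x x≤X = Sum-≥0 x (λ n p q → Λ≥0 n p ⊗ ↑ (ℓ-mono p q (ℕₚ.m≤n⇒m≤1+n x≤X)))

  A≤ : ∀ x → x ℕ.≤ X → A x ≤ ♯ 32 * ι x
  A≤ zero _ = ♯≥0 32 ⊗ ι≥0 0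
  A≤ (suc zero) _ = ≤-trans (≤-reflexive (lem (Λ 1) (ℓ 1))) (♯≥0 32 ⊗ ι≥0 1)
    where
    lem = ring 2 (λ m a → con 0ℚ :+ m :* (a :- a) , con 0ℚ)
  A≤ (suc (suc y)) x<X = lem (A x) (A (suc x)) (s x) (ψ x) (ι x) (ι (suc x)) (inv x) (A≤ (suc y) x≤X) (A-suc x) (ι-suc x) (s≤2inv x 1≤x x≤X) (ψ≥0 x) (ψ≤ x x≤X) (ι*inv 1≤x) (inv≥0 x)
    where
    x = suc y
    1≤x = s≤s (z≤n {y})
    x≤X = ℕₚ.<⇒≤ x<X
    lem = lin 7 (λ a b s f x y i → a ≼ # 32 :* x ∷ b ≗ a :+ s :* f ∷ y ≗ x :+ con 1ℚ ∷ s ≼ # 2 :* i ∷ con 0ℚ ≼ f ∷ f ≼ # 16 :* x ∷ x :* i ≗ con 1ℚ ∷ con 0ℚ ≼ i ∷ [] , b , # 32 :* y) ((1ℚ , 0 ∷ []) ∷ (1ℚ , 1 ∷ []) ∷ (- (♯ 32) , 2 ∷ []) ∷ (♯ 32 , 6 ∷ []) ∷ (1ℚ , 3 ∷ 4 ∷ []) ∷ (♯ 2 , 5 ∷ 7 ∷ []) ∷ [])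

  -- The remainder R and its iterated bound

  R : Arith
  R x = ψ x - ι x

  R-bound : ∀ x → x ℕ.≤ X → ∣ R x ∣ ≤ ♯ 16 * ι x
  R-bound x x≤X = abs≤ (lem₁ (ψ x) (ι x) (ψ≤ x x≤X) (ι≥0 x)) (lem₂ (ψ x) (ι x) (ψ≥0 x) (ι≥0 x))
    where
    lem₁ = lin 2 (λ f x → f ≼ # 16 :* x ∷ con 0ℚ ≼ x ∷ [] , f :- x , # 16 :* x) ((1ℚ , 0 ∷ []) ∷ (1ℚ , 1 ∷ []) ∷ [])
    lem₂ = lin 2 (λ f x → con 0ℚ ≼ f ∷ con 0ℚ ≼ x ∷ [] , :- (f :- x) , # 16 :* x) ((1ℚ , 0 ∷ []) ∷ (♯ 15 , 1 ∷ []) ∷ [])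

  F-split : ∀ x → F x ≡ (ψ x * ℓ x - A x) + Sum x (λ n → Λ n * ψ (x // n))
  F-split x = begin
    Sum x Λ₂
      ≡⟨ trans (Sum-cong x (λ n _ _ → trans (Λ₂-def n) (cong₂ _+_ (lem (Λ n) (ℓ x) (ℓ n)) (sym (*-identityˡ ((Λ ⋆ Λ) n)))))) (Sum-+ x _ _) ⟩
    Sum x (λ n → Λ n * ℓ x - Λ n * (ℓ x - ℓ n)) + Sum x (λ n → 1ℚ * (Λ ⋆ Λ) n)
      ≡⟨ cong₂ _+_ (trans (Sum-- x _ _) (cong (_- A x) (Sum-*ʳ x (ℓ x) Λ))) (trans (Sum-⋆ x one Λ Λ) (trans (Hyp-cong x (λ d m _ _ _ → *-identityˡ (Λ d * Λ m))) (Hyp-*ˡ x Λ (λ _ → Λ)))) ⟩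
    (ψ x * ℓ x - A x) + Sum x (λ n → Λ n * ψ (x // n)) ∎
    where
    open ≡-Reasoning
    lem = ring 3 (λ m a b → b :* m , m :* a :- m :* (a :- b))

  -- Subtracting x log x and Σ Λ(n) ⌊x/n⌋ = T x from Selberg's formula cancels the main term 2 x log
  -- x.
  selberg-R : ∀ x → 1 ℕ.≤ x → x ℕ.≤ X → ∣ R x * ℓ x + Sum x (λ n → Λ n * R (x // n)) ∣ ≤ ♯ 70100 * ι x
  selberg-R x 1≤x x≤X = ≤-trans (subst (λ z → ∣ z ∣ ≤ ♯ 70000 * ι x + (♯ 32 * ι x + ♯ 2 * ι x)) (sym eq)
      (abs-+ (selberg 1≤x x≤X) (abs-+ (≤-trans (≤-reflexive (0≤p⇒∣p∣≡p (A≥0 x x≤X))) (A≤ x x≤X)) (≤-trans (≤-reflexive (0≤p⇒∣p∣≡p (S₁≥0 x x≤X′))) (S₁≤ x 1≤x x≤X′)))))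
      (fin (ι x) (ι≥0 x))
    where
    x≤X′ = ℕₚ.m≤n⇒m≤1+n x≤X
    fin = lin 1 (λ x → con 0ℚ ≼ x ∷ [] , # 70000 :* x :+ (# 32 :* x :+ # 2 :* x) , # 70100 :* x) ((♯ 66 , 0 ∷ []) ∷ [])
    lem₀ = ring 3 (λ m a b → m :* (a :- b) , m :* a :- m :* b)
    lem = ring 6 (λ f x l a q b → (f :- x) :* l :+ (q :- (x :* l :- b)) , ((f :* l :- a) :+ q :- # 2 :* (x :* l)) :+ (a :+ b))
    eq : R x * ℓ x + Sum x (λ n → Λ n * R (x // n)) ≡ (F x - ♯ 2 * (ι x * ℓ x)) + (A x + S₁ x)
    eq = trans (cong (λ z → R x * ℓ x + z) (trans (Sum-cong x (λ n _ _ → lem₀ (Λ n) (ψ (x // n)) (ι (x // n)))) (trans (Sum-- x _ _) (cong (λ z → Sum x (λ n → Λ n * ψ (x // n)) - z) (trans (T-Λ x) (T-S₁ x))))))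
      (trans (lem (ψ x) (ι x) (ℓ x) (A x) (Sum x (λ n → Λ n * ψ (x // n))) (S₁ x)) (cong (λ z → (z - ♯ 2 * (ι x * ℓ x)) + (A x + S₁ x)) (sym (F-split x))))

  abs-diff : ∀ {p q e} → ∣ p - q ∣ ≤ e → ∣ ∣ p ∣ - ∣ q ∣ ∣ ≤ e
  abs-diff {p} {q} {e} h = abs≤ (l₁ ∣ p ∣ ∣ q ∣ e (tri p q h)) (l₂ ∣ p ∣ ∣ q ∣ e (tri q p (subst (_≤ e) (trans (sym (∣-p∣≡∣p∣ (p - q))) (cong ∣_∣ (l₃ p q))) h)))
    where
    l₁ = lin 3 (λ u v e → u ≼ e :+ v ∷ [] , u :- v , e) ((1ℚ , 0 ∷ []) ∷ [])
    l₂ = lin 3 (λ u v e → v ≼ e :+ u ∷ [] , :- (u :- v) , e) ((1ℚ , 0 ∷ []) ∷ [])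
    l₃ = ring 2 (λ p q → :- (p :- q) , q :- p)
    l₄ = ring 2 (λ p q → (p :- q) :+ q , p)
    tri : ∀ p q → ∣ p - q ∣ ≤ e → ∣ p ∣ ≤ e + ∣ q ∣
    tri p q h = subst (λ z → ∣ z ∣ ≤ e + ∣ q ∣) (l₄ p q) (abs-+ h ≤-refl)

  R-diff : ∀ {a b} → b ℕ.≤ a → ∣ R a - R b ∣ ≤ (ψ a + ι a) - (ψ b + ι b)
  R-diff {a} {b} b≤a = abs≤ (l1 (ψ a) (ψ b) (ι a) (ι b) (ψ-mono b≤a) (ι-mono b≤a)) (l2 (ψ a) (ψ b) (ι a) (ι b) (ψ-mono b≤a) (ι-mono b≤a))
    where
    l1 = lin 4 (λ p q x y → q ≼ p ∷ y ≼ x ∷ [] , (p :- x) :- (q :- y) , (p :+ x) :- (q :+ y)) ((♯ 2 , 1 ∷ []) ∷ [])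
    l2 = lin 4 (λ p q x y → q ≼ p ∷ y ≼ x ∷ [] , :- ((p :- x) :- (q :- y)) , (p :+ x) :- (q :+ y)) ((♯ 2 , 0 ∷ []) ∷ [])

  module _ {x : ℕ} (1≤x : 1 ℕ.≤ x) (x≤X : x ℕ.≤ X) where
    private
      N : ℕ → ℕ
      N n = x // n
      g : Arith
      g n = ∣ R (x // n) ∣
      x≤X′ : x ℕ.≤ suc X
      x≤X′ = ℕₚ.m≤n⇒m≤1+n x≤X
      N≤X : ∀ n → N n ℕ.≤ X
      N≤X n = ℕₚ.≤-trans (//-≤ x n) x≤X
      E : ℕ → ℚ
      E n = R (N n) * ℓ (N n) + Sum (N n) (λ m → Λ m * R (N n // m))

    -- `selberg-R` is inserted into itself: log x is split into log n, log ⌊x/n⌋ and a rounding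
    -- error, and R(x/n) log (x/n) is eliminated by the formula at x/n. The two main sums have
    -- opposite signs, but their absolute values add up to a sum against Λ₂ (`g-sum`).
    R-iterated : R x * (ℓ x * ℓ x) ≡
      ((Sum x (λ n → Λ n * Sum (N n) (λ m → Λ m * R (N n // m))) - Sum x (λ n → Λ n * ℓ n * R (N n)))
        - (Sum x (λ n → Λ n * E n) + Sum x (λ n → Λ n * (R (N n) * ((ℓ x - ℓ n) - ℓ (N n))))))
      + (R x * ℓ x + Sum x (λ n → Λ n * R (N n))) * ℓ x
    R-iterated = trans (lem₀ (R x) (ℓ x) (Sum x (λ n → Λ n * R (N n)))) (cong (λ z → z + (R x * ℓ x + Sum x (λ n → Λ n * R (N n))) * ℓ x)
        (trans (cong -_ (trans (sym (Sum-*ʳ x (ℓ x) _)) (trans (Sum-cong x (λ n _ _ → lem (Λ n) (R (N n)) (ℓ x) (ℓ n) (ℓ (N n)) (Sum (N n) (λ m → Λ m * R (N n // m)))))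
          (trans (Sum-- x _ _) (cong₂ _-_ (trans (Sum-+ x _ _) (cong (λ z → Sum x (λ n → Λ n * ℓ n * R (N n)) + z) (Sum-+ x _ _))) refl)))))
          (lem₁ (Sum x (λ n → Λ n * ℓ n * R (N n))) (Sum x (λ n → Λ n * E n)) (Sum x (λ n → Λ n * (R (N n) * ((ℓ x - ℓ n) - ℓ (N n))))) (Sum x (λ n → Λ n * Sum (N n) (λ m → Λ m * R (N n // m)))))))
      where
      lem₀ = ring 3 (λ r l q → r :* (l :* l) , :- (q :* l) :+ (r :* l :+ q) :* l)
      lem = ring 6 (λ m r lx ln lN q → m :* r :* lx , m :* ln :* r :+ (m :* (r :* lN :+ q) :+ m :* (r :* ((lx :- ln) :- lN))) :- m :* q)
      lem₁ = ring 4 (λ a b c d → :- (a :+ (b :+ c) :- d) , (d :- a) :- (b :+ c))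

    error₁ : ∣ Sum x (λ n → Λ n * E n) ∣ ≤ ♯ 70100 * (ι x * ℓ x)
    error₁ = ≤-trans (Sum-abs x (λ n p q → abs-* (≤-reflexive (0≤p⇒∣p∣≡p (Λ≥0 n p))) (selberg-R (N n) (1≤// p q) (N≤X n))))
      (≤-trans (≤-reflexive (trans (Sum-cong x (λ n _ _ → *-left-comm (Λ n) (♯ 70100) (ι (N n)))) (trans (Sum-*ˡ x (♯ 70100) _) (cong (♯ 70100 *_) (trans (T-Λ x) (T-S₁ x))))))
        (lem (ι x * ℓ x) (S₁ x) (S₁≥0 x x≤X′)))
      where
      lem = lin 2 (λ a b → con 0ℚ ≼ b ∷ [] , # 70100 :* (a :- b) , # 70100 :* a) ((♯ 70100 , 0 ∷ []) ∷ [])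

    error₂ : ∣ Sum x (λ n → Λ n * (R (N n) * ((ℓ x - ℓ n) - ℓ (N n)))) ∣ ≤ ♯ 512 * ι x
    error₂ = ≤-trans (Sum-abs x (λ n p q → abs-* (≤-reflexive (0≤p⇒∣p∣≡p (Λ≥0 n p))) (term n p q))) (≤-trans (≤-reflexive (Sum-*ʳ x (♯ 32) Λ)) (lem (ψ x) (ι x) (ψ≤ x x≤X)))
      where
      lem = lin 2 (λ f x → f ≼ # 16 :* x ∷ [] , f :* # 32 , # 512 :* x) ((♯ 32 , 0 ∷ []) ∷ [])
      l₂ = lin 3 (λ t l i → l ≼ t ∷ con 0ℚ ≼ i ∷ [] , :- (t :- l) , # 2 :* i) ((1ℚ , 0 ∷ []) ∷ (♯ 2 , 1 ∷ []) ∷ [])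
      l₃ = ring 2 (λ n i → # 16 :* n :* (# 2 :* i) , # 32 :* (n :* i))
      term : ∀ n → 1 ℕ.≤ n → n ℕ.≤ x → ∣ R (N n) * ((ℓ x - ℓ n) - ℓ (N n)) ∣ ≤ ♯ 32
      term n p q = subst (∣ R (N n) * ((ℓ x - ℓ n) - ℓ (N n)) ∣ ≤_) (trans (l₃ (ι (N n)) (inv (N n))) (trans (cong (♯ 32 *_) (ι*inv (1≤// p q))) (*-identityʳ (♯ 32))))
        (abs-* (R-bound (N n) (N≤X n)) (abs≤ (Term.t≤l p q x≤X) (l₂ (ℓ x - ℓ n) (ℓ (N n)) (inv (N n)) (Term.l≤t p q x≤X) (inv≥0 (N n)))))

    g-sum : Sum x (λ n → Λ₂ n * g n) ≡ Sum x (λ n → Λ n * Sum (N n) (λ m → Λ m * ∣ R (N n // m) ∣)) + Sum x (λ n → Λ n * ℓ n * g n)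
    g-sum = begin
      Sum x (λ n → Λ₂ n * g n)
        ≡⟨ trans (Sum-cong x (λ n _ _ → trans (cong (_* g n) (Λ₂-def n)) (lem (ℓ n) (Λ n) ((Λ ⋆ Λ) n) (g n)))) (Sum-+ x _ _) ⟩
      Sum x (λ n → g n * (Λ ⋆ Λ) n) + Sum x (λ n → Λ n * ℓ n * g n)
        ≡⟨ cong (_+ Sum x (λ n → Λ n * ℓ n * g n)) (trans (Sum-⋆ x g Λ Λ) (trans (Hyp-cong x (λ d m p q _ →
             trans (lem₂ (g (d ℕ.* m)) (Λ d) (Λ m)) (cong (λ k → Λ d * (Λ m * ∣ R k ∣)) (sym (//-assoc x p q))))) (Hyp-*ˡ x Λ (λ d m → Λ m * ∣ R (N d // m) ∣)))) ⟩
      Sum x (λ n → Λ n * Sum (N n) (λ m → Λ m * ∣ R (N n // m) ∣)) + Sum x (λ n → Λ n * ℓ n * g n) ∎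
      where
      open ≡-Reasoning
      lem = ring 4 (λ l m c g → (l :* m :+ c) :* g , g :* c :+ m :* l :* g)
      lem₂ = ring 3 (λ g a b → g :* (a :* b) , a :* (b :* g))

    R-Λ₂ : ∣ R x ∣ * (ℓ x * ℓ x) ≤ Sum x (λ n → Λ₂ n * g n) + ♯ 140200 * (ι x * (1ℚ + ℓ x))
    R-Λ₂ = subst₂ _≤_ (trans (∣p*q∣≡∣p∣*∣q∣ (R x) (ℓ x * ℓ x)) (cong (∣ R x ∣ *_) (0≤p⇒∣p∣≡p (ℓ≥0 x ⊗ ℓ≥0 x)))) refl
      (≤-trans (subst (λ z → ∣ z ∣ ≤ ((DD + LL) + (♯ 70100 * (ι x * ℓ x) + ♯ 512 * ι x)) + ♯ 70100 * ι x * ℓ x) (sym R-iterated)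
        (abs-+ (abs-- (abs-- dd ll) (abs-+ error₁ error₂)) (abs-* (selberg-R x 1≤x x≤X) (≤-reflexive (0≤p⇒∣p∣≡p (ℓ≥0 x))))))
        (fin DD LL (ι x) (ℓ x) (Sum x (λ n → Λ₂ n * g n)) g-sum (ι≥0 x)))
      where
      DD = Sum x (λ n → Λ n * Sum (N n) (λ m → Λ m * ∣ R (N n // m) ∣))
      LL = Sum x (λ n → Λ n * ℓ n * g n)
      dd : ∣ Sum x (λ n → Λ n * Sum (N n) (λ m → Λ m * R (N n // m))) ∣ ≤ DD
      dd = Sum-abs x (λ n p _ → abs-* (≤-reflexive (0≤p⇒∣p∣≡p (Λ≥0 n p))) (Sum-abs (N n) (λ m q _ → abs-* (≤-reflexive (0≤p⇒∣p∣≡p (Λ≥0 m q))) ≤-refl)))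
      ll : ∣ Sum x (λ n → Λ n * ℓ n * R (N n)) ∣ ≤ LL
      ll = Sum-abs x (λ n p _ → abs-* (≤-reflexive (0≤p⇒∣p∣≡p (Λ≥0 n p ⊗ ℓ≥0 n))) ≤-refl)
      fin = lin 5 (λ d l x y s → s ≗ d :+ l ∷ con 0ℚ ≼ x ∷ [] , ((d :+ l) :+ (# 70100 :* (x :* y) :+ # 512 :* x)) :+ # 70100 :* x :* y , s :+ # 140200 :* (x :* (con 1ℚ :+ y))) ((- 1ℚ , 0 ∷ []) ∷ (♯ 139688 , 1 ∷ []) ∷ [])

    -- By `selberg` the partial sums of Λ₂ - 2 ℓ are O(n), and |R(x/n)| varies no faster than ψ(x/n)
    -- + ⌊x/n⌋, which is monotone in n and has sum O(x log x). So `abel` exchanges Λ₂ for the smooth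
    -- weight 2 ℓ.
    transfer : ∣ Sum x (λ n → (Λ₂ n - ♯ 2 * ℓ n) * g n) ∣ ≤ ♯ 70004 * (♯ 153 * (ι x * (1ℚ + ℓ x)))
    transfer = ≤-trans (abel (♯ 70004) (λ n → Λ₂ n - ♯ 2 * ℓ n) g k x 1≤x (nonNegative⁻¹ (♯ 70004)) partial steps last)
        (lem (Sum x k) (ι x * (1ℚ + ℓ x)) k-sum)
      where
      k : Arith
      k n = ψ (N n) + ι (N n)
      lem = lin 2 (λ a b → a ≼ # 153 :* b ∷ [] , # 70004 :* a , # 70004 :* (# 153 :* b)) ((♯ 70004 , 0 ∷ []) ∷ [])
      l₁ = lin 5 (λ f t n l s → f :- # 2 :* (n :* l) ≼ # 70000 :* n ∷ t ≗ n :* l :- s ∷ s ≼ # 2 :* n ∷ [] , f :- # 2 :* t , # 70004 :* n) ((1ℚ , 0 ∷ []) ∷ (- (♯ 2) , 1 ∷ []) ∷ (♯ 2 , 2 ∷ []) ∷ [])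
      l₂ = lin 5 (λ f t n l s → :- (f :- # 2 :* (n :* l)) ≼ # 70000 :* n ∷ t ≗ n :* l :- s ∷ con 0ℚ ≼ s ∷ con 0ℚ ≼ n ∷ [] , :- (f :- # 2 :* t) , # 70004 :* n) ((1ℚ , 0 ∷ []) ∷ (♯ 2 , 1 ∷ []) ∷ (♯ 2 , 2 ∷ []) ∷ (♯ 4 , 3 ∷ []) ∷ [])
      partial : ∀ n → 1 ℕ.≤ n → n ℕ.≤ x → ∣ Sum n (λ n → Λ₂ n - ♯ 2 * ℓ n) ∣ ≤ ♯ 70004 * ι n
      partial n p q = subst (λ z → ∣ z ∣ ≤ ♯ 70004 * ι n) (sym (trans (Sum-- n _ _) (cong (λ z → F n - z) (Sum-*ˡ n (♯ 2) ℓ))))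
        (abs≤ (l₁ (F n) (T n) (ι n) (ℓ n) (S₁ n) (abs-hi (selberg p (ℕₚ.≤-trans q x≤X))) (T-S₁ n) (S₁≤ n p n≤))
              (l₂ (F n) (T n) (ι n) (ℓ n) (S₁ n) (abs-lo (selberg p (ℕₚ.≤-trans q x≤X))) (T-S₁ n) (S₁≥0 n n≤) (ι≥0 n)))
        where n≤ = ℕₚ.m≤n⇒m≤1+n (ℕₚ.≤-trans q x≤X)
      steps : ∀ n → 1 ℕ.≤ n → n ℕ.< x → ∣ g n - g (suc n) ∣ ≤ k n - k (suc n)
      steps n p _ = abs-diff {R (N n)} {R (N (suc n))} (R-diff (//-anti x p (ℕₚ.n≤1+n n)))
      last : ∣ g x ∣ ≤ k x
      last = subst (_≤ k x) (sym (∣∣p∣∣≡∣p∣ (R (N x)))) (≤-trans (∣p-q∣≤∣p∣+∣q∣ (ψ (N x)) (ι (N x))) (≤-reflexive (cong₂ _+_ (0≤p⇒∣p∣≡p (ψ≥0 (N x))) (0≤p⇒∣p∣≡p (ι≥0 (N x))))))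
      l₃ = lin 3 (λ f n v → f ≼ # 16 :* n ∷ n ≼ v ∷ [] , f :+ n , # 17 :* v) ((1ℚ , 0 ∷ []) ∷ (♯ 17 , 1 ∷ []) ∷ [])
      l₄ = lin 3 (λ x h l → h ≼ l :+ # 9 ∷ con 0ℚ ≼ x ∷ con 0ℚ ≼ l ∷ [] , # 17 :* (x :* h) , # 153 :* (x :* (con 1ℚ :+ l))) ((♯ 17 , 0 ∷ 1 ∷ []) ∷ (♯ 136 , 1 ∷ 2 ∷ []) ∷ [])
      k-sum : Sum x k ≤ ♯ 153 * (ι x * (1ℚ + ℓ x))
      k-sum = ≤-trans (Sum-mono x (λ n p _ → l₃ (ψ (N n)) (ι (N n)) (ι x * inv n) (ψ≤ (N n) (N≤X n)) (ι//≤ {x} p)))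
        (≤-trans (≤-reflexive (trans (Sum-*ˡ x (♯ 17) _) (cong (♯ 17 *_) (Sum-*ˡ x (ι x) inv)))) (l₄ (ι x) (H x) (ℓ x) (H≤ℓ x 1≤x x≤X) (ι≥0 x) (ℓ≥0 x)))

    selberg-inequality : ∣ R x ∣ * (ℓ x * ℓ x) ≤ ♯ 2 * Sum x (λ n → ℓ n * ∣ R (x // n) ∣) + ♯ 11000000 * (ι x * (1ℚ + ℓ x))
    selberg-inequality = fin (∣ R x ∣ * (ℓ x * ℓ x)) (Sum x (λ n → Λ₂ n * g n)) (Sum x (λ n → ℓ n * g n)) (ι x * (1ℚ + ℓ x)) R-Λ₂
        (subst (_≤ ♯ 70004 * (♯ 153 * (ι x * (1ℚ + ℓ x)))) (trans (Sum-cong x (λ n _ _ → lem (Λ₂ n) (ℓ n) (g n))) (trans (Sum-- x _ _) (cong (λ z → Sum x (λ n → Λ₂ n * g n) - z) (Sum-*ˡ x (♯ 2) _)))) (abs-hi transfer))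
        (ι≥0 x ⊗ (0≤1 ⊕ ℓ≥0 x))
      where
      lem = ring 3 (λ a b c → (a :- # 2 :* b) :* c , a :* c :- # 2 :* (b :* c))
      fin = lin 4 (λ r a b y → r ≼ a :+ # 140200 :* y ∷ a :- # 2 :* b ≼ # 70004 :* (# 153 :* y) ∷ con 0ℚ ≼ y ∷ [] , r , # 2 :* b :+ # 11000000 :* y) ((1ℚ , 0 ∷ []) ∷ (1ℚ , 1 ∷ []) ∷ (♯ 149188 , 2 ∷ []) ∷ [])

  -- Sizes of logarithms, short intervals and cancellation against Λ₂

  ℓ2≤2 : ℓ 2 ≤ ♯ 2
  ℓ2≤2 = lem (ℓ 2) (ℓ 1) (inv 1) (s≤2inv 1 ℕₚ.≤-refl 1≤X) ℓ1≡0 inv1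
    where
    lem = lin 3 (λ a b i → a :- b ≼ # 2 :* i ∷ b ≗ con 0ℚ ∷ i ≗ con 1ℚ ∷ [] , a , # 2) ((1ℚ , 0 ∷ []) ∷ (1ℚ , 1 ∷ []) ∷ (♯ 2 , 2 ∷ []) ∷ [])

  ℓ-2^ : ∀ e → ℓ (2 ℕ.^ e) ≡ ι e * ℓ 2
  ℓ-2^ zero    = trans ℓ1≡0 (sym (trans (cong (_* ℓ 2) (ι≡♯ 0)) (*-zeroˡ (ℓ 2))))
  ℓ-2^ (suc e) = trans (ℓ-* 2 (2 ℕ.^ e) (s≤s z≤n) (1≤2^ e)) (trans (cong (λ z → ℓ 2 + z) (ℓ-2^ e)) (trans (lem (ι e) (ℓ 2)) (cong (_* ℓ 2) (sym (ι-suc e)))))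
    where
    lem = ring 2 (λ a b → b :+ a :* b , (a :+ con 1ℚ) :* b)

  ℓ-large : ∀ c {x} → 2 ℕ.^ (2 ℕ.* c) ℕ.≤ x → x ℕ.≤ suc X → ι c ≤ ℓ x
  ℓ-large c {x} p q = ≤-trans (lem (ι c) (ι (2 ℕ.* c)) (ℓ 2) (ℓ (2 ℕ.^ (2 ℕ.* c))) (trans (ι-* 2 c) (cong (_* ι c) (ι≡♯ 2))) ℓ2≥½ (ι≥0 c) (ℓ-2^ (2 ℕ.* c))) (ℓ-mono (1≤2^ (2 ℕ.* c)) p q)
    where
    lem = lin 4 (λ c d l m → d ≗ # 2 :* c ∷ con ½ ≼ l ∷ con 0ℚ ≼ c ∷ m ≗ d :* l ∷ [] , c , m) ((- 1ℚ , 3 ∷ []) ∷ (- 1ℚ , 0 ∷ 1 ∷ []) ∷ (- ½ , 0 ∷ []) ∷ (♯ 2 , 1 ∷ 2 ∷ []) ∷ [])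

  -- Beyond 16 q the logarithm has slope at most 2/(16 q), half of what is allowed; 256 q² absorbs
  -- its value at 16 q.
  ℓ-sublinear : ∀ q v → 1 ℕ.≤ q → 256 ℕ.* (q ℕ.* q) ℕ.+ 1 ℕ.≤ v → v ℕ.≤ X → ♯ 4 * (ι q * ℓ (suc v)) ≤ ι v
  ℓ-sublinear q v 1≤q big v≤X = lem (ι q) (ι v) (ι (suc v)) (ℓ c) (ℓ (suc v)) (ι c) (inv c) (ℓ-Lipschitz 1≤c c≤v (s≤s v≤X)) (ℓ≤2ι c 1≤c (ℕₚ.≤-trans c≤v (s≤s v≤X))) (ι-suc v)
      (trans (ι-* 16 q) (cong (_* ι q) (ι≡♯ 16))) (ι*inv 1≤c) (ι≥1 1≤q)
      (subst (_≤ ι v) (trans (ι-+ (256 ℕ.* (q ℕ.* q)) 1) (cong₂ _+_ (trans (ι-* 256 (q ℕ.* q)) (cong₂ _*_ (ι≡♯ 256) (ι-* q q))) (ι≡♯ 1))) (ι-mono big))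
    where
    c = 16 ℕ.* q
    1≤c : 1 ℕ.≤ c
    1≤c = ℕₚ.≤-trans 1≤q (m≤d*m {16} q (s≤s z≤n))
    c≤v : c ℕ.≤ suc v
    c≤v = ℕₚ.m≤n⇒m≤1+n (ℕₚ.≤-trans (ℕₚ.*-monoˡ-≤ q {16} {256} (from-yes (16 ℕ.≤? 256))) (ℕₚ.≤-trans (ℕₚ.*-monoʳ-≤ 256 (d≤d*m q 1≤q)) (ℕₚ.≤-trans (ℕₚ.m≤m+n (256 ℕ.* (q ℕ.* q)) 1) big)))
    lem : ∀ q v w lc l c i → l - lc ≤ ♯ 2 * ((w - c) * i) → lc ≤ ♯ 2 * c → w ≡ v + 1ℚ → c ≡ ♯ 16 * q → c * i ≡ 1ℚ → 1ℚ ≤ q → ♯ 256 * (q * q) + 1ℚ ≤ v → ♯ 4 * (q * l) ≤ v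
    lem q v _ lc l _ i p r refl refl e q1 b = lem′ q v lc l i p r e q1 b
      where
      lem′ = lin 5 (λ q v lc l i → l :- lc ≼ # 2 :* ((v :+ con 1ℚ :- # 16 :* q) :* i) ∷ lc ≼ # 2 :* (# 16 :* q) ∷ # 16 :* q :* i ≗ con 1ℚ ∷ con 1ℚ ≼ q ∷ # 256 :* (q :* q) :+ con 1ℚ ≼ v ∷ [] , # 4 :* (q :* l) , v) ((♯ 8 , []) ∷ (♯ 4 , 0 ∷ 3 ∷ []) ∷ (♯ 4 , 0 ∷ []) ∷ (♯ 4 , 1 ∷ 3 ∷ []) ∷ (♯ 4 , 1 ∷ []) ∷ (♯ 121 , 2 ∷ []) ∷ (♯ 248 , 2 ∷ 3 ∷ []) ∷ (½ , 2 ∷ 4 ∷ []) ∷ (½ , 4 ∷ []) ∷ (♯ 8 , 3 ∷ []) ∷ (♯ 128 , 2 ∷ 3 ∷ 3 ∷ []) ∷ [])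

  ℓ-inv-sum : ∀ x → 1 ℕ.≤ x → x ℕ.≤ X → ♯ 2 * Sum x (λ n → ℓ n * inv n) ≤ ℓ x * ℓ x + ♯ 130 * (1ℚ + ℓ x)
  ℓ-inv-sum x 1≤x x≤X = lem (Sum x (λ n → ℓ n * inv n)) (ℓ x) (H x) (K x) c₁ (inv x) eq (abs-lo (K-near x 1≤x x≤X)) (abs-hi (K-near x 1≤x x≤X)) c₁-lo (inv≤1 1≤x) (H≥0 x) (H≤ℓ x 1≤x x≤X) (sq (H x - ℓ x)) (ℓ≥0 x)
    where
    l₀ = ring 3 (λ a b i → a :* i , b :* i :- (b :- a) :* i)
    eq : Sum x (λ n → ℓ n * inv n) ≡ ℓ x * H x - K x
    eq = trans (Sum-cong x (λ n _ _ → l₀ (ℓ n) (ℓ x) (inv n))) (trans (Sum-- x _ _) (cong (_- K x) (Sum-*ˡ x (ℓ x) inv)))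
    lem = lin 6 (λ u l h k c i → u ≗ l :* h :- k ∷ :- (c :- (k :- con ½ :* (h :* h))) ≼ (# 12 :+ # 4 :* h) :* i ∷ c :- (k :- con ½ :* (h :* h)) ≼ (# 12 :+ # 4 :* h) :* i ∷ :- c ≼ # 17 ∷ i ≼ con 1ℚ ∷ con 0ℚ ≼ h ∷ h ≼ l :+ # 9 ∷ con 0ℚ ≼ (h :- l) :* (h :- l) ∷ con 0ℚ ≼ l ∷ [] , # 2 :* u , l :* l :+ # 130 :* (con 1ℚ :+ l)) ((♯ 2 , 0 ∷ []) ∷ (♯ 2 , 2 ∷ []) ∷ (♯ 2 , 3 ∷ []) ∷ (♯ 24 , 4 ∷ []) ∷ (♯ 8 , 6 ∷ []) ∷ (1ℚ , 7 ∷ []) ∷ (♯ 122 , 8 ∷ []) ∷ (♯ 8 , 4 ∷ 5 ∷ []) ∷ [])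

  -- A bound of Brun-Titchmarsh type out of Selberg's formula: Λ log ≤ Λ₂, and F n - F m has main
  -- term 2 (n - m) log m.
  ψ-local : ∀ {m n} → 1 ℕ.≤ m → m ℕ.≤ n → n ℕ.≤ 2 ℕ.* m → n ℕ.≤ X → ℓ m * (ψ n - ψ m) ≤ ♯ 2 * (ℓ m * (ι n - ι m)) + ♯ 140004 * ι n
  ψ-local {m} {n} 1≤m m≤n n≤2m n≤X = ≤-trans step (lem (F m) (F n) (ι m) (ι n) (ℓ m) (ℓ n) (inv m) (abs-lo (selberg 1≤m m≤X)) (abs-hi (selberg 1≤n n≤X)) (ℓ-Lipschitz 1≤m m≤n (ℕₚ.m≤n⇒m≤1+n n≤X))
      (subst (ι n ≤_) (trans (ι-* 2 m) (cong (_* ι m) (ι≡♯ 2))) (ι-mono n≤2m)) (ι-mono m≤n) (ι*inv 1≤m) (inv≥0 m) (ι≥0 n))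
    where
    m≤X = ℕₚ.≤-trans m≤n n≤X
    1≤n = ℕₚ.≤-trans 1≤m m≤n
    step : ℓ m * (ψ n - ψ m) ≤ F n - F m
    step = subst (_≤ F n - F m) (trans (cong₂ _-_ (Sum-*ˡ n (ℓ m) Λ) (Sum-*ˡ m (ℓ m) Λ)) (l₀ (ℓ m) (ψ n) (ψ m)))
      (Sum-range-mono m≤n (λ k p q → ≤-trans (*-monoʳ-≤-nonNeg (Λ k) {{nonNegative (Λ≥0 k (ℕₚ.≤-trans (s≤s z≤n) p))}} (ℓ-mono 1≤m (ℕₚ.<⇒≤ p) (ℕₚ.m≤n⇒m≤1+n (ℕₚ.≤-trans q n≤X)))) (ℓΛ≤Λ₂ k)))
      where
      l₀ = ring 3 (λ a b c → a :* b :- a :* c , a :* (b :- c))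
    lem = lin 7 (λ f g m n a b i → :- (f :- # 2 :* (m :* a)) ≼ # 70000 :* m ∷ g :- # 2 :* (n :* b) ≼ # 70000 :* n ∷ b :- a ≼ # 2 :* ((n :- m) :* i) ∷ n ≼ # 2 :* m ∷ m ≼ n ∷ m :* i ≗ con 1ℚ ∷ con 0ℚ ≼ i ∷ con 0ℚ ≼ n ∷ [] , g :- f , # 2 :* (a :* (n :- m)) :+ # 140004 :* n) ((1ℚ , 0 ∷ []) ∷ (1ℚ , 1 ∷ []) ∷ (♯ 2 , 2 ∷ 7 ∷ []) ∷ (♯ 4 , 3 ∷ 6 ∷ 7 ∷ []) ∷ (♯ 4 , 5 ∷ 7 ∷ []) ∷ (♯ 70000 , 4 ∷ []) ∷ [])

  -- Partial summation turns this sum into a difference that Mertens' estimate bounds (`D-eq`,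
  -- `D-bound`). Being bounded, it prevents R from keeping one sign and a size of at least n/(4q)
  -- over a long range.
  D : Arith
  D N = Sum N (λ n → R n * (inv n * inv (suc n)))

  D-eq : ∀ N → D N ≡ M N - ψ N * inv (suc N) - (H (suc N) - 1ℚ)
  D-eq zero = sym (trans (cong (λ z → 0ℚ - 0ℚ * inv 1 - (z - 1ℚ)) H1) (lem (inv 1)))
    where
    lem = ring 1 (λ i → con 0ℚ :- con 0ℚ :* i :- (con 1ℚ :- con 1ℚ) , con 0ℚ)
  D-eq (suc N) = trans (cong (_+ R (suc N) * (inv (suc N) * inv (suc (suc N)))) (D-eq N))
      (lem (M N) (ψ N) (Λ (suc N)) (H (suc N)) (inv (suc N)) (inv (suc (suc N))) (ι (suc N)) (ι*inv (s≤s z≤n)) (inv-suc (s≤s z≤n)))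
    where
    lem₁ = ring 7 (λ m f l h j k n → m :- f :* j :- (h :- con 1ℚ) :+ (f :+ l :- n) :* (j :* k) , m :- f :* j :- (h :- con 1ℚ) :+ (f :+ l) :* (j :* k) :- (n :* j) :* k)
    lem₂ = ring 6 (λ m f l h j k → m :- f :* j :- (h :- con 1ℚ) :+ (f :+ l) :* (j :- k) :- con 1ℚ :* k , m :+ l :* j :- (f :+ l) :* k :- (h :+ k :- con 1ℚ))
    lem : ∀ m f l h j k n → n * j ≡ 1ℚ → j - k ≡ j * k → m - f * j - (h - 1ℚ) + (f + l - n) * (j * k) ≡ m + l * j - (f + l) * k - (h + k - 1ℚ)
    lem m f l h j k n e₁ e₂ = trans (lem₁ m f l h j k n) (trans (cong₂ (λ a b → m - f * j - (h - 1ℚ) + (f + l) * a - b * k) (sym e₂) e₁) (lem₂ m f l h j k))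

  D-bound : ∀ N → 1 ℕ.≤ N → N ℕ.≤ X → ∣ D N ∣ ≤ ♯ 44
  D-bound N p q = subst (λ z → ∣ z ∣ ≤ ♯ 44) (sym (D-eq N)) (abs≤
      (lem₁ (M N) (ℓ N) (H N) (inv N) (inv (suc N)) (ψ N) (ι N) γ (abs-hi (mertens N p q)) (abs-hi (H-ℓ N p q)) γ-lo (inv≤1 p) (inv≥0 (suc N)) (ψ≥0 N))
      (lem₂ (M N) (ℓ N) (H N) (inv N) (inv (suc N)) (ψ N) (ι N) γ (abs-lo (mertens N p q)) (abs-lo (H-ℓ N p q)) γ-hi (inv≤1 p) (inv≥0 (suc N)) (inv-mono p (ℕₚ.n≤1+n N)) (ψ≤ N q) (ι*inv p) (ι≥0 N)))
    where
    lem₁ = lin 8 (λ m l h i j f n g → m :- l ≼ # 18 ∷ g :- (h :- l) ≼ # 4 :* i ∷ :- g ≼ # 3 ∷ i ≼ con 1ℚ ∷ con 0ℚ ≼ j ∷ con 0ℚ ≼ f ∷ [] , m :- f :* j :- (h :+ j :- con 1ℚ) , # 44) ((♯ 18 , []) ∷ (1ℚ , 0 ∷ []) ∷ (1ℚ , 1 ∷ []) ∷ (1ℚ , 2 ∷ []) ∷ (♯ 4 , 3 ∷ []) ∷ (1ℚ , 4 ∷ []) ∷ (1ℚ , 4 ∷ 5 ∷ []) ∷ [])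
    lem₂ = lin 8 (λ m l h i j f n g → :- (m :- l) ≼ # 18 ∷ :- (g :- (h :- l)) ≼ # 4 :* i ∷ g ≼ # 5 ∷ i ≼ con 1ℚ ∷ con 0ℚ ≼ j ∷ j ≼ i ∷ f ≼ # 16 :* n ∷ n :* i ≗ con 1ℚ ∷ con 0ℚ ≼ n ∷ [] , :- (m :- f :* j :- (h :+ j :- con 1ℚ)) , # 44) ((1ℚ , []) ∷ (1ℚ , 0 ∷ []) ∷ (1ℚ , 1 ∷ []) ∷ (1ℚ , 2 ∷ []) ∷ (♯ 5 , 3 ∷ []) ∷ (1ℚ , 5 ∷ []) ∷ (♯ 16 , 7 ∷ []) ∷ (1ℚ , 4 ∷ 6 ∷ []) ∷ (♯ 16 , 5 ∷ 8 ∷ []) ∷ [])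

  -- Expand Λ₂ = μ ⋆ ℓ². For each d the sum of w (d m) against the increasing log² m is at most 2 b
  -- log² (x/d), and `S₂≤` sums this to O(b x). No logarithm is lost, so the result is of lower
  -- order than F x.
  Λ₂-cancel : ∀ (w : Arith) b → (∀ d v → 1 ℕ.≤ d → ∣ Sum v (λ m → w (d ℕ.* m)) ∣ ≤ b) → ∀ x → 1 ℕ.≤ x → x ℕ.≤ X →
    ∣ Sum x (λ n → w n * Λ₂ n) ∣ ≤ ♯ 24 * b * ι x
  Λ₂-cancel w b hw x 1≤x x≤X = subst (λ z → ∣ z ∣ ≤ ♯ 24 * b * ι x) (sym (trans (Sum-Λ₂ x w) (Hyp-*ˡ x μ (λ d m → w (d ℕ.* m) * ℓ² m))))
      (≤-trans (μ-weighted x term) (≤-trans (≤-reflexive (Sum-*ˡ x (♯ 2 * b) _)) (lem b (S₂ x) (ι x) b≥0 (S₂≤ x 1≤x (ℕₚ.m≤n⇒m≤1+n x≤X)))))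
    where
    b≥0 : 0ℚ ≤ b
    b≥0 = hw 1 0 ℕₚ.≤-refl
    lem = lin 3 (λ b s x → con 0ℚ ≼ b ∷ s ≼ # 12 :* x ∷ [] , # 2 :* b :* s , # 24 :* b :* x) ((♯ 2 , 0 ∷ 1 ∷ []) ∷ [])
    sq-mono = lin 2 (λ a c → con 0ℚ ≼ a ∷ a ≼ c ∷ [] , a :* a , c :* c) ((♯ 2 , 0 ∷ 1 ∷ []) ∷ (1ℚ , 1 ∷ 1 ∷ []) ∷ [])
    lem₂ = lin 3 (λ b s t → con 0ℚ ≼ b ∷ s ≼ t ∷ [] , # 2 :* b :* s , # 2 :* b :* t) ((♯ 2 , 0 ∷ 1 ∷ []) ∷ [])
    term : ∀ d → 1 ℕ.≤ d → d ℕ.≤ x → ∣ Sum (x // d) (λ m → w (d ℕ.* m) * ℓ² m) ∣ ≤ ♯ 2 * b * ((ℓ x - ℓ d) * (ℓ x - ℓ d))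
    term d p r = ≤-trans (monotone-weight (x // d) (λ m → w (d ℕ.* m)) ℓ² b (1≤// p r) (λ v → hw d v p) (λ n → ℓ≥0 n ⊗ ℓ≥0 n)
        (λ n q s → sq-mono (ℓ n) (ℓ (suc n)) (ℓ≥0 n) (step≥0 n q (ℕₚ.≤-trans (ℕₚ.<⇒≤ s) N≤X))))
        (lem₂ b (ℓ² (x // d)) ((ℓ x - ℓ d) * (ℓ x - ℓ d)) b≥0 (sq-mono (ℓ (x // d)) (ℓ x - ℓ d) (ℓ≥0 (x // d)) (Term.l≤t p r x≤X)))
      where N≤X = ℕₚ.≤-trans (//-≤ x d) x≤X

  -- Prime powers

  Λ-support : ∀ n → 1 ℕ.≤ n → Λ n ≡ 0ℚ ⊎ (∃[ p ] ∃[ k ] (Prime p × n ≡ p ℕ.^ suc k))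
  Λ-support = prime-rec _ (inj₁ Λ-1) step
    where
    step : ∀ r m → Prime r → 1 ℕ.≤ m → Λ m ≡ 0ℚ ⊎ (∃[ p ] ∃[ k ] (Prime p × m ≡ p ℕ.^ suc k)) → Λ (r ℕ.* m) ≡ 0ℚ ⊎ (∃[ p ] ∃[ k ] (Prime p × r ℕ.* m ≡ p ℕ.^ suc k))
    step r m pr 1≤m ih with 1 ℕ.≟ m | r ∣? m | ih
    ... | yes refl | _ | _ = inj₂ (r , 0 , pr , refl)
    ... | no 1≢m | no r∤m | _ = inj₁ (trans (Λ-prime-* pr 1≤m) (trans (cong₂ (λ a b → ℓ r * a + b * Λ m) ([]-no (1 ℕ.≟ m) 1≢m) ([]-no (r ∣? m) r∤m)) (lem (ℓ r) (Λ m))))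
      where
      lem = ring 2 (λ a b → a :* con 0ℚ :+ con 0ℚ :* b , con 0ℚ)
    ... | no 1≢m | yes r∣m | inj₁ z = inj₁ (trans (Λ-prime-* pr 1≤m) (trans (cong₂ (λ a b → ℓ r * a + [ r ∣? m ] * b) ([]-no (1 ℕ.≟ m) 1≢m) z) (lem (ℓ r) [ r ∣? m ])))
      where
      lem = ring 2 (λ a b → a :* con 0ℚ :+ b :* con 0ℚ , con 0ℚ)
    ... | no _ | yes r∣m | inj₂ (p , k , pp , refl) = inj₂ (p , suc k , pp , cong (ℕ._* p ℕ.^ suc k) (prime∣power (suc k) pr pp r∣m))

  nonprime : Arith
  nonprime n = (1ℚ - [ prime? n ]) * Λ n

  nonprime≥0 : ∀ n → 0ℚ ≤ nonprime n
  nonprime≥0 zero = ≤-reflexive (sym (trans (cong ((1ℚ - [ prime? 0 ]) *_) Λ-0) (*-zeroʳ (1ℚ - [ prime? 0 ]))))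
  nonprime≥0 (suc n) = ↑ ([]-≤1 (prime? (suc n))) ⊗ Λ≥0 (suc n) (s≤s z≤n)

  -- A proper prime power p^k ≤ x has p ≤ √x, k ≤ log₂ x and weight at most log x.
  nonprime≤ : ∀ x {s t} → 1 ℕ.≤ x → x ℕ.≤ X → x ℕ.< suc s ℕ.* suc s → x ℕ.< 2 ℕ.^ suc t → Sum x nonprime ≤ ι s * (ι t * ℓ x)
  nonprime≤ x {s} {t} 1≤x x≤X x<s² x<2^t = ≤-trans (≤-reflexive (Sum-cong x (λ n _ n≤x → sym ([]*-yes (n ℕ.≤? x) n≤x))))
      (≤-trans (Sum-cover₂ x s t (λ p k → p ℕ.^ k) g g≥0 cover) (≤-trans (Sum-mono s (λ p _ _ → ≤-trans (Sum-mono t (λ k _ _ → g≤ (p ℕ.^ k))) (≤-reflexive (Sum-const t (ℓ x))))) (≤-reflexive (Sum-const s (ι t * ℓ x)))))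
    where
    g : Arith
    g n = [ n ℕ.≤? x ] * nonprime n
    g≥0 : ∀ n → 0ℚ ≤ g n
    g≥0 n = []-≥0 (n ℕ.≤? x) ⊗ nonprime≥0 n
    lem = lin 3 (λ i l m → con 0ℚ ≼ i ∷ con 0ℚ ≼ l ∷ l ≼ m ∷ [] , con 1ℚ :* ((con 1ℚ :- i) :* l) , m) ((1ℚ , 2 ∷ []) ∷ (1ℚ , 0 ∷ 1 ∷ []) ∷ [])
    g≤ : ∀ n → g n ≤ ℓ x
    g≤ n with n ℕ.≤? x
    ... | no _ = subst (_≤ ℓ x) (sym (*-zeroˡ (nonprime n))) (ℓ≥0 x)
    g≤ zero | yes _ = ≤-trans (≤-reflexive (trans (cong (λ z → 1ℚ * ((1ℚ - [ prime? 0 ]) * z)) Λ-0) (lem₀ [ prime? 0 ]))) (ℓ≥0 x)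
      where
      lem₀ = ring 1 (λ i → con 1ℚ :* ((con 1ℚ :- i) :* con 0ℚ) , con 0ℚ)
    g≤ (suc n) | yes n≤x = lem [ prime? (suc n) ] (Λ (suc n)) (ℓ x) ([]-≥0 (prime? (suc n))) (Λ≥0 (suc n) (s≤s z≤n)) (≤-trans (Λ≤ℓ (suc n) (s≤s z≤n)) (ℓ-mono (s≤s z≤n) n≤x (ℕₚ.m≤n⇒m≤1+n x≤X)))
    zero-case : ∀ n → Λ n ≡ 0ℚ → g n ≡ 0ℚ
    zero-case n z = trans (cong (λ w → [ n ℕ.≤? x ] * ((1ℚ - [ prime? n ]) * w)) z) (lem₀ [ n ℕ.≤? x ] [ prime? n ])
      where
      lem₀ = ring 2 (λ i j → i :* ((con 1ℚ :- j) :* con 0ℚ) , con 0ℚ)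
    prime-case : ∀ n → Prime n → g n ≡ 0ℚ
    prime-case n pn = trans (cong (λ w → [ n ℕ.≤? x ] * ((1ℚ - w) * Λ n)) ([]-yes (prime? n) pn)) (lem₀ [ n ℕ.≤? x ] (Λ n))
      where
      lem₀ = ring 2 (λ i j → i :* ((con 1ℚ :- con 1ℚ) :* j) , con 0ℚ)
    cover : ∀ n → 1 ℕ.≤ n → n ℕ.≤ x → g n ≡ 0ℚ ⊎ (∃[ a ] ∃[ b ] (1 ℕ.≤ a × a ℕ.≤ s × 1 ℕ.≤ b × b ℕ.≤ t × a ℕ.^ b ≡ n))
    cover n 1≤n n≤x with Λ-support n 1≤n
    ... | inj₁ z = inj₁ (zero-case n z)
    ... | inj₂ (p , zero , pp , eq) = inj₁ (prime-case n (subst Prime (sym (trans eq (ℕₚ.*-identityʳ p))) pp))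
    ... | inj₂ (p , suc k , pp , eq) = inj₂ (p , suc (suc k) , prime≥1 pp , p≤s , s≤s z≤n , k≤t , sym eq)
      where
      instance _ = prime⇒nonZero pp
      2≤p = ℕ.nonTrivial⇒n>1 p {{prime⇒nonTrivial pp}}
      p²≤x : p ℕ.* p ℕ.≤ x
      p²≤x = ℕₚ.≤-trans (ℕₚ.*-monoʳ-≤ p (d≤d*m p (ℕₚ.m^n>0 p k))) (subst (ℕ._≤ x) eq n≤x)
      p≤s : p ℕ.≤ s
      p≤s with p ℕ.≤? s
      ... | yes h = h
      ... | no ¬h = ⊥-elim (ℕₚ.<⇒≱ x<s² (ℕₚ.≤-trans (ℕₚ.*-mono-≤ (ℕₚ.≰⇒> ¬h) (ℕₚ.≰⇒> ¬h)) p²≤x))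
      k≤t : suc (suc k) ℕ.≤ t
      k≤t with suc (suc k) ℕ.≤? t
      ... | yes h = h
      ... | no ¬h = ⊥-elim (ℕₚ.<⇒≱ x<2^t (ℕₚ.≤-trans (ℕₚ.^-monoʳ-≤ 2 (ℕₚ.≰⇒> ¬h)) (ℕₚ.≤-trans (ℕₚ.^-monoˡ-≤ (suc (suc k)) 2≤p) (subst (ℕ._≤ x) eq n≤x))))

  ℓ≤log₂ : ∀ x {t} → x ℕ.≤ X → 2 ℕ.^ t ℕ.≤ x → x ℕ.< 2 ℕ.^ suc t → ℓ x ≤ ♯ 2 * ι t + ♯ 2
  ℓ≤log₂ x {t} x≤X p r = lem (ℓ x) (ℓ (2 ℕ.^ t)) (ℓ N) (inv N) (ι t) (ℓ 2) (Term.t≤l (1≤2^ t) p x≤X) (inv≤1 (1≤// (1≤2^ t) p)) (trans (cong ℓ N≡1) ℓ1≡0) (ℓ-2^ t) ℓ2≤2 (ι≥0 t)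
    where
    N : ℕ
    N = x // (2 ℕ.^ t)
    N≡1 : N ≡ 1
    N≡1 = ℕₚ.≤-antisym (ℕₚ.≤-pred (ℕₚ.*-cancelʳ-< (2 ℕ.^ t) N 2 (ℕₚ.≤-<-trans (//-*≤ x (2 ℕ.^ t)) r))) (1≤// (1≤2^ t) p)
    lem = lin 6 (λ a b c i t l → a :- b :- c ≼ # 2 :* i ∷ i ≼ con 1ℚ ∷ c ≗ con 0ℚ ∷ b ≗ t :* l ∷ l ≼ # 2 ∷ con 0ℚ ≼ t ∷ [] , a , # 2 :* t :+ # 2) ((1ℚ , 0 ∷ []) ∷ (♯ 2 , 1 ∷ []) ∷ (1ℚ , 2 ∷ []) ∷ (1ℚ , 3 ∷ []) ∷ (1ℚ , 4 ∷ 5 ∷ []) ∷ [])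

  -- Sign changes of R and the saving they produce

  module Step (q : ℕ) (1≤q : 1 ℕ.≤ q) where
    open Constants q

    Small : ℕ → Set
    Small v = ♯ 4 * (ι q * ∣ R v ∣) ≤ ι v

    R-suc : ∀ v → R (suc v) ≡ R v + Λ (suc v) - 1ℚ
    R-suc v = trans (cong (λ z → ψ v + Λ (suc v) - z) (ι-suc v)) (lem (ψ v) (Λ (suc v)) (ι v))
      where
      lem = ring 3 (λ f l n → f :+ l :- (n :+ con 1ℚ) , f :- n :+ l :- con 1ℚ)

    q²-big : ∀ {v} → 256 ℕ.* (q ℕ.* q) ℕ.+ 1 ℕ.≤ v → ♯ 256 * (ι q * ι q) + 1ℚ ≤ ι v
    q²-big {v} big = subst (_≤ ι v) (trans (ι-+ (256 ℕ.* (q ℕ.* q)) 1) (cong₂ _+_ (trans (ι-* 256 (q ℕ.* q)) (cong₂ _*_ (ι≡♯ 256) (ι-* q q))) (ι≡♯ 1))) (ι-mono big)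

    module NoSmall {U V : ℕ} (big : 256 ℕ.* (q ℕ.* q) ℕ.+ 1 ℕ.≤ U) (U≤V : U ℕ.≤ V) (V≤X : V ℕ.≤ X)
        (none : ∀ v → U ℕ.≤ v → v ℕ.≤ V → ¬ Small v) where
      large : ∀ v → U ℕ.≤ v → v ℕ.≤ V → ι v ≤ ♯ 4 * (ι q * ∣ R v ∣)
      large v p r with ≤-total (♯ 4 * (ι q * ∣ R v ∣)) (ι v)
      ... | inj₁ h = ⊥-elim (none v p r h)
      ... | inj₂ h = h

      1≤U : 1 ℕ.≤ U
      1≤U = ℕₚ.≤-trans (ℕₚ.m≤n+m 1 (256 ℕ.* (q ℕ.* q))) big

      -- R falls by at most 1 per step, too little to pass from v/(4q) to -v/(4q).
      positive-run : 0ℚ ≤ R U → ∀ w → U ℕ.+ w ℕ.≤ V → ι (U ℕ.+ w) ≤ ♯ 4 * (ι q * R (U ℕ.+ w))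
      positive-run r0 zero p = subst (λ z → ι z ≤ ♯ 4 * (ι q * R z)) (sym (ℕₚ.+-identityʳ U)) (subst (λ z → ι U ≤ ♯ 4 * (ι q * z)) (0≤p⇒∣p∣≡p r0) (large U ℕₚ.≤-refl U≤V))
      positive-run r0 (suc w) p = subst (λ z → ι z ≤ ♯ 4 * (ι q * R z)) (sym (ℕₚ.+-suc U w)) (go (≤-total 0ℚ (R (suc v))))
        where
        v = U ℕ.+ w
        v<V : suc v ℕ.≤ V
        v<V = subst (ℕ._≤ V) (ℕₚ.+-suc U w) p
        ih = positive-run r0 w (ℕₚ.<⇒≤ v<V)
        at = large (suc v) (ℕₚ.m≤n⇒m≤1+n (ℕₚ.m≤m+n U w)) v<V
        lem = lin 7 (λ q v v' r r' l a → v ≼ # 4 :* (q :* r) ∷ v' ≼ # 4 :* (q :* a) ∷ a ≗ :- r' ∷ r' ≗ r :+ l :- con 1ℚ ∷ con 0ℚ ≼ l ∷ v' ≗ v :+ con 1ℚ ∷ # 256 :* (q :* q) :+ con 1ℚ ≼ v ∷ con 1ℚ ≼ q ∷ [] , con 1ℚ , con 0ℚ) ((+ 1 / 511 , 0 ∷ []) ∷ (+ 1 / 511 , 1 ∷ []) ∷ (+ 4 / 511 , 2 ∷ 7 ∷ []) ∷ (+ 4 / 511 , 2 ∷ []) ∷ (- (+ 4 / 511) , 3 ∷ 7 ∷ []) ∷ (- (+ 4 / 511) , 3 ∷ []) ∷ (+ 4 / 511 , 4 ∷ 7 ∷ []) ∷ (+ 4 / 511 , 4 ∷ []) ∷ (-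 (+ 1 / 511) , 5 ∷ []) ∷ (+ 2 / 511 , 6 ∷ []) ∷ (+ 1020 / 511 , 7 ∷ []) ∷ (+ 512 / 511 , 7 ∷ 7 ∷ []) ∷ [])
        go : (0ℚ ≤ R (suc v)) ⊎ (R (suc v) ≤ 0ℚ) → ι (suc v) ≤ ♯ 4 * (ι q * R (suc v))
        go (inj₁ h) = subst (λ z → ι (suc v) ≤ ♯ 4 * (ι q * z)) (0≤p⇒∣p∣≡p h) at
        go (inj₂ h) = ⊥-elim (1≰0 (lem (ι q) (ι v) (ι (suc v)) (R v) (R (suc v)) (Λ (suc v)) ∣ R (suc v) ∣ ih at
          (trans (sym (∣-p∣≡∣p∣ (R (suc v)))) (0≤p⇒∣p∣≡p (neg-antimono-≤ h)))
          (R-suc v) (Λ≥0 (suc v) (s≤s z≤n)) (ι-suc v) (q²-big (ℕₚ.≤-trans big (ℕₚ.m≤m+n U w))) (ι≥1 1≤q)))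

      -- Upward jumps are at most log (v + 1), which `ℓ-sublinear` keeps below v/(4q), while a
      -- change of sign would take a jump of about twice that.
      negative-run : R U ≤ 0ℚ → ∀ w → U ℕ.+ w ℕ.≤ V → ι (U ℕ.+ w) ≤ ♯ 4 * (ι q * - R (U ℕ.+ w))
      negative-run r0 zero p = subst (λ z → ι z ≤ ♯ 4 * (ι q * - R z)) (sym (ℕₚ.+-identityʳ U)) (subst (λ z → ι U ≤ ♯ 4 * (ι q * z)) (trans (sym (∣-p∣≡∣p∣ (R U))) (0≤p⇒∣p∣≡p (neg-antimono-≤ r0))) (large U ℕₚ.≤-refl U≤V))
      negative-run r0 (suc w) p = subst (λ z → ι z ≤ ♯ 4 * (ι q * - R z)) (sym (ℕₚ.+-suc U w)) (go (≤-total 0ℚ (R (suc v))))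
        where
        v = U ℕ.+ w
        v<V : suc v ℕ.≤ V
        v<V = subst (ℕ._≤ V) (ℕₚ.+-suc U w) p
        ih = negative-run r0 w (ℕₚ.<⇒≤ v<V)
        at = large (suc v) (ℕₚ.m≤n⇒m≤1+n (ℕₚ.m≤m+n U w)) v<V
        lem = lin 7 (λ q v v' r r' l b → v ≼ # 4 :* (q :* :- r) ∷ v' ≼ # 4 :* (q :* r') ∷ r' ≗ r :+ l :- con 1ℚ ∷ l ≼ b ∷ # 4 :* (q :* b) ≼ v ∷ v' ≗ v :+ con 1ℚ ∷ con 1ℚ ≼ q ∷ con 0ℚ ≼ v ∷ [] , con 1ℚ , con 0ℚ) ((+ 1 / 5 , 7 ∷ []) ∷ (+ 1 / 5 , 0 ∷ []) ∷ (+ 1 / 5 , 1 ∷ []) ∷ (+ 4 / 5 , 2 ∷ []) ∷ (+ 4 / 5 , 2 ∷ 6 ∷ []) ∷ (+ 4 / 5 , 3 ∷ []) ∷ (+ 4 / 5 , 3 ∷ 6 ∷ []) ∷ (+ 1 / 5 , 4 ∷ []) ∷ (- (+ 1 / 5) , 5 ∷ []) ∷ (+ 4 / 5 , 6 ∷ []) ∷ [])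
        go : (0ℚ ≤ R (suc v)) ⊎ (R (suc v) ≤ 0ℚ) → ι (suc v) ≤ ♯ 4 * (ι q * - R (suc v))
        go (inj₂ h) = subst (λ z → ι (suc v) ≤ ♯ 4 * (ι q * z)) (trans (sym (∣-p∣≡∣p∣ (R (suc v)))) (0≤p⇒∣p∣≡p (neg-antimono-≤ h))) at
        go (inj₁ h) = ⊥-elim (1≰0 (lem (ι q) (ι v) (ι (suc v)) (R v) (R (suc v)) (Λ (suc v)) (ℓ (suc v)) ih
          (subst (λ z → ι (suc v) ≤ ♯ 4 * (ι q * z)) (0≤p⇒∣p∣≡p h) at)
          (R-suc v) (Λ≤ℓ (suc v) (s≤s z≤n)) (ℓ-sublinear q v 1≤q (ℕₚ.≤-trans big (ℕₚ.m≤m+n U w)) (ℕₚ.≤-trans (ℕₚ.<⇒≤ v<V) V≤X)) (ι-suc v) (ι≥1 1≤q) (ι≥0 v)))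

      Sum-inv-suc : ∀ n → Sum n (inv ∘ suc) ≡ H (suc n) - 1ℚ
      Sum-inv-suc zero = sym (cong (_- 1ℚ) H1)
      Sum-inv-suc (suc n) = trans (cong (_+ inv (suc (suc n))) (Sum-inv-suc n)) (lem (H (suc n)) (inv (suc (suc n))))
        where
        lem = ring 2 (λ a b → a :- con 1ℚ :+ b , a :+ b :- con 1ℚ)

      at-shift : ∀ {P : ℕ → Set} → (∀ w → U ℕ.+ w ℕ.≤ V → P (U ℕ.+ w)) → ∀ n → U ℕ.≤ n → n ℕ.≤ V → P n
      at-shift {P} h n p r = subst P (ℕₚ.m+[n∸m]≡n p) (h (n ℕ.∸ U) (subst (ℕ._≤ V) (sym (ℕₚ.m+[n∸m]≡n p)) r))

      weigh : ∀ n y → 1 ℕ.≤ n → ι n ≤ ♯ 4 * (ι q * y) → inv (suc n) ≤ ♯ 4 * ι q * (y * (inv n * inv (suc n)))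
      weigh n y p h = subst₂ _≤_ (trans (lem₁ (ι n) (inv n) (inv (suc n))) (trans (cong (_* inv (suc n)) (ι*inv p)) (*-identityˡ (inv (suc n))))) (lem₂ (ι q) y (inv n * inv (suc n)))
          (*-monoʳ-≤-nonNeg (inv n * inv (suc n)) {{nonNegative (inv≥0 n ⊗ inv≥0 (suc n))}} h)
        where
        lem₁ = ring 3 (λ n i j → n :* (i :* j) , (n :* i) :* j)
        lem₂ = ring 3 (λ q y i → # 4 :* (q :* y) :* i , # 4 :* q :* (y :* i))

      -- As R keeps its sign, 1/(n + 1) is at most 4q |R(n)|/(n (n + 1)), and the sum of the
      -- right-hand sides is 4q |D V - D U|. Thus 352 = 4 · (44 + 44).
      conclude : H (suc V) - H (suc U) ≤ ♯ 352 * ι q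
      conclude with ≤-total 0ℚ (R U)
      ... | inj₁ r0 = lem (H (suc V)) (H (suc U)) (ι q) (D V) (D U) (Sum-range-mono {f = inv ∘ suc} U≤V (λ n p r → weigh n (R n) (ℕₚ.≤-trans (s≤s z≤n) p) (at-shift {λ z → ι z ≤ ♯ 4 * (ι q * R z)} (positive-run r0) n (ℕₚ.<⇒≤ p) r))
              ▹ trans (cong₂ _-_ (Sum-inv-suc V) (Sum-inv-suc U)) refl ▹ cong₂ _-_ (Sum-*ˡ V (♯ 4 * ι q) _) (Sum-*ˡ U (♯ 4 * ι q) _))
              (abs-hi (D-bound V (ℕₚ.≤-trans 1≤U U≤V) V≤X)) (abs-lo (D-bound U 1≤U (ℕₚ.≤-trans U≤V V≤X))) (ι≥0 q)
        where
        _▹_▹_ : ∀ {a b c d} → a ≤ b → a ≡ c → b ≡ d → c ≤ d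
        p ▹ e ▹ f = subst₂ _≤_ e f p
        lem = lin 5 (λ a b q d e → a :- con 1ℚ :- (b :- con 1ℚ) ≼ # 4 :* q :* d :- # 4 :* q :* e ∷ d ≼ # 44 ∷ :- e ≼ # 44 ∷ con 0ℚ ≼ q ∷ [] , a :- b , # 352 :* q) ((1ℚ , 0 ∷ []) ∷ (♯ 4 , 1 ∷ 3 ∷ []) ∷ (♯ 4 , 2 ∷ 3 ∷ []) ∷ [])
      ... | inj₂ r0 = lem (H (suc V)) (H (suc U)) (ι q) (D V) (D U) (Sum-range-mono {f = inv ∘ suc} U≤V (λ n p r → weigh n (- R n) (ℕₚ.≤-trans (s≤s z≤n) p) (at-shift {λ z → ι z ≤ ♯ 4 * (ι q * - R z)} (negative-run r0) n (ℕₚ.<⇒≤ p) r))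
              ▹ trans (cong₂ _-_ (Sum-inv-suc V) (Sum-inv-suc U)) refl ▹ cong₂ _-_ (negated V) (negated U))
              (abs-lo (D-bound V (ℕₚ.≤-trans 1≤U U≤V) V≤X)) (abs-hi (D-bound U 1≤U (ℕₚ.≤-trans U≤V V≤X))) (ι≥0 q)
        where
        _▹_▹_ : ∀ {a b c d} → a ≤ b → a ≡ c → b ≡ d → c ≤ d
        p ▹ e ▹ f = subst₂ _≤_ e f p
        l₀ = ring 3 (λ a b c → a :* (:- b :* c) , (:- a) :* (b :* c))
        negated : ∀ N → Sum N (λ n → ♯ 4 * ι q * (- R n * (inv n * inv (suc n)))) ≡ - (♯ 4 * ι q) * D N
        negated N = trans (Sum-cong N (λ n _ _ → l₀ (♯ 4 * ι q) (R n) (inv n * inv (suc n)))) (Sum-*ˡ N (- (♯ 4 * ι q)) _)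
        lem = lin 5 (λ a b q d e → a :- con 1ℚ :- (b :- con 1ℚ) ≼ :- (# 4 :* q) :* d :- :- (# 4 :* q) :* e ∷ :- d ≼ # 44 ∷ e ≼ # 44 ∷ con 0ℚ ≼ q ∷ [] , a :- b , # 352 :* q) ((1ℚ , 0 ∷ []) ∷ (♯ 4 , 1 ∷ 3 ∷ []) ∷ (♯ 4 , 2 ∷ 3 ∷ []) ∷ [])

    sign-change : ∀ {U V} → 256 ℕ.* (q ℕ.* q) ℕ.+ 1 ℕ.≤ U → U ℕ.≤ V → V ℕ.≤ X → ♯ 352 * ι q + 1ℚ ≤ H (suc V) - H (suc U) →
      ∃[ v ] (U ℕ.≤ v × v ℕ.≤ V × Small v)
    sign-change {U} {V} big U≤V V≤X wide with search (λ v → ♯ 4 * (ι q * ∣ R v ∣) ≤? ι v) U V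
    ... | inj₁ found = found
    ... | inj₂ none = ⊥-elim (1≰0 (lem (H (suc V) - H (suc U)) (♯ 352 * ι q) wide (NoSmall.conclude big U≤V V≤X none)))
      where
      lem = lin 2 (λ a b → b :+ con 1ℚ ≼ a ∷ a ≼ b ∷ [] , con 1ℚ , con 0ℚ) ((1ℚ , 0 ∷ []) ∷ (1ℚ , 1 ∷ []) ∷ [])

    -- |R u| ≤ |R v| + (ψ u - ψ v) + (u - v). After multiplication by 2q the three parts are at most
    -- v/2, 4q (u - v) + v/4 and 2q (u - v), while 24 q (u - v) ≤ v. The term v/4 needs log v ≥ 16 ·
    -- 140004 q, with the error constant of `ψ-local`.
    window : ∀ {v u} → 1 ℕ.≤ v → Small v → ♯ 2240064 * ι q ≤ ℓ v → v ℕ.≤ u → 24 ℕ.* q ℕ.* (u ℕ.∸ v) ℕ.≤ v → u ℕ.≤ X → ♯ 2 * (ι q * ∣ R u ∣) ≤ ι u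
    window {v} {u} 1≤v small big v≤u near u≤X = fin (ι q) ∣ R u ∣ ∣ R v ∣ (ψ u) (ψ v) (ι u) (ι v) small tri P (ι-mono v≤u) near′ (ι≥0 q)
      where
      1≤24q : 1 ℕ.≤ 24 ℕ.* q
      1≤24q = ℕₚ.≤-trans 1≤q (m≤d*m {24} q (s≤s z≤n))
      near′ : ♯ 24 * ι q * (ι u - ι v) ≤ ι v
      near′ = subst (_≤ ι v) (trans (ι-* (24 ℕ.* q) (u ℕ.∸ v)) (cong₂ _*_ (trans (ι-* 24 q) (cong (_* ι q) (ι≡♯ 24))) (ι-- v≤u))) (ι-mono near)
      u≤2v : u ℕ.≤ 2 ℕ.* v
      u≤2v = subst (ℕ._≤ 2 ℕ.* v) (ℕₚ.m+[n∸m]≡n v≤u) (subst (v ℕ.+ (u ℕ.∸ v) ℕ.≤_) (cong (v ℕ.+_) (sym (ℕₚ.+-identityʳ v))) (ℕₚ.+-monoʳ-≤ v (ℕₚ.≤-trans (m≤d*m (u ℕ.∸ v) 1≤24q) near)))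
      tri-lem = lin 3 (λ a b e → a :- b ≼ e ∷ [] , a , b :+ e) ((1ℚ , 0 ∷ []) ∷ [])
      tri : ∣ R u ∣ ≤ ∣ R v ∣ + ((ψ u + ι u) - (ψ v + ι v))
      tri = tri-lem ∣ R u ∣ ∣ R v ∣ _ (abs-hi (abs-diff {R u} {R v} (R-diff v≤u)))
      L≥1 : 1ℚ ≤ ℓ v
      L≥1 = ≤-trans (lem (ι q) (ι≥1 1≤q)) big
        where
        lem = lin 1 (λ q → con 1ℚ ≼ q ∷ [] , con 1ℚ , # 2240064 :* q) ((♯ 2240063 , []) ∷ (♯ 2240064 , 0 ∷ []) ∷ [])
      P : ♯ 8 * ι q * (ψ u - ψ v) ≤ ♯ 16 * ι q * (ι u - ι v) + ι v
      P = *-cancelˡ-≤ L≥1 (lem (ℓ v) (ι q) (ψ u - ψ v) (ι u) (ι v) (ψ-local 1≤v v≤u u≤2v u≤X) big (subst (ι u ≤_) (trans (ι-* 2 v) (cong (_* ι v) (ι≡♯ 2))) (ι-mono u≤2v)) (ι≥0 q) (ι≥0 v))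
        where
        lem = lin 5 (λ l q p u v → l :* p ≼ # 2 :* (l :* (u :- v)) :+ # 140004 :* u ∷ # 2240064 :* q ≼ l ∷ u ≼ # 2 :* v ∷ con 0ℚ ≼ q ∷ con 0ℚ ≼ v ∷ [] , l :* (# 8 :* q :* p) , l :* (# 16 :* q :* (u :- v) :+ v)) ((♯ 8 , 0 ∷ 3 ∷ []) ∷ (1ℚ , 1 ∷ 4 ∷ []) ∷ (♯ 1120032 , 2 ∷ 3 ∷ []) ∷ [])
      fin = lin 7 (λ q a b f g u v → # 4 :* (q :* b) ≼ v ∷ a ≼ b :+ ((f :+ u) :- (g :+ v)) ∷ # 8 :* q :* (f :- g) ≼ # 16 :* q :* (u :- v) :+ v ∷ v ≼ u ∷ # 24 :* q :* (u :- v) ≼ v ∷ con 0ℚ ≼ q ∷ [] , # 2 :* (q :* a) , u) ((½ , 0 ∷ []) ∷ (♯ 2 , 1 ∷ 5 ∷ []) ∷ (+ 1 / 4 , 2 ∷ []) ∷ (1ℚ , 3 ∷ []) ∷ (+ 1 / 4 , 4 ∷ []) ∷ [])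

    1≤m : 1 ℕ.≤ m
    1≤m = ℕₚ.≤-trans 1≤q (m≤d*m {24} q (s≤s z≤n))

    good : ℕ → Arith
    good x n = [ ♯ 2 * (ι q * ∣ R (x // n) ∣) ≤? ι (x // n) ]

    G : ℕ → Arith
    G x n = inv n * good x n

    G≥0 : ∀ x n → 0ℚ ≤ G x n
    G≥0 x n = inv≥0 n ⊗ []-≥0 (♯ 2 * (ι q * ∣ R (x // n) ∣) ≤? ι (x // n))

    -- For n between a and 2σa the quotients x/n fill a range long enough to contain a point v with
    -- |R v| small. The window [v, v + w] around it corresponds to the n in (n₁, n₂], and all of
    -- these are `good`.
    module Block {x a : ℕ} (x≤X : x ℕ.≤ X) (2m≤a : 2 ℕ.* m ℕ.≤ a) (room : 2 ℕ.* σ ℕ.* a ℕ.* y₀ ℕ.≤ x) where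
      ρa = 2 ℕ.* σ ℕ.* a
      1≤a : 1 ℕ.≤ a
      1≤a = ℕₚ.≤-trans 1≤m (ℕₚ.≤-trans (m≤d*m {2} m (s≤s z≤n)) 2m≤a)
      1≤ρa : 1 ℕ.≤ ρa
      1≤ρa = ℕₚ.*-mono-≤ (ℕₚ.*-mono-≤ {1} {2} (s≤s z≤n) (1≤2^ (2 ℕ.* c))) 1≤a
      y Lo V : ℕ
      y = x // ρa
      Lo = suc y
      V = x // (2 ℕ.* a)
      y₀≤y : y₀ ℕ.≤ y
      y₀≤y = *≤⇒≤// 1≤ρa room
      1≤y : 1 ℕ.≤ y
      1≤y = ℕₚ.≤-trans (ℕₚ.≤-trans (1≤2^ (2 ℕ.* (q ℕ.* 2240064))) (ℕₚ.m≤m+n _ (256 ℕ.* (q ℕ.* q) ℕ.+ 1))) y₀≤y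
      1≤2a : 1 ℕ.≤ 2 ℕ.* a
      1≤2a = ℕₚ.*-mono-≤ {1} {2} (s≤s z≤n) 1≤a
      V≤X : V ℕ.≤ X
      V≤X = ℕₚ.≤-trans (//-≤ x (2 ℕ.* a)) x≤X
      σy≤V : σ ℕ.* y ℕ.≤ V
      σy≤V = *≤⇒≤// 1≤2a (subst (ℕ._≤ x) eq (≤//⇒*≤ {x} {ρa} ℕₚ.≤-refl))
        where
        eq : 2 ℕ.* σ ℕ.* a ℕ.* y ≡ 2 ℕ.* a ℕ.* (σ ℕ.* y)
        eq = trans (cong (ℕ._* y) (trans (ℕₚ.*-assoc 2 σ a) (trans (cong (2 ℕ.*_) (ℕₚ.*-comm σ a)) (sym (ℕₚ.*-assoc 2 a σ))))) (ℕₚ.*-assoc (2 ℕ.* a) σ y)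
      2≤σ : 2 ℕ.≤ σ
      2≤σ = ℕₚ.^-monoʳ-≤ 2 {1} {2 ℕ.* c} (ℕₚ.≤-trans (s≤s z≤n) (ℕₚ.*-monoʳ-≤ 2 (ℕₚ.m≤n+m 12 (q ℕ.* 352))))
      2y≤V : 2 ℕ.* y ℕ.≤ V
      2y≤V = ℕₚ.≤-trans (ℕₚ.*-monoˡ-≤ y 2≤σ) σy≤V
      Lo≤2y : Lo ℕ.≤ 2 ℕ.* y
      Lo≤2y = subst (Lo ℕ.≤_) (cong (y ℕ.+_) (sym (ℕₚ.+-identityʳ y))) (ℕₚ.+-monoˡ-≤ y 1≤y)
      Lo≤V : Lo ℕ.≤ V
      Lo≤V = ℕₚ.≤-trans Lo≤2y 2y≤V
      1≤V : 1 ℕ.≤ V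
      1≤V = ℕₚ.≤-trans (s≤s z≤n) Lo≤V

      -- The 12 in `c` pays for two errors 4 from `H-ℓ`, for log 2 ≤ 2 between `Lo` and `y`, for the
      -- term 1/(Lo + 1), and for the 1 in the claim.
      wide : ♯ 352 * ι q + 1ℚ ≤ H (suc V) - H (suc Lo)
      wide = lem (ι q) (H V) (inv (suc V)) (H Lo) (inv (suc Lo)) (ℓ V) (ℓ Lo) (ℓ σ) (ℓ y) (ℓ 2) (inv V) (inv Lo) γ (inv≥0 (suc V)) (inv≤1 (s≤s z≤n)) (abs-hi (H-ℓ V 1≤V V≤X)) (abs-lo (H-ℓ Lo (s≤s z≤n) (ℕₚ.≤-trans Lo≤V V≤X))) (inv≤1 1≤V) (inv≤1 (s≤s z≤n))
          (subst (_≤ ℓ V) (ℓ-* σ y (1≤2^ (2 ℕ.* c)) 1≤y) (ℓ-mono (ℕₚ.*-mono-≤ (1≤2^ (2 ℕ.* c)) 1≤y) σy≤V (ℕₚ.m≤n⇒m≤1+n V≤X)))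
          (subst (ℓ Lo ≤_) (ℓ-* 2 y (s≤s z≤n) 1≤y) (ℓ-mono (s≤s z≤n) Lo≤2y (ℕₚ.m≤n⇒m≤1+n (ℕₚ.≤-trans 2y≤V V≤X)))) ℓ2≤2
          (subst (_≤ ℓ σ) (trans (ι-+ (q ℕ.* 352) 12) (cong₂ _+_ (trans (ι-* q 352) (cong (ι q *_) (ι≡♯ 352))) (ι≡♯ 12))) (ℓ-large c ℕₚ.≤-refl (ℕₚ.≤-trans (d≤d*m σ 1≤y) (ℕₚ.m≤n⇒m≤1+n (ℕₚ.≤-trans σy≤V V≤X)))))
        where
        lem = lin 13 (λ q hV iV hU iU lV lU ls ly l2 vV vU g → con 0ℚ ≼ iV ∷ iU ≼ con 1ℚ ∷ g :- (hV :- lV) ≼ # 4 :* vV ∷ :- (g :- (hU :- lU)) ≼ # 4 :* vU ∷ vV ≼ con 1ℚ ∷ vU ≼ con 1ℚ ∷ ls :+ ly ≼ lV ∷ lU ≼ l2 :+ ly ∷ l2 ≼ # 2 ∷ q :* # 352 :+ # 12 ≼ ls ∷ [] , # 352 :* q :+ con 1ℚ , (hV :+ iV) :- (hU :+ iU)) ((1ℚ , 0 ∷ []) ∷ (1ℚ , 1 ∷ []) ∷ (1ℚ , 2 ∷ []) ∷ (1ℚ , 3 ∷ []) ∷ (♯ 4 , 4 ∷ []) ∷ (♯ 4 , 5 ∷ []) ∷ (1ℚ , 6 ∷ []) ∷ (1ℚ , 7 ∷ []) ∷ (1ℚ , 8 ∷ []) ∷ (1ℚ , 9 ∷ []) ∷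 [])

      abstract
       chosen : ∃[ v ] (Lo ℕ.≤ v × v ℕ.≤ V × Small v)
       chosen = sign-change (ℕₚ.≤-trans (ℕₚ.m≤n+m _ (2 ℕ.^ (2 ℕ.* (q ℕ.* 2240064)))) (ℕₚ.m≤n⇒m≤1+n y₀≤y)) Lo≤V V≤X wide

      v w n₁ n₂ : ℕ
      v = proj₁ chosen
      w = v // m
      n₁ = x // suc (v ℕ.+ w)
      n₂ = x // v
      Lo≤v = proj₁ (proj₂ chosen)
      v≤V = proj₁ (proj₂ (proj₂ chosen))
      small = proj₂ (proj₂ (proj₂ chosen))
      1≤v : 1 ℕ.≤ v
      1≤v = ℕₚ.≤-trans (s≤s z≤n) Lo≤v

      ℓv-big : ♯ 2240064 * ι q ≤ ℓ v
      ℓv-big = subst (_≤ ℓ v) (trans (ι-* q 2240064) (trans (*-comm (ι q) (ι 2240064)) (cong (_* ι q) (ι≡♯ 2240064))))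
        (ℓ-large (q ℕ.* 2240064) (ℕₚ.≤-trans (ℕₚ.m≤m+n _ _) (ℕₚ.≤-trans y₀≤y (ℕₚ.≤-trans (ℕₚ.n≤1+n y) Lo≤v))) (ℕₚ.m≤n⇒m≤1+n (ℕₚ.≤-trans v≤V V≤X)))

      mw≤v : m ℕ.* w ℕ.≤ v
      mw≤v = ≤//⇒*≤ {v} {m} ℕₚ.≤-refl

      sw≤v : suc w ℕ.≤ v
      sw≤v = go w refl
        where
        2≤m : 2 ℕ.≤ m
        2≤m = ℕₚ.≤-trans (from-yes (2 ℕ.≤? 24)) (d≤d*m 24 1≤q)
        go : ∀ k → w ≡ k → suc w ℕ.≤ v
        go zero    eq = subst (λ z → suc z ℕ.≤ v) (sym eq) 1≤v
        go (suc k) eq = ℕₚ.≤-trans (ℕₚ.+-monoˡ-≤ w {1} {w} (subst (1 ℕ.≤_) (sym eq) (s≤s z≤n))) (ℕₚ.≤-trans (ℕₚ.≤-reflexive (cong (w ℕ.+_) (sym (ℕₚ.+-identityʳ w)))) (ℕₚ.≤-trans (ℕₚ.*-monoˡ-≤ w 2≤m) mw≤v))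

      W≤2v : suc (v ℕ.+ w) ℕ.≤ 2 ℕ.* v
      W≤2v = subst₂ ℕ._≤_ (ℕₚ.+-suc v w) (cong (v ℕ.+_) (sym (ℕₚ.+-identityʳ v))) (ℕₚ.+-monoʳ-≤ v sw≤v)

      2av≤x : 2 ℕ.* a ℕ.* v ℕ.≤ x
      2av≤x = ≤//⇒*≤ {x} {2 ℕ.* a} v≤V

      a≤n₁ : a ℕ.≤ n₁
      a≤n₁ = *≤⇒≤// (s≤s z≤n) (ℕₚ.≤-trans (ℕₚ.*-monoˡ-≤ a W≤2v) (ℕₚ.≤-trans (ℕₚ.≤-reflexive (trans (ℕₚ.*-assoc 2 v a) (trans (cong (2 ℕ.*_) (ℕₚ.*-comm v a)) (sym (ℕₚ.*-assoc 2 a v))))) 2av≤x))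

      n₂≤ρa : n₂ ℕ.≤ ρa
      n₂≤ρa = ℕₚ.<⇒≤ (ℕₚ.*-cancelʳ-< v n₂ ρa (ℕₚ.≤-<-trans (//-*≤ x v) (ℕₚ.<-≤-trans (<*suc// x 1≤ρa) (ℕₚ.*-monoʳ-≤ ρa Lo≤v))))

      n₁≤n₂ : n₁ ℕ.≤ n₂
      n₁≤n₂ = //-anti x 1≤v (ℕₚ.m≤n⇒m≤1+n (ℕₚ.m≤m+n v w))

      good-here : ∀ n → n₁ ℕ.< n → n ℕ.≤ n₂ → good x n ≡ 1ℚ
      good-here n p r = []-yes (♯ 2 * (ι q * ∣ R (x // n) ∣) ≤? ι (x // n)) (window 1≤v small ℓv-big v≤u (ℕₚ.≤-trans (ℕₚ.*-monoʳ-≤ m (ℕₚ.m≤n+o⇒m∸n≤o (x // n) v u≤vw)) mw≤v) (ℕₚ.≤-trans (//-≤ x n) x≤X))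
        where
        1≤n = ℕₚ.≤-trans (s≤s z≤n) p
        v≤u : v ℕ.≤ x // n
        v≤u = *≤⇒≤// 1≤n (subst (ℕ._≤ x) (ℕₚ.*-comm v n) (≤//⇒*≤ {x} {v} r))
        u≤vw : x // n ℕ.≤ v ℕ.+ w
        u≤vw with x // n ℕ.≤? v ℕ.+ w
        ... | yes h = h
        ... | no ¬h = ⊥-elim (ℕₚ.<⇒≱ p (*≤⇒≤// (s≤s z≤n) (subst (ℕ._≤ x) (ℕₚ.*-comm n (suc (v ℕ.+ w))) (≤//⇒*≤ {x} {n} (ℕₚ.≰⇒> ¬h)))))

      -- n₂ - n₁ is roughly (x/v) (w/v), the proportion 1/m of n₂. Because a ≥ 2m, the quotient x/v
      -- is at least 4m, so the roundings cost only a constant factor.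
      many : ι n₂ ≤ ♯ 4 * ι m * (ι n₂ - ι n₁)
      many = *-cancelˡ-≤ {ι v * ι W} (lem₁ (ι v) (ι W) (ι≥1 1≤v) (ι≥1 (s≤s z≤n)))
          (lem (ι x) (ι v) (ι W) (ι w) (ι m) (ι n₁) (ι n₂)
            (subst (_≤ ι x) (ι-* n₂ v) (ι-mono (//-*≤ x v)))
            (subst (ι x ≤_) (trans (ι-* v (suc n₂)) (cong (ι v *_) (ι-suc n₂))) (ι-mono (ℕₚ.<⇒≤ (<*suc// x 1≤v))))
            (subst (_≤ ι x) (ι-* n₁ W) (ι-mono (//-*≤ x W)))
            (trans (ι-suc (v ℕ.+ w)) (cong (_+ 1ℚ) (ι-+ v w)))
            (subst (ι v ≤_) (trans (ι-* m (suc w)) (cong (ι m *_) (ι-suc w))) (ι-mono (ℕₚ.<⇒≤ (<*suc// v 1≤m))))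
            (subst (ι W ≤_) (trans (ι-* 2 v) (cong (_* ι v) (ι≡♯ 2))) (ι-mono W≤2v))
            (subst (_≤ ι x) (trans (ι-* (2 ℕ.* (2 ℕ.* m)) v) (cong (_* ι v) (trans (ι-* 2 (2 ℕ.* m)) (cong₂ _*_ (ι≡♯ 2) (trans (ι-* 2 m) (cong (_* ι m) (ι≡♯ 2)))))))
              (ι-mono (ℕₚ.≤-trans (ℕₚ.*-monoˡ-≤ v (ℕₚ.*-monoʳ-≤ 2 2m≤a)) 2av≤x)))
            (ι≥0 v) (ι≥0 W) (ι≥0 m) (ι≥0 x))
        where
        W = suc (v ℕ.+ w)
        lem₁ = lin 2 (λ a b → con 1ℚ ≼ a ∷ con 1ℚ ≼ b ∷ [] , con 1ℚ , a :* b) ((1ℚ , 0 ∷ []) ∷ (1ℚ , 1 ∷ []) ∷ (1ℚ , 0 ∷ 1 ∷ []) ∷ [])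
        lem = lin 7 (λ x v W w m a b → b :* v ≼ x ∷ x ≼ v :* (b :+ con 1ℚ) ∷ a :* W ≼ x ∷ W ≗ v :+ w :+ con 1ℚ ∷ v ≼ m :* (w :+ con 1ℚ) ∷ W ≼ # 2 :* v ∷ # 2 :* (# 2 :* m) :* v ≼ x ∷ con 0ℚ ≼ v ∷ con 0ℚ ≼ W ∷ con 0ℚ ≼ m ∷ con 0ℚ ≼ x ∷ [] , v :* W :* b , v :* W :* (# 4 :* m :* (b :- a))) ((1ℚ , 0 ∷ 8 ∷ []) ∷ (♯ 4 , 1 ∷ 8 ∷ 9 ∷ []) ∷ (♯ 4 , 2 ∷ 7 ∷ 9 ∷ []) ∷ (♯ 4 , 4 ∷ 10 ∷ []) ∷ (♯ 2 , 5 ∷ 10 ∷ []) ∷ (1ℚ , 6 ∷ 8 ∷ []) ∷ (- (♯ 4) , 3 ∷ 10 ∷ 9 ∷ []) ∷ [])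

      saving : 1ℚ ≤ ♯ 4 * ι m * (Sum ρa (G x) - Sum a (G x))
      saving = fin (ι n₂) (ι n₁) (inv n₂) (ι m) (Sum ρa (G x)) (Sum n₂ (G x)) (Sum n₁ (G x)) (Sum a (G x)) many
          (subst (_≤ Sum n₂ (G x) - Sum n₁ (G x)) (cong₂ _-_ (Sum-const n₂ (inv n₂)) (Sum-const n₁ (inv n₂))) (Sum-range-mono n₁≤n₂ term))
          (Sum-extend (G x) a≤n₁ (λ n _ _ → G≥0 x n)) (Sum-extend (G x) n₂≤ρa (λ n _ _ → G≥0 x n)) (ι*inv (ℕₚ.≤-trans 1≤a (ℕₚ.≤-trans a≤n₁ n₁≤n₂))) (inv≥0 n₂) (ι≥0 m)
        where
        term : ∀ n → n₁ ℕ.< n → n ℕ.≤ n₂ → inv n₂ ≤ G x n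
        term n p r = subst (inv n₂ ≤_) (sym (trans (cong (inv n *_) (good-here n p r)) (*-identityʳ (inv n)))) (inv-mono (ℕₚ.≤-trans (s≤s z≤n) p) r)
        fin = lin 8 (λ b a i m R S T A → b ≼ # 4 :* m :* (b :- a) ∷ b :* i :- a :* i ≼ S :- T ∷ A ≼ T ∷ S ≼ R ∷ b :* i ≗ con 1ℚ ∷ con 0ℚ ≼ i ∷ con 0ℚ ≼ m ∷ [] , con 1ℚ , # 4 :* m :* (R :- A)) ((1ℚ , 0 ∷ 5 ∷ []) ∷ (♯ 4 , 1 ∷ 6 ∷ []) ∷ (♯ 4 , 2 ∷ 6 ∷ []) ∷ (♯ 4 , 3 ∷ 6 ∷ []) ∷ (- 1ℚ , 4 ∷ []) ∷ [])

    ρ : ℕ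
    ρ = 2 ℕ.* σ

    1≤ρ : 1 ℕ.≤ ρ
    1≤ρ = 1≤2^ (suc (2 ℕ.* c))

    2≤ρ : 2 ℕ.≤ ρ
    2≤ρ = d≤d*m 2 (1≤2^ (2 ℕ.* c))

    ιE : ι E ≡ ♯ 2 * ι (suc (2 ℕ.* c))
    ιE = trans (ι-* 2 (suc (2 ℕ.* c))) (cong (_* ι (suc (2 ℕ.* c))) (ι≡♯ 2))

    ℓρ≤E : ℓ ρ ≤ ι E
    ℓρ≤E = lem (ℓ ρ) (ι (suc (2 ℕ.* c))) (ℓ 2) (ι E) (ℓ-2^ (suc (2 ℕ.* c))) ιE ℓ2≤2 (ι≥0 (suc (2 ℕ.* c)))
      where
      lem = lin 4 (λ r e l E → r ≗ e :* l ∷ E ≗ # 2 :* e ∷ l ≼ # 2 ∷ con 0ℚ ≼ e ∷ [] , r , E) ((1ℚ , 0 ∷ []) ∷ (- 1ℚ , 1 ∷ []) ∷ (1ℚ , 2 ∷ 3 ∷ []) ∷ [])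

    ℓρ≥0 : 0ℚ ≤ ℓ ρ
    ℓρ≥0 = ℓ≥0 ρ

    pw : ℕ → ℕ
    pw zero    = 2 ℕ.* m
    pw (suc i) = ρ ℕ.* pw i

    2m≤pw : ∀ i → 2 ℕ.* m ℕ.≤ pw i
    2m≤pw zero    = ℕₚ.≤-refl
    2m≤pw (suc i) = ℕₚ.≤-trans (2m≤pw i) (m≤d*m (pw i) 1≤ρ)

    1≤2m : 1 ℕ.≤ 2 ℕ.* m
    1≤2m = ℕₚ.≤-trans 1≤m (m≤d*m {2} m (s≤s z≤n))

    1≤pw : ∀ i → 1 ℕ.≤ pw i
    1≤pw i = ℕₚ.≤-trans 1≤2m (2m≤pw i)

    i<pw : ∀ i → i ℕ.< pw i
    i<pw zero    = 1≤2m
    i<pw (suc i) = ℕₚ.≤-trans (s≤s (i<pw i)) (ℕₚ.≤-trans (ℕₚ.+-monoˡ-≤ (pw i) {1} {pw i} (1≤pw i)) (ℕₚ.≤-trans (ℕₚ.≤-reflexive (cong (pw i ℕ.+_) (sym (ℕₚ.+-identityʳ (pw i))))) (ℕₚ.*-monoˡ-≤ (pw i) 2≤ρ)))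

    ℓ-pw : ∀ i → ℓ (pw i) ≡ ι i * ℓ ρ + ℓ (2 ℕ.* m)
    ℓ-pw zero = sym (trans (cong (λ z → z * ℓ ρ + ℓ (2 ℕ.* m)) (ι≡♯ 0)) (lem (ℓ ρ) (ℓ (2 ℕ.* m))))
      where
      lem = ring 2 (λ a b → con 0ℚ :* a :+ b , b)
    ℓ-pw (suc i) = trans (ℓ-* ρ (pw i) 1≤ρ (1≤pw i)) (trans (cong (λ z → ℓ ρ + z) (ℓ-pw i)) (trans (lem (ℓ ρ) (ι i) (ℓ (2 ℕ.* m))) (cong (λ z → z * ℓ ρ + ℓ (2 ℕ.* m)) (sym (ι-suc i)))))
      where
      lem = ring 3 (λ a i b → a :+ (i :* a :+ b) , (i :+ con 1ℚ) :* a :+ b)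

    1≤y₀ : 1 ℕ.≤ y₀
    1≤y₀ = ℕₚ.≤-trans (1≤2^ (2 ℕ.* (q ℕ.* 2240064))) (ℕₚ.m≤m+n _ (256 ℕ.* (q ℕ.* q) ℕ.+ 1))

    module _ {x : ℕ} (x≤X : x ℕ.≤ X) where
      ℓG : Arith
      ℓG n = ℓ n * G x n

      ℓG≥0 : ∀ n → 0ℚ ≤ ℓG n
      ℓG≥0 n = ℓ≥0 n ⊗ G≥0 x n

      -- Block i contributes at least log (pw i)/(4m) ≥ i log ρ/(4m). The total is quadratic in the
      -- number of blocks, hence of order log² x, like Σ log n/n itself.
      savings : ∀ i → pw i ℕ.* y₀ ℕ.≤ x → ℓ ρ * (½ * (ι i * (ι i - 1ℚ))) ≤ ♯ 4 * ι m * Sum (pw i) ℓG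
      savings zero _ = subst (λ z → ℓ ρ * (½ * (z * (z - 1ℚ))) ≤ ♯ 4 * ι m * Sum (pw 0) ℓG) (sym (ι≡♯ 0))
          (lem (ℓ ρ) (ι m) (Sum (pw 0) ℓG) (ι≥0 m) (Sum-≥0 (pw 0) (λ n _ _ → ℓG≥0 n)))
        where
        lem = lin 3 (λ r m s → con 0ℚ ≼ m ∷ con 0ℚ ≼ s ∷ [] , r :* (con ½ :* (con 0ℚ :* (con 0ℚ :- con 1ℚ))) , # 4 :* m :* s) ((♯ 4 , 0 ∷ 1 ∷ []) ∷ [])
      savings (suc i) p = lem (ℓ ρ) (ι i) (ι (suc i)) (ι m) (ℓ (pw i)) (ℓ (2 ℕ.* m)) (Sum (pw i) ℓG) (Sum (pw (suc i)) ℓG) (Sum (pw (suc i)) (G x) - Sum (pw i) (G x))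
          (savings i (ℕₚ.≤-trans (ℕₚ.*-monoˡ-≤ y₀ (m≤d*m (pw i) 1≤ρ)) p)) (Block.saving x≤X (2m≤pw i) p) range (ℓ-pw i) (ℓ≥0 (2 ℕ.* m)) (ι≥0 m) (ι-suc i) (ℓ≥0 (pw i))
        where
        range : ℓ (pw i) * (Sum (pw (suc i)) (G x) - Sum (pw i) (G x)) ≤ Sum (pw (suc i)) ℓG - Sum (pw i) ℓG
        range = subst (_≤ Sum (pw (suc i)) ℓG - Sum (pw i) ℓG) (trans (cong₂ _-_ (Sum-*ˡ (pw (suc i)) (ℓ (pw i)) (G x)) (Sum-*ˡ (pw i) (ℓ (pw i)) (G x))) (l₀ (ℓ (pw i)) (Sum (pw (suc i)) (G x)) (Sum (pw i) (G x))))
            (Sum-range-mono (m≤d*m (pw i) 1≤ρ) (λ n a b → *-monoʳ-≤-nonNeg (G x n) {{nonNegative (G≥0 x n)}} (ℓ-mono (1≤pw i) (ℕₚ.<⇒≤ a) (ℕₚ.m≤n⇒m≤1+n (ℕₚ.≤-trans b (ℕₚ.≤-trans (d≤d*m (pw (suc i)) 1≤y₀) (ℕₚ.≤-trans p x≤X)))))))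
          where
          l₀ = ring 3 (λ a b c → a :* b :- a :* c , a :* (b :- c))
        lem : ∀ r i j m l b s t g → r * (½ * (i * (i - 1ℚ))) ≤ ♯ 4 * m * s → 1ℚ ≤ ♯ 4 * m * g → l * g ≤ t - s → l ≡ i * r + b → 0ℚ ≤ b → 0ℚ ≤ m → j ≡ i + 1ℚ → 0ℚ ≤ l →
          r * (½ * (j * (j - 1ℚ))) ≤ ♯ 4 * m * t
        lem r i _ m _ b s t g h1 h2 h3 refl b0 m0 refl l0 = lem′ r i m b s t g h1 h2 h3 b0 m0 l0
          where
          lem′ = lin 7 (λ r i m b s t g → r :* (con ½ :* (i :* (i :- con 1ℚ))) ≼ # 4 :* m :* s ∷ con 1ℚ ≼ # 4 :* m :* g ∷ (i :* r :+ b) :* g ≼ t :- s ∷ con 0ℚ ≼ b ∷ con 0ℚ ≼ m ∷ con 0ℚ ≼ i :* r :+ b ∷ [] , r :* (con ½ :* ((i :+ con 1ℚ) :* ((i :+ con 1ℚ) :- con 1ℚ))) , # 4 :* m :* t) ((1ℚ , 0 ∷ []) ∷ (1ℚ , 1 ∷ 5 ∷ []) ∷ (♯ 4 , 2 ∷ 4 ∷ []) ∷ (1ℚ , 3 ∷ []) ∷ [])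

      level : 2 ℕ.* m ℕ.* y₀ ℕ.≤ x → ∃[ i ] (pw i ℕ.* y₀ ℕ.≤ x × x ℕ.< pw (suc i) ℕ.* y₀)
      level = bracket (λ i → pw i ℕ.* y₀) (λ i → ℕₚ.<-≤-trans (ℕₚ.<-trans (ℕₚ.n<1+n i) (i<pw (suc i))) (d≤d*m (pw (suc i)) 1≤y₀)) x

      level-log : ∀ i → pw i ℕ.* y₀ ℕ.≤ x → x ℕ.< pw (suc i) ℕ.* y₀ → ℓ x ≤ ι i * ℓ ρ + ι C₁
      level-log i p r = lem (ℓ x) (ℓ d) (ℓ N) (ι N) (inv N) (ℓ (pw i)) (ℓ y₀) (ι i * ℓ ρ) (ℓ (2 ℕ.* m)) (ι (2 ℕ.* m)) (ι y₀) (ι ρ) (ι C₁)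
          (Term.t≤l 1≤d p x≤X) (inv≤1 1≤N) (ℓ≤2ι N 1≤N (ℕₚ.m≤n⇒m≤1+n (ℕₚ.≤-trans (//-≤ x d) x≤X))) (ι-mono N≤ρ) (ℓ-* (pw i) y₀ (1≤pw i) 1≤y₀) (ℓ-pw i)
          (ℓ≤2ι (2 ℕ.* m) 1≤2m (ℕₚ.≤-trans (2m≤pw i) (ℕₚ.≤-trans (d≤d*m (pw i) 1≤y₀) d≤X))) (ℓ≤2ι y₀ 1≤y₀ (ℕₚ.≤-trans (m≤d*m y₀ (1≤pw i)) d≤X)) ιC₁
        where
        d N : ℕ
        d = pw i ℕ.* y₀
        N = x // d
        d≤X = ℕₚ.m≤n⇒m≤1+n (ℕₚ.≤-trans p x≤X)
        1≤d = ℕₚ.*-mono-≤ (1≤pw i) 1≤y₀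
        1≤N : 1 ℕ.≤ N
        1≤N = 1≤// 1≤d p
        N≤ρ : N ℕ.≤ ρ
        N≤ρ = ℕₚ.<⇒≤ (ℕₚ.*-cancelʳ-< d N ρ (ℕₚ.≤-<-trans (//-*≤ x d) (subst (x ℕ.<_) (ℕₚ.*-assoc ρ (pw i) y₀) r)))
        two : ∀ n → ι (2 ℕ.* n) ≡ ♯ 2 * ι n
        two n = trans (ι-* 2 n) (cong (_* ι n) (ι≡♯ 2))
        ιC₁ : ι C₁ ≡ ♯ 2 * ι ρ + ♯ 2 + ♯ 2 * ι (2 ℕ.* m) + ♯ 2 * ι y₀
        ιC₁ = trans (ι-+ (2 ℕ.* ρ ℕ.+ 2 ℕ.+ 2 ℕ.* (2 ℕ.* m)) (2 ℕ.* y₀)) (cong₂ _+_ (trans (ι-+ (2 ℕ.* ρ ℕ.+ 2) (2 ℕ.* (2 ℕ.* m))) (cong₂ _+_ (trans (ι-+ (2 ℕ.* ρ) 2) (cong₂ _+_ (two ρ) (ι≡♯ 2))) (two (2 ℕ.* m)))) (two y₀))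
        lem = lin 13 (λ lx ld lN n i lp ly ir la a y r C → lx :- ld :- lN ≼ # 2 :* i ∷ i ≼ con 1ℚ ∷ lN ≼ # 2 :* n ∷ n ≼ r ∷ ld ≗ lp :+ ly ∷ lp ≗ ir :+ la ∷ la ≼ # 2 :* a ∷ ly ≼ # 2 :* y ∷ C ≗ # 2 :* r :+ # 2 :+ # 2 :* a :+ # 2 :* y ∷ [] , lx , ir :+ C) ((1ℚ , 0 ∷ []) ∷ (♯ 2 , 1 ∷ []) ∷ (1ℚ , 2 ∷ []) ∷ (♯ 2 , 3 ∷ []) ∷ (1ℚ , 4 ∷ []) ∷ (1ℚ , 5 ∷ []) ∷ (1ℚ , 6 ∷ []) ∷ (1ℚ , 7 ∷ []) ∷ (- 1ℚ , 8 ∷ []) ∷ [])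

      -- By `level-log`, i log ρ equals log x up to a constant; this converts the number of blocks
      -- into log² x with an error linear in log x.
      total-saving : 2 ℕ.* m ℕ.* y₀ ℕ.≤ x → ι C₁ + ι E ≤ ℓ x → ℓ x * ℓ x - ι C₂ * ℓ x ≤ ι B * Sum x ℓG
      total-saving p big with level p
      ... | i , h₁ , h₂ = subst₂ (λ a b → ℓ x * ℓ x - a * ℓ x ≤ b * Sum x ℓG) (sym ιC₂) (sym ιB)
          (lem (ℓ x) (ι C₁) (ι E) (ℓ ρ) (ι i * ℓ ρ) (ι m) (Sum x ℓG)
            (square (ℓ x) (ι C₁) (ι E) (ℓ ρ) (ι i * ℓ ρ) (level-log i h₁ h₂) big ℓρ≤E (ι≥0 C₁) (ι≥0 E))
            (≤-trans (≤-reflexive (l₀ (ι i) (ℓ ρ))) (scale (ℓ ρ) (ℓ ρ * (½ * (ι i * (ι i - 1ℚ)))) (ι m) (Sum (pw i) ℓG) (Sum x ℓG) (savings i h₁) (Sum-extend ℓG (ℕₚ.≤-trans (d≤d*m (pw i) 1≤y₀) h₁) (λ n _ _ → ℓG≥0 n)) ℓρ≥0 (ι≥0 m)))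
            ℓρ≤E (ι≥0 m) (Sum-≥0 x (λ n _ _ → ℓG≥0 n)) (ι≥0 C₁) (ι≥0 E))
        where
        ιC₂ : ι C₂ ≡ ♯ 2 * ι C₁ + ι E
        ιC₂ = trans (ι-+ (2 ℕ.* C₁) E) (cong (_+ ι E) (trans (ι-* 2 C₁) (cong (_* ι C₁) (ι≡♯ 2))))
        ιB : ι B ≡ ♯ 8 * ι m * ι E
        ιB = trans (ι-* (8 ℕ.* m) E) (cong (_* ι E) (trans (ι-* 8 m) (cong (_* ι m) (ι≡♯ 8))))
        l₀ = ring 2 (λ i r → i :* r :* (i :* r :- r) , # 2 :* r :* (r :* (con ½ :* (i :* (i :- con 1ℚ)))))
        scale = lin 5 (λ r z m s t → z ≼ # 4 :* m :* s ∷ s ≼ t ∷ con 0ℚ ≼ r ∷ con 0ℚ ≼ m ∷ [] , # 2 :* r :* z , # 8 :* m :* r :* t) ((♯ 2 , 0 ∷ 2 ∷ []) ∷ (♯ 8 , 1 ∷ 2 ∷ 3 ∷ []) ∷ [])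
        square = lin 5 (λ l a e r p → l ≼ p :+ a ∷ a :+ e ≼ l ∷ r ≼ e ∷ con 0ℚ ≼ a ∷ con 0ℚ ≼ e ∷ [] , (l :- a) :* (l :- a :- e) , p :* (p :- r)) ((1ℚ , 0 ∷ 0 ∷ []) ∷ (♯ 2 , 0 ∷ 1 ∷ []) ∷ (1ℚ , 0 ∷ 2 ∷ []) ∷ (1ℚ , 0 ∷ 4 ∷ []) ∷ (1ℚ , 1 ∷ 2 ∷ []) ∷ (1ℚ , 2 ∷ 4 ∷ []) ∷ [])
        lem = lin 7 (λ l a e r p m s → (l :- a) :* (l :- a :- e) ≼ p :* (p :- r) ∷ p :* (p :- r) ≼ # 8 :* m :* r :* s ∷ r ≼ e ∷ con 0ℚ ≼ m ∷ con 0ℚ ≼ s ∷ con 0ℚ ≼ a ∷ con 0ℚ ≼ e ∷ [] , l :* l :- (# 2 :* a :+ e) :* l , # 8 :* m :* e :* s) ((1ℚ , 0 ∷ []) ∷ (1ℚ , 1 ∷ []) ∷ (♯ 8 , 2 ∷ 3 ∷ 4 ∷ []) ∷ (1ℚ , 5 ∷ 5 ∷ []) ∷ (1ℚ , 5 ∷ 6 ∷ []) ∷ [])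

    -- Improving a bound for |R|

    module Contraction (α′ : ℚ) (k≤α : inv q ≤ α′) (α≤16 : α′ ≤ ♯ 16) (x₀ : ℕ) (1≤x₀ : 1 ℕ.≤ x₀) where
      module _ (bound : ∀ n → x₀ ℕ.≤ n → n ℕ.≤ X → ∣ R n ∣ ≤ α′ * ι n) {x : ℕ} (x₁≤x : x₁ x₀ ℕ.≤ x) (x≤X : x ℕ.≤ X) where
        private
          k L : ℚ
          k = inv q
          L = ℓ x
          x₀≤x : x₀ ℕ.≤ x
          x₀≤x = ℕₚ.≤-trans (ℕₚ.≤-trans (ℕₚ.m≤n+m x₀ (2 ℕ.^ (2 ℕ.* L₀ x₀))) (ℕₚ.m≤m+n _ (2 ℕ.* m ℕ.* y₀))) x₁≤x
          1≤x : 1 ℕ.≤ x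
          1≤x = ℕₚ.≤-trans 1≤x₀ x₀≤x
          L-big : ι (L₀ x₀) ≤ L
          L-big = ℓ-large (L₀ x₀) (ℕₚ.≤-trans (ℕₚ.≤-trans (ℕₚ.m≤m+n _ x₀) (ℕₚ.m≤m+n _ (2 ℕ.* m ℕ.* y₀))) x₁≤x) (ℕₚ.m≤n⇒m≤1+n x≤X)
          z : Arith
          z n = [ x // n ℕ.<? x₀ ]

        term : ∀ n → 1 ℕ.≤ n → n ℕ.≤ x → ℓ n * ∣ R (x // n) ∣ ≤ ι x * (α′ * (ℓ n * inv n) - ½ * k * (ℓ n * (inv n * good x n)) + ♯ 16 * (ℓ n * inv n * z n))
        term n p r = go (♯ 2 * (ι q * ∣ R (x // n) ∣) ≤? ι (x // n)) (x // n ℕ.<? x₀)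
          where
          N≤X = ℕₚ.≤-trans (//-≤ x n) x≤X
          go : ∀ (d : Dec (♯ 2 * (ι q * ∣ R (x // n) ∣) ≤ ι (x // n))) (e : Dec (x // n ℕ.< x₀)) →
            ℓ n * ∣ R (x // n) ∣ ≤ ι x * (α′ * (ℓ n * inv n) - ½ * k * (ℓ n * (inv n * [ d ])) + ♯ 16 * (ℓ n * inv n * [ e ]))
          -- For good n, |R(x/n)| ≤ x/(2qn) ≤ (α′ - 1/(2q)) x/n because 1/q ≤ α′; half of 1/q is
          -- saved.
          go (yes g) e = lem (ℓ n) ∣ R (x // n) ∣ (ι x) (inv n) (ι (x // n)) (ι q) k α′ [ e ] g (ι//≤ {x} p) (ι*inv 1≤q) (inv≥0 q) (ℓ≥0 n) k≤α ([]-≥0 e) (ι≥0 x ⊗ inv≥0 n) (0≤∣p∣ (R (x // n)))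
            where
            lem = lin 9 (λ l r x i N q k a z → # 2 :* (q :* r) ≼ N ∷ N ≼ x :* i ∷ q :* k ≗ con 1ℚ ∷ con 0ℚ ≼ k ∷ con 0ℚ ≼ l ∷ k ≼ a ∷ con 0ℚ ≼ z ∷ con 0ℚ ≼ x :* i ∷ con 0ℚ ≼ r ∷ [] , l :* r , x :* (a :* (l :* i) :- con ½ :* k :* (l :* (i :* con 1ℚ)) :+ # 16 :* (l :* i :* z))) ((½ , 0 ∷ 3 ∷ 4 ∷ []) ∷ (½ , 1 ∷ 3 ∷ 4 ∷ []) ∷ (- 1ℚ , 2 ∷ 8 ∷ 4 ∷ []) ∷ (1ℚ , 5 ∷ 7 ∷ 4 ∷ []) ∷ (♯ 16 , 7 ∷ 4 ∷ 6 ∷ []) ∷ [])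
          go (no _) (no N≥) = lem (ℓ n) ∣ R (x // n) ∣ (ι x) (inv n) (ι (x // n)) k α′ (bound (x // n) (ℕₚ.≮⇒≥ N≥) N≤X) (ι//≤ {x} p) (≤-trans (inv≥0 q) k≤α) (ℓ≥0 n)
            where
            lem = lin 7 (λ l r x i N k a → r ≼ a :* N ∷ N ≼ x :* i ∷ con 0ℚ ≼ a ∷ con 0ℚ ≼ l ∷ [] , l :* r , x :* (a :* (l :* i) :- con ½ :* k :* (l :* (i :* con 0ℚ)) :+ # 16 :* (l :* i :* con 0ℚ))) ((1ℚ , 0 ∷ 3 ∷ []) ∷ (1ℚ , 1 ∷ 2 ∷ 3 ∷ []) ∷ [])
          go (no _) (yes _) = lem (ℓ n) ∣ R (x // n) ∣ (ι x) (inv n) (ι (x // n)) k α′ (R-bound (x // n) N≤X) (ι//≤ {x} p) (≤-trans (inv≥0 q) k≤α) (ℓ≥0 n) (ι≥0 x ⊗ inv≥0 n)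
            where
            lem = lin 7 (λ l r x i N k a → r ≼ # 16 :* N ∷ N ≼ x :* i ∷ con 0ℚ ≼ a ∷ con 0ℚ ≼ l ∷ con 0ℚ ≼ x :* i ∷ [] , l :* r , x :* (a :* (l :* i) :- con ½ :* k :* (l :* (i :* con 0ℚ)) :+ # 16 :* (l :* i :* con 1ℚ))) ((1ℚ , 0 ∷ 3 ∷ []) ∷ (♯ 16 , 1 ∷ 3 ∷ []) ∷ (1ℚ , 2 ∷ 3 ∷ 4 ∷ []) ∷ [])

        P S Z : ℚ
        P = Sum x (λ n → ℓ n * inv n)
        S = Sum x (ℓG x≤X)
        Z = Sum x (λ n → ℓ n * inv n * z n)

        summed : Sum x (λ n → ℓ n * ∣ R (x // n) ∣) ≤ ι x * (α′ * P - ½ * k * S + ♯ 16 * Z)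
        summed = ≤-trans (Sum-mono x term) (≤-reflexive (trans (Sum-*ˡ x (ι x) _) (cong (ι x *_) (trans (Sum-+ x _ _)
          (cong₂ _+_ (trans (Sum-- x _ _) (cong₂ _-_ (Sum-*ˡ x α′ _) (Sum-*ˡ x (½ * k) _))) (Sum-*ˡ x (♯ 16) _))))))

        -- The quotient x/n drops below x₀ only for n > x/x₀, where Σ 1/n is about log x₀. So the
        -- trivial bound for R costs a single factor log x there, against log² x in the main term.
        Z-bound : Z ≤ L * (♯ 2 * ι x₀ + ♯ 10)
        Z-bound = ≤-trans Z-range (lem L (H x) (H y) (ℓ y) (ℓ x₀) (ι x₀) γ (inv x) (inv y) (ℓ≥0 x) (abs-lo (H-ℓ x 1≤x x≤X)) (abs-hi (H-ℓ y 1≤y (ℕₚ.≤-trans (//-≤ x x₀) x≤X))) (inv≤1 1≤x) (inv≤1 1≤y) (Term.t≤l 1≤x₀ x₀≤x x≤X) (ℓ≤2ι x₀ 1≤x₀ (ℕₚ.m≤n⇒m≤1+n (ℕₚ.≤-trans x₀≤x x≤X))))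
          where
          y : ℕ
          y = x // x₀
          1≤y : 1 ℕ.≤ y
          1≤y = 1≤// 1≤x₀ x₀≤x
          zero-below : ∀ n → 1 ℕ.≤ n → n ℕ.≤ y → ℓ n * inv n * z n ≡ 0ℚ
          zero-below n p r = trans (cong (ℓ n * inv n *_) ([]-no (x // n ℕ.<? x₀) (ℕₚ.≤⇒≯ (*≤⇒≤// p (subst (ℕ._≤ x) (ℕₚ.*-comm x₀ n) (≤//⇒*≤ {x} {x₀} r)))))) (*-zeroʳ (ℓ n * inv n))
          l₁ = ring 1 (λ a → a :- con 0ℚ , a)
          l₂ = ring 3 (λ a b c → a :* b :- a :* c , a :* (b :- c))
          l₃ : ∀ n → 1 ℕ.≤ n → n ℕ.≤ x → ℓ n * inv n * z n ≤ L * inv n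
          l₃ n p r = l₄ (ℓ n) L (inv n) (z n) (ℓ-mono p r (ℕₚ.m≤n⇒m≤1+n x≤X)) (inv≥0 n) ([]-≤1 (x // n ℕ.<? x₀)) (ℓ≥0 n)
            where
            l₄ = lin 4 (λ a b i z → a ≼ b ∷ con 0ℚ ≼ i ∷ z ≼ con 1ℚ ∷ con 0ℚ ≼ a ∷ [] , a :* i :* z , b :* i) ((1ℚ , 0 ∷ 1 ∷ []) ∷ (1ℚ , 2 ∷ 3 ∷ 1 ∷ []) ∷ [])
          Z-range : Z ≤ L * (H x - H y)
          Z-range = subst₂ _≤_ (trans (cong (λ w → Z - w) (Sum-vanish y zero-below)) (l₁ Z)) (trans (cong₂ _-_ (Sum-*ˡ x L inv) (Sum-*ˡ y L inv)) (l₂ L (H x) (H y)))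
            (Sum-range-mono (//-≤ x x₀) (λ n p r → l₃ n (ℕₚ.≤-trans (s≤s z≤n) p) r))
          lem = lin 9 (λ l hx hy ly l0 x0 g ix iy → con 0ℚ ≼ l ∷ :- (g :- (hx :- l)) ≼ # 4 :* ix ∷ g :- (hy :- ly) ≼ # 4 :* iy ∷ ix ≼ con 1ℚ ∷ iy ≼ con 1ℚ ∷ l :- l0 :- ly ≼ # 2 :* iy ∷ l0 ≼ # 2 :* x0 ∷ [] , l :* (hx :- hy) , l :* (# 2 :* x0 :+ # 10)) ((1ℚ , 1 ∷ 0 ∷ []) ∷ (1ℚ , 2 ∷ 0 ∷ []) ∷ (♯ 4 , 3 ∷ 0 ∷ []) ∷ (♯ 6 , 4 ∷ 0 ∷ []) ∷ (1ℚ , 5 ∷ 0 ∷ []) ∷ (1ℚ , 6 ∷ 0 ∷ []) ∷ [])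

        stage₁ : ∣ R x ∣ * (L * L) ≤ ι x * (α′ * (L * L) - k * S + ι (C₄ x₀) * (1ℚ + L))
        stage₁ = lem (∣ R x ∣ * (L * L)) (Sum x (λ n → ℓ n * ∣ R (x // n) ∣)) L (ι x) α′ k S P Z (ι x₀) (ι (C₄ x₀)) (selberg-inequality 1≤x x≤X) summed (ℓ-inv-sum x 1≤x x≤X) Z-bound α≤16 (≤-trans (inv≥0 q) k≤α) (ι≥0 x) (ℓ≥0 x) ιC₄ (ι≥0 x₀)
          where
          ιC₄ : ι (C₄ x₀) ≡ ι x₀ * ♯ 64 + ♯ 11002400
          ιC₄ = trans (ι-+ (x₀ ℕ.* 64) 11002400) (cong₂ _+_ (trans (ι-* x₀ 64) (cong (ι x₀ *_) (ι≡♯ 64))) (ι≡♯ 11002400))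
          lem : ∀ r s L x a k S P Z x0 C → r ≤ ♯ 2 * s + ♯ 11000000 * (x * (1ℚ + L)) → s ≤ x * (a * P - ½ * k * S + ♯ 16 * Z) → ♯ 2 * P ≤ L * L + ♯ 130 * (1ℚ + L) → Z ≤ L * (♯ 2 * x0 + ♯ 10) →
            a ≤ ♯ 16 → 0ℚ ≤ a → 0ℚ ≤ x → 0ℚ ≤ L → C ≡ x0 * ♯ 64 + ♯ 11002400 → 0ℚ ≤ x0 → r ≤ x * (a * (L * L) - k * S + C * (1ℚ + L))
          lem r s L x a k S P Z x0 _ h1 h2 h3 h4 a1 a0 x≥ L0 refl x00 = lem′ r s L x a k S P Z x0 h1 h2 h3 h4 a1 a0 x≥ L0 x00
            where
            lem′ = lin 10 (λ r s L x a k S P Z x0 → r ≼ # 2 :* s :+ # 11000000 :* (x :* (con 1ℚ :+ L)) ∷ s ≼ x :* (a :* P :- con ½ :* k :* S :+ # 16 :* Z) ∷ # 2 :* P ≼ L :* L :+ # 130 :* (con 1ℚ :+ L) ∷ Z ≼ L :* (# 2 :* x0 :+ # 10) ∷ a ≼ # 16 ∷ con 0ℚ ≼ a ∷ con 0ℚ ≼ x ∷ con 0ℚ ≼ L ∷ con 0ℚ ≼ x0 ∷ [] , r , x :* (a :* (L :* L) :- k :* S :+ (x0 :* # 64 :+ # 11002400) :* (con 1ℚ :+ L))) ((1ℚ , 0 ∷ []) ∷ (♯ 2 , 1 ∷ []) ∷ (1ℚ , 2 ∷ 5 ∷ 6 ∷ []) ∷ (♯ 32 , 3 ∷ 6 ∷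 []) ∷ (♯ 130 , 4 ∷ 6 ∷ []) ∷ (♯ 130 , 4 ∷ 6 ∷ 7 ∷ []) ∷ (♯ 64 , 6 ∷ 8 ∷ []) ∷ (♯ 320 , 6 ∷ []) ∷ [])

        L≥1 : 1ℚ ≤ L
        L≥1 = ≤-trans (ι≥1 (ℕₚ.m≤n+m 1 _)) L-big

        qB : ℕ
        qB = q ℕ.* B

        1≤qB : 1 ℕ.≤ qB
        1≤qB = ℕₚ.*-mono-≤ 1≤q (ℕₚ.*-mono-≤ (ℕₚ.*-mono-≤ {1} {8} (s≤s z≤n) 1≤m) (ℕₚ.*-mono-≤ {1} {2} (s≤s z≤n) (s≤s z≤n)))

        L-dominates : ♯ 2 * (ι C₂ + ♯ 2 * (ι qB * ι (C₄ x₀))) + (ι C₁ + ι E) + 1ℚ ≤ L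
        L-dominates = subst (_≤ L) (trans (ι-+ _ 1) (cong₂ _+_ (trans (ι-+ (2 ℕ.* (C₂ ℕ.+ 2 ℕ.* (q ℕ.* B ℕ.* C₄ x₀))) (C₁ ℕ.+ E)) (cong₂ _+_ (trans (two _) (cong (♯ 2 *_) (trans (ι-+ C₂ _) (cong (λ w → ι C₂ + w) (trans (two _) (cong (♯ 2 *_) (ι-* qB (C₄ x₀)))))))) (ι-+ C₁ E))) (ι≡♯ 1))) L-big
          where
          two : ∀ n → ι (2 ℕ.* n) ≡ ♯ 2 * ι n
          two n = trans (ι-* 2 n) (cong (_* ι n) (ι≡♯ 2))

        -- Multiplied by qB, the saving is log² x up to terms linear in log x; `L₀` is chosen to
        -- make these at most half of it, and ½ remains.
        stage₂ : L * L * (ι qB * ∣ R x ∣) ≤ L * L * (ι x * (ι qB * α′ - ½))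
        stage₂ = lem ∣ R x ∣ L (ι x) α′ k S (ι (C₄ x₀)) (ι q) (ι B) (ι qB) (ι C₂) (ι C₁ + ι E) stage₁ (total-saving x≤X room big) (ι*inv 1≤q) (ι-* q B) L-dominates (ι≥0 C₁ ⊕ ι≥0 E) (ι≥0 x) (ι≥0 qB) (ι≥0 (C₄ x₀)) L≥1 (ι≥0 C₂)
          where
          room : 2 ℕ.* m ℕ.* y₀ ℕ.≤ x
          room = ℕₚ.≤-trans (ℕₚ.m≤n+m _ (2 ℕ.^ (2 ℕ.* L₀ x₀) ℕ.+ x₀)) x₁≤x
          big : ι C₁ + ι E ≤ ℓ x
          big = lem (ι C₂) (ι qB * ι (C₄ x₀)) (ι C₁ + ι E) L (ι≥0 C₂) (ι≥0 qB ⊗ ι≥0 (C₄ x₀)) L-dominates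
            where
            lem = lin 4 (λ c d e L → con 0ℚ ≼ c ∷ con 0ℚ ≼ d ∷ # 2 :* (c :+ # 2 :* d) :+ e :+ con 1ℚ ≼ L ∷ [] , e , L) ((1ℚ , []) ∷ (♯ 2 , 0 ∷ []) ∷ (♯ 4 , 1 ∷ []) ∷ (1ℚ , 2 ∷ []) ∷ [])
          half = lin 4 (λ L c w e → # 2 :* (c :+ # 2 :* w) :+ e :+ con 1ℚ ≼ L ∷ con 0ℚ ≼ e ∷ con 1ℚ ≼ L ∷ con 0ℚ ≼ c ∷ con 0ℚ ≼ w ∷ [] , c :* L :+ w :* (con 1ℚ :+ L) , con ½ :* (L :* L)) ((½ , []) ∷ (½ , 0 ∷ 2 ∷ []) ∷ (½ , 0 ∷ []) ∷ (½ , 2 ∷ []) ∷ (1ℚ , 4 ∷ 2 ∷ []) ∷ (½ , 1 ∷ 2 ∷ []) ∷ (½ , 1 ∷ []) ∷ [])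
          expand = ring 8 (λ p b L x a k s C → b :* p :* (x :* (a :* (L :* L) :- k :* s :+ C :* (con 1ℚ :+ L))) , x :* (p :* b :* a :* (L :* L) :- (p :* k) :* (b :* s) :+ p :* b :* C :* (con 1ℚ :+ L)))
          fin = lin 8 (λ L x a p b t c w → L :* L :- c :* L ≼ t ∷ c :* L :+ w :* (con 1ℚ :+ L) ≼ con ½ :* (L :* L) ∷ con 0ℚ ≼ x ∷ [] , x :* (p :* b :* a :* (L :* L) :- con 1ℚ :* t :+ w :* (con 1ℚ :+ L)) , L :* L :* (x :* (p :* b :* a :- con ½))) ((1ℚ , 0 ∷ 2 ∷ []) ∷ (1ℚ , 1 ∷ 2 ∷ []) ∷ [])
          l₀ = ring 4 (λ L p b r → L :* L :* (p :* b :* r) , b :* p :* (r :* (L :* L)))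
          lem : ∀ r L x a k s C q b qb c e → r * (L * L) ≤ x * (a * (L * L) - k * s + C * (1ℚ + L)) → L * L - c * L ≤ b * s → q * k ≡ 1ℚ → qb ≡ q * b →
            ♯ 2 * (c + ♯ 2 * (qb * C)) + e + 1ℚ ≤ L → 0ℚ ≤ e → 0ℚ ≤ x → 0ℚ ≤ qb → 0ℚ ≤ C → 1ℚ ≤ L → 0ℚ ≤ c → L * L * (qb * r) ≤ L * L * (x * (qb * a - ½))
          lem r L x a k s C q b _ c e h1 h2 kq refl h3 e0 x0 qb0 C0 L1 c0 = ≤-trans (≤-reflexive (l₀ L q b r)) (≤-trans
            (*-monoˡ-≤-nonNeg (b * q) {{nonNegative (subst (0ℚ ≤_) (*-comm q b) qb0)}} h1)
            (≤-trans (≤-reflexive (trans (expand q b L x a k s C) (cong (λ w → x * (q * b * a * (L * L) - w * (b * s) + q * b * C * (1ℚ + L))) kq)))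
              (fin L x a q b (b * s) c (q * b * C) h2 (half L c (q * b * C) e h3 e0 L1 c0 (qb0 ⊗ C0)) x0)))

        contraction : ∣ R x ∣ ≤ (α′ - gain) * ι x
        contraction = *-cancelˡ-≤ (ι≥1 1≤qB) (≤-trans (*-cancelˡ-≤ (lem₁ L L≥1) stage₂) (≤-reflexive (trans (cong (λ w → ι x * (ι qB * α′ - ½ * w)) (sym (ι*inv 1≤qB))) (lem₂ (ι x) (ι qB) α′ (inv qB)))))
          where
          lem₁ = lin 1 (λ L → con 1ℚ ≼ L ∷ [] , con 1ℚ , L :* L) ((♯ 2 , 0 ∷ []) ∷ (1ℚ , 0 ∷ 0 ∷ []) ∷ [])
          lem₂ = ring 4 (λ x p a i → x :* (p :* a :- con ½ :* (p :* i)) , p :* ((a :- con ½ :* i) :* x))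

-- The prime number theorem

ψ[_] : ∀ {X} → LogTo X → 1 ℕ.≤ X → Arith
ψ[_] {X} logarithm 1≤X = Analysis.ψ X 1≤X logarithm

Remainder≤ : ℚ → ℕ → Set
Remainder≤ a x₀ = ∀ X (1≤X : 1 ℕ.≤ X) (logarithm : LogTo X) n → x₀ ℕ.≤ n → n ℕ.≤ X → ∣ ψ[ logarithm ] 1≤X n - ι n ∣ ≤ a * ι n

-- x₀ does not depend on the approximate logarithm, nor on the range in which it is one.
prime-number-theorem : ∀ q → 1 ℕ.≤ q → ∃[ x₀ ] (1 ℕ.≤ x₀ × Remainder≤ (inv q) x₀)
-- A round gains 1/(2qB), so 32 qB rounds use up the initial bound 16.
prime-number-theorem q 1≤q = iterate (q ℕ.* B ℕ.* 32) (♯ 16) enough ≤-refl 1 ℕₚ.≤-refl (λ X 1≤X logarithm n _ n≤X → Analysis.R-bound X 1≤X logarithm n n≤X)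
  where
  open Constants q
  1≤qB : 1 ℕ.≤ q ℕ.* B
  1≤qB = ℕₚ.*-mono-≤ 1≤q (ℕₚ.*-mono-≤ (ℕₚ.*-mono-≤ {1} {8} (s≤s z≤n) (ℕₚ.*-mono-≤ {1} {24} (s≤s z≤n) 1≤q)) (ℕₚ.*-mono-≤ {1} {2} (s≤s z≤n) (s≤s z≤n)))
  lem₀ = lin 4 (λ k p i n → con 0ℚ ≼ k ∷ p :* i ≗ con 1ℚ ∷ n ≗ p :* # 32 ∷ con 0ℚ ≼ i ∷ [] , # 16 , k :+ n :* (con ½ :* i)) ((1ℚ , 0 ∷ []) ∷ (- (♯ 16) , 1 ∷ []) ∷ (- ½ , 2 ∷ 3 ∷ []) ∷ [])
  enough : ♯ 16 ≤ inv q + ι (q ℕ.* B ℕ.* 32) * gain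
  enough = lem₀ (inv q) (ι (q ℕ.* B)) (inv (q ℕ.* B)) (ι (q ℕ.* B ℕ.* 32)) (inv≥0 q) (ι*inv 1≤qB) (trans (ι-* (q ℕ.* B) 32) (cong (ι (q ℕ.* B) *_) (ι≡♯ 32))) (inv≥0 (q ℕ.* B))
  gain≥0 : 0ℚ ≤ gain
  gain≥0 = ½≥0 ⊗ inv≥0 (q ℕ.* B)
  lem₁ = lin 5 (λ a k n m g → a ≼ k :+ m :* g ∷ m ≗ n :+ con 1ℚ ∷ con 0ℚ ≼ g ∷ [] , a :- g , k :+ n :* g) ((1ℚ , 0 ∷ []) ∷ (1ℚ , 1 ∷ 2 ∷ []) ∷ [])
  lem₂ = lin 2 (λ a g → a ≼ # 16 ∷ con 0ℚ ≼ g ∷ [] , a :- g , # 16) ((1ℚ , 0 ∷ []) ∷ (1ℚ , 1 ∷ []) ∷ [])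
  weaken : ∀ {a b x₀} → a ≤ b → Remainder≤ a x₀ → Remainder≤ b x₀
  weaken a≤b h X 1≤X logarithm n p r = ≤-trans (h X 1≤X logarithm n p r) (*-monoʳ-≤-nonNeg (ι n) {{nonNegative (ι≥0 n)}} a≤b)
  iterate : ∀ j a → a ≤ inv q + ι j * gain → a ≤ ♯ 16 → ∀ x₀ → 1 ℕ.≤ x₀ → Remainder≤ a x₀ → ∃[ x ] (1 ℕ.≤ x × Remainder≤ (inv q) x)
  iterate zero a h _ x₀ 1≤x₀ r = x₀ , 1≤x₀ , weaken (≤-trans h (≤-reflexive (trans (cong (λ w → inv q + w * gain) (ι≡♯ 0)) (trans (cong (λ w → inv q + w) (*-zeroˡ gain)) (+-identityʳ (inv q)))))) r
  iterate (suc j) a h a≤16 x₀ 1≤x₀ r with ≤-total a (inv q)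
  ... | inj₁ a≤k = x₀ , 1≤x₀ , weaken a≤k r
  ... | inj₂ k≤a = iterate j (a - gain) (lem₁ a (inv q) (ι j) (ι (suc j)) gain h (ι-suc j) gain≥0) (lem₂ a gain a≤16 gain≥0) (x₁ x₀)
      (ℕₚ.≤-trans 1≤x₀ (ℕₚ.≤-trans (ℕₚ.m≤n+m x₀ (2 ℕ.^ (2 ℕ.* L₀ x₀))) (ℕₚ.m≤m+n _ (2 ℕ.* m ℕ.* y₀))))
      (λ X 1≤X logarithm n p n≤X → Analysis.Step.Contraction.contraction X 1≤X logarithm q 1≤q a k≤a a≤16 x₀ 1≤x₀ (r X 1≤X logarithm) p n≤X)

-- Existence of the rational logarithms

H-block : ∀ a b → 1 ℕ.≤ a → (ι b * inv (a ℕ.+ b) ≤ H (a ℕ.+ b) - H a) × (H (a ℕ.+ b) - H a ≤ ι b * inv a)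
H-block a b 1≤a =
  subst (_≤ H (a ℕ.+ b) - H a) (eq (inv (a ℕ.+ b))) (Sum-range-mono (ℕₚ.m≤m+n a b) (λ n p r → inv-mono (ℕₚ.≤-trans (s≤s z≤n) p) r)) ,
  subst (H (a ℕ.+ b) - H a ≤_) (eq (inv a)) (Sum-range-mono (ℕₚ.m≤m+n a b) (λ n p r → inv-mono 1≤a (ℕₚ.<⇒≤ p)))
  where
  lem = ring 3 (λ a b i → (a :+ b) :* i :- a :* i , b :* i)
  eq : ∀ i → Sum (a ℕ.+ b) (λ _ → i) - Sum a (λ _ → i) ≡ ι b * i
  eq i = trans (cong₂ _-_ (trans (Sum-const (a ℕ.+ b) i) (cong (_* i) (ι-+ a b))) (Sum-const a i)) (lem (ι a) (ι b) i)

ι*inv-* : ∀ {m n} → 1 ℕ.≤ m → 1 ℕ.≤ n → ι m * inv (m ℕ.* n) ≡ inv n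
ι*inv-* {m} {n} p q = trans (cong (ι m *_) (inv-* p q)) (trans (sym (*-assoc (ι m) (inv m) (inv n))) (trans (cong (_* inv n) (ι*inv p)) (*-identityˡ (inv n))))

-- The m terms by which H (m j) grows lie between 1/(m (j + 1)) and 1/(m j), so they add up to
-- something between 1/(j + 1) and 1/j; H (m j) - H j is nearly independent of j.
H-ratio-step : ∀ m j → 1 ℕ.≤ m → 1 ℕ.≤ j → ∣ (H (m ℕ.* suc j) - H (suc j)) - (H (m ℕ.* j) - H j) ∣ ≤ inv j - inv (suc j)
H-ratio-step m j 1≤m 1≤j = abs≤
    (lem₁ (H (m ℕ.* suc j)) (H j) (H (m ℕ.* j)) (inv (suc j)) (inv j) (subst₂ (λ a b → H a - H (m ℕ.* j) ≤ b) eq (ι*inv-* 1≤m 1≤j) (proj₂ blk)))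
    (lem₂ (H (m ℕ.* suc j)) (H j) (H (m ℕ.* j)) (inv (suc j)) (inv j) (subst₂ (λ a b → b ≤ H a - H (m ℕ.* j)) eq (trans (cong (λ z → ι m * inv z) eq) (ι*inv-* 1≤m (s≤s z≤n))) (proj₁ blk)) (inv-mono 1≤j (ℕₚ.n≤1+n j)))
  where
  eq : m ℕ.* j ℕ.+ m ≡ m ℕ.* suc j
  eq = trans (ℕₚ.+-comm (m ℕ.* j) m) (sym (ℕₚ.*-suc m j))
  blk = H-block (m ℕ.* j) m (ℕₚ.*-mono-≤ 1≤m 1≤j)
  lem₁ = lin 5 (λ a h b j i → a :- b ≼ i ∷ [] , (a :- (h :+ j)) :- (b :- h) , i :- j) ((1ℚ , 0 ∷ []) ∷ [])
  lem₂ = lin 5 (λ a h b j i → j ≼ a :- b ∷ j ≼ i ∷ [] , :- ((a :- (h :+ j)) :- (b :- h)) , i :- j) ((1ℚ , 0 ∷ []) ∷ (1ℚ , 1 ∷ []) ∷ [])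

sumℚ : (ℕ → ℚ) → List ℕ → ℚ
sumℚ f []       = 0ℚ
sumℚ f (p ∷ ps) = f p + sumℚ f ps

sumℚ-++ : ∀ f ps qs → sumℚ f (ps ++ qs) ≡ sumℚ f ps + sumℚ f qs
sumℚ-++ f []       qs = sym (+-identityˡ (sumℚ f qs))
sumℚ-++ f (p ∷ ps) qs = trans (cong (λ z → f p + z) (sumℚ-++ f ps qs)) (sym (+-assoc (f p) (sumℚ f ps) (sumℚ f qs)))

sumℚ-↭ : ∀ f {ps qs} → ps ↭ qs → sumℚ f ps ≡ sumℚ f qs
sumℚ-↭ f ↭.refl = refl
sumℚ-↭ f (↭.prep p h) = cong (λ z → f p + z) (sumℚ-↭ f h)
sumℚ-↭ f (↭.swap {xs} {ys} p q h) = trans (cong (λ z → f p + (f q + z)) (sumℚ-↭ f h)) (lem (f p) (f q) (sumℚ f ys))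
  where
  lem = ring 3 (λ a b c → a :+ (b :+ c) , b :+ (a :+ c))
sumℚ-↭ f (↭.trans h k) = trans (sumℚ-↭ f h) (sumℚ-↭ f k)

sumℚ-≥0 : ∀ f → (∀ n → 0ℚ ≤ f n) → ∀ ps → 0ℚ ≤ sumℚ f ps
sumℚ-≥0 f h []       = ≤-refl
sumℚ-≥0 f h (p ∷ ps) = h p ⊕ sumℚ-≥0 f h ps

-- log n is approximated by Σ 1/j over N < j ≤ nN; additivity is forced by summing over the prime factors of n.
module Logarithm (X : ℕ) where
  S N : ℕ
  S = suc X
  -- So large that the errors n/N and (n + 1)/N together stay below 1/(n + 1)² for n ≤ X
  -- (`precision`).
  N = 2 ℕ.* (S ℕ.* (S ℕ.* S))
  1≤N : 1 ℕ.≤ N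
  1≤N = ℕₚ.*-mono-≤ {1} {2} (s≤s z≤n) (ℕₚ.*-mono-≤ {1} {S} (s≤s z≤n) (ℕₚ.*-mono-≤ {1} {S} {1} {S} (s≤s z≤n) (s≤s z≤n)))

  Ln ln : Arith
  Ln n = H (n ℕ.* N) - H N
  -- The absolute value only affects n = 0; it makes `ln` nonnegative without a side condition.
  ln n = ∣ Ln n ∣

  Ln≥0 : ∀ n → 1 ℕ.≤ n → 0ℚ ≤ Ln n
  Ln≥0 n p = ↑ (Sum-extend inv (m≤d*m N p) (λ k _ _ → inv≥0 k))

  Ln-1 : Ln 1 ≡ 0ℚ
  Ln-1 = trans (cong (λ z → H z - H N) (ℕₚ.*-identityˡ N)) (+-inverseʳ (H N))

  Ln-step : ∀ n → 1 ℕ.≤ n → (inv (suc n) ≤ Ln (suc n) - Ln n) × (Ln (suc n) - Ln n ≤ inv n)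
  Ln-step n 1≤n =
    subst₂ _≤_ (trans (cong (λ z → ι N * inv z) (trans eq (ℕₚ.*-comm (suc n) N))) (ι*inv-* 1≤N (s≤s z≤n))) lhs (proj₁ blk) ,
    subst₂ _≤_ lhs (trans (cong (λ z → ι N * inv z) (ℕₚ.*-comm n N)) (ι*inv-* 1≤N 1≤n)) (proj₂ blk)
    where
    blk = H-block (n ℕ.* N) N (ℕₚ.*-mono-≤ 1≤n 1≤N)
    eq : n ℕ.* N ℕ.+ N ≡ suc n ℕ.* N
    eq = ℕₚ.+-comm (n ℕ.* N) N
    lem = ring 3 (λ a b c → a :- b , (a :- c) :- (b :- c))
    lhs : H (n ℕ.* N ℕ.+ N) - H (n ℕ.* N) ≡ Ln (suc n) - Ln n
    lhs = trans (cong (λ z → H z - H (n ℕ.* N)) eq) (lem (H (suc n ℕ.* N)) (H (n ℕ.* N)) (H N))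

  -- Ln (m n) - Ln n and Ln m are the values of H (m j) - H j at j = n N and j = N, and by
  -- `H-ratio-step` these differ by at most 1/N.
  Ln-* : ∀ m n → 1 ℕ.≤ m → 1 ℕ.≤ n → ∣ Ln (m ℕ.* n) - (Ln m + Ln n) ∣ ≤ inv N
  Ln-* m n 1≤m 1≤n = ≤-trans (subst (λ z → ∣ z ∣ ≤ inv N - inv (n ℕ.* N)) eq
      (dominated (n ℕ.* N) (λ j → H (m ℕ.* j) - H j) inv (λ j p _ → H-ratio-step m j 1≤m p) 1≤N (m≤d*m N 1≤n) (ℕₚ.n≤1+n (n ℕ.* N))))
      (lem₂ (inv N) (inv (n ℕ.* N)) (inv≥0 (n ℕ.* N)))
    where
    lem₂ = lin 2 (λ a b → con 0ℚ ≼ b ∷ [] , a :- b , a) ((1ℚ , 0 ∷ []) ∷ [])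
    lem = ring 4 (λ a b c d → (a :- b) :- (c :- d) , (a :- d) :- ((c :- d) :+ (b :- d)))
    eq : (H (m ℕ.* (n ℕ.* N)) - H (n ℕ.* N)) - (H (m ℕ.* N) - H N) ≡ Ln (m ℕ.* n) - (Ln m + Ln n)
    eq = trans (lem (H (m ℕ.* (n ℕ.* N))) (H (n ℕ.* N)) (H (m ℕ.* N)) (H N)) (cong (λ z → (H z - H N) - (Ln m + Ln n)) (sym (ℕₚ.*-assoc m n N)))

  abstract
    ℓ : Arith
    ℓ n = sumℚ ln (fac n)

    ℓ≥0 : ∀ n → 0ℚ ≤ ℓ n
    ℓ≥0 n = sumℚ-≥0 ln (λ n → 0≤∣p∣ (Ln n)) (fac n)

    ℓ-* : ∀ m n → 1 ℕ.≤ m → 1 ℕ.≤ n → ℓ (m ℕ.* n) ≡ ℓ m + ℓ n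
    ℓ-* m n p q = trans (sumℚ-↭ ln (fac-* p q)) (sumℚ-++ ln (fac m) (fac n))

    ℓ-prime : ∀ {p} → Prime p → ℓ p ≡ Ln p
    ℓ-prime {p} pp = trans (cong (λ z → sumℚ ln (fac z)) (sym (ℕₚ.*-identityʳ p))) (trans (sumℚ-↭ ln (fac-prime-* pp ℕₚ.≤-refl)) (trans (+-identityʳ (ln p)) (0≤p⇒∣p∣≡p (Ln≥0 p (prime≥1 pp)))))

    ℓ-1 : ℓ 1 ≡ 0ℚ
    ℓ-1 = refl

  -- Each prime factor adds an error of at most 1/N, and m + 1 ≤ p m keeps the total below n/N.
  ℓ-Ln : ∀ n → 1 ℕ.≤ n → ∣ ℓ n - Ln n ∣ ≤ ι n * inv N
  ℓ-Ln = prime-rec _ base step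
    where
    base : ∣ ℓ 1 - Ln 1 ∣ ≤ ι 1 * inv N
    base = subst₂ (λ a b → ∣ a - b ∣ ≤ ι 1 * inv N) (sym ℓ-1) (sym Ln-1) (ι≥0 1 ⊗ inv≥0 N)
    step : ∀ p m → Prime p → 1 ℕ.≤ m → ∣ ℓ m - Ln m ∣ ≤ ι m * inv N → ∣ ℓ (p ℕ.* m) - Ln (p ℕ.* m) ∣ ≤ ι (p ℕ.* m) * inv N
    step p m pp 1≤m ih = ≤-trans (subst (λ z → ∣ z ∣ ≤ ι m * inv N + inv N) (sym eq) (abs-- ih (Ln-* p m (prime≥1 pp) 1≤m)))
        (≤-trans (≤-reflexive (trans (lem₁ (ι m) (inv N)) (cong (_* inv N) (sym (ι-suc m))))) (*-monoʳ-≤-nonNeg (inv N) {{nonNegative (inv≥0 N)}} (ι-mono m<pm)))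
      where
      lem₁ = ring 2 (λ a i → a :* i :+ i , (a :+ con 1ℚ) :* i)
      lem = ring 4 (λ a b c d → (a :+ b) :- d , (b :- c) :- (d :- (a :+ c)))
      eq : ℓ (p ℕ.* m) - Ln (p ℕ.* m) ≡ (ℓ m - Ln m) - (Ln (p ℕ.* m) - (Ln p + Ln m))
      eq = trans (cong (_- Ln (p ℕ.* m)) (trans (ℓ-* p m (prime≥1 pp) 1≤m) (cong (_+ ℓ m) (ℓ-prime pp)))) (lem (Ln p) (ℓ m) (Ln m) (Ln (p ℕ.* m)))
      m<pm : m ℕ.< p ℕ.* m
      m<pm = ℕₚ.≤-trans (ℕₚ.+-monoˡ-≤ m {1} {m} 1≤m) (ℕₚ.≤-trans (ℕₚ.≤-reflexive (cong (m ℕ.+_) (sym (ℕₚ.+-identityʳ m)))) (ℕₚ.*-monoˡ-≤ m (ℕ.nonTrivial⇒n>1 p {{prime⇒nonTrivial pp}})))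

  precision : ∀ n → 1 ℕ.≤ n → n ℕ.≤ X → (ι n + ι (suc n)) * inv N ≤ inv (suc n) * inv (suc n)
  precision n 1≤n n≤X = ≤-trans (lem (ι n) (ι (suc n)) (inv N) (inv N′) (ι-mono (ℕₚ.n≤1+n n)) (inv-mono 1≤N′ N′≤N) (inv≥0 N′) (ι≥0 n) (ι≥0 (suc n)))
      (≤-reflexive (trans (cong (λ z → ♯ 2 * ι s * z) inv-N′) (trans (l₀ (ι s) (inv 2) (inv s)) (trans (cong₂ (λ a b → a * b * (inv s * inv s)) two (ι*inv 1≤s)) (l₁ (inv s * inv s))))))
    where
    s N′ : ℕ
    s = suc n
    1≤s : 1 ℕ.≤ s
    1≤s = s≤s z≤n
    N′ = 2 ℕ.* (s ℕ.* (s ℕ.* s))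
    1≤N′ : 1 ℕ.≤ N′
    1≤N′ = ℕₚ.*-mono-≤ {1} {2} (s≤s z≤n) (ℕₚ.*-mono-≤ {1} {s} (s≤s z≤n) (ℕₚ.*-mono-≤ {1} {s} {1} {s} (s≤s z≤n) (s≤s z≤n)))
    N′≤N : N′ ℕ.≤ N
    N′≤N = ℕₚ.*-monoʳ-≤ 2 (ℕₚ.*-mono-≤ (s≤s n≤X) (ℕₚ.*-mono-≤ (s≤s n≤X) (s≤s n≤X)))
    inv-N′ : inv N′ ≡ inv 2 * (inv s * (inv s * inv s))
    inv-N′ = trans (inv-* (s≤s z≤n) (ℕₚ.*-mono-≤ {1} {s} 1≤s (ℕₚ.*-mono-≤ {1} {s} {1} {s} 1≤s 1≤s))) (cong (inv 2 *_) (trans (inv-* 1≤s (ℕₚ.*-mono-≤ {1} {s} {1} {s} 1≤s 1≤s)) (cong (inv s *_) (inv-* 1≤s 1≤s))))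
    two : ♯ 2 * inv 2 ≡ 1ℚ
    two = trans (cong (_* inv 2) (sym (ι≡♯ 2))) (ι*inv (s≤s z≤n))
    l₀ = ring 3 (λ s a i → # 2 :* s :* (a :* (i :* (i :* i))) , (# 2 :* a) :* (s :* i) :* (i :* i))
    l₁ = ring 1 (λ a → con 1ℚ :* con 1ℚ :* a , a)
    lem = lin 4 (λ n s i j → n ≼ s ∷ i ≼ j ∷ con 0ℚ ≼ j ∷ con 0ℚ ≼ n ∷ con 0ℚ ≼ s ∷ [] , (n :+ s) :* i , # 2 :* s :* j) ((1ℚ , 0 ∷ 2 ∷ []) ∷ (1ℚ , 1 ∷ 3 ∷ []) ∷ (1ℚ , 1 ∷ 4 ∷ []) ∷ [])

  module _ (n : ℕ) (1≤n : 1 ℕ.≤ n) (n≤X : n ℕ.≤ X) where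
    private
      i = inv n
      j = inv (suc n)
      j≤i = inv-mono 1≤n (ℕₚ.n≤1+n n)
    upper : ℓ (suc n) - ℓ n ≤ i + i * i
    upper = lem (ℓ (suc n)) (ℓ n) (Ln (suc n)) (Ln n) (ι n) (ι (suc n)) (inv N) i j (abs-hi (ℓ-Ln (suc n) (s≤s z≤n))) (abs-lo (ℓ-Ln n 1≤n)) (proj₂ (Ln-step n 1≤n)) (precision n 1≤n n≤X) j≤i (inv≥0 (suc n))
      where
      lem = lin 9 (λ a b c d n s e i j → a :- c ≼ s :* e ∷ :- (b :- d) ≼ n :* e ∷ c :- d ≼ i ∷ (n :+ s) :* e ≼ j :* j ∷ j ≼ i ∷ con 0ℚ ≼ j ∷ [] , a :- b , i :+ i :* i) ((1ℚ , 0 ∷ []) ∷ (1ℚ , 1 ∷ []) ∷ (1ℚ , 2 ∷ []) ∷ (1ℚ , 3 ∷ []) ∷ (1ℚ , 4 ∷ 4 ∷ []) ∷ (♯ 2 , 4 ∷ 5 ∷ []) ∷ [])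
    lower : j - j * j ≤ ℓ (suc n) - ℓ n
    lower = lem (ℓ (suc n)) (ℓ n) (Ln (suc n)) (Ln n) (ι n) (ι (suc n)) (inv N) i j (abs-lo (ℓ-Ln (suc n) (s≤s z≤n))) (abs-hi (ℓ-Ln n 1≤n)) (proj₁ (Ln-step n 1≤n)) (precision n 1≤n n≤X)
      where
      lem = lin 9 (λ a b c d n s e i j → :- (a :- c) ≼ s :* e ∷ b :- d ≼ n :* e ∷ j ≼ c :- d ∷ (n :+ s) :* e ≼ j :* j ∷ [] , j :- j :* j , a :- b) ((1ℚ , 0 ∷ []) ∷ (1ℚ , 1 ∷ []) ∷ (1ℚ , 2 ∷ []) ∷ (1ℚ , 3 ∷ []) ∷ [])
    lower′ : i - ♯ 2 * (i * i) ≤ ℓ (suc n) - ℓ n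
    lower′ = ≤-trans (lem i j (inv-suc 1≤n) j≤i (inv≥0 (suc n))) lower
      where
      lem = lin 2 (λ i j → i :- j ≗ i :* j ∷ j ≼ i ∷ con 0ℚ ≼ j ∷ [] , i :- # 2 :* (i :* i) , j :- j :* j) ((1ℚ , 0 ∷ []) ∷ (♯ 2 , 1 ∷ 1 ∷ []) ∷ (♯ 3 , 1 ∷ 2 ∷ []) ∷ [])
    monotone : ℓ n ≤ ℓ (suc n)
    monotone = lem (ℓ n) (ℓ (suc n)) j lower (inv≤1 (s≤s z≤n)) (inv≥0 (suc n))
      where
      lem = lin 3 (λ a b j → j :- j :* j ≼ b :- a ∷ j ≼ con 1ℚ ∷ con 0ℚ ≼ j ∷ [] , a , b) ((1ℚ , 0 ∷ []) ∷ (1ℚ , 1 ∷ 2 ∷ []) ∷ [])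

  logarithm : LogTo X
  logarithm = record
    { ℓ = ℓ ; ℓ-* = ℓ-* ; ℓ≥0 = ℓ≥0 ; step≥0 = monotone ; step-hi = upper ; step-lo = lower′
    ; ℓ2≥½ = subst (½ ≤_) (sym (ℓ-prime (from-yes (prime? 2)))) (lem (Ln 2) (Ln 1) (inv 2) (proj₁ (Ln-step 1 ℕₚ.≤-refl)) Ln-1 (trans (cong (_* inv 2) (sym (ι≡♯ 2))) (ι*inv (s≤s z≤n))))
    }
    where
    lem = lin 3 (λ a b i → i ≼ a :- b ∷ b ≗ con 0ℚ ∷ # 2 :* i ≗ con 1ℚ ∷ [] , con ½ , a) ((1ℚ , 0 ∷ []) ∷ (- 1ℚ , 1 ∷ []) ∷ (- ½ , 2 ∷ []) ∷ [])

-- Units modulo M and a shift with few coincidences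

Sum-≤-one : ∀ D (f : Arith) → (∀ n → f n ≡ 0ℚ ⊎ f n ≡ 1ℚ) → (∀ a b → 1 ℕ.≤ a → a ℕ.≤ D → 1 ℕ.≤ b → b ℕ.≤ D → f a ≡ 1ℚ → f b ≡ 1ℚ → a ≡ b) → Sum D f ≤ 1ℚ
Sum-≤-one zero    f bit uniq = 0≤1
Sum-≤-one (suc D) f bit uniq with bit (suc D)
... | inj₁ z = subst (_≤ 1ℚ) (sym (trans (cong (λ a → Sum D f + a) z) (+-identityʳ (Sum D f)))) (Sum-≤-one D f bit (λ a b p q r s → uniq a b p (ℕₚ.m≤n⇒m≤1+n q) r (ℕₚ.m≤n⇒m≤1+n s)))
... | inj₂ o = ≤-reflexive (trans (cong₂ _+_ (Sum-vanish D others) o) (+-identityˡ 1ℚ))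
  where
  others : ∀ n → 1 ℕ.≤ n → n ℕ.≤ D → f n ≡ 0ℚ
  others n p q with bit n
  ... | inj₁ z = z
  ... | inj₂ e = ⊥-elim (ℕₚ.<⇒≢ (s≤s q) (uniq n (suc D) p (ℕₚ.m≤n⇒m≤1+n q) (s≤s z≤n) ℕₚ.≤-refl e o))

argmin : ∀ M (f : Arith) → 1 ℕ.≤ M → ∃[ c ] (1 ℕ.≤ c × c ℕ.≤ M × (∀ n → 1 ℕ.≤ n → n ℕ.≤ M → f c ≤ f n))
argmin (suc zero) f _ = 1 , ℕₚ.≤-refl , ℕₚ.≤-refl , λ n p q → ≤-reflexive (cong f (ℕₚ.≤-antisym p q))
argmin (suc (suc M)) f _ with argmin (suc M) f (s≤s z≤n)
... | c , p , q , h with ≤-total (f c) (f (suc (suc M)))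
...   | inj₁ le = c , p , ℕₚ.m≤n⇒m≤1+n q , λ n r s → case n r (ℕₚ.m≤n⇒m<n∨m≡n s)
  where
  case : ∀ n → 1 ℕ.≤ n → (n ℕ.< suc (suc M)) ⊎ (n ≡ suc (suc M)) → f c ≤ f n
  case n r (inj₁ (s≤s s)) = h n r s
  case n r (inj₂ refl) = le
...   | inj₂ ge = suc (suc M) , s≤s z≤n , ℕₚ.≤-refl , λ n r s → case n r (ℕₚ.m≤n⇒m<n∨m≡n s)
  where
  case : ∀ n → 1 ℕ.≤ n → (n ℕ.< suc (suc M)) ⊎ (n ≡ suc (suc M)) → f (suc (suc M)) ≤ f n
  case n r (inj₁ (s≤s s)) = ≤-trans ge (h n r s)
  case n r (inj₂ refl) = ≤-refl

module Units (M : ℕ) (1≤M : 1 ℕ.≤ M) where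
  u : Arith
  u n = [ coprime? n M ]

  u≥0 : ∀ n → 0ℚ ≤ u n
  u≥0 n = []-≥0 (coprime? n M)

  u≤1 : ∀ n → u n ≤ 1ℚ
  u≤1 n = []-≤1 (coprime? n M)

  u-periodic : Periodic M u
  u-periodic n = []-cong (coprime? (M ℕ.+ n) M) (coprime? n M) (λ c (d₁ , d₂) → c (∣.∣m∣n⇒∣m+n d₂ d₁ , d₂)) (λ c → Coprimality.coprime-+ c)

  φ : ℚ
  φ = Sum M u

  φ≥1 : 1ℚ ≤ φ
  φ≥1 = subst (_≤ φ) (trans (+-identityˡ (u 1)) ([]-yes (coprime? 1 M) (Coprimality.1-coprimeTo M))) (Sum-extend u 1≤M (λ n _ _ → u≥0 n))

  -- Counts the i with both n and n + c + i units, for units n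
  w : ℕ → ℕ → Arith
  w c L n = Sum L (λ i → u n * u (n ℕ.+ c ℕ.+ i))

  W : ℕ → ℕ → ℚ
  W c L = Sum M (w c L)

  w≥0 : ∀ c L n → 0ℚ ≤ w c L n
  w≥0 c L n = Sum-≥0 L (λ i _ _ → u≥0 n ⊗ u≥0 (n ℕ.+ c ℕ.+ i))

  w≤ : ∀ c L n → w c L n ≤ ι L
  w≤ c L n = ≤-trans (Sum-mono L (λ i _ _ → lem (u n) (u (n ℕ.+ c ℕ.+ i)) (u≥0 n) (u≤1 n) (u≤1 (n ℕ.+ c ℕ.+ i)))) (≤-reflexive (trans (Sum-const L 1ℚ) (*-identityʳ (ι L))))
    where
    lem = lin 2 (λ a b → con 0ℚ ≼ a ∷ a ≼ con 1ℚ ∷ b ≼ con 1ℚ ∷ [] , a :* b , con 1ℚ) ((1ℚ , 1 ∷ []) ∷ (1ℚ , 0 ∷ 2 ∷ []) ∷ [])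

  W≥0 : ∀ c L → 0ℚ ≤ W c L
  W≥0 c L = Sum-≥0 M (λ n _ _ → w≥0 c L n)

  w-periodic : ∀ c L → Periodic M (w c L)
  w-periodic c L n = Sum-cong L (λ i _ _ → cong₂ _*_ (u-periodic n) (trans (cong u (trans (cong (ℕ._+ i) (ℕₚ.+-assoc M n c)) (ℕₚ.+-assoc M (n ℕ.+ c) i))) (u-periodic (n ℕ.+ c ℕ.+ i))))

  -- For fixed n and i the argument n + c + i runs through a full period with c, so the sum over c
  -- of the second factor is φ.
  W-average : ∀ L → Sum M (λ c → W c L) ≡ ι L * (φ * φ)
  W-average L = begin
    Sum M (λ c → Sum M (λ n → Sum L (λ i → u n * u (n ℕ.+ c ℕ.+ i))))
      ≡⟨ Sum-swap M M _ ⟩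
    Sum M (λ n → Sum M (λ c → Sum L (λ i → u n * u (n ℕ.+ c ℕ.+ i))))
      ≡⟨ Sum-cong M (λ n _ _ → trans (Sum-swap M L _) (Sum-cong L (λ i _ _ → trans (Sum-*ˡ M (u n) _) (cong (u n *_)
           (trans (Sum-cong M (λ c _ _ → cong u (trans (ℕₚ.+-assoc n c i) (trans (cong (n ℕ.+_) (ℕₚ.+-comm c i)) (sym (ℕₚ.+-assoc n i c)))))) (Sum-shift M u u-periodic (n ℕ.+ i))))))) ⟩
    Sum M (λ n → Sum L (λ i → u n * φ))
      ≡⟨ Sum-cong M (λ n _ _ → trans (Sum-const L (u n * φ)) (lem (ι L) (u n) φ)) ⟩
    Sum M (λ n → u n * (ι L * φ))
      ≡⟨ Sum-*ʳ M (ι L * φ) u ⟩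
    φ * (ι L * φ)
      ≡⟨ *-left-comm φ (ι L) φ ⟩
    ι L * (φ * φ) ∎
    where
    open ≡-Reasoning
    lem = ring 3 (λ l a f → l :* (a :* f) , a :* (l :* f))

  small-shift : ∀ L → ∃[ c ] (ι M * W c L ≤ ι L * (φ * φ))
  small-shift L with argmin M (λ c → W c L) 1≤M
  ... | c , _ , _ , h = c , subst₂ _≤_ (Sum-const M (W c L)) (W-average L) (Sum-mono M h)

  Sum-periods : ∀ k → Sum (M ℕ.* k) u ≡ ι k * φ
  Sum-periods zero    = trans (cong (λ z → Sum z u) (ℕₚ.*-zeroʳ M)) (sym (trans (cong (_* φ) (ι≡♯ 0)) (*-zeroˡ φ)))
  Sum-periods (suc k) = trans (cong (λ z → Sum z u) (ℕₚ.*-suc M k)) (trans (Sum-split M (M ℕ.* k) u) (trans (cong (λ z → φ + z) (trans (Sum-cong (M ℕ.* k) (λ n _ _ → u-periodic n)) (Sum-periods k)))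
    (trans (lem φ (ι k)) (cong (_* φ) (sym (ι-suc k))))))
    where
    lem = ring 2 (λ f k → f :+ k :* f , (k :+ con 1ℚ) :* f)

  -- If all d ≤ D divide M, the sets d · {units} are disjoint, so their densities add up to at most one.
  unit-density : ∀ D → (∀ d → 1 ℕ.≤ d → d ℕ.≤ D → d ∣ M) → φ * H D ≤ ι M
  unit-density D divs = *-cancelˡ-≤ (ι≥1 1≤M) (subst₂ _≤_ lhs (trans (Sum-const (M ℕ.* M) 1ℚ) (trans (*-identityʳ (ι (M ℕ.* M))) (ι-* M M)))
      (Sum-mono (M ℕ.* M) (λ n p _ → Sum-≤-one D (t n) (bit n) (uniq n p))))
    where
    t : ℕ → Arith
    t n d = [ d ∣? n ] * u (n // d)
    bit : ∀ n d → t n d ≡ 0ℚ ⊎ t n d ≡ 1ℚ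
    bit n d with d ∣? n | coprime? (n // d) M
    ... | yes _ | yes _ = inj₂ refl
    ... | yes _ | no _  = inj₁ refl
    ... | no _  | yes _ = inj₁ refl
    ... | no _  | no _  = inj₁ refl
    decode : ∀ n d → t n d ≡ 1ℚ → (d ∣ n) × Coprime (n // d) M
    decode n d with d ∣? n | coprime? (n // d) M
    ... | yes a | yes b = λ _ → a , b
    ... | yes _ | no _  = λ ()
    ... | no _  | yes _ = λ ()
    ... | no _  | no _  = λ ()
    div-eq : ∀ n d → 1 ℕ.≤ d → d ∣ n → n ≡ d ℕ.* (n // d)
    div-eq n (suc d) _ h = sym (ℕ.m*[n/m]≡n h)
    -- a divides b (n/b) and, as a divisor of M, is coprime to n/b.
    half : ∀ n a b → 1 ℕ.≤ a → a ℕ.≤ D → 1 ℕ.≤ b → a ∣ n → b ∣ n → Coprime (n // b) M → a ∣ b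
    half n a b 1≤a a≤D 1≤b a∣n b∣n cop = coprime-divisor {a} {n // b} {b} (λ (d₁ , d₂) → cop (d₂ , ∣.∣-trans d₁ (divs a 1≤a a≤D)))
      (subst (a ∣_) (trans (div-eq n b 1≤b b∣n) (ℕₚ.*-comm b (n // b))) a∣n)
    uniq : ∀ n → 1 ℕ.≤ n → ∀ a b → 1 ℕ.≤ a → a ℕ.≤ D → 1 ℕ.≤ b → b ℕ.≤ D → t n a ≡ 1ℚ → t n b ≡ 1ℚ → a ≡ b
    uniq n _ a b 1≤a a≤D 1≤b b≤D ta tb = ∣.∣-antisym (half n a b 1≤a a≤D 1≤b (proj₁ A) (proj₁ B) (proj₂ B)) (half n b a 1≤b b≤D 1≤a (proj₁ B) (proj₁ A) (proj₂ A))
      where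
      A = decode n a ta
      B = decode n b tb
    -- The set d · {units} has period d M, so densities for all d ≤ D are read off on the common
    -- range M².
    one-d : ∀ d → 1 ℕ.≤ d → d ℕ.≤ D → Sum (M ℕ.* M) (λ n → t n d) ≡ ι M * φ * inv d
    one-d d 1≤d d≤D = begin
      Sum (M ℕ.* M) (λ n → t n d)
        ≡⟨ cong (λ z → Sum z (λ n → t n d)) eq ⟩
      Sum (d ℕ.* (M ℕ.* k)) (λ n → [ d ∣? n ] * u (n // d))
        ≡⟨ Sum-multiples d (M ℕ.* k) (λ n → u (n // d)) 1≤d ⟩
      Sum (M ℕ.* k) (λ e → u ((d ℕ.* e) // d))
        ≡⟨ Sum-cong (M ℕ.* k) (λ e _ _ → cong u (cancel d e 1≤d)) ⟩
      Sum (M ℕ.* k) u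
        ≡⟨ Sum-periods k ⟩
      ι k * φ
        ≡⟨ cong (_* φ) (trans (sym (*-identityʳ (ι k))) (trans (cong (ι k *_) (sym (ι*inv 1≤d))) (trans (sym (*-assoc (ι k) (ι d) (inv d))) (cong (_* inv d) (trans (sym (ι-* k d)) (cong ι (trans (ℕₚ.*-comm k d) (sym M≡)))))))) ⟩
      ι M * inv d * φ
        ≡⟨ lem (ι M) (inv d) φ ⟩
      ι M * φ * inv d ∎
      where
      open ≡-Reasoning
      k : ℕ
      k = M // d
      M≡ : M ≡ d ℕ.* k
      M≡ = div-eq M d 1≤d (divs d 1≤d d≤D)
      eq : M ℕ.* M ≡ d ℕ.* (M ℕ.* k)
      eq = trans (cong (M ℕ.*_) M≡) (trans (sym (ℕₚ.*-assoc M d k)) (trans (cong (ℕ._* k) (ℕₚ.*-comm M d)) (ℕₚ.*-assoc d M k)))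
      cancel : ∀ d e → 1 ℕ.≤ d → (d ℕ.* e) // d ≡ e
      cancel (suc d) e _ = trans (cong (ℕ._/ suc d) (ℕₚ.*-comm (suc d) e)) (ℕ.m*n/n≡m e (suc d))
      lem = ring 3 (λ a b c → a :* b :* c , a :* c :* b)
    lhs : Sum (M ℕ.* M) (λ n → Sum D (t n)) ≡ ι M * (φ * H D)
    lhs = trans (Sum-swap (M ℕ.* M) D t) (trans (Sum-cong D one-d) (trans (Sum-*ˡ D (ι M * φ) inv) (*-assoc (ι M) φ (H D))))

  -- The combination has mean 0 along the multiples of every d: if d is coprime to M, multiplication
  -- by d permutes the residues, and otherwise no d m is a unit and both terms vanish. This is the
  -- hypothesis of `Λ₂-cancel`, which then compares w with u.
  balanced : ∀ c L d v → 1 ℕ.≤ d → ∣ Sum v (λ m → φ * w c L (d ℕ.* m) - W c L * u (d ℕ.* m)) ∣ ≤ ι M * (φ * ι L + W c L)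
  balanced c L d v 1≤d = periodic-bound M f (φ * ι L + W c L) 1≤M per mean bound v
    where
    open Residues M 1≤M
    f : Arith
    f m = φ * w c L (d ℕ.* m) - W c L * u (d ℕ.* m)
    per : Periodic M f
    per n = cong₂ (λ a b → φ * a - W c L * b) (Periodic-dilate (w c L) (w-periodic c L) d n) (Periodic-dilate u u-periodic d n)
    φ≥0 = ≤-trans 0≤1 φ≥1
    bound : ∀ n → ∣ f n ∣ ≤ φ * ι L + W c L
    bound n = abs≤ (lem₁ φ (w c L (d ℕ.* n)) (W c L) (u (d ℕ.* n)) (ι L) φ≥0 (w≤ c L (d ℕ.* n)) (W≥0 c L) (u≥0 (d ℕ.* n)))
                   (lem₂ φ (w c L (d ℕ.* n)) (W c L) (u (d ℕ.* n)) (ι L) φ≥0 (w≥0 c L (d ℕ.* n)) (W≥0 c L) (u≤1 (d ℕ.* n)) (ι≥0 L))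
      where
      lem₁ = lin 5 (λ f w W u L → con 0ℚ ≼ f ∷ w ≼ L ∷ con 0ℚ ≼ W ∷ con 0ℚ ≼ u ∷ [] , f :* w :- W :* u , f :* L :+ W) ((1ℚ , 2 ∷ []) ∷ (1ℚ , 0 ∷ 1 ∷ []) ∷ (1ℚ , 2 ∷ 3 ∷ []) ∷ [])
      lem₂ = lin 5 (λ f w W u L → con 0ℚ ≼ f ∷ con 0ℚ ≼ w ∷ con 0ℚ ≼ W ∷ u ≼ con 1ℚ ∷ con 0ℚ ≼ L ∷ [] , :- (f :* w :- W :* u) , f :* L :+ W) ((1ℚ , 0 ∷ 1 ∷ []) ∷ (1ℚ , 0 ∷ 4 ∷ []) ∷ (1ℚ , 2 ∷ 3 ∷ []) ∷ [])
    l₀ = ring 2 (λ f w → f :* w :- w :* f , con 0ℚ)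
    l₁ = ring 2 (λ f w → f :* con 0ℚ :- w :* con 0ℚ , con 0ℚ)
    mean : Sum M f ≡ 0ℚ
    mean with coprime? d M
    ... | yes cop with coprime-inverse cop
    ...   | d′ , 1≤d′ , iv = trans (Sum-- M _ _) (trans (cong₂ _-_ (trans (Sum-*ˡ M φ _) (cong (φ *_) (permute (w c L) (w-periodic c L) (w≥0 c L) 1≤d 1≤d′ iv)))
              (trans (Sum-*ˡ M (W c L) _) (cong (W c L *_) (permute u u-periodic u≥0 1≤d 1≤d′ iv)))) (l₀ φ (W c L)))
    mean | no ¬cop = Sum-vanish M (λ m _ _ → trans (cong₂ (λ a b → φ * a - W c L * b) (Sum-vanish L (λ i _ _ → trans (cong (_* u (d ℕ.* m ℕ.+ c ℕ.+ i)) (u0 m)) (*-zeroˡ (u (d ℕ.* m ℕ.+ c ℕ.+ i))))) (u0 m)) (l₁ φ (W c L)))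
      where
      u0 : ∀ m → u (d ℕ.* m) ≡ 0ℚ
      u0 m = []-no (coprime? (d ℕ.* m) M) (λ cop → ¬cop (λ (d₁ , d₂) → cop (∣.∣m⇒∣m*n m d₁ , d₂)))

-- Oresme's argument: each doubling of the range adds at least ½.
H-large : ∀ k → ½ * ι k ≤ H (2 ℕ.^ k)
H-large zero    = ≤-trans (≤-reflexive (trans (cong (½ *_) (ι≡♯ 0)) (*-zeroʳ ½))) (H≥0 1)
H-large (suc k) = lem (ι k) (ι (suc k)) (H a) (H (2 ℕ.* a)) (H-large k) (ι-suc k) (subst₂ (λ x y → y ≤ H x - H a) (cong (a ℕ.+_) (sym (ℕₚ.+-identityʳ a))) half (proj₁ (H-block a a (1≤2^ k))))
  where
  a = 2 ℕ.^ k
  half : ι a * inv (a ℕ.+ a) ≡ inv 2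
  half = trans (cong (λ z → ι a * inv z) (trans (cong (a ℕ.+_) (sym (ℕₚ.+-identityʳ a))) (ℕₚ.*-comm 2 a))) (ι*inv-* (1≤2^ k) (s≤s z≤n))
  inv2 : inv 2 ≡ ½
  inv2 = *-inverse-unique (♯ 2) (inv 2) ½ (trans (cong (_* inv 2) (sym (ι≡♯ 2))) (ι*inv (s≤s z≤n))) refl
  lem : ∀ k k′ a b → ½ * k ≤ a → k′ ≡ k + 1ℚ → inv 2 ≤ b - a → ½ * k′ ≤ b
  lem k _ a b p refl r = lem′ k a b p (subst (_≤ b - a) inv2 r)
    where
    lem′ = lin 3 (λ k a b → con ½ :* k ≼ a ∷ con ½ ≼ b :- a ∷ [] , con ½ :* (k :+ con 1ℚ) , b) ((1ℚ , 0 ∷ []) ∷ (1ℚ , 1 ∷ []) ∷ [])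

-- M W ≤ L φ² from averaging and φ ≤ M/H D from the unit density give W ≤ L φ/H D. With D = 2^(2LK)
-- the harmonic sum is at least L K, and M = D! is divisible by all d ≤ D.
sieve : ∀ L K → 1 ℕ.≤ L → ∃[ M ] Σ (1 ℕ.≤ M) λ 1≤M → ∃[ c ] (ι K * Units.W M 1≤M c L ≤ Units.φ M 1≤M)
sieve L K 1≤L = M , 1≤M , c , *-cancelˡ-≤ (lem₁ (ι L) φ (ι≥1 1≤L) φ≥1)
    (lem (ι L) (ι K) φ (H D) (W c L) (ι M) (unit-density D divs) (proj₂ (small-shift L)) H-big (W≥0 c L) (≤-trans 0≤1 φ≥1))
  where
  k D M : ℕ
  k = 2 ℕ.* (L ℕ.* K)
  D = 2 ℕ.^ k
  M = D ℕ.!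
  1≤M : 1 ℕ.≤ M
  1≤M = ℕₚ.1≤n! D
  open Units M 1≤M
  c = proj₁ (small-shift L)
  divs : ∀ d → 1 ℕ.≤ d → d ℕ.≤ D → d ∣ M
  divs d 1≤d d≤D = ∣.∣-trans (self d 1≤d) (∣.m≤n⇒m!∣n! d≤D)
    where
    self : ∀ d → 1 ℕ.≤ d → d ∣ d ℕ.!
    self (suc d) _ = ∣.m∣m*n (d ℕ.!)
  H-big : ι L * ι K ≤ H D
  H-big = subst (_≤ H D) (trans (cong (½ *_) (trans (ι-* 2 (L ℕ.* K)) (cong₂ _*_ (ι≡♯ 2) (ι-* L K)))) (l₀ (ι L * ι K))) (H-large k)
    where
    l₀ = ring 1 (λ a → con ½ :* (# 2 :* a) , a)
  lem₁ = lin 2 (λ a b → con 1ℚ ≼ a ∷ con 1ℚ ≼ b ∷ [] , con 1ℚ , a :* b) ((1ℚ , 0 ∷ []) ∷ (1ℚ , 1 ∷ []) ∷ (1ℚ , 0 ∷ 1 ∷ []) ∷ [])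
  lem = lin 6 (λ L K f h W M → f :* h ≼ M ∷ M :* W ≼ L :* (f :* f) ∷ L :* K ≼ h ∷ con 0ℚ ≼ W ∷ con 0ℚ ≼ f ∷ [] , L :* f :* (K :* W) , L :* f :* f) ((1ℚ , 0 ∷ 3 ∷ []) ∷ (1ℚ , 1 ∷ []) ∷ (1ℚ , 2 ∷ 3 ∷ 4 ∷ []) ∷ [])

-- Bad primes in intervals, for one length

prm : Arith
prm n = [ prime? n ]

π : Arith
π N = Sum N prm

Sum-range≤ : ∀ {a b} (f : Arith) → (∀ n → 0ℚ ≤ f n) → Sum b f - Sum a f ≤ Sum b f
Sum-range≤ {a} {b} f f≥0 = lem (Sum b f) (Sum a f) (Sum-≥0 a (λ n _ _ → f≥0 n))
  where
  lem = lin 2 (λ x y → con 0ℚ ≼ y ∷ [] , x :- y , x) ((1ℚ , 0 ∷ []) ∷ [])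

-- K is the gain of the sieve and 1/e the relative error allowed. `X₀` collects the thresholds for
-- the prime number theorem with error 1/(256 e), for log y ≥ 32 e C, and for √y log² y to be
-- negligible.
module BadPrimes (L K M : ℕ) (1≤M : 1 ℕ.≤ M) (c : ℕ) (sieved : ι K * Units.W M 1≤M c L ≤ Units.φ M 1≤M) (e : ℕ) (1≤e : 1 ℕ.≤ e) where
  open Units M 1≤M

  b : ℚ
  b = ι M * (φ * ι L + W c L)

  abstract
    C : ∃[ n ] ♯ 140004 + ♯ 48 * (ι K * b) ≤ ι n
    C = archimedean (♯ 140004 + ♯ 48 * (ι K * b))

    pnt : ∃[ x₀ ] (1 ℕ.≤ x₀ × Remainder≤ (inv (e ℕ.* 256)) x₀)
    pnt = prime-number-theorem (e ℕ.* 256) (ℕₚ.*-mono-≤ 1≤e (s≤s z≤n))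

  E′ X₀ : ℕ
  E′ = e ℕ.* 64 ℕ.+ e ℕ.* K ℕ.* 8
  X₀ = proj₁ pnt ℕ.+ (2 ℕ.^ (2 ℕ.* (e ℕ.* proj₁ C ℕ.* 32)) ℕ.+ 2 ℕ.^ (E′ ℕ.* 432))

  module _ (β : Arith) (β≥0 : ∀ n → 0ℚ ≤ β n) (β≤prm : ∀ n → β n ≤ prm n) (β≤w : ∀ n → β n ≤ w c L n)
      {z y : ℕ} (X₀≤z : X₀ ℕ.≤ z) (z≤y : z ℕ.≤ y) where
    private
      x₀≤z : proj₁ pnt ℕ.≤ z
      x₀≤z = ℕₚ.≤-trans (ℕₚ.m≤m+n _ _) X₀≤z
      1≤z : 1 ℕ.≤ z
      1≤z = ℕₚ.≤-trans (proj₁ (proj₂ pnt)) x₀≤z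
      1≤y : 1 ℕ.≤ y
      1≤y = ℕₚ.≤-trans 1≤z z≤y
      X : ℕ
      -- The logarithm has to be good up to y², since `counted` compares log y with log n² for n
      -- beyond √y.
      X = y ℕ.* y
      y≤X : y ℕ.≤ X
      y≤X = d≤d*m y 1≤y
      1≤X : 1 ℕ.≤ X
      1≤X = ℕₚ.≤-trans 1≤y y≤X
      y≤X′ = ℕₚ.m≤n⇒m≤1+n y≤X
      z≤X = ℕₚ.≤-trans z≤y y≤X
      logarithm : LogTo X
      logarithm = Logarithm.logarithm X
    open Analysis X 1≤X logarithm using (ℓ; Λ; Λ₂; F; ℓ²; ψ; R; ℓ≥0; Λ≥0; Λ₂≥0; ℓΛ≤Λ₂; Λ-prime; Λ₂-cancel; selberg; ℓ-Lipschitz; ℓ-mono; ℓ-*; ℓ-large; ℓ≤log₂; nonprime; nonprime≥0; nonprime≤; Λ≤ℓ)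
    private
      l Y Z k Δw np : ℚ
      l = ℓ y
      Y = ι y
      Z = ι z
      k = inv (e ℕ.* 256)
      Δw = Sum y (λ n → w c L n * Λ₂ n) - Sum z (λ n → w c L n * Λ₂ n)
      np = Sum y nonprime

    -- Up to the errors of `Λ₂-cancel`, φ Δw equals W Δu ≤ W (F y - F z), and K W ≤ φ. The constant
    -- b, which depends on M, meets Y without a logarithm.
    sieve-bound : ι K * Δw ≤ (F y - F z) + ♯ 48 * (ι K * b) * Y
    sieve-bound = *-cancelˡ-≤ φ≥1 (lem φ (ι K) (W c L) Δw Δu (F y - F z) (Ty - Tz) Ty Tz b Y Z (φ-eq) refl (abs-hi (Λ₂-cancel f b (balanced c L) y 1≤y y≤X)) (abs-lo (Λ₂-cancel f b (balanced c L) z 1≤z z≤X)) (ι-mono z≤y) sieved Δu≤ Δu≥0 φ≥1 (ι≥0 K) b≥0 (ι≥0 y) )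
      where
      f : Arith
      f n = φ * w c L n - W c L * u n
      Ty = Sum y (λ n → f n * Λ₂ n)
      Tz = Sum z (λ n → f n * Λ₂ n)
      Δu = Sum y (λ n → u n * Λ₂ n) - Sum z (λ n → u n * Λ₂ n)
      b≥0 : 0ℚ ≤ b
      b≥0 = ι≥0 M ⊗ ((≤-trans 0≤1 φ≥1 ⊗ ι≥0 L) ⊕ W≥0 c L)
      expand : ∀ x → Sum x (λ n → f n * Λ₂ n) ≡ φ * Sum x (λ n → w c L n * Λ₂ n) - W c L * Sum x (λ n → u n * Λ₂ n)
      expand x = trans (Sum-cong x (λ n _ _ → l₀ φ (w c L n) (W c L) (u n) (Λ₂ n))) (trans (Sum-- x _ _) (cong₂ _-_ (Sum-*ˡ x φ _) (Sum-*ˡ x (W c L) _)))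
        where
        l₀ = ring 5 (λ a w b u t → (a :* w :- b :* u) :* t , a :* (w :* t) :- b :* (u :* t))
      φ-eq : φ * Δw ≡ W c L * Δu + (Ty - Tz)
      φ-eq = trans (l₁ φ (Sum y (λ n → w c L n * Λ₂ n)) (Sum z (λ n → w c L n * Λ₂ n)) (W c L) (Sum y (λ n → u n * Λ₂ n)) (Sum z (λ n → u n * Λ₂ n)))
          (cong₂ (λ p q → W c L * Δu + (p - q)) (sym (expand y)) (sym (expand z)))
        where
        l₁ = ring 6 (λ f a a′ w d d′ → f :* (a :- a′) , w :* (d :- d′) :+ ((f :* a :- w :* d) :- (f :* a′ :- w :* d′)))
      Δu≤ : Δu ≤ F y - F z
      Δu≤ = Sum-range-mono z≤y (λ n p _ → l₂ (u n) (Λ₂ n) (u≤1 n) (Λ₂≥0 n (ℕₚ.≤-trans (s≤s z≤n) p)))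
        where
        l₂ = lin 2 (λ a b → a ≼ con 1ℚ ∷ con 0ℚ ≼ b ∷ [] , a :* b , b) ((1ℚ , 0 ∷ 1 ∷ []) ∷ [])
      Δu≥0 : 0ℚ ≤ Δu
      Δu≥0 = ↑ (Sum-extend (λ n → u n * Λ₂ n) z≤y (λ n p _ → u≥0 n ⊗ Λ₂≥0 n p))
      lem : ∀ f K W D U F T Ty Tz b Y Z → f * D ≡ W * U + T → T ≡ Ty - Tz → Ty ≤ ♯ 24 * b * Y → - Tz ≤ ♯ 24 * b * Z → Z ≤ Y → K * W ≤ f → U ≤ F → 0ℚ ≤ U → 1ℚ ≤ f → 0ℚ ≤ K → 0ℚ ≤ b → 0ℚ ≤ Y →
        f * (K * D) ≤ f * (F + ♯ 48 * (K * b) * Y)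
      lem f K W D U F _ Ty Tz b Y Z e₁ refl h₁ h₂ zy kw uf u0 f1 K0 b0 Y0 = lem′ f K W D U F Ty Tz b Y Z e₁ h₁ h₂ zy kw uf u0 f1 K0 b0 Y0
        where
        lem′ = lin 11 (λ f K W D U F Ty Tz b Y Z → f :* D ≗ W :* U :+ (Ty :- Tz) ∷ Ty ≼ # 24 :* b :* Y ∷ :- Tz ≼ # 24 :* b :* Z ∷ Z ≼ Y ∷ K :* W ≼ f ∷ U ≼ F ∷ con 0ℚ ≼ U ∷ con 1ℚ ≼ f ∷ con 0ℚ ≼ K ∷ con 0ℚ ≼ b ∷ con 0ℚ ≼ Y ∷ [] , f :* (K :* D) , f :* (F :+ # 48 :* (K :* b) :* Y)) ((1ℚ , 0 ∷ 8 ∷ []) ∷ (1ℚ , 1 ∷ 8 ∷ []) ∷ (1ℚ , 2 ∷ 8 ∷ []) ∷ (♯ 24 , 3 ∷ 9 ∷ 8 ∷ []) ∷ (1ℚ , 4 ∷ 6 ∷ []) ∷ (1ℚ , 5 ∷ 7 ∷ []) ∷ (1ℚ , 5 ∷ []) ∷ (♯ 48 , 7 ∷ 8 ∷ 9 ∷ 10 ∷ []) ∷ [])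

    F-range : F y - F z ≤ ♯ 2 * (Y - Z) * l + ♯ 140004 * Y
    F-range = lem (F y) (F z) Y Z l (ℓ z) (inv z) (abs-hi (selberg 1≤y y≤X)) (abs-lo (selberg 1≤z z≤X)) (ℓ-Lipschitz 1≤z z≤y y≤X′) (ι*inv 1≤z) (ι-mono z≤y) (ι≥0 z)
      where
      lem = lin 7 (λ f g Y Z l m i → f :- # 2 :* (Y :* l) ≼ # 70000 :* Y ∷ :- (g :- # 2 :* (Z :* m)) ≼ # 70000 :* Z ∷ l :- m ≼ # 2 :* ((Y :- Z) :* i) ∷ Z :* i ≗ con 1ℚ ∷ Z ≼ Y ∷ con 0ℚ ≼ Z ∷ [] , f :- g , # 2 :* (Y :- Z) :* l :+ # 140004 :* Y) ((1ℚ , 0 ∷ []) ∷ (1ℚ , 1 ∷ []) ∷ (♯ 2 , 2 ∷ 5 ∷ []) ∷ (♯ 4 , 3 ∷ 4 ∷ []) ∷ (♯ 70000 , 4 ∷ []) ∷ (♯ 4 , 5 ∷ []) ∷ [])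

    -- At a prime Λ₂ ≥ ℓ Λ = ℓ².
    weighted : Sum y (λ n → β n * ℓ² n) - Sum z (λ n → β n * ℓ² n) ≤ Δw
    weighted = Sum-range-mono z≤y (λ n p _ → term n (ℕₚ.≤-trans (s≤s z≤n) p) (prime? n) (β≤prm n))
      where
      term : ∀ n → 1 ℕ.≤ n → (d : Dec (Prime n)) → β n ≤ [ d ] → β n * ℓ² n ≤ w c L n * Λ₂ n
      term n 1≤n (yes pn) _ = lem (β n) (w c L n) (ℓ² n) (Λ₂ n) (β≥0 n) (β≤w n) (subst (λ v → ℓ n * v ≤ Λ₂ n) (Λ-prime pn) (ℓΛ≤Λ₂ n)) (Λ₂≥0 n 1≤n)
        where
        lem = lin 4 (λ b w s t → con 0ℚ ≼ b ∷ b ≼ w ∷ s ≼ t ∷ con 0ℚ ≼ t ∷ [] , b :* s , w :* t) ((1ℚ , 0 ∷ 2 ∷ []) ∷ (1ℚ , 1 ∷ 3 ∷ []) ∷ [])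
      term n 1≤n (no _) β≤0 = lem (β n) (ℓ² n) (w c L n) (Λ₂ n) β≤0 (ℓ≥0 n ⊗ ℓ≥0 n) (w≥0 c L n) (Λ₂≥0 n 1≤n)
        where
        lem = lin 4 (λ b s w t → b ≼ con 0ℚ ∷ con 0ℚ ≼ s ∷ con 0ℚ ≼ w ∷ con 0ℚ ≼ t ∷ [] , b :* s , w :* t) ((1ℚ , 0 ∷ 1 ∷ []) ∷ (1ℚ , 2 ∷ 3 ∷ []) ∷ [])

    private
      s t : ℕ
      s = proj₁ (sqrt y)
      t = proj₁ (log₂ y 1≤y)
      s²≤y = proj₁ (proj₂ (sqrt y))
      y<s² = proj₂ (proj₂ (sqrt y))
      2^t≤y = proj₁ (proj₂ (log₂ y 1≤y))
      y<2^t = proj₂ (proj₂ (log₂ y 1≤y))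
      small : E′ ℕ.* (s ℕ.* (t ℕ.* (2 ℕ.* t ℕ.+ 2))) ℕ.≤ y
      small = sqrt*log²-small E′ {y} {s} {t} (ℕₚ.≤-trans (ℕₚ.m≤n+m _ _) (ℕₚ.≤-trans (ℕₚ.m≤n+m _ (proj₁ pnt)) (ℕₚ.≤-trans X₀≤z z≤y))) s²≤y y<s² 2^t≤y y<2^t
      1≤E′ : 1 ℕ.≤ E′
      1≤E′ = ℕₚ.≤-trans (ℕₚ.*-mono-≤ 1≤e (s≤s z≤n)) (ℕₚ.m≤m+n (e ℕ.* 64) (e ℕ.* K ℕ.* 8))
      1≤t : 1 ℕ.≤ t
      1≤t with 1 ℕ.≤? t
      ... | yes p = p
      ... | no ¬p = ⊥-elim (ℕₚ.<⇒≱ y<2^t (ℕₚ.≤-trans (ℕₚ.^-monoʳ-≤ 2 {suc t} {E′ ℕ.* 432} (ℕₚ.≤-trans (ℕₚ.≰⇒> ¬p) (ℕₚ.*-mono-≤ 1≤E′ (s≤s z≤n)))) (ℕₚ.≤-trans (ℕₚ.m≤n+m _ _) (ℕₚ.≤-trans (ℕₚ.m≤n+m _ (proj₁ pnt)) (ℕₚ.≤-trans X₀≤z z≤y)))))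

    s≤y : s ℕ.≤ y
    s≤y = ℕₚ.≤-trans (s≤s*s s) s²≤y
      where
      s≤s*s : ∀ s → s ℕ.≤ s ℕ.* s
      s≤s*s zero    = z≤n
      s≤s*s (suc s) = d≤d*m (suc s) (s≤s z≤n)

    B : Arith
    B x = Sum x β

    -- For n > √y one has log y ≤ 2 log n, hence the factor 4; the n up to √y are counted trivially.
    counted : l * l * (B y - B z) ≤ ♯ 4 * (Sum y (λ n → β n * ℓ² n) - Sum z (λ n → β n * ℓ² n)) + l * l * ι s
    counted = ≤-trans (subst₂ _≤_ (trans (cong₂ _-_ (Sum-*ˡ y (l * l) β) (Sum-*ˡ z (l * l) β)) (l₀ (l * l) (B y) (B z)))
          (trans (cong₂ _-_ (trans (Sum-+ y _ _) (cong₂ _+_ (Sum-*ˡ y (♯ 4) _) (Sum-*ˡ y (l * l) _))) (trans (Sum-+ z _ _) (cong₂ _+_ (Sum-*ˡ z (♯ 4) _) (Sum-*ˡ z (l * l) _))))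
            (l₁ (♯ 4) (l * l) (Sum y (λ n → β n * ℓ² n)) (Sum z (λ n → β n * ℓ² n)) (Sum y low) (Sum z low)))
          (Sum-range-mono z≤y (λ n p q → term n (ℕₚ.≤-trans (s≤s z≤n) p) q (n ℕ.≤? s))))
        (+-monoʳ-≤ (♯ 4 * (Sum y (λ n → β n * ℓ² n) - Sum z (λ n → β n * ℓ² n))) (*-monoˡ-≤-nonNeg (l * l) {{nonNegative (ℓ≥0 y ⊗ ℓ≥0 y)}} (≤-trans (Sum-range≤ {z} {y} low (λ n → []-≥0 (n ℕ.≤? s)))
          (≤-reflexive (trans (Sum-trunc low s≤y (λ n p _ → []-no (n ℕ.≤? s) (ℕₚ.<⇒≱ p))) (trans (Sum-cong s (λ n _ q → []-yes (n ℕ.≤? s) q)) (trans (Sum-const s 1ℚ) (*-identityʳ (ι s)))))))))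
      where
      low : Arith
      low n = [ n ℕ.≤? s ]
      l₀ = ring 3 (λ a b c → a :* b :- a :* c , a :* (b :- c))
      l₁ = ring 6 (λ f m a b p q → (f :* a :+ m :* p) :- (f :* b :+ m :* q) , f :* (a :- b) :+ m :* (p :- q))
      term : ∀ n → 1 ℕ.≤ n → n ℕ.≤ y → (d : Dec (n ℕ.≤ s)) → l * l * β n ≤ ♯ 4 * (β n * ℓ² n) + l * l * [ d ]
      term n 1≤n n≤y (yes _) = lem l (β n) (ℓ n) (≤-trans (β≤prm n) ([]-≤1 (prime? n))) (β≥0 n) (sq l) (sq (ℓ n))
        where
        lem = lin 3 (λ l b m → b ≼ con 1ℚ ∷ con 0ℚ ≼ b ∷ con 0ℚ ≼ l :* l ∷ con 0ℚ ≼ m :* m ∷ [] , l :* l :* b , # 4 :* (b :* (m :* m)) :+ l :* l :* con 1ℚ) ((1ℚ , 0 ∷ 2 ∷ []) ∷ (♯ 4 , 1 ∷ 3 ∷ []) ∷ [])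
      term n 1≤n n≤y (no n≰s) = lem l (β n) (ℓ n) (β≥0 n) (ℓ≥0 y) (subst (l ≤_) (ℓ-* n n 1≤n 1≤n) (ℓ-mono 1≤y (ℕₚ.≤-trans (ℕₚ.<⇒≤ y<s²) (ℕₚ.*-mono-≤ (ℕₚ.≰⇒> n≰s) (ℕₚ.≰⇒> n≰s))) (ℕₚ.m≤n⇒m≤1+n (ℕₚ.*-mono-≤ n≤y n≤y))))
        where
        lem = lin 3 (λ l b m → con 0ℚ ≼ b ∷ con 0ℚ ≼ l ∷ l ≼ m :+ m ∷ [] , l :* l :* b , # 4 :* (b :* (m :* m)) :+ l :* l :* con 0ℚ) ((♯ 2 , 2 ∷ 1 ∷ 0 ∷ []) ∷ (1ℚ , 2 ∷ 2 ∷ 0 ∷ []) ∷ [])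

    ψ-π : ∀ {a} → a ℕ.≤ y → (ψ y - ψ a) ≤ l * (π y - π a) + np
    ψ-π {a} a≤y = ≤-trans (subst (ψ y - ψ a ≤_) (trans (cong₂ _-_ (trans (Sum-+ y _ _) (cong (_+ Sum y nonprime) (Sum-*ˡ y l prm))) (trans (Sum-+ a _ _) (cong (_+ Sum a nonprime) (Sum-*ˡ a l prm)))) (l₀ l (π y) (π a) (Sum y nonprime) (Sum a nonprime)))
        (Sum-range-mono a≤y (λ n p q → term n (ℕₚ.≤-trans (s≤s z≤n) p) q)))
        (+-monoʳ-≤ (l * (π y - π a)) (Sum-range≤ {a} {y} nonprime nonprime≥0))
      where
      l₀ = ring 5 (λ l p r a b → (l :* p :+ a) :- (l :* r :+ b) , l :* (p :- r) :+ (a :- b))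
      lem = lin 3 (λ i a l → con 0ℚ ≼ i ∷ a ≼ l ∷ [] , a , l :* i :+ (con 1ℚ :- i) :* a) ((1ℚ , 0 ∷ 1 ∷ []) ∷ [])
      term : ∀ n → 1 ℕ.≤ n → n ℕ.≤ y → Λ n ≤ l * prm n + nonprime n
      term n p q = lem (prm n) (Λ n) l ([]-≥0 (prime? n)) (≤-trans (Λ≤ℓ n p) (ℓ-mono p q y≤X′))

    R-bounds : (∣ R y ∣ ≤ k * Y) × (∣ R z ∣ ≤ k * Z)
    R-bounds = proj₂ (proj₂ pnt) X 1≤X logarithm y (ℕₚ.≤-trans x₀≤z z≤y) y≤X , proj₂ (proj₂ pnt) X 1≤X logarithm z x₀≤z z≤X

    -- The prime number theorem enters here: it bounds the primes in (z, y] from below with main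
    -- term y - z, to be set against the upper bound `combined`.
    interval : Y - Z ≤ l * (π y - π z) + np + ♯ 2 * (k * Y)
    interval = lem (ψ y) (ψ z) Y Z k (l * (π y - π z) + np) (ψ-π z≤y) (abs-lo (proj₁ R-bounds)) (abs-hi (proj₂ R-bounds)) (ι-mono z≤y) (inv≥0 (e ℕ.* 256))
      where
      lem = lin 6 (λ f g Y Z k m → f :- g ≼ m ∷ :- (f :- Y) ≼ k :* Y ∷ g :- Z ≼ k :* Z ∷ Z ≼ Y ∷ con 0ℚ ≼ k ∷ [] , Y :- Z , m :+ # 2 :* (k :* Y)) ((1ℚ , 0 ∷ []) ∷ (1ℚ , 1 ∷ []) ∷ (1ℚ , 2 ∷ []) ∷ (1ℚ , 3 ∷ 4 ∷ []) ∷ [])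

    chebyshev-lower : Y ≤ l * π y + np + k * Y
    chebyshev-lower = lem (ψ y) Y k (l * (π y - 0ℚ) + np) (l * π y) np (ψ-π z≤n) (abs-lo (proj₁ R-bounds)) (l₀ l (π y) np)
      where
      l₀ = ring 3 (λ l p n → l :* (p :- con 0ℚ) :+ n , l :* p :+ n)
      lem = lin 6 (λ f Y k m p n → f :- con 0ℚ ≼ m ∷ :- (f :- Y) ≼ k :* Y ∷ m ≗ p :+ n ∷ [] , Y , p :+ n :+ k :* Y) ((1ℚ , 0 ∷ []) ∷ (1ℚ , 1 ∷ []) ∷ (1ℚ , 2 ∷ []) ∷ [])

    small-ℚ : (ι e * ♯ 64 + ι e * ι K * ♯ 8) * (ι s * (ι t * (♯ 2 * ι t + ♯ 2))) ≤ Y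
    small-ℚ = subst (_≤ Y) (trans (ι-* E′ _) (cong₂ _*_ (trans (ι-+ (e ℕ.* 64) (e ℕ.* K ℕ.* 8)) (cong₂ _+_ (trans (ι-* e 64) (cong (ι e *_) (ι≡♯ 64))) (trans (ι-* (e ℕ.* K) 8) (cong₂ _*_ (ι-* e K) (ι≡♯ 8)))))
      (trans (ι-* s _) (cong (ι s *_) (trans (ι-* t _) (cong (ι t *_) (trans (ι-+ (2 ℕ.* t) 2) (cong₂ _+_ (trans (ι-* 2 t) (cong (_* ι t) (ι≡♯ 2))) (ι≡♯ 2))))))))) (ι-mono small)

    l≤t : l ≤ ♯ 2 * ι t + ♯ 2
    l≤t = ℓ≤log₂ y {t} y≤X 2^t≤y y<2^t

    np-small : ι e * ♯ 64 * np ≤ Y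
    np-small = ≤-trans (lem (ι e) (ι K) (ι s) (ι t) l np (nonprime≤ y {s} {t} 1≤y y≤X y<s² y<2^t) l≤t (ι≥0 e) (ι≥0 K) (ι≥0 s) (ι≥0 t) ) small-ℚ
      where
      lem₁ = lin 3 (λ e n x → n ≼ x ∷ con 0ℚ ≼ e ∷ [] , e :* # 64 :* n , e :* # 64 :* x) ((♯ 64 , 0 ∷ 1 ∷ []) ∷ [])
      lem₂ = lin 3 (λ s t l → l ≼ # 2 :* t :+ # 2 ∷ con 0ℚ ≼ s ∷ con 0ℚ ≼ t ∷ [] , s :* (t :* l) , s :* (t :* (# 2 :* t :+ # 2))) ((1ℚ , 0 ∷ 1 ∷ 2 ∷ []) ∷ [])
      lem₃ = lin 3 (λ e K p → con 0ℚ ≼ e ∷ con 0ℚ ≼ K ∷ con 0ℚ ≼ p ∷ [] , e :* # 64 :* p , (e :* # 64 :+ e :* K :* # 8) :* p) ((♯ 8 , 0 ∷ 1 ∷ 2 ∷ []) ∷ [])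
      lem : ∀ e K s t l n → n ≤ s * (t * l) → l ≤ ♯ 2 * t + ♯ 2 → 0ℚ ≤ e → 0ℚ ≤ K → 0ℚ ≤ s → 0ℚ ≤ t → e * ♯ 64 * n ≤ (e * ♯ 64 + e * K * ♯ 8) * (s * (t * (♯ 2 * t + ♯ 2)))
      lem e K s t l n h₁ h₂ e0 K0 s0 t0 = ≤-trans (lem₁ e n (s * (t * (♯ 2 * t + ♯ 2))) (≤-trans h₁ (lem₂ s t l h₂ s0 t0)) e0) (lem₃ e K (s * (t * (♯ 2 * t + ♯ 2))) e0 K0 (s0 ⊗ (t0 ⊗ ((♯≥0 2 ⊗ t0) ⊕ nonNegative⁻¹ (♯ 2)))))

    s-small : ι e * ι K * ♯ 8 * (ι s * l) ≤ Y
    s-small = ≤-trans (lem (ι e) (ι K) (ι s) (ι t) l l≤t (ι≥1 1≤t) (ι≥0 e) (ι≥0 K) (ι≥0 s)) small-ℚ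
      where
      lem₁ = lin 3 (λ s t l → l ≼ # 2 :* t :+ # 2 ∷ con 0ℚ ≼ s ∷ con 1ℚ ≼ t ∷ [] , s :* l , s :* (t :* (# 2 :* t :+ # 2))) ((1ℚ , 0 ∷ 1 ∷ []) ∷ (♯ 2 , 2 ∷ 2 ∷ 1 ∷ []) ∷ (♯ 4 , 2 ∷ 1 ∷ []) ∷ [])
      lem₂ = lin 4 (λ e K x p → x ≼ p ∷ con 0ℚ ≼ p ∷ con 0ℚ ≼ e ∷ con 0ℚ ≼ K ∷ [] , e :* K :* # 8 :* x , (e :* # 64 :+ e :* K :* # 8) :* p) ((♯ 8 , 0 ∷ 2 ∷ 3 ∷ []) ∷ (♯ 64 , 1 ∷ 2 ∷ []) ∷ [])
      lem : ∀ e K s t l → l ≤ ♯ 2 * t + ♯ 2 → 1ℚ ≤ t → 0ℚ ≤ e → 0ℚ ≤ K → 0ℚ ≤ s → e * K * ♯ 8 * (s * l) ≤ (e * ♯ 64 + e * K * ♯ 8) * (s * (t * (♯ 2 * t + ♯ 2)))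
      lem e K s t l h t1 e0 K0 s0 = lem₂ e K (s * l) (s * (t * (♯ 2 * t + ♯ 2))) (lem₁ s t l h s0 t1) (s0 ⊗ (≤-trans 0≤1 t1 ⊗ ((♯≥0 2 ⊗ ≤-trans 0≤1 t1) ⊕ nonNegative⁻¹ (♯ 2)))) e0 K0

    l-large : ι e * ι (proj₁ C) * ♯ 32 ≤ l
    l-large = subst (_≤ l) (trans (ι-* (e ℕ.* proj₁ C) 32) (cong₂ _*_ (ι-* e (proj₁ C)) (ι≡♯ 32))) (ℓ-large (e ℕ.* proj₁ C ℕ.* 32) (ℕₚ.≤-trans (ℕₚ.m≤m+n _ _) (ℕₚ.≤-trans (ℕₚ.m≤n+m _ (proj₁ pnt)) (ℕₚ.≤-trans X₀≤z z≤y))) y≤X′)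

    l≥1 : 1ℚ ≤ l
    l≥1 = ≤-trans (lem (ι e) (ι (proj₁ C)) (ι K) b (ι≥1 1≤e) (proj₂ C) (ι≥0 K) (ι≥0 M ⊗ ((≤-trans 0≤1 φ≥1 ⊗ ι≥0 L) ⊕ W≥0 c L))) l-large
      where
      lem = lin 4 (λ e C K b → con 1ℚ ≼ e ∷ # 140004 :+ # 48 :* (K :* b) ≼ C ∷ con 0ℚ ≼ K ∷ con 0ℚ ≼ b ∷ [] , con 1ℚ , e :* C :* # 32) ((♯ 4480127 , []) ∷ (♯ 32 , 0 ∷ 1 ∷ []) ∷ (♯ 4480128 , 0 ∷ []) ∷ (♯ 32 , 1 ∷ []) ∷ (♯ 1536 , 2 ∷ 3 ∷ []) ∷ (♯ 1536 , 0 ∷ 2 ∷ 3 ∷ []) ∷ [])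

    combined : ι K * (l * l * (B y - B z)) ≤ ♯ 8 * l * (Y - Z) + ♯ 4 * ι (proj₁ C) * Y + ι K * (l * l * ι s)
    combined = lem (ι K) (l * l * (B y - B z)) (Sum y (λ n → β n * ℓ² n) - Sum z (λ n → β n * ℓ² n)) (l * l * ι s) Δw (F y - F z) Y Z l b (ι (proj₁ C)) counted weighted sieve-bound F-range (proj₂ C) (ι≥0 K) (ι≥0 y)
      where
      lem = lin 11 (λ K x q r w F Y Z l b C → x ≼ # 4 :* q :+ r ∷ q ≼ w ∷ K :* w ≼ F :+ # 48 :* (K :* b) :* Y ∷ F ≼ # 2 :* (Y :- Z) :* l :+ # 140004 :* Y ∷ # 140004 :+ # 48 :* (K :* b) ≼ C ∷ con 0ℚ ≼ K ∷ con 0ℚ ≼ Y ∷ [] , K :* x , # 8 :* l :* (Y :- Z) :+ # 4 :* C :* Y :+ K :* r) ((1ℚ , 0 ∷ 5 ∷ []) ∷ (♯ 4 , 1 ∷ 5 ∷ []) ∷ (♯ 4 , 2 ∷ []) ∷ (♯ 4 , 3 ∷ []) ∷ (♯ 4 , 4 ∷ 6 ∷ []) ∷ [])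

    -- In `combined` the main term 8 (Y - Z) log y becomes 8 log² y (π y - π z) through `interval`.
    -- All errors, multiplied by e, fit into ½ Y log y, which is at most log² y π y by
    -- `chebyshev-lower`; log² y is then cancelled.
    bad-primes : ι e * (ι K * (B y - B z)) ≤ ι e * (♯ 8 * (π y - π z)) + π y
    bad-primes = *-cancelˡ-≤ {l * l} (lem₁ l l≥1) (lem (ι e) (ι K) l (B y - B z) (π y - π z) (π y) Y Z np k (ι s) (ι (proj₁ C)) combined interval chebyshev-lower np-small s-small l-large
        (trans (cong (_* k) (trans (*-comm (♯ 256) (ι e)) (trans (cong (ι e *_) (sym (ι≡♯ 256))) (sym (ι-* e 256))))) (ι*inv (ℕₚ.*-mono-≤ 1≤e (s≤s z≤n)))) (ι≥1 1≤e) (ℓ≥0 y) (ι≥0 y) (inv≥0 (e ℕ.* 256)) (Sum-≥0 y (λ n _ _ → nonprime≥0 n)))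
      where
      lem₁ = lin 1 (λ l → con 1ℚ ≼ l ∷ [] , con 1ℚ , l :* l) ((♯ 2 , 0 ∷ []) ∷ (1ℚ , 0 ∷ 0 ∷ []) ∷ [])
      stage₁ = lin 9 (λ e T l P Y Z np k E → T ≼ # 8 :* l :* (Y :- Z) :+ E ∷ Y :- Z ≼ l :* P :+ np :+ # 2 :* (k :* Y) ∷ con 0ℚ ≼ e ∷ con 0ℚ ≼ l ∷ [] , e :* T , # 8 :* e :* (l :* l :* P) :+ l :* (# 8 :* e :* np :+ # 16 :* (e :* k) :* Y) :+ e :* E) ((1ℚ , 0 ∷ 2 ∷ []) ∷ (♯ 8 , 1 ∷ 3 ∷ 2 ∷ []) ∷ [])
      stage₂ = lin 8 (λ e l Y np k C K s → e :* # 64 :* np ≼ Y ∷ e :* K :* # 8 :* (s :* l) ≼ Y ∷ e :* C :* # 32 ≼ l ∷ # 256 :* e :* k ≗ con 1ℚ ∷ con 0ℚ ≼ l ∷ con 0ℚ ≼ Y ∷ [] , l :* (# 8 :* e :* np :+ # 16 :* (e :* k) :* Y) :+ e :* (# 4 :* C :* Y :+ K :* (l :* l :* s)) , con ½ :* (l :* Y)) ((+ 1 / 8 , 0 ∷ 4 ∷ []) ∷ (+ 1 / 8 , 1 ∷ 4 ∷ []) ∷ (+ 1 / 8 , 2 ∷ 5 ∷ []) ∷ (+ 1 / 16 , 3 ∷ 4 ∷ 5 ∷ []) ∷ (+ 1 / 16 , 4 ∷ 5 ∷ []) ∷ [])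
      stage₃ = lin 6 (λ e l Y np k p → Y ≼ l :* p :+ np :+ k :* Y ∷ e :* # 64 :* np ≼ Y ∷ # 256 :* e :* k ≗ con 1ℚ ∷ con 1ℚ ≼ e ∷ con 0ℚ ≼ l ∷ con 0ℚ ≼ Y ∷ con 0ℚ ≼ np ∷ con 0ℚ ≼ k ∷ [] , con ½ :* (l :* Y) , l :* l :* p) ((1ℚ , 0 ∷ 4 ∷ []) ∷ (+ 1 / 64 , 1 ∷ 4 ∷ []) ∷ (+ 1 / 256 , 2 ∷ 4 ∷ 5 ∷ []) ∷ (1ℚ , 3 ∷ 4 ∷ 6 ∷ []) ∷ (1ℚ , 3 ∷ 7 ∷ 4 ∷ 5 ∷ []) ∷ (+ 123 / 256 , 4 ∷ 5 ∷ []) ∷ [])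
      fin : ∀ e K l D P p → e * (K * (l * l * D)) ≤ ♯ 8 * e * (l * l * P) + l * l * p → l * l * (e * (K * D)) ≤ l * l * (e * (♯ 8 * P) + p)
      fin e K l D P p h = subst₂ _≤_ (l₂ e K l D) (l₃ e l P p) h
        where
        l₂ = ring 4 (λ e K l D → e :* (K :* (l :* l :* D)) , l :* l :* (e :* (K :* D)))
        l₃ = ring 4 (λ e l P p → # 8 :* e :* (l :* l :* P) :+ l :* l :* p , l :* l :* (e :* (# 8 :* P) :+ p))
      lem : ∀ e K l D P p Y Z np k s C → K * (l * l * D) ≤ ♯ 8 * l * (Y - Z) + ♯ 4 * C * Y + K * (l * l * s) → Y - Z ≤ l * P + np + ♯ 2 * (k * Y) → Y ≤ l * p + np + k * Y →
        e * ♯ 64 * np ≤ Y → e * K * ♯ 8 * (s * l) ≤ Y → e * C * ♯ 32 ≤ l → ♯ 256 * e * k ≡ 1ℚ → 1ℚ ≤ e → 0ℚ ≤ l → 0ℚ ≤ Y → 0ℚ ≤ k → 0ℚ ≤ np → l * l * (e * (K * D)) ≤ l * l * (e * (♯ 8 * P) + p)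
      lem e K l D P p Y Z np k s C h i c n s8 L ek e1 l0 Y0 k0 np0 = fin e K l D P p (≤-trans (stage₁ e (K * (l * l * D)) l P Y Z np k (♯ 4 * C * Y + K * (l * l * s)) (subst (K * (l * l * D) ≤_) (+-assoc (♯ 8 * l * (Y - Z)) (♯ 4 * C * Y) (K * (l * l * s))) h) i (≤-trans 0≤1 e1) l0)
        (≤-trans (≤-reflexive (+-assoc (♯ 8 * e * (l * l * P)) _ _)) (+-monoʳ-≤ (♯ 8 * e * (l * l * P)) (≤-trans (stage₂ e l Y np k C K s n s8 L ek l0 Y0) (stage₃ e l Y np k p c n ek e1 l0 Y0 np0 k0)))))

Sum-single : ∀ N (f : Arith) i → (∀ n → 0ℚ ≤ f n) → 1 ℕ.≤ i → i ℕ.≤ N → f i ≤ Sum N f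
Sum-single N f i f≥0 p q = subst (_≤ Sum N f) (Sum-pick N i f p q) (Sum-mono N (λ n _ _ → lem [ i ℕ.≟ n ] (f n) ([]-≤1 (i ℕ.≟ n)) (f≥0 n)))
  where
  lem = lin 2 (λ a b → a ≼ con 1ℚ ∷ con 0ℚ ≼ b ∷ [] , a :* b , b) ((1ℚ , 0 ∷ 1 ∷ []) ∷ [])

π-mono : ∀ {a b} → a ℕ.≤ b → π a ≤ π b
π-mono a≤b = Sum-extend prm a≤b (λ n _ _ → []-≥0 (prime? n))

π≥0 : ∀ n → 0ℚ ≤ π n
π≥0 n = Sum-≥0 n (λ k _ _ → []-≥0 (prime? k))

-- Bad primes for all lengths together

module BadSets (n₀ : ℕ) (1≤n₀ : 1 ℕ.≤ n₀) where

  -- The 8 cancels the one in `bad-primes`; level L is left with the share 2^(-L)/n₀, and for L ≥ 1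
  -- the shares add up to at most 1/n₀.
  K : ℕ → ℕ
  K L = n₀ ℕ.* 2 ℕ.^ L ℕ.* 8

  abstract
    level : ∀ L → ∃[ M ] Σ (1 ℕ.≤ M) λ 1≤M → ∃[ c ] (ι (K L) * Units.W M 1≤M c (suc L) ≤ Units.φ M 1≤M)
    level L = sieve (suc L) (K L) (s≤s z≤n)

  M c : ℕ → ℕ
  M L = proj₁ (level L)
  1≤M : ∀ L → 1 ℕ.≤ M L
  1≤M L = proj₁ (proj₂ (level L))
  c L = proj₁ (proj₂ (proj₂ (level L)))

  module At (L e : ℕ) (1≤e : 1 ℕ.≤ e) = BadPrimes (suc L) (K L) (M L) (1≤M L) (c L) (proj₂ (proj₂ (proj₂ (level L)))) e 1≤e

  X₁ : ℕ → ℕ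
  X₁ L = At.X₀ L 1 ℕₚ.≤-refl

  abstract
    -- A prime beyond M L is coprime to M L; a prime beyond L has level L in the search range of
    -- `AnyBad`; and beyond X₁ L the estimate `bad-primes` with e = 1 is available.
    X : ℕ → ℕ
    X L = M L ℕ.+ L ℕ.+ X₁ L

    X₁≤X : ∀ L → X₁ L ℕ.≤ X L
    X₁≤X L = ℕₚ.m≤n+m (X₁ L) (M L ℕ.+ L)

    M≤X : ∀ L → M L ℕ.≤ X L
    M≤X L = ℕₚ.≤-trans (ℕₚ.m≤m+n (M L) L) (ℕₚ.m≤m+n (M L ℕ.+ L) (X₁ L))

    L≤X : ∀ L → L ℕ.≤ X L
    L≤X L = ℕₚ.≤-trans (ℕₚ.m≤n+m L (M L)) (ℕₚ.m≤m+n (M L ℕ.+ L) (X₁ L))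

  Bad : ℕ → ℕ → Set
  Bad L n = Prime n × (X L ℕ.< n) × (∃[ i ] (1 ℕ.≤ i × i ℕ.≤ suc L × Coprime (n ℕ.+ c L ℕ.+ i) (M L)))

  Bad? : ∀ L n → Dec (Bad L n)
  Bad? L n = prime? n ×-dec ((X L ℕ.<? n) ×-dec search? (λ i → coprime? (n ℕ.+ c L ℕ.+ i) (M L)) 1 (suc L))

  β : ℕ → Arith
  β L n = [ Bad? L n ]

  β≥0 : ∀ L n → 0ℚ ≤ β L n
  β≥0 L n = []-≥0 (Bad? L n)

  []-mono : ∀ {P Q : Set} (d : Dec P) (d′ : Dec Q) → (P → Q) → [ d ] ≤ [ d′ ]
  []-mono (yes p) d′ f = ≤-reflexive (sym ([]-yes d′ (f p)))
  []-mono (no _)  d′ f = []-≥0 d′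

  β≤prm : ∀ L n → β L n ≤ prm n
  β≤prm L n = []-mono (Bad? L n) (prime? n) proj₁

  β≤w : ∀ L n → β L n ≤ Units.w (M L) (1≤M L) (c L) (suc L) n
  β≤w L n = go (Bad? L n)
    where
    open Units (M L) (1≤M L)
    go : (d : Dec (Bad L n)) → [ d ] ≤ w (c L) (suc L) n
    go (no _) = w≥0 (c L) (suc L) n
    go (yes (pn , X<n , i , 1≤i , i≤L , cop)) = ≤-trans (≤-reflexive (sym (cong₂ _*_ un ui))) (Sum-single (suc L) (λ i → u n * u (n ℕ.+ c L ℕ.+ i)) i (λ i → u≥0 n ⊗ u≥0 (n ℕ.+ c L ℕ.+ i)) 1≤i i≤L)
      where
      M<n : M L ℕ.< n
      M<n = ℕₚ.≤-<-trans (M≤X L) X<n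
      un : u n ≡ 1ℚ
      un = []-yes (coprime? n (M L)) (prime⇒coprime pn {{ℕ.>-nonZero (1≤M L)}} M<n)
      ui : u (n ℕ.+ c L ℕ.+ i) ≡ 1ℚ
      ui = []-yes (coprime? (n ℕ.+ c L ℕ.+ i) (M L)) cop

  g : Arith
  g L = inv (2 ℕ.^ L)

  g≥0 : ∀ L → 0ℚ ≤ g L
  g≥0 L = inv≥0 (2 ℕ.^ L)

  BL : ℕ → Arith
  BL L N = Sum N (β L)

  scaled : ∀ L e → 1 ℕ.≤ e → ∀ x p r → ι e * (ι (K L) * x) ≤ ι e * (♯ 8 * p) + r → 0ℚ ≤ r → ι n₀ * x ≤ g L * (p + ½ * (inv e * r))
  scaled L e 1≤e x p r h r0 = *-cancelˡ-≤ {♯ 8 * (ι e * ι (2 ℕ.^ L))} (lem₀ (ι e) (ι (2 ℕ.^ L)) (ι≥1 1≤e) (ι≥1 (1≤2^ L)))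
      (≤-trans (≤-reflexive (trans (l₁ (ι e) (ι (2 ℕ.^ L)) (ι n₀) x) (cong (λ z → ι e * (z * x)) (sym ιK)))) (≤-trans h (≤-trans (lem₁ (ι e * (♯ 8 * p)) r r0)
        (≤-reflexive (sym (trans (l₂ (ι e) (ι (2 ℕ.^ L)) (g L) p (inv e) r) (cong₂ (λ a b → (a * (ι e * (♯ 8 * p)) + ♯ 4 * (a * b * r))) (ι*inv (1≤2^ L)) (ι*inv 1≤e)))))) ))
    where
    ιK : ι (K L) ≡ ι n₀ * ι (2 ℕ.^ L) * ♯ 8
    ιK = trans (ι-* (n₀ ℕ.* 2 ℕ.^ L) 8) (cong₂ _*_ (ι-* n₀ (2 ℕ.^ L)) (ι≡♯ 8))
    lem₀ = lin 2 (λ a b → con 1ℚ ≼ a ∷ con 1ℚ ≼ b ∷ [] , con 1ℚ , # 8 :* (a :* b)) ((♯ 7 , []) ∷ (♯ 8 , 0 ∷ []) ∷ (♯ 8 , 1 ∷ []) ∷ (♯ 8 , 0 ∷ 1 ∷ []) ∷ [])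
    lem₁ = lin 2 (λ a r → con 0ℚ ≼ r ∷ [] , a :+ r , con 1ℚ :* a :+ # 4 :* (con 1ℚ :* con 1ℚ :* r)) ((♯ 3 , 0 ∷ []) ∷ [])
    l₁ = ring 4 (λ e t n x → # 8 :* (e :* t) :* (n :* x) , e :* (n :* t :* # 8 :* x))
    l₂ = ring 6 (λ e t g p i r → # 8 :* (e :* t) :* (g :* (p :+ con ½ :* (i :* r))) , (t :* g) :* (e :* (# 8 :* p)) :+ # 4 :* ((t :* g) :* (e :* i) :* r))

  level-strong : ∀ L e (1≤e : 1 ℕ.≤ e) {z y} → At.X₀ L e 1≤e ℕ.≤ z → z ℕ.≤ y → ι n₀ * (BL L y - BL L z) ≤ g L * ((π y - π z) + ½ * (inv e * π y))
  level-strong L e 1≤e {z} {y} p r = scaled L e 1≤e (BL L y - BL L z) (π y - π z) (π y) (At.bad-primes L e 1≤e (β L) (β≥0 L) (β≤prm L) (β≤w L) p r) (π≥0 y)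

  BL-below : ∀ L {z} → z ℕ.≤ X L → BL L z ≡ 0ℚ
  BL-below L {z} z≤X = Sum-vanish z (λ n _ n≤z → []-no (Bad? L n) (λ (_ , X<n , _) → ℕₚ.<⇒≱ X<n (ℕₚ.≤-trans n≤z z≤X)))

  -- There are no bad primes of level L up to `X L`, so the estimate with e = 1 extends to every z.
  -- Its relative error is fixed, but weighted by 2^(-L), which suits high levels.
  level-weak : ∀ L {z y} → z ℕ.≤ y → ι n₀ * (BL L y - BL L z) ≤ g L * ((π y - π z) + ½ * π y)
  level-weak L {z} {y} z≤y = go (ℕₚ.≤-total (X L) z) (ℕₚ.≤-total y (X L))
    where
    one-inv : ∀ {a} → inv 1 * a ≡ a
    one-inv {a} = trans (cong (_* a) inv1) (*-identityˡ a)
    from : ∀ {z} → X L ℕ.≤ z → z ℕ.≤ y → ι n₀ * (BL L y - BL L z) ≤ g L * ((π y - π z) + ½ * π y)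
    from {z} p r = subst (λ a → ι n₀ * (BL L y - BL L z) ≤ g L * ((π y - π z) + ½ * a)) one-inv (level-strong L 1 ℕₚ.≤-refl (ℕₚ.≤-trans (X₁≤X L) p) r)
    go : (X L ℕ.≤ z) ⊎ (z ℕ.≤ X L) → (y ℕ.≤ X L) ⊎ (X L ℕ.≤ y) → ι n₀ * (BL L y - BL L z) ≤ g L * ((π y - π z) + ½ * π y)
    go (inj₁ p) _ = from p z≤y
    go (inj₂ z≤X) (inj₁ y≤X) = ≤-trans (≤-reflexive (trans (cong₂ (λ a b → ι n₀ * (a - b)) (BL-below L y≤X) (BL-below L z≤X)) (*-zeroʳ (ι n₀)))) (g≥0 L ⊗ (↑ (π-mono z≤y) ⊕ (½≥0 ⊗ π≥0 y)))
    go (inj₂ z≤X) (inj₂ X≤y) = ≤-trans (≤-reflexive (cong (λ b → ι n₀ * (BL L y - b)) (trans (BL-below L z≤X) (sym (BL-below L ℕₚ.≤-refl)))))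
      (≤-trans (from ℕₚ.≤-refl X≤y) (lem (g L) (π y) (π z) (π (X L)) (g≥0 L) (π-mono z≤X)))
      where
      lem = lin 4 (λ g y z x → con 0ℚ ≼ g ∷ z ≼ x ∷ [] , g :* ((y :- x) :+ con ½ :* y) , g :* ((y :- z) :+ con ½ :* y)) ((1ℚ , 0 ∷ 1 ∷ []) ∷ [])

  Sum-g : ∀ N → Sum N g ≡ 1ℚ - g N
  Sum-g zero    = sym (trans (cong (λ z → 1ℚ - z) inv1) refl)
  Sum-g (suc N) = trans (cong (_+ g (suc N)) (Sum-g N)) (trans (cong (λ z → 1ℚ - z + g (suc N)) half) (lem (g (suc N))))
    where
    lem = ring 1 (λ a → con 1ℚ :- # 2 :* a :+ a , con 1ℚ :- a)
    half : g N ≡ ♯ 2 * g (suc N)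
    half = sym (trans (cong (_* g (suc N)) (sym (ι≡♯ 2))) (ι*inv-* {2} {2 ℕ.^ N} (s≤s z≤n) (1≤2^ N)))

  AnyBad : ℕ → Set
  AnyBad n = ∃[ L ] (1 ℕ.≤ L × L ℕ.≤ n × Bad L n)

  AnyBad? : ∀ n → Dec (AnyBad n)
  AnyBad? n = search? (λ L → Bad? L n) 1 n

  B : Arith
  B N = Sum N (λ n → [ AnyBad? n ])

  B-union : ∀ T {z y} → z ℕ.≤ y → B y - B z ≤ Sum (T ℕ.+ y) (λ L → BL L y - BL L z)
  B-union T {z} {y} z≤y = ≤-trans (Sum-range-mono {g = λ n → Sum (T ℕ.+ y) (λ L → β L n)} z≤y (λ n _ n≤y → term n n≤y (AnyBad? n)))
      (≤-reflexive (trans (cong₂ _-_ (Sum-swap y (T ℕ.+ y) _) (Sum-swap z (T ℕ.+ y) _)) (sym (Sum-- (T ℕ.+ y) (λ L → BL L y) (λ L → BL L z)))))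
    where
    term : ∀ n → n ℕ.≤ y → (d : Dec (AnyBad n)) → [ d ] ≤ Sum (T ℕ.+ y) (λ L → β L n)
    term n n≤y (no _) = Sum-≥0 (T ℕ.+ y) (λ L _ _ → β≥0 L n)
    term n n≤y (yes (L , 1≤L , L≤n , bad)) = ≤-trans (≤-reflexive (sym ([]-yes (Bad? L n) bad))) (Sum-single (T ℕ.+ y) (λ L → β L n) L (λ L → β≥0 L n) 1≤L (ℕₚ.≤-trans L≤n (ℕₚ.≤-trans n≤y (ℕₚ.m≤n+m y T))))

  max-X₀ : ∀ T e (1≤e : 1 ℕ.≤ e) → ∃[ X* ] (∀ L → L ℕ.≤ T → At.X₀ L e 1≤e ℕ.≤ X*)
  max-X₀ zero e 1≤e = At.X₀ 0 e 1≤e , λ { zero _ → ℕₚ.≤-refl }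
  max-X₀ (suc T) e 1≤e with max-X₀ T e 1≤e
  ... | X* , h = X* ℕ.+ At.X₀ (suc T) e 1≤e , λ L p → case L (ℕₚ.m≤n⇒m<n∨m≡n p)
    where
    case : ∀ L → (L ℕ.< suc T) ⊎ (L ≡ suc T) → At.X₀ L e 1≤e ℕ.≤ X* ℕ.+ At.X₀ (suc T) e 1≤e
    case L (inj₁ (s≤s p)) = ℕₚ.≤-trans (h L p) (ℕₚ.m≤m+n X* _)
    case L (inj₂ refl) = ℕₚ.m≤n+m _ X*

  -- The levels L ≤ e have finitely many thresholds and use `level-strong`. The levels L > e use
  -- `level-weak`, and their weights sum to at most 2^(-e) ≤ 1/e. Each group has error at most π
  -- y/(2e).
  union-bound-from : ∀ e (1≤e : 1 ℕ.≤ e) z y → proj₁ (max-X₀ e e 1≤e) ℕ.≤ z → z ℕ.≤ y → ι e * (ι n₀ * (B y - B z)) ≤ ι e * (π y - π z) + π y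
  union-bound-from e 1≤e z y X≤z z≤y = fin (ι e) (inv e) (ι n₀ * (B y - B z)) (π y - π z) (π y) (Sum N (λ L → g L * h L)) (Sum N g) (Sum N (λ L → [ e ℕ.<? L ] * g L))
      (≤-trans (*-monoˡ-≤-nonNeg (ι n₀) {{nonNegative (ι≥0 n₀)}} (B-union e z≤y)) (≤-trans (≤-reflexive (sym (Sum-*ˡ N (ι n₀) _))) (Sum-mono N (λ L _ _ → term L (e ℕ.<? L)))))
      (trans (Sum-cong N (λ L _ _ → l₀ (g L) (π y - π z) (inv e) [ e ℕ.<? L ] (π y))) (trans (Sum-+ N _ _) (cong₂ _+_ (Sum-*ʳ N ((π y - π z) + ½ * (inv e * π y)) g) (Sum-*ʳ N (½ * π y) _))))
      (≤-trans (≤-reflexive (Sum-g N)) (lem₁ (g N) (g≥0 N))) tail (ι*inv 1≤e) (↑ (π-mono z≤y)) (π≥0 y) (ι≥0 e) (inv≥0 e)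
    where
    N : ℕ
    -- Levels up to y occur; adding e puts the point of division inside the range.
    N = e ℕ.+ y
    h : ℕ → ℚ
    h L = (π y - π z) + ½ * ((inv e + [ e ℕ.<? L ]) * π y)
    lem₁ = lin 1 (λ a → con 0ℚ ≼ a ∷ [] , con 1ℚ :- a , con 1ℚ) ((1ℚ , 0 ∷ []) ∷ [])
    l₀ = ring 5 (λ g d i j p → g :* (d :+ con ½ :* ((i :+ j) :* p)) , g :* (d :+ con ½ :* (i :* p)) :+ j :* g :* (con ½ :* p))
    lem₂ = lin 4 (λ g d i p → con 0ℚ ≼ g ∷ con 0ℚ ≼ i ∷ con 0ℚ ≼ p ∷ [] , g :* (d :+ con ½ :* p) , g :* (d :+ con ½ :* ((i :+ con 1ℚ) :* p))) ((½ , 0 ∷ 1 ∷ 2 ∷ []) ∷ [])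
    l₃ = ring 4 (λ g d i p → g :* (d :+ con ½ :* (i :* p)) , g :* (d :+ con ½ :* ((i :+ con 0ℚ) :* p)))
    term : ∀ L (d : Dec (e ℕ.< L)) → ι n₀ * (BL L y - BL L z) ≤ g L * ((π y - π z) + ½ * ((inv e + [ d ]) * π y))
    term L (yes _) = ≤-trans (level-weak L z≤y) (lem₂ (g L) (π y - π z) (inv e) (π y) (g≥0 L) (inv≥0 e) (π≥0 y))
    term L (no e≮L) = ≤-trans (level-strong L e 1≤e (ℕₚ.≤-trans (proj₂ (max-X₀ e e 1≤e) L (ℕₚ.≮⇒≥ e≮L)) X≤z) z≤y) (≤-reflexive (l₃ (g L) (π y - π z) (inv e) (π y)))
    tail : Sum N (λ L → [ e ℕ.<? L ] * g L) ≤ inv e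
    tail = ≤-trans (subst₂ _≤_ (trans (cong (λ a → Sum N (λ L → [ e ℕ.<? L ] * g L) - a) (Sum-vanish e (λ L _ L≤e → []*-no (e ℕ.<? L) (ℕₚ.≤⇒≯ L≤e)))) (l₄ (Sum N (λ L → [ e ℕ.<? L ] * g L)))) (cong₂ _-_ (Sum-g N) (Sum-g e))
        (Sum-range-mono {f = λ L → [ e ℕ.<? L ] * g L} {g} (ℕₚ.m≤m+n e y) (λ L _ _ → lem₅ [ e ℕ.<? L ] (g L) ([]-≤1 (e ℕ.<? L)) (g≥0 L))))
        (lem₆ (g N) (g e) (inv e) (g≥0 N) (inv-mono 1≤e (ℕₚ.<⇒≤ (n<2^n e))))
      where
      l₄ = ring 1 (λ a → a :- con 0ℚ , a)
      lem₅ = lin 2 (λ a b → a ≼ con 1ℚ ∷ con 0ℚ ≼ b ∷ [] , a :* b , b) ((1ℚ , 0 ∷ 1 ∷ []) ∷ [])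
      lem₆ = lin 3 (λ a b i → con 0ℚ ≼ a ∷ b ≼ i ∷ [] , (con 1ℚ :- a) :- (con 1ℚ :- b) , i) ((1ℚ , 0 ∷ []) ∷ (1ℚ , 1 ∷ []) ∷ [])
    fin : ∀ e i x d p s G Tl → x ≤ s → s ≡ G * (d + ½ * (i * p)) + Tl * (½ * p) → G ≤ 1ℚ → Tl ≤ i → e * i ≡ 1ℚ → 0ℚ ≤ d → 0ℚ ≤ p → 0ℚ ≤ e → 0ℚ ≤ i → e * x ≤ e * d + p
    fin e i x d p _ G Tl h refl G1 T1 ei d0 p0 e0 i0 = fin′ e i x d p G Tl h G1 T1 ei d0 p0 e0 i0
      where
      fin′ = lin 7 (λ e i x d p G Tl → x ≼ G :* (d :+ con ½ :* (i :* p)) :+ Tl :* (con ½ :* p) ∷ G ≼ con 1ℚ ∷ Tl ≼ i ∷ e :* i ≗ con 1ℚ ∷ con 0ℚ ≼ d ∷ con 0ℚ ≼ p ∷ con 0ℚ ≼ e ∷ con 0ℚ ≼ i ∷ [] , e :* x , e :* d :+ p) ((1ℚ , 0 ∷ 6 ∷ []) ∷ (1ℚ , 1 ∷ 4 ∷ 6 ∷ []) ∷ (½ , 1 ∷ 7 ∷ 5 ∷ 6 ∷ []) ∷ (½ , 2 ∷ 5 ∷ 6 ∷ []) ∷ (1ℚ , 3 ∷ 5 ∷ []) ∷ [])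

  abstract
    union-bound : ∀ e → 1 ℕ.≤ e → ∃[ X* ] (∀ z y → X* ℕ.≤ z → z ℕ.≤ y → ι e * (ι n₀ * (B y - B z)) ≤ ι e * (π y - π z) + π y)
    union-bound e 1≤e = proj₁ (max-X₀ e e 1≤e) , union-bound-from e 1≤e

-- Boolean counting, greedy removal and the density

bitℕ : Bool → ℕ
bitℕ b = if b then 1 else 0

bit : Bool → ℚ
bit true  = 1ℚ
bit false = 0ℚ

ι-bitℕ : ∀ b → ι (bitℕ b) ≡ bit b
ι-bitℕ true  = ι≡♯ 1
ι-bitℕ false = ι≡♯ 0

bit-isYes : ∀ {P : Set} (d : Dec P) → bit (isYes d) ≡ [ d ]
bit-isYes (yes _) = refl
bit-isYes (no _)  = refl

ι-count : ∀ p N → ι (count p N) ≡ Sum N (bit ∘ p)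
ι-count p zero    = ι≡♯ 0
ι-count p (suc N) = trans (ι-+ (count p N) (bitℕ (p (suc N)))) (cong₂ _+_ (ι-count p N) (ι-bitℕ (p (suc N))))

ι-π : ∀ N → ι (count isPrime N) ≡ π N
ι-π N = trans (ι-count isPrime N) (Sum-cong N (λ n _ _ → bit-isYes (prime? n)))

isYes-T : ∀ {P : Set} (d : Dec P) → P → 𝔹.T (isYes d)
isYes-T (yes _) _ = _
isYes-T (no ¬p) p = ¬p p

prime-above : ∀ n → ∃[ p ] (Prime p × n ℕ.< p)
prime-above n with prime-factor (suc (n ℕ.!)) (s≤s (ℕₚ.1≤n! n))
... | q , m , pq , _ , _ , eq = q , pq , ℕₚ.≰⇒> too-small
  where
  q∣n! : q ℕ.≤ n → q ∣ n ℕ.!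
  q∣n! q≤n = ∣.∣-trans (self q (prime≥1 pq)) (∣.m≤n⇒m!∣n! q≤n)
    where
    self : ∀ d → 1 ℕ.≤ d → d ∣ d ℕ.!
    self (suc d) _ = ∣.m∣m*n (d ℕ.!)
  too-small : ¬ (q ℕ.≤ n)
  too-small q≤n = ¬prime[1] (subst Prime (∣.∣1⇒≡1 (∣.∣m+n∣m⇒∣n (subst (q ∣_) (trans (sym eq) (ℕₚ.+-comm 1 (n ℕ.!))) (∣.m∣m*n m)) (q∣n! q≤n))) pq)

π-unbounded : ∀ r → ∃[ N ] (ι r ≤ π N)
π-unbounded zero = 0 , ≤-reflexive (ι≡♯ 0)
π-unbounded (suc r) with π-unbounded r
... | N , h with prime-above N
...   | suc p , pp , s≤s N≤p = suc p , subst₂ _≤_ (sym (ι-suc r)) (cong (λ z → π p + z) (sym ([]-yes (prime? (suc p)) pp))) (+-monoˡ-≤ 1ℚ (≤-trans h (π-mono N≤p)))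

-- Greedy removal: all bad primes, and any prime whose removal keeps the removed proportion below 1/n₀; this makes the density exist.
module Greedy (n₀ : ℕ) (1≤n₀ : 1 ℕ.≤ n₀) where
  open BadSets n₀ 1≤n₀

  Remove : ℕ → ℕ → Set
  Remove n r = Prime n × (AnyBad n ⊎ n₀ ℕ.* suc r ℕ.≤ count isPrime n)

  Remove? : ∀ n r → Dec (Remove n r)
  Remove? n r = prime? n ×-dec (AnyBad? n ⊎-dec (n₀ ℕ.* suc r ℕ.≤? count isPrime n))

  removed : ℕ → ℕ
  removed zero    = 0
  removed (suc n) = removed n ℕ.+ bitℕ (isYes (Remove? (suc n) (removed n)))

  isRemoved : DSet
  isRemoved zero    = false
  isRemoved (suc n) = isYes (Remove? (suc n) (removed n))

  A : DSet
  A n = isPrime n ∧ not (isRemoved n)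

  A⊆ℙ : ⊆ℙ A
  A⊆ℙ n = T-∧ˡ

  A-good : ∀ n → 𝔹.T (A n) → ¬ AnyBad n
  A-good zero _ (L , 1≤L , L≤0 , _) = ℕₚ.<⇒≱ 1≤L L≤0
  A-good (suc n) a bad = T-not (T-∧ʳ {isPrime (suc n)} a) (isYes-T (Remove? (suc n) (removed n)) (T-isYes (prime? (suc n)) (T-∧ˡ a) , inj₁ bad))
    where
    T-not : ∀ {b} → 𝔹.T (not b) → 𝔹.T b → ⊥
    T-not {true} () _
    T-not {false} _ ()

  count-A : ∀ N → ι (count (A ∩ℙ) N) ≡ π N - ι (removed N)
  count-A zero    = trans (ι≡♯ 0) (sym (cong (λ z → 0ℚ - z) (ι≡♯ 0)))
  count-A (suc N) = trans (ι-+ (count (A ∩ℙ) N) _) (trans (cong₂ _+_ (count-A N) (trans (ι-bitℕ ((A ∩ℙ) (suc N))) (term (prime? (suc N)) (Remove? (suc N) (removed N)))))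
      (trans (lem (π N) (ι (removed N)) (prm (suc N)) [ Remove? (suc N) (removed N) ]) (cong (λ z → π (suc N) - z) (sym (trans (ι-+ (removed N) _) (cong (λ z → ι (removed N) + z) (trans (ι-bitℕ _) (bit-isYes (Remove? (suc N) (removed N))))))))))
    where
    lem = ring 4 (λ a b c d → a :- b :+ (c :- d) , a :+ c :- (b :+ d))
    term : (d : Dec (Prime (suc N))) (d′ : Dec (Remove (suc N) (removed N))) → bit ((isYes d ∧ not (isYes d′)) ∧ isYes d) ≡ [ d ] - [ d′ ]
    term (yes _) (yes _) = refl
    term (yes _) (no _)  = refl
    term (no _)  (no _)  = refl
    term (no ¬p) (yes r) = ⊥-elim (¬p (proj₁ r))

  -- A prime is kept only if n₀ (r + 1) exceeds the current number of primes, and a removal raises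
  -- the right-hand side by n₀ ≥ 1.
  removed-lower : ∀ N → count isPrime N ℕ.≤ n₀ ℕ.* suc (removed N)
  removed-lower zero    = z≤n
  removed-lower (suc N) = go (prime? (suc N)) (Remove? (suc N) (removed N)) refl refl
    where
    ih = removed-lower N
    go : (d : Dec (Prime (suc N))) (d′ : Dec (Remove (suc N) (removed N))) → d ≡ prime? (suc N) → d′ ≡ Remove? (suc N) (removed N) →
      count isPrime N ℕ.+ bitℕ (isYes (prime? (suc N))) ℕ.≤ n₀ ℕ.* suc (removed N ℕ.+ bitℕ (isYes (Remove? (suc N) (removed N))))
    go (no ¬p) d′ e₁ e₂ = subst (λ d → count isPrime N ℕ.+ bitℕ (isYes d) ℕ.≤ n₀ ℕ.* suc (removed N ℕ.+ bitℕ (isYes (Remove? (suc N) (removed N))))) e₁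
      (ℕₚ.≤-trans (ℕₚ.≤-reflexive (ℕₚ.+-identityʳ _)) (ℕₚ.≤-trans ih (ℕₚ.*-monoʳ-≤ n₀ (s≤s (ℕₚ.m≤m+n (removed N) _)))))
    go (yes _) (yes _) e₁ e₂ = subst₂ (λ d d′ → count isPrime N ℕ.+ bitℕ (isYes d) ℕ.≤ n₀ ℕ.* suc (removed N ℕ.+ bitℕ (isYes d′))) e₁ e₂
      (ℕₚ.≤-trans (ℕₚ.+-mono-≤ ih 1≤n₀) (ℕₚ.≤-reflexive (trans (ℕₚ.+-comm _ n₀) (trans (sym (ℕₚ.*-suc n₀ (suc (removed N)))) (cong (λ z → n₀ ℕ.* suc z) (ℕₚ.+-comm 1 (removed N)))))))
    go (yes p) (no ¬r) e₁ e₂ = subst (λ d′ → count isPrime (suc N) ℕ.≤ n₀ ℕ.* suc (removed N ℕ.+ bitℕ (isYes d′))) e₂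
      (ℕₚ.≤-trans (ℕₚ.<⇒≤ (ℕₚ.≰⇒> (λ h → ¬r (p , inj₂ h)))) (ℕₚ.≤-reflexive (cong (λ z → n₀ ℕ.* suc z) (sym (ℕₚ.+-identityʳ (removed N))))))

  -- z is the last time the removed proportion was at most 1/n₀; only bad primes were removed since.
  removed-upper : ∀ N → ∃[ z ] (z ℕ.≤ N × ι n₀ * ι (removed N) - π N ≤ ι n₀ * (B N - B z) - (π N - π z))
  removed-upper zero = 0 , z≤n , ≤-reflexive (trans (cong (λ z → ι n₀ * z - 0ℚ) (ι≡♯ 0)) (lem (ι n₀)))
    where
    lem = ring 1 (λ n → n :* con 0ℚ :- con 0ℚ , n :* (con 0ℚ :- con 0ℚ) :- (con 0ℚ :- con 0ℚ))
  removed-upper (suc N) with removed-upper N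
  ... | z , z≤N , ih = go (prime? (suc N)) (AnyBad? (suc N)) (n₀ ℕ.* suc (removed N) ℕ.≤? count isPrime (suc N))
    where
    r : ℚ
    r = ι (removed N)
    r′ : ι (removed (suc N)) ≡ r + [ Remove? (suc N) (removed N) ]
    r′ = trans (ι-+ (removed N) _) (cong (λ z → r + z) (trans (ι-bitℕ _) (bit-isYes (Remove? (suc N) (removed N)))))
    Goal : ℕ → Set
    Goal z = ι n₀ * ι (removed (suc N)) - π (suc N) ≤ ι n₀ * (B (suc N) - B z) - (π (suc N) - π z)
    keep : ∀ i j k → [ Remove? (suc N) (removed N) ] ≡ i → prm (suc N) ≡ j → [ AnyBad? (suc N) ] ≡ k → i ≤ k → Goal z
    keep i j k ei ej ek i≤k = subst₂ (λ p q → ι n₀ * p - (π N + q) ≤ ι n₀ * (B (suc N) - B z) - ((π N + q) - π z)) (sym (trans r′ (cong (λ w → r + w) ei))) (sym ej)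
      (subst (λ w → ι n₀ * (r + i) - (π N + j) ≤ ι n₀ * (B N + w - B z) - ((π N + j) - π z)) (sym ek) (lem (ι n₀) r i j k (π N) (B N) (B z) (π z) ih i≤k (ι≥0 n₀)))
      where
      lem = lin 9 (λ n r i j k p b c d → n :* r :- p ≼ n :* (b :- c) :- (p :- d) ∷ i ≼ k ∷ con 0ℚ ≼ n ∷ [] , n :* (r :+ i) :- (p :+ j) , n :* (b :+ k :- c) :- ((p :+ j) :- d)) ((1ℚ , 0 ∷ []) ∷ (1ℚ , 1 ∷ 2 ∷ []) ∷ [])
    go : Dec (Prime (suc N)) → Dec (AnyBad (suc N)) → Dec (n₀ ℕ.* suc (removed N) ℕ.≤ count isPrime (suc N)) → ∃[ z ] (z ℕ.≤ suc N × Goal z)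
    go (no ¬p) (yes (L , _ , _ , pn , _)) _ = ⊥-elim (¬p pn)
    go (no ¬p) (no ¬b) _ = z , ℕₚ.m≤n⇒m≤1+n z≤N , keep 0ℚ 0ℚ 0ℚ ([]-no (Remove? (suc N) (removed N)) (¬p ∘ proj₁)) ([]-no (prime? (suc N)) ¬p) ([]-no (AnyBad? (suc N)) ¬b) ≤-refl
    go (yes p) (yes b) _ = z , ℕₚ.m≤n⇒m≤1+n z≤N , keep 1ℚ 1ℚ 1ℚ ([]-yes (Remove? (suc N) (removed N)) (p , inj₁ b)) ([]-yes (prime? (suc N)) p) ([]-yes (AnyBad? (suc N)) b) ≤-refl
    go (yes p) (no ¬b) (no ¬h) = z , ℕₚ.m≤n⇒m≤1+n z≤N , keep 0ℚ 1ℚ 0ℚ ([]-no (Remove? (suc N) (removed N)) (λ { (_ , inj₁ b) → ¬b b ; (_ , inj₂ h) → ¬h h })) ([]-yes (prime? (suc N)) p) ([]-no (AnyBad? (suc N)) ¬b) ≤-refl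
    -- A greedy removal leaves the proportion at most 1/n₀, so z restarts here.
    go (yes p) (no ¬b) (yes h) = suc N , ℕₚ.≤-refl , lem (ι n₀) (ι (removed (suc N))) (π (suc N)) (B (suc N)) (subst₂ _≤_ (trans (ι-* n₀ (suc (removed N))) (cong (ι n₀ *_) (trans (ι-suc (removed N)) (sym (trans r′ (cong (λ w → r + w) ([]-yes (Remove? (suc N) (removed N)) (p , inj₂ h)))))))) (ι-π (suc N)) (ι-mono h))
      where
      lem = lin 4 (λ n r p b → n :* r ≼ p ∷ [] , n :* r :- p , n :* (b :- b) :- (p :- p)) ((1ℚ , 0 ∷ []) ∷ [])

  -- Apply `union-bound` between N and the z of `removed-upper`; if z lies before X*, the initial
  -- segment costs a constant.
  removed≤ : ∀ e → 1 ℕ.≤ e → ∃[ c ] (∀ N → ι e * (ι n₀ * ι (removed N) - π N) ≤ π N + ι c)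
  removed≤ e 1≤e with union-bound e 1≤e
  ... | X* , ub = e ℕ.* (n₀ ℕ.* X*) , bound
    where
    B≤ : ∀ x → B x ≤ ι x
    B≤ x = ≤-trans (Sum-mono x (λ n _ _ → []-≤1 (AnyBad? n))) (≤-reflexive (trans (Sum-const x 1ℚ) (*-identityʳ (ι x))))
    B≥0 : ∀ x → 0ℚ ≤ B x
    B≥0 x = Sum-≥0 x (λ n _ _ → []-≥0 (AnyBad? n))
    ιc : ι (e ℕ.* (n₀ ℕ.* X*)) ≡ ι e * (ι n₀ * ι X*)
    ιc = trans (ι-* e (n₀ ℕ.* X*)) (cong (ι e *_) (ι-* n₀ X*))
    range : ∀ z N → z ℕ.≤ N → ι e * (ι n₀ * (B N - B z) - (π N - π z)) ≤ π N + ι e * (ι n₀ * ι X*)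
    range z N z≤N with ℕₚ.≤-total X* z | ℕₚ.≤-total X* N
    ... | inj₁ X≤z | _ = lem (ι e) (ι n₀ * (B N - B z)) (π N - π z) (π N) (ι n₀ * ι X*) (ub z N X≤z z≤N) (ι≥0 e) (ι≥0 n₀ ⊗ ι≥0 X*)
      where
      lem = lin 5 (λ e x d p c → e :* x ≼ e :* d :+ p ∷ con 0ℚ ≼ e ∷ con 0ℚ ≼ c ∷ [] , e :* (x :- d) , p :+ e :* c) ((1ℚ , 0 ∷ []) ∷ (1ℚ , 1 ∷ 2 ∷ []) ∷ [])
    ... | inj₂ z≤X | inj₁ X≤N = lem (ι e) (ι n₀) (B N) (B X*) (B z) (π N) (π X*) (π z) (ι X*) (ub X* N ℕₚ.≤-refl X≤N) (B≤ X*) (B≥0 z) (π-mono z≤X) (ι≥0 e) (ι≥0 n₀)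
      where
      lem = lin 9 (λ e n a b c p q r x → e :* (n :* (a :- b)) ≼ e :* (p :- q) :+ p ∷ b ≼ x ∷ con 0ℚ ≼ c ∷ r ≼ q ∷ con 0ℚ ≼ e ∷ con 0ℚ ≼ n ∷ [] , e :* (n :* (a :- c) :- (p :- r)) , p :+ e :* (n :* x)) ((1ℚ , 0 ∷ []) ∷ (1ℚ , 1 ∷ 5 ∷ 4 ∷ []) ∷ (1ℚ , 2 ∷ 5 ∷ 4 ∷ []) ∷ (1ℚ , 3 ∷ 4 ∷ []) ∷ [])
    ... | inj₂ z≤X | inj₂ N≤X = lem (ι e) (ι n₀) (B N) (B z) (π N) (π z) (ι X*) (≤-trans (B≤ N) (ι-mono N≤X)) (B≥0 z) (π-mono z≤N) (π≥0 N) (ι≥0 e) (ι≥0 n₀)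
      where
      lem = lin 7 (λ e n a c p r x → a ≼ x ∷ con 0ℚ ≼ c ∷ r ≼ p ∷ con 0ℚ ≼ p ∷ con 0ℚ ≼ e ∷ con 0ℚ ≼ n ∷ [] , e :* (n :* (a :- c) :- (p :- r)) , p :+ e :* (n :* x)) ((1ℚ , 0 ∷ 5 ∷ 4 ∷ []) ∷ (1ℚ , 1 ∷ 5 ∷ 4 ∷ []) ∷ (1ℚ , 2 ∷ 4 ∷ []) ∷ (1ℚ , 3 ∷ []) ∷ [])
    bound : ∀ N → ι e * (ι n₀ * ι (removed N) - π N) ≤ π N + ι (e ℕ.* (n₀ ℕ.* X*))
    bound N with removed-upper N
    ... | z , z≤N , h = ≤-trans (*-monoˡ-≤-nonNeg (ι e) {{nonNegative (ι≥0 e)}} h) (subst (λ w → ι e * (ι n₀ * (B N - B z) - (π N - π z)) ≤ π N + w) (sym ιc) (range z N z≤N))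

  ratio-eq : ∀ N → 1 ℕ.≤ count isPrime N → ratioℙ A N ≡ (π N - ι (removed N)) * inv (count isPrime N)
  ratio-eq N p with count isPrime N in eq
  ... | suc k = trans (/-ι-inv (count (A ∩ℙ) N) k) (cong (_* inv (suc k)) (count-A N))

  -- `removed-lower` bounds the ratio from above up to 1/π(N), and `removed≤` from below up to 1/e
  -- and a constant over π(N). From N₀ on π(N) exceeds both e and the constant.
  density : ∀ e → 1 ℕ.≤ e → ∃[ N₀ ] (∀ N → N₀ ℕ.≤ N → ∣ ratioℙ A N - (1ℚ - inv n₀) ∣ ≤ ♯ 2 * inv e)
  density e 1≤e with removed≤ e 1≤e
  ... | c , ub with π-unbounded (suc (c ℕ.+ e ℕ.* n₀))
  ...   | N₀ , big = N₀ , go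
    where
    go : ∀ N → N₀ ℕ.≤ N → ∣ ratioℙ A N - (1ℚ - inv n₀) ∣ ≤ ♯ 2 * inv e
    go N N₀≤N = subst (λ z → ∣ z - (1ℚ - inv n₀) ∣ ≤ ♯ 2 * inv e) (sym (ratio-eq N 1≤P)) (abs≤ upper-side lower-side)
      where
      P : ℕ
      P = count isPrime N
      r : ℚ
      r = ι (removed N)
      ιsum : ι (suc (c ℕ.+ e ℕ.* n₀)) ≡ ι c + ι e * ι n₀ + 1ℚ
      ιsum = trans (ι-suc (c ℕ.+ e ℕ.* n₀)) (cong (_+ 1ℚ) (trans (ι-+ c (e ℕ.* n₀)) (cong (λ z → ι c + z) (ι-* e n₀))))
      big₀ : ι c + ι e * ι n₀ + 1ℚ ≤ π N
      big₀ = subst (_≤ π N) ιsum (≤-trans big (π-mono N₀≤N))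
      1≤P : 1 ℕ.≤ P
      1≤P = ι-cancel-≤ (subst₂ _≤_ (sym (ι≡♯ 1)) (sym (ι-π N)) (≤-trans (l₁ (ι c) (ι e * ι n₀) (ι≥0 c) (ι≥0 e ⊗ ι≥0 n₀)) big₀))
        where
        l₁ = lin 2 (λ a b → con 0ℚ ≼ a ∷ con 0ℚ ≼ b ∷ [] , con 1ℚ , a :+ b :+ con 1ℚ) ((1ℚ , 0 ∷ []) ∷ (1ℚ , 1 ∷ []) ∷ [])
      π*inv : π N * inv P ≡ 1ℚ
      π*inv = trans (cong (_* inv P) (sym (ι-π N))) (ι*inv 1≤P)
      big′ : ι c + ι e * ι n₀ ≤ π N
      big′ = l₂ (ι c + ι e * ι n₀) (π N) big₀
        where
        l₂ = lin 2 (λ a b → a :+ con 1ℚ ≼ b ∷ [] , a , b) ((1ℚ , []) ∷ (1ℚ , 0 ∷ []) ∷ [])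
      big″ : ι c ≤ π N
      big″ = l₃ (ι c) (ι e * ι n₀) (π N) big₀ (ι≥0 e ⊗ ι≥0 n₀)
        where
        l₃ = lin 3 (λ a d b → a :+ d :+ con 1ℚ ≼ b ∷ con 0ℚ ≼ d ∷ [] , a , b) ((1ℚ , []) ∷ (1ℚ , 0 ∷ []) ∷ (1ℚ , 1 ∷ []) ∷ [])
      lower : π N ≤ ι n₀ * (ι (removed N) + 1ℚ)
      lower = subst₂ _≤_ (ι-π N) (trans (ι-* n₀ (suc (removed N))) (cong (ι n₀ *_) (ι-suc (removed N)))) (ι-mono (removed-lower N))
      divide : ∀ p i x → p * i ≡ 1ℚ → (p * x) * i ≡ x
      divide p i x h = trans (l₄ p i x) (trans (cong (_* x) h) (*-identityˡ x))
        where
        l₄ = ring 3 (λ p i x → (p :* x) :* i , (p :* i) :* x)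
      over : ∀ p i a x y → p * i ≡ 1ℚ → 0ℚ ≤ i → a - p * x ≤ p * y → a * i - x ≤ y
      over p i a x y pi i0 h = subst₂ _≤_ (trans (l₅ p i a x) (cong (λ v → a * i - v) (divide p i x pi))) (divide p i y pi) (*-monoʳ-≤-nonNeg i {{nonNegative i0}} h)
        where
        l₅ = ring 4 (λ p i a x → (a :- p :* x) :* i , a :* i :- p :* x :* i)
      upper-side : (π N - r) * inv P - (1ℚ - inv n₀) ≤ ♯ 2 * inv e
      upper-side = over (π N) (inv P) (π N - r) (1ℚ - inv n₀) (♯ 2 * inv e) π*inv (inv≥0 P) (l₇ (π N) r (inv n₀) (inv e)
          (subst (π N * inv n₀ ≤_) (divide (ι n₀) (inv n₀) (r + 1ℚ) (ι*inv 1≤n₀)) (*-monoʳ-≤-nonNeg (inv n₀) {{nonNegative (inv≥0 n₀)}} lower))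
          (subst (_≤ π N * inv e) (ι*inv 1≤e) (*-monoʳ-≤-nonNeg (inv e) {{nonNegative (inv≥0 e)}} e≤π)) (π≥0 N) (inv≥0 e))
        where
        l₆ = lin 4 (λ c e n p → c :+ e :* n ≼ p ∷ con 0ℚ ≼ c ∷ con 1ℚ ≼ n ∷ con 0ℚ ≼ e ∷ [] , e , p) ((1ℚ , 0 ∷ []) ∷ (1ℚ , 1 ∷ []) ∷ (1ℚ , 2 ∷ 3 ∷ []) ∷ [])
        e≤π : ι e ≤ π N
        e≤π = l₆ (ι c) (ι e) (ι n₀) (π N) big′ (ι≥0 c) (ι≥1 1≤n₀) (ι≥0 e)
        l₇ = lin 4 (λ p r j f → p :* j ≼ r :+ con 1ℚ ∷ con 1ℚ ≼ p :* f ∷ con 0ℚ ≼ p ∷ con 0ℚ ≼ f ∷ [] , (p :- r) :- p :* (con 1ℚ :- j) , p :* (# 2 :* f)) ((1ℚ , []) ∷ (1ℚ , 0 ∷ []) ∷ (♯ 2 , 1 ∷ []) ∷ [])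
      lower-side : - ((π N - r) * inv P - (1ℚ - inv n₀)) ≤ ♯ 2 * inv e
      lower-side = subst (_≤ ♯ 2 * inv e) (l₁₀ (π N - r) (inv P) (1ℚ - inv n₀)) (over (π N) (inv P) (- (π N - r)) (- (1ℚ - inv n₀)) (♯ 2 * inv e) π*inv (inv≥0 P)
          (l₉ (π N) r (inv n₀) (inv e) (subst₂ _≤_ (trans (l₈ (ι n₀) r (π N) (inv n₀)) (cong (λ v → v - π N * inv n₀) (divide (ι n₀) (inv n₀) r (ι*inv 1≤n₀)))) refl
            (*-monoʳ-≤-nonNeg (inv n₀) {{nonNegative (inv≥0 n₀)}} step)) (inv≤1 1≤n₀) (π≥0 N ⊗ inv≥0 e)))
        where
        l₈ = ring 4 (λ n r p j → (n :* r :- p) :* j , n :* r :* j :- p :* j)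
        l₁₀ = ring 3 (λ a i x → :- a :* i :- :- x , :- (a :* i :- x))
        l₁₁ = lin 3 (λ x p d → x ≼ p :+ d ∷ d ≼ p ∷ [] , x , # 2 :* p) ((1ℚ , 0 ∷ []) ∷ (1ℚ , 1 ∷ []) ∷ [])
        l₁₂ = ring 2 (λ p f → # 2 :* p :* f , # 2 :* (p :* f))
        step : ι n₀ * r - π N ≤ ♯ 2 * (π N * inv e)
        step = subst₂ _≤_ (divide (ι e) (inv e) (ι n₀ * r - π N) (ι*inv 1≤e)) (l₁₂ (π N) (inv e)) (*-monoʳ-≤-nonNeg (inv e) {{nonNegative (inv≥0 e)}} (l₁₁ (ι e * (ι n₀ * r - π N)) (π N) (ι c) (ub N) big″))
        l₉ = lin 4 (λ p r j f → r :- p :* j ≼ # 2 :* (p :* f) :* j ∷ j ≼ con 1ℚ ∷ con 0ℚ ≼ p :* f ∷ [] , :- (p :- r) :- p :* :- (con 1ℚ :- j) , p :* (# 2 :* f)) ((1ℚ , 0 ∷ []) ∷ (♯ 2 , 1 ∷ 2 ∷ []) ∷ [])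

-- Intervals free of differences, and the conclusions

prodFrom : ℕ → ℕ → ℕ
prodFrom c zero    = 1
prodFrom c (suc j) = prodFrom c j ℕ.* (c ℕ.+ suc j)

prodFrom-∣ : ∀ c {i j} → 1 ℕ.≤ i → i ℕ.≤ j → (c ℕ.+ i) ∣ prodFrom c j
prodFrom-∣ c {suc i} {suc j} 1≤i i≤j with ℕₚ.m≤n⇒m<n∨m≡n i≤j
... | inj₁ (s≤s i≤j′) = ∣.∣m⇒∣m*n (c ℕ.+ suc j) (prodFrom-∣ c 1≤i i≤j′)
... | inj₂ refl = ∣.n∣m*n (prodFrom c j)

1≤prodFrom : ∀ c j → 1 ℕ.≤ prodFrom c j
1≤prodFrom c zero    = ℕₚ.≤-refl
1≤prodFrom c (suc j) = ℕₚ.*-mono-≤ (1≤prodFrom c j) (ℕₚ.≤-trans (s≤s z≤n) (ℕₚ.m≤n+m (suc j) c))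

prime-divisor : ∀ {p d} → Prime p → d ∣ p → d ≢ 1 → ¬ (d ℕ.< p)
prime-divisor pp d∣p d≢1 d<p with prime⇒irreducible pp d∣p
... | inj₁ e = d≢1 e
... | inj₂ refl = ℕₚ.<-irrefl refl d<p

list-bound : ∀ (F : List ℤ.ℤ) → ∃[ k ] (∀ f → f ∈ F → ℤ.∣ f ∣ ℕ.≤ k)
list-bound [] = 0 , λ f ()
list-bound (f ∷ F) with list-bound F
... | k , h = ℤ.∣ f ∣ ℕ.+ k , λ { g (here refl) → ℕₚ.m≤m+n ℤ.∣ f ∣ k ; g (there g∈F) → ℕₚ.≤-trans (h g g∈F) (ℕₚ.m≤n+m k ℤ.∣ f ∣) }

shifted : ∀ n s f k → ℤ.∣ f ∣ ℕ.≤ k → + n ≡ + s ℤ.- f → n ℕ.≤ s ℕ.+ k × s ℕ.≤ n ℕ.+ k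
shifted n s (+ f) k f≤k eq = ℕₚ.≤-trans (ℕₚ.m≤m+n n f) (ℕₚ.≤-trans (ℕₚ.≤-reflexive s≡) (ℕₚ.m≤m+n s k)) , ℕₚ.≤-trans (ℕₚ.≤-reflexive (sym s≡)) (ℕₚ.+-monoʳ-≤ n f≤k)
  where
  s≡ : n ℕ.+ f ≡ s
  s≡ = ℤₚ.+-injective (trans (cong (ℤ._+ + f) eq) (trans (ℤₚ.+-assoc (+ s) (ℤ.- (+ f)) (+ f)) (trans (cong (λ z → + s ℤ.+ z) (ℤₚ.+-inverseˡ (+ f))) (ℤₚ.+-identityʳ (+ s)))))
shifted n s ℤ.-[1+ f ] k f≤k eq = ℕₚ.≤-trans (ℕₚ.≤-reflexive (ℤₚ.+-injective eq)) (ℕₚ.+-monoʳ-≤ s f≤k) , ℕₚ.≤-trans (ℕₚ.m≤m+n s (suc f)) (ℕₚ.≤-trans (ℕₚ.≤-reflexive (sym (ℤₚ.+-injective eq))) (ℕₚ.m≤m+n n k))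

HasDensity : (ℕ → Bool) → ℚ → Set
HasDensity A α = ∀ δ → 0ℚ < δ → ∃[ N₀ ] (∀ N → N₀ ℕ.≤ N → ∣ ratioℙ A N - α ∣ < δ)

rate⇒density : ∀ A α → (∀ e → 1 ℕ.≤ e → ∃[ N₀ ] (∀ N → N₀ ℕ.≤ N → ∣ ratioℙ A N - α ∣ ≤ ♯ 2 * inv e)) → HasDensity A α
rate⇒density A α rate δ δ>0 with archimedean-inv δ>0
-- The factor 3 makes the bound strict: 2/(3d) < 1/d ≤ δ when divided out, with δ ≥ 1/d from
-- `archimedean-inv`.
... | d , 1≤d , h with rate (d ℕ.* 3) (ℕₚ.*-mono-≤ 1≤d (s≤s z≤n))
...   | N₀ , bound = N₀ , λ N p → ≤-<-trans (bound N p) small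
  where
  small : ♯ 2 * inv (d ℕ.* 3) < δ
  small = ≤-<-trans (*-cancelˡ-≤ {ι d * ♯ 3} (l₁ (ι d) (ι≥1 1≤d)) (≤-trans (≤-reflexive (trans (l₂ (ι d * ♯ 3) (inv (d ℕ.* 3))) (cong (♯ 2 *_) (trans (cong (_* inv (d ℕ.* 3)) (trans (cong (ι d *_) (sym (ι≡♯ 3))) (sym (ι-* d 3)))) (ι*inv (ℕₚ.*-mono-≤ 1≤d (s≤s z≤n))))))) (l₃ (ι d) δ h)))
      (subst₂ _<_ refl (*-identityˡ δ) (*-monoˡ-<-pos δ {{positive δ>0}} (from-yes ((♯ 2 * (ℤ.+ 1 / 3)) <? 1ℚ))))
    where
    l₁ = lin 1 (λ d → con 1ℚ ≼ d ∷ [] , con 1ℚ , d :* # 3) ((♯ 2 , []) ∷ (♯ 3 , 0 ∷ []) ∷ [])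
    l₂ = ring 2 (λ a i → a :* (# 2 :* i) , # 2 :* (a :* i))
    l₃ = lin 2 (λ d x → con 1ℚ ≼ d :* x ∷ [] , # 2 :* con 1ℚ , d :* # 3 :* (# 2 :* con (ℤ.+ 1 / 3) :* x)) ((♯ 2 , 0 ∷ []) ∷ [])

density⇒atLeast : ∀ {A α β} → HasDensity A α → β ≤ α → densityExistsAtLeast A β
density⇒atLeast {A} {α} {β} lim β≤α = cauchy , below
  where
  cauchy : ∀ δ → 0ℚ < δ → ∃[ N₀ ] ∀ N N′ → N₀ ℕ.≤ N → N₀ ℕ.≤ N′ → ∣ ratioℙ A N - ratioℙ A N′ ∣ < δ
  cauchy δ δ>0 with lim (½ * δ) (subst (_< ½ * δ) (*-zeroʳ ½) (*-monoʳ-<-pos ½ δ>0))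
  ... | N₀ , h = N₀ , λ N N′ p q → subst₂ _<_ (cong ∣_∣ (l₁ (ratioℙ A N) (ratioℙ A N′) α)) (l₂ δ)
        (≤-<-trans (∣p-q∣≤∣p∣+∣q∣ (ratioℙ A N - α) (ratioℙ A N′ - α)) (+-mono-< (h N p) (h N′ q)))
    where
    l₁ = ring 3 (λ a b c → (a :- c) :- (b :- c) , a :- b)
    l₂ = ring 1 (λ d → con ½ :* d :+ con ½ :* d , d)
  below : ∀ δ → 0ℚ < δ → ∃[ N₀ ] ∀ N → N₀ ℕ.≤ N → β - δ ≤ ratioℙ A N
  below δ δ>0 with lim δ δ>0
  ... | N₀ , h = N₀ , λ N p → lem (ratioℙ A N) α β δ (abs-lo (<⇒≤ (h N p))) β≤α
    where
    lem = lin 4 (λ a i e d → :- (a :- i) ≼ d ∷ e ≼ i ∷ [] , e :- d , a) ((1ℚ , 0 ∷ []) ∷ (1ℚ , 1 ∷ []) ∷ [])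

density⇒upperDensityPos : ∀ {A α} → HasDensity A α → ½ ≤ α → upperDensityPos A
density⇒upperDensityPos {A} {α} lim ½≤α with lim (ℤ.+ 1 / 4) (from-yes (0ℚ <? ℤ.+ 1 / 4))
... | N₀ , h = ℤ.+ 1 / 4 , from-yes (0ℚ <? ℤ.+ 1 / 4) , λ N → N ℕ.+ N₀ , ℕₚ.m≤m+n N N₀ , lem (ratioℙ A (N ℕ.+ N₀)) α (abs-lo (<⇒≤ (h (N ℕ.+ N₀) (ℕₚ.m≤n+m N₀ N)))) ½≤α
  where
  lem = lin 2 (λ a i → :- (a :- i) ≼ con (ℤ.+ 1 / 4) ∷ con ½ ≼ i ∷ [] , con (ℤ.+ 1 / 4) , a) ((1ℚ , 0 ∷ []) ∷ (1ℚ , 1 ∷ []) ∷ [])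

module Construction (n₀ : ℕ) (1≤n₀ : 1 ℕ.≤ n₀) where
  open Greedy n₀ 1≤n₀
  open BadSets n₀ 1≤n₀

  period : ℕ → ℕ
  period L = M L ℕ.* prodFrom (c L) (suc L ℕ.+ X L)

  1≤period : ∀ L → 1 ℕ.≤ period L
  1≤period L = ℕₚ.*-mono-≤ (1≤M L) (1≤prodFrom (c L) (suc L ℕ.+ X L))

  -- Small a are excluded by the factor c + i + a of the period, large a by a common factor of a + c + i and M.
  block-free : ∀ L t i → 1 ℕ.≤ L → 1 ℕ.≤ t → 1 ℕ.≤ i → i ℕ.≤ suc L → ∀ a → 𝔹.T (A a) → ¬ Prime (c L ℕ.+ period L ℕ.* t ℕ.+ i ℕ.+ a)
  block-free L t i 1≤L 1≤t 1≤i i≤L a a∈A prime-sum = go (a ℕ.≤? X L)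
    where
    pa : Prime a
    pa = T-isYes (prime? a) (A⊆ℙ a a∈A)
    1≤pt : 1 ℕ.≤ period L ℕ.* t
    1≤pt = ℕₚ.*-mono-≤ (1≤period L) 1≤t
    go : Dec (a ℕ.≤ X L) → ⊥
    go (yes a≤X) = prime-divisor prime-sum d∣ d≢1 d<
      where
      d : ℕ
      d = c L ℕ.+ (i ℕ.+ a)
      sum≡ : c L ℕ.+ period L ℕ.* t ℕ.+ i ℕ.+ a ≡ period L ℕ.* t ℕ.+ d
      sum≡ = lem (c L) (period L ℕ.* t) i a
        where
        lem : ∀ c p i a → c ℕ.+ p ℕ.+ i ℕ.+ a ≡ p ℕ.+ (c ℕ.+ (i ℕ.+ a))
        lem = ℕ-Ring.solve-∀
      d∣ : d ∣ c L ℕ.+ period L ℕ.* t ℕ.+ i ℕ.+ a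
      d∣ = subst (d ∣_) (sym sum≡) (∣.∣m∣n⇒∣m+n (∣.∣m⇒∣m*n t (∣.∣n⇒∣m*n (M L) (prodFrom-∣ (c L) (ℕₚ.≤-trans 1≤i (ℕₚ.m≤m+n i a)) (ℕₚ.+-mono-≤ i≤L a≤X)))) ∣.∣-refl)
      d≢1 : d ≢ 1
      d≢1 = ℕₚ.>⇒≢ (ℕₚ.≤-trans (ℕ.nonTrivial⇒n>1 a {{prime⇒nonTrivial pa}}) (ℕₚ.≤-trans (ℕₚ.m≤n+m a i) (ℕₚ.m≤n+m (i ℕ.+ a) (c L))))
      d< : d ℕ.< c L ℕ.+ period L ℕ.* t ℕ.+ i ℕ.+ a
      d< = subst (d ℕ.<_) (sym sum≡) (ℕₚ.+-monoˡ-≤ d 1≤pt)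
    go (no a≰X) = prime-divisor prime-sum g∣ g≢1 g<
      where
      X<a = ℕₚ.≰⇒> a≰X
      k : ℕ
      k = a ℕ.+ c L ℕ.+ i
      L≤a : L ℕ.≤ a
      L≤a = ℕₚ.≤-trans (L≤X L) (ℕₚ.<⇒≤ X<a)
      -- Otherwise `a` would be bad at level L; this level is among those searched by `AnyBad`
      -- because L ≤ a.
      not-coprime : ¬ Coprime k (M L)
      not-coprime cop = A-good a a∈A (L , 1≤L , L≤a , pa , X<a , i , 1≤i , i≤L , cop)
      common : ℕ
      common = gcd k (M L)
      g≢1 : common ≢ 1
      g≢1 e = not-coprime (Coprimality.gcd≡1⇒coprime e)
      sum≡ : c L ℕ.+ period L ℕ.* t ℕ.+ i ℕ.+ a ≡ period L ℕ.* t ℕ.+ k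
      sum≡ = lem (c L) (period L ℕ.* t) i a
        where
        lem : ∀ c p i a → c ℕ.+ p ℕ.+ i ℕ.+ a ≡ p ℕ.+ (a ℕ.+ c ℕ.+ i)
        lem = ℕ-Ring.solve-∀
      g∣ : common ∣ c L ℕ.+ period L ℕ.* t ℕ.+ i ℕ.+ a
      g∣ = subst (common ∣_) (sym sum≡) (∣.∣m∣n⇒∣m+n (∣.∣m⇒∣m*n t (∣.∣m⇒∣m*n _ (gcd[m,n]∣n k (M L)))) (gcd[m,n]∣m k (M L)))
      g< : common ℕ.< c L ℕ.+ period L ℕ.* t ℕ.+ i ℕ.+ a
      g< = ℕₚ.≤-<-trans (∣.∣⇒≤ {{ℕ.>-nonZero (1≤M L)}} (gcd[m,n]∣n k (M L))) (ℕₚ.≤-<-trans (M≤X L) (ℕₚ.<-≤-trans X<a (ℕₚ.m≤n+m a (c L ℕ.+ period L ℕ.* t ℕ.+ i))))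

  Free : ℕ → Set
  Free n = 1 ℕ.≤ n × ¬ ℙminus A n

  -- A long interval of the thick set contains a whole free block b + 1, ..., b + L + 1 with b = c +
  -- p t. If k bounds the entries of F, the syndetic set has an element within k of b + k + 1, and L
  -- = 2k + 1 keeps it inside the block.
  free-thickly-syndetic : ThicklySyndetic Free
  free-thickly-syndetic P (Tk , Sy , thick , (F , syndetic) , split) = s , 1≤s , (1≤s , free) , proj₂ (split s 1≤s) (in-thick , s∈Sy)
    where
    k L p len : ℕ
    k = proj₁ (list-bound F)
    L = suc (k ℕ.+ k)
    p = period L
    -- One period to reach the next block, `c L` for its offset, and the rest for the block itself.
    len = p ℕ.+ c L ℕ.+ (L ℕ.+ 3)
    m = proj₁ (thick len)
    t b : ℕ
    t = suc (m // p)
    b = c L ℕ.+ p ℕ.* t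
    m≤b : m ℕ.≤ b
    m≤b = ℕₚ.≤-trans (ℕₚ.<⇒≤ (<*suc// m (1≤period L))) (ℕₚ.m≤n+m (p ℕ.* t) (c L))
    b≤ : b ℕ.≤ m ℕ.+ (p ℕ.+ c L)
    b≤ = ℕₚ.≤-trans (ℕₚ.+-monoʳ-≤ (c L) (ℕₚ.≤-trans (ℕₚ.≤-reflexive (ℕₚ.*-suc p (m // p))) (ℕₚ.+-monoʳ-≤ p (≤//⇒*≤ {m} {p} ℕₚ.≤-refl)))) (ℕₚ.≤-reflexive (lem (c L) p m))
      where
      lem : ∀ c p m → c ℕ.+ (p ℕ.+ m) ≡ m ℕ.+ (p ℕ.+ c)
      lem = ℕ-Ring.solve-∀
    centre : ℕ
    centre = b ℕ.+ suc k
    found = syndetic centre (ℕₚ.≤-trans (s≤s z≤n) (ℕₚ.m≤n+m (suc k) b))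
    f = proj₁ found
    s = proj₁ (proj₂ (proj₂ found))
    1≤s = proj₁ (proj₂ (proj₂ (proj₂ found)))
    s∈Sy = proj₁ (proj₂ (proj₂ (proj₂ (proj₂ found))))
    near = shifted centre s f k (proj₂ (list-bound F) f (proj₁ (proj₂ found))) (proj₂ (proj₂ (proj₂ (proj₂ (proj₂ found)))))
    b<s : b ℕ.< s
    b<s = ℕₚ.+-cancelʳ-≤ k (suc b) s (ℕₚ.≤-trans (ℕₚ.≤-reflexive (sym (ℕₚ.+-suc b k))) (proj₁ near))
    s≤ : s ℕ.≤ b ℕ.+ suc L
    s≤ = ℕₚ.≤-trans (proj₂ near) (ℕₚ.≤-trans (ℕₚ.≤-reflexive (lem b k)) (ℕₚ.+-monoʳ-≤ b (ℕₚ.n≤1+n L)))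
      where
      lem : ∀ b k → b ℕ.+ suc k ℕ.+ k ≡ b ℕ.+ suc (k ℕ.+ k)
      lem = ℕ-Ring.solve-∀
    in-thick : Tk s
    in-thick = subst Tk (ℕₚ.m+[n∸m]≡n m≤s) (proj₂ (proj₂ (thick len)) (s ℕ.∸ m) (ℕₚ.+-cancelˡ-< m (s ℕ.∸ m) len (subst (ℕ._< m ℕ.+ len) (sym (ℕₚ.m+[n∸m]≡n m≤s)) s<)))
      where
      m≤s = ℕₚ.≤-trans m≤b (ℕₚ.<⇒≤ b<s)
      s< : s ℕ.< m ℕ.+ len
      s< = ℕₚ.≤-trans (s≤s s≤) (ℕₚ.≤-trans (s≤s (ℕₚ.+-monoˡ-≤ (suc L) b≤)) (ℕₚ.≤-trans (ℕₚ.≤-reflexive (lem m (p ℕ.+ c L) L)) (ℕₚ.+-monoʳ-≤ m (ℕₚ.+-monoʳ-≤ (p ℕ.+ c L) (ℕₚ.+-monoʳ-≤ L (ℕₚ.n≤1+n 2))))))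
        where
        lem : ∀ m q L → suc (m ℕ.+ q ℕ.+ suc L) ≡ m ℕ.+ (q ℕ.+ (L ℕ.+ 2))
        lem = ℕ-Ring.solve-∀
    free : ¬ ℙminus A s
    free (_ , a , a∈A , pr) = block-free L t (s ℕ.∸ b) (s≤s z≤n) (s≤s z≤n) (ℕₚ.m<n⇒0<n∸m b<s) (ℕₚ.m≤n+o⇒m∸n≤o s b s≤) a a∈A (subst (λ z → Prime (z ℕ.+ a)) (sym (ℕₚ.m+[n∸m]≡n (ℕₚ.<⇒≤ b<s))) (T-isYes (prime? (s ℕ.+ a)) pr))

  not-piecewise-syndetic : ¬ PiecewiseSyndetic (ℙminus A)
  not-piecewise-syndetic ps = let (_ , _ , (_ , ¬h) , h) = free-thickly-syndetic (ℙminus A) ps in ¬h h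

  A-density : HasDensity A (1ℚ - inv n₀)
  A-density = rate⇒density A (1ℚ - inv n₀) density

  not-prime-intersective : inv n₀ ≤ ½ → ¬ PrimeIntersective Free
  not-prime-intersective n₀≥2 intersective =
    let (n , 1≤n , (_ , free) , (_ , a , b , a∈A , b∈A , eq)) = intersective A A⊆ℙ (density⇒upperDensityPos A-density (lem (inv n₀) n₀≥2))
    in free (1≤n , b , b∈A , subst (𝔹.T ∘ isPrime) (sym eq) (A⊆ℙ a a∈A))
    where
    lem = lin 1 (λ i → i ≼ con ½ ∷ [] , con ½ , con 1ℚ :- i) ((1ℚ , 0 ∷ []) ∷ [])

theoremC : (ε : ℚ) → 0ℚ < ε →
    ∃[ A ] (⊆ℙ A × densityExistsAtLeast A (1ℚ - ε) × ¬ PiecewiseSyndetic (ℙminus A)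
      × ThicklySyndetic (λ n → 1 ℕ.≤ n × ¬ ℙminus A n)
      × ¬ PrimeIntersective (λ n → 1 ℕ.≤ n × ¬ ℙminus A n))
theoremC ε ε>0 with archimedean-inv ε>0
... | d , 1≤d , h = Greedy.A n₀ 1≤n₀ , Greedy.A⊆ℙ n₀ 1≤n₀ , density⇒atLeast A-density (lem (inv n₀) ε n₀≤ε) , not-piecewise-syndetic , free-thickly-syndetic , not-prime-intersective n₀≥2
  where
  n₀ : ℕ
  -- The 2 keeps the density at least ½ even when ε is large, so that A also refutes prime
  -- intersectivity.
  n₀ = 2 ℕ.* d
  1≤n₀ : 1 ℕ.≤ n₀
  1≤n₀ = ℕₚ.*-mono-≤ {1} {2} (s≤s z≤n) 1≤d
  open Construction n₀ 1≤n₀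
  inv2 : inv 2 ≡ ½
  inv2 = *-inverse-unique (♯ 2) (inv 2) ½ (trans (cong (_* inv 2) (sym (ι≡♯ 2))) (ι*inv (s≤s z≤n))) refl
  n₀≥2 : inv n₀ ≤ ½
  n₀≥2 = subst (inv n₀ ≤_) inv2 (inv-mono (s≤s z≤n) (d≤d*m 2 1≤d))
  n₀≤ε : inv n₀ ≤ ε
  n₀≤ε = ≤-trans (inv-mono 1≤d (m≤d*m {2} d (s≤s z≤n))) (*-cancelˡ-≤ (ι≥1 1≤d) (subst (_≤ ι d * ε) (sym (ι*inv 1≤d)) h))
  lem = lin 2 (λ i e → i ≼ e ∷ [] , con 1ℚ :- e , con 1ℚ :- i) ((1ℚ , 0 ∷ []) ∷ [])
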